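{- Let $n\ge1$ and let $\lambda\in\mathbb{Z}^n$ with $\lambda_1\ge\cdots\ge\lambda_n$. Then $$P_\lambda=\sum_{z\in W^\lambda}t^{\frac12\ell(v_\lambda z)}\,\mathrm{ev}^t_{z\lambda}\big(c^Y_{v_\lambda z}\big)E_{z\lambda}\qquad\text{and}\qquad A_{\lambda+\rho}=\sum_{z\in S_n}(-t^{\frac12})^{\ell(w_0z)}\,\mathrm{ev}^t_{z(\lambda+\rho)}\big(c^{Y^{ -1}}_{w_0z}\big)E_{z(\lambda+\rho)}.$$ Alternatively, $$P_\lambda=\sum_{\mu\in S_n\lambda}\Big(\prod_{1\le i<j\le n,\ \mu_i>\mu_j}t\,\frac{1-q^{\mu_i-\mu_j}t^{v_\mu(i)-v_\mu(j)-1}}{1-q^{\mu_i-\mu_j}t^{v_\mu(i)-v_\mu(j)}}\Big)E_\mu$$ and $$A_{\lambda+\rho}=\sum_{\mu\in S_n(\lambda+\rho)}\Big(\prod_{1\le i<j\le n,\ \mu_i>\mu_j}(-1)\,\frac{1-q^{\mu_i-\mu_j}t^{v_\mu(i)-v_\mu(j)+1}}{1-q^{\mu_i-\mu_j}t^{v_\mu(i)-v_\mu(j)}}\Big)E_\mu .$$ Here $S_n\lambda$ denotes the set of distinct rearrangements of $\lambda$.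
   Context: Let $q,t^{1/2}$ be independent indeterminates over $\mathbb{C}$, $t=(t^{1/2})^2$, $K=\mathbb{C}(q,t^{1/2})$, $K[X]=K[x_1^{\pm1},\ldots,x_n^{\pm1}]$. $S_n$ acts on $K[X]$ by permuting variables and on $\mathbb{Z}^n$ by $(w\mu)_{w(i)}=\mu_i$; $s_i=(i,i+1)$; $\ell$ is the length; $w_0$ is the longest element of $S_n$. Put $x^\mu=x_1^{\mu_1}\cdots x_n^{\mu_n}$, $\rho=(n-1,n-2,\ldots,1,0)$, $\partial_if=\frac{f-s_if}{x_i-x_{i+1}}$. For $\mu\in\mathbb{Z}^n$, $v_\mu\in S_n$ is the minimal length permutation such that $v_\mu\mu$ is weakly increasing; explicitly $v_\mu(r)=1+\#\{r'<r:\mu_{r'}\le\mu_r\}+\#\{r'>r:\mu_{r'}<\mu_r\}$. The electronic (nonsymmetric) Macdonald polynomials $E_\mu\in K[X]$, $\mu\in\mathbb{Z}^n$, are determined by: (E0) $E_{(0,\ldots,0)}=1$; (E1) $E_{(\mu_n+1,\mu_1,\ldots,\mu_{n-1})}=q^{\mu_n}x_1E_\mu(x_2,\ldots,x_n,q^{ -1}x_1)$; (E2) if $\mu\in\mathbb{Z}_{\ge0}^n$ and $\mu_i>\mu_{i+1}$ then $E_{s_i\mu}=\partial_i(x_iE_\mu)-tx_i\partial_iE_\mu+\frac{(1-t)a}{1-a}E_\mu$ with $a=q^{\mu_i-\mu_{i+1}}t^{v_\mu(i)-v_\mu(i+1)}$; (E3) $E_{(\mu_1-1,\ldots,\mu_n-1)}=x_1^{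 -1}\cdots x_n^{ -1}E_\mu$. For weakly decreasing $\lambda$: $P_\lambda=\frac1{W_\lambda(t)}\sum_{w\in S_n}w\big(E_\lambda\prod_{i<j}\frac{x_i-tx_j}{x_i-x_j}\big)$, where $W_\lambda(t)$ is the constant making the coefficient of $x^\lambda$ in $P_\lambda$ equal to $1$; and $A_{\lambda+\rho}=\big(\prod_{i<j}\frac{x_j-tx_i}{x_i-x_j}\big)\sum_{w\in S_n}(-1)^{\ell(w)}wE_{\lambda+\rho}$. $W_\lambda$ is the stabilizer of $\lambda$ in $S_n$ and $W^\lambda$ is the set of minimal length representatives of the cosets in $S_n/W_\lambda$; the permutation $v_\lambda$ above is the longest element of $W^\lambda$. For commuting variables $Y_1,\ldots,Y_n$ set $$c^Y_{ij}=\frac{t^{ -\frac12}-t^{\frac12}Y_iY_j^{ -1}}{1-Y_iY_j^{ -1}},\qquad c^{Y^{ -1}}_{ij}=\frac{t^{ -\frac12}-t^{\frac12}Y_i^{ -1}Y_j}{1-Y_i^{ -1}Y_j},$$ and for $w\in S_n$ let $c^Y_w=\prod_{(i,j)\in\mathrm{Inv}(w)}c^Y_{ij}$ and $c^{Y^{ -1}}_w=\prod_{(i,j)\in\mathrm{Inv}(w)}c^{Y^{ -1}}_{ij}$, where $\mathrm{Inv}(w)=\{(i,j):1\le i<j\le n,\ w(i)>w(j)\}$. For $\mu\in\mathbb{Z}^n$, $\mathrm{ev}^t_\mu$ is the evaluation homomorphism $\mathrm{ev}^t_\mu(Y_i)=q^{ -\mu_i}t^{ -(v_\mu(i)-1)+\frac12(n-1)}$,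 extended to rational functions whose evaluated denominator is nonzero.
   Formalization: In the first two formulas v_λz and w_0z are replaced by v_λz^{ -1} and w_0z^{ -1}: as printed, n=3, λ=(1,0,0), z=v_λ gives E_{(0,0,1)} the coefficient (1-qt^3)/(1-qt) instead of 1, contradicting the alternative formula. ℂ is replaced by an arbitrary field. -}

module Defs where

open import Algebra.Bundles using (CommutativeRing)
open import Algebra.Structures using (IsCommutativeRing)
open import Algebra.Apartness.Bundles using (HeytingField; HeytingCommutativeRing)
import Algebra.Properties.Ring
import Algebra.Properties.CommutativeSemigroup
import Algebra.Properties.Semiring.Exp
import Algebra.Solver.Ring.NaturalCoefficients.Default
open import Data.Bool.Base using (if_then_else_)
open import Data.Fin.Base as Fin using (Fin; zero; suc; toℕ; fromℕ<; inject₁; opposite; punchOut)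
import Data.Fin.Properties as Fin
open import Data.Fin.Permutation as Perm using (Permutation′; _⟨$⟩ʳ_; _⟨$⟩ˡ_)
open import Data.Integer.Base as ℤ using (ℤ; +_; 0ℤ; 1ℤ; -1ℤ)
import Data.Integer.Properties as ℤ
open import Data.List.Base as List using (List; []; _∷_; _++_; length; allFin)
import Data.List.Properties as List
open import Data.List.Membership.Propositional using (lose)
open import Data.List.Membership.Propositional.Properties using (∈-allFin)
open import Data.List.Relation.Unary.All as All using (All)
open import Data.List.Relation.Unary.Any using (Any; here; there)
import Data.Maybe.Base as Maybe
open import Data.Nat.Base as ℕ using (ℕ; zero; suc)
import Data.Nat.Properties as ℕ
open import Data.Product.Base using (_×_; _,_; proj₁; proj₂; ∃-syntax)
open import Data.Sum.Base using (_⊎_; inj₁; inj₂)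
open import Data.Vec.Base as Vec using (Vec; []; _∷_; lookup; tabulate)
import Data.Vec.Properties as Vec
open import Function.Base using (_∘_; id)
open import Function.Definitions using (Injective)
open import Level using (_⊔_)
open import Relation.Binary.Definitions using (tri<; tri≈; tri>)
open import Relation.Binary.PropositionalEquality as ≡ using (_≡_; _≢_)
import Relation.Binary.Reasoning.Setoid
open import Relation.Nullary.Decidable using (Dec; yes; no; does; _×-dec_; _⊎-dec_; _→-dec_; dec⇒maybe)
open import Relation.Nullary.Negation using (¬_; contradiction)
open import Relation.Unary using (Pred; Decidable)

-- Every element of Sₙ exactly once: zero ↦ j, composed with each
-- bijection of the remaining points.
Sₙ : ∀ n → List (Permutation′ n)
Sₙ zero    = Perm.id ∷ []
Sₙ (suc n) = List.concatMap (λ j → List.map (Perm.insert zero j) (Sₙ n)) (allFin (suc n))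

module _ {n : ℕ} where

  infixr 9 _·_
  infixr 8 _•_
  infix  10 _⁻¹

  -- (w · u)(i) = w(u(i)); the library's _∘ₚ_ composes in the other order.
  _·_ : Permutation′ n → Permutation′ n → Permutation′ n
  w · u = u Perm.∘ₚ w

  _⁻¹ : Permutation′ n → Permutation′ n
  w ⁻¹ = Perm.flip w

  -- (w • μ)_{w(i)} = μ_i
  _•_ : ∀ {a} {A : Set a} → Permutation′ n → Vec A n → Vec A n
  w • μ = tabulate (λ i → lookup μ (w ⟨$⟩ˡ i))

  w₀ : Permutation′ n
  w₀ = Perm.reverse

_≟ᵉ_ : ∀ {n} (α β : Vec ℤ n) → Dec (α ≡ β)
_≟ᵉ_ = Vec.≡-dec ℤ._≟_

record Pair (n : ℕ) : Set where
  constructor pair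
  field
    fst snd : Fin n
    fst<snd : fst Fin.< snd

  fst≢snd : fst ≢ snd
  fst≢snd = Fin.<⇒≢ fst<snd

pairs : ∀ n → List (Pair n)
pairs n = List.mapMaybe (λ (i , j) → Maybe.map (pair i j) (dec⇒maybe (i Fin.<? j)))
                        (List.cartesianProduct (allFin n) (allFin n))

module _ {n : ℕ} where

  Inv : Permutation′ n → List (Pair n)
  Inv w = List.filter (λ p → let open Pair p in (w ⟨$⟩ʳ snd) Fin.<? (w ⟨$⟩ʳ fst)) (pairs n)

  ℓ : Permutation′ n → ℕ
  ℓ w = length (Inv w)

  -- z is of minimal length in its coset z W_μ, where W_μ is the
  -- stabilizer of μ.
  IsMinRep : Vec ℤ n → Permutation′ n → Set
  IsMinRep μ z = All (λ w → w • μ ≡ μ → ℓ z ℕ.≤ ℓ (z · w)) (Sₙ n)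

  isMinRep? : ∀ μ → Decidable (IsMinRep μ)
  isMinRep? μ z = All.all? (λ w → ((w • μ) ≟ᵉ μ) →-dec (ℓ z ℕ.≤? ℓ (z · w))) (Sₙ n)

  W^ : Vec ℤ n → List (Permutation′ n)
  W^ μ = List.filter (isMinRep? μ) (Sₙ n)

  orbit : Vec ℤ n → List (Vec ℤ n)
  orbit μ = List.deduplicate _≟ᵉ_ (List.map (_• μ) (Sₙ n))

  ρ : Vec ℤ n
  ρ = tabulate (λ i → + toℕ (opposite i))

  WeaklyDecreasing : Vec ℤ n → Set
  WeaklyDecreasing μ = ∀ {i j} → i Fin.≤ j → lookup μ j ℤ.≤ lookup μ i

private
  length-filter-mono : ∀ {a p q} {A : Set a} {P : Pred A p} {Q : Pred A q}
    (P? : Decidable P) (Q? : Decidable Q) → (∀ {x} → P x → Q x) →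
    ∀ xs → length (List.filter P? xs) ℕ.≤ length (List.filter Q? xs)
  length-filter-mono P? Q? P⊆Q [] = ℕ.z≤n
  length-filter-mono P? Q? P⊆Q (x ∷ xs) with length-filter-mono P? Q? P⊆Q xs | P? x | Q? x
  ... | ih | yes _  | yes _ = ℕ.s≤s ih
  ... | ih | yes Px | no ¬Qx = contradiction (P⊆Q Px) ¬Qx
  ... | ih | no  _  | yes _ = ℕ.m≤n⇒m≤1+n ih
  ... | ih | no  _  | no  _ = ih

  length-filter-strict : ∀ {a p q} {A : Set a} {P : Pred A p} {Q : Pred A q}
    (P? : Decidable P) (Q? : Decidable Q) → (∀ {x} → P x → Q x) →
    ∀ {xs} → Any (λ x → Q x × ¬ P x) xs →
    length (List.filter P? xs) ℕ.< length (List.filter Q? xs)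
  length-filter-strict P? Q? P⊆Q {x ∷ xs} (here (Qx , ¬Px)) with P? x | Q? x
  ... | yes Px | _      = contradiction Px ¬Px
  ... | no  _  | yes _  = ℕ.s≤s (length-filter-mono P? Q? P⊆Q xs)
  ... | no  _  | no ¬Qx = contradiction Qx ¬Qx
  length-filter-strict P? Q? P⊆Q {x ∷ xs} (there p) with length-filter-strict P? Q? P⊆Q p | P? x | Q? x
  ... | ih | yes _  | yes _ = ℕ.s≤s ih
  ... | ih | yes Px | no ¬Qx = contradiction (P⊆Q Px) ¬Qx
  ... | ih | no  _  | yes _ = ℕ.m≤n⇒m≤1+n ih
  ... | ih | no  _  | no  _ = ih

  injective⇒permutation : ∀ {n} (f : Fin n → Fin n) → Injective _≡_ _≡_ f → Permutation′ n
  injective⇒permutation {n} f inj = Perm.permutation f g f∘g (λ x → inj (f∘g (f x)))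
    where
    preimage : ∀ {n} (f : Fin n → Fin n) → Injective _≡_ _≡_ f → ∀ y → ∃[ x ] f x ≡ y
    preimage {suc n} f inj y with Fin.any? (λ x → f x Fin.≟ y)
    ... | yes p = p
    ... | no ¬p = contradiction
      (Fin.injective⇒≤ (λ {x} {x′} eq → inj (Fin.punchOut-injective (missed x) (missed x′) eq)))
      ℕ.1+n≰n
      where
      missed : ∀ x → y ≢ f x
      missed x y≡fx = ¬p (x , ≡.sym y≡fx)

    g : Fin n → Fin n
    g y = proj₁ (preimage f inj y)

    f∘g : ∀ y → f (g y) ≡ y
    f∘g y = proj₂ (preimage f inj y)

module _ {n : ℕ} (μ : Vec ℤ n) where

  Before : Fin n → Fin n → Set
  Before s r = (s Fin.< r × lookup μ s ℤ.≤ lookup μ r)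
             ⊎ (r Fin.< s × lookup μ s ℤ.< lookup μ r)

  before? : ∀ s r → Dec (Before s r)
  before? s r = ((s Fin.<? r) ×-dec (lookup μ s ℤ.≤? lookup μ r))
          ⊎-dec ((r Fin.<? s) ×-dec (lookup μ s ℤ.<? lookup μ r))

  rank : Fin n → ℕ
  rank r = length (List.filter (λ s → before? s r) (allFin n))

  before-irrefl : ∀ {r} → ¬ Before r r
  before-irrefl (inj₁ (r<r , _)) = ℕ.<-irrefl ≡.refl r<r
  before-irrefl (inj₂ (r<r , _)) = ℕ.<-irrefl ≡.refl r<r

  before-trans : ∀ {r s u} → Before r s → Before s u → Before r u
  before-trans {r} {s} {u} p q with ℕ.<-cmp (toℕ r) (toℕ u)
  before-trans (inj₁ (_ , a)) (inj₁ (_ , b)) | tri< r<u _ _ = inj₁ (r<u , ℤ.≤-trans a b)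
  before-trans (inj₁ (_ , a)) (inj₂ (_ , b)) | tri< r<u _ _ = inj₁ (r<u , ℤ.<⇒≤ (ℤ.≤-<-trans a b))
  before-trans (inj₂ (_ , a)) (inj₁ (_ , b)) | tri< r<u _ _ = inj₁ (r<u , ℤ.<⇒≤ (ℤ.<-≤-trans a b))
  before-trans (inj₂ (_ , a)) (inj₂ (_ , b)) | tri< r<u _ _ = inj₁ (r<u , ℤ.<⇒≤ (ℤ.<-trans a b))
  before-trans (inj₁ (r<s , _)) (inj₁ (s<u , _)) | tri> _ _ u<r = contradiction (ℕ.<-trans r<s s<u) (ℕ.<-asym u<r)
  before-trans (inj₁ (_ , a)) (inj₂ (_ , b)) | tri> _ _ u<r = inj₂ (u<r , ℤ.≤-<-trans a b)
  before-trans (inj₂ (_ , a)) (inj₁ (_ , b)) | tri> _ _ u<r = inj₂ (u<r , ℤ.<-≤-trans a b)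
  before-trans (inj₂ (_ , a)) (inj₂ (_ , b)) | tri> _ _ u<r = inj₂ (u<r , ℤ.<-trans a b)
  before-trans p q | tri≈ _ r≡u _ with Fin.toℕ-injective r≡u
  before-trans (inj₁ (r<s , _)) (inj₁ (s<r , _)) | tri≈ _ _ _ | ≡.refl = contradiction s<r (ℕ.<-asym r<s)
  before-trans (inj₁ (_ , a)) (inj₂ (_ , b)) | tri≈ _ _ _ | ≡.refl = contradiction (ℤ.≤-<-trans a b) (ℤ.<-irrefl ≡.refl)
  before-trans (inj₂ (_ , a)) (inj₁ (_ , b)) | tri≈ _ _ _ | ≡.refl = contradiction (ℤ.<-≤-trans a b) (ℤ.<-irrefl ≡.refl)
  before-trans (inj₂ (_ , a)) (inj₂ (_ , b)) | tri≈ _ _ _ | ≡.refl = contradiction (ℤ.<-trans a b) (ℤ.<-irrefl ≡.refl)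

  before-total : ∀ {r s} → r ≢ s → Before r s ⊎ Before s r
  before-total {r} {s} r≢s with ℕ.<-cmp (toℕ r) (toℕ s) | ℤ.<-cmp (lookup μ r) (lookup μ s)
  ... | tri≈ _ r≡s _ | _           = contradiction (Fin.toℕ-injective r≡s) r≢s
  ... | tri< r<s _ _ | tri< a _ _  = inj₁ (inj₁ (r<s , ℤ.<⇒≤ a))
  ... | tri< r<s _ _ | tri≈ _ a _  = inj₁ (inj₁ (r<s , ℤ.≤-reflexive a))
  ... | tri< r<s _ _ | tri> _ _ a  = inj₂ (inj₂ (r<s , a))
  ... | tri> _ _ s<r | tri< a _ _  = inj₁ (inj₂ (s<r , a))
  ... | tri> _ _ s<r | tri≈ _ a _  = inj₂ (inj₁ (s<r , ℤ.≤-reflexive (≡.sym a)))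
  ... | tri> _ _ s<r | tri> _ _ a  = inj₂ (inj₁ (s<r , ℤ.<⇒≤ a))

  before⇒rank< : ∀ {r s} → Before r s → rank r ℕ.< rank s
  before⇒rank< {r} {s} p = length-filter-strict (λ u → before? u r) (λ u → before? u s)
    (λ q → before-trans q p) (lose (∈-allFin r) (p , before-irrefl))

  rank<n : ∀ r → rank r ℕ.< n
  rank<n r = ≡.subst (rank r ℕ.<_) (List.length-tabulate _)
    (List.filter-notAll (λ s → before? s r) _ (lose (∈-allFin r) before-irrefl))

  rank-injective : Injective _≡_ _≡_ rank
  rank-injective {r} {s} eq with r Fin.≟ s
  ... | yes r≡s = r≡s
  ... | no  r≢s with before-total r≢s
  ...   | inj₁ p = contradiction eq (ℕ.<⇒≢ (before⇒rank< p))
  ...   | inj₂ p = contradiction (≡.sym eq) (ℕ.<⇒≢ (before⇒rank< p))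

  -- v_μ(r) = 1 + #{s < r : μ_s ≤ μ_r} + #{s > r : μ_s < μ_r}; since Fin n
  -- starts at 0 the summand 1 is dropped, so toℕ (v μ r) is v_μ(r) − 1.
  v : Permutation′ n
  v = injective⇒permutation (λ r → fromℕ< (rank<n r))
        (λ {r} {s} eq → rank-injective (Fin.fromℕ<-injective _ _ (rank<n r) (rank<n s) eq))

  vᶻ : Fin n → ℤ
  vᶻ r = + toℕ (v ⟨$⟩ʳ r)

  vᶻ-injective : Injective _≡_ _≡_ vᶻ
  vᶻ-injective {r} {s} eq = rank-injective
    (≡.trans (≡.sym (Fin.toℕ-fromℕ< (rank<n r)))
      (≡.trans (ℤ.+-injective eq) (Fin.toℕ-fromℕ< (rank<n s))))

module _ {c ℓ} (R : CommutativeRing c ℓ) where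
  open CommutativeRing R

  ∑ : ∀ {a} {A : Set a} → List A → (A → Carrier) → Carrier
  ∑ xs f = List.foldr (λ x s → f x + s) 0# xs

  ∏ : ∀ {a} {A : Set a} → List A → (A → Carrier) → Carrier
  ∏ xs f = List.foldr (λ x p → f x * p) 1# xs

  -- Not a zero divisor; in an integral domain: nonzero.
  record Regular (x : Carrier) : Set (c ⊔ ℓ) where
    constructor mkRegular
    field
      cancel : ∀ y → x * y ≈ 0# → y ≈ 0#

open Regular public

module _ {c ℓ} {R : CommutativeRing c ℓ} where
  open CommutativeRing R hiding (zero)

  regular-1 : Regular R 1#
  regular-1 = mkRegular λ y 1y≈0 → trans (sym (*-identityˡ y)) 1y≈0

  regular-* : ∀ {x y} → Regular R x → Regular R y → Regular R (x * y)
  regular-* {x} {y} rx ry = mkRegular λ z xyz≈0 →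
    cancel ry z (cancel rx (y * z) (trans (sym (*-assoc x y z)) xyz≈0))

  regular-cong : ∀ {x y} → x ≈ y → Regular R x → Regular R y
  regular-cong x≈y rx = mkRegular λ z yz≈0 → cancel rx z (trans (*-congʳ x≈y) yz≈0)

  ∏-cong : ∀ {a} {A : Set a} (xs : List A) {f g} → (∀ x → f x ≈ g x) → ∏ R xs f ≈ ∏ R xs g
  ∏-cong []       p = refl
  ∏-cong (x ∷ xs) p = *-cong (p x) (∏-cong xs p)

  ∏-1 : ∀ {a} {A : Set a} (xs : List A) {f} → (∀ x → f x ≈ 1#) → ∏ R xs f ≈ 1#
  ∏-1 []       p = refl
  ∏-1 (x ∷ xs) p = trans (*-cong (p x) (∏-1 xs p)) (*-identityˡ 1#)

  ∏-* : ∀ {a} {A : Set a} (xs : List A) f g → ∏ R xs (λ x → f x * g x) ≈ ∏ R xs f * ∏ R xs g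
  ∏-* []       f g = sym (*-identityˡ 1#)
  ∏-* (x ∷ xs) f g = trans (*-congˡ (∏-* xs f g))
    (Algebra.Properties.CommutativeSemigroup.interchange *-commutativeSemigroup _ _ _ _)

  ∏-single : ∀ {a} {A : Set a} {k} (h : Fin k → A) (f : A → Carrier) i →
             (∀ j → j ≢ i → f (h j) ≈ 1#) → ∏ R (List.tabulate h) f ≈ f (h i)
  ∏-single {k = suc k} h f zero p =
    trans (*-congˡ (rest (h ∘ suc) λ j → p (suc j) λ ())) (*-identityʳ _)
    where
    rest : ∀ {k} (h : Fin k → _) → (∀ j → f (h j) ≈ 1#) → ∏ R (List.tabulate h) f ≈ 1#
    rest {zero}  h q = refl
    rest {suc k} h q = trans (*-cong (q zero) (rest (h ∘ suc) (q ∘ suc))) (*-identityˡ 1#)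
  ∏-single h f (suc i) p = trans
    (*-cong (p zero λ ()) (∏-single (h ∘ suc) f i λ j j≢i → p (suc j) (j≢i ∘ Fin.suc-injective)))
    (*-identityˡ _)

infixl 6 _⊕_
infix  8 ⊖_

_⊕_ : ∀ {n} → Vec ℤ n → Vec ℤ n → Vec ℤ n
_⊕_ = Vec.zipWith ℤ._+_

⊖_ : ∀ {n} → Vec ℤ n → Vec ℤ n
⊖_ = Vec.map (λ k → ℤ.- k)

𝟎 : ∀ {n} → Vec ℤ n
𝟎 = Vec.replicate _ 0ℤ

indicator : ∀ {n} → Fin n → Fin n → ℤ
indicator i j = if does (i Fin.≟ j) then 1ℤ else 0ℤ

-- exponent vector of the i-th variable
𝐞 : ∀ {n} → Fin n → Vec ℤ n
𝐞 i = tabulate (indicator i)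

lookup-𝐞-≡ : ∀ {n} (i : Fin n) → lookup (𝐞 i) i ≡ 1ℤ
lookup-𝐞-≡ i = ≡.trans (Vec.lookup∘tabulate (indicator i) i) on
  where
  on : indicator i i ≡ 1ℤ
  on with i Fin.≟ i
  ... | yes _  = ≡.refl
  ... | no i≢i = contradiction ≡.refl i≢i

lookup-𝐞-≢ : ∀ {n} {i j : Fin n} → i ≢ j → lookup (𝐞 i) j ≡ 0ℤ
lookup-𝐞-≢ {i = i} {j} i≢j = ≡.trans (Vec.lookup∘tabulate (indicator i) j) off
  where
  off : indicator i j ≡ 0ℤ
  off with i Fin.≟ j
  ... | yes i≡j = contradiction i≡j i≢j
  ... | no  _   = ≡.refl

𝐞-injective : ∀ {n} {i j : Fin n} → i ≢ j → 𝐞 i ≢ 𝐞 j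
𝐞-injective {i = i} {j} i≢j eq with () ← ≡.trans (≡.sym (lookup-𝐞-≡ i))
  (≡.trans (≡.cong (λ γ → lookup γ i) eq) (lookup-𝐞-≢ (i≢j ∘ ≡.sym)))

⊕-comm : ∀ {n} (α β : Vec ℤ n) → α ⊕ β ≡ β ⊕ α
⊕-comm = Vec.zipWith-comm ℤ.+-comm

⊕-assoc : ∀ {n} (α β γ : Vec ℤ n) → (α ⊕ β) ⊕ γ ≡ α ⊕ (β ⊕ γ)
⊕-assoc = Vec.zipWith-assoc ℤ.+-assoc

⊕-identityˡ : ∀ {n} (α : Vec ℤ n) → 𝟎 ⊕ α ≡ α
⊕-identityˡ = Vec.zipWith-identityˡ ℤ.+-identityˡ

⊕-inverseˡ : ∀ {n} (α : Vec ℤ n) → (⊖ α) ⊕ α ≡ 𝟎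
⊕-inverseˡ = Vec.zipWith-inverseˡ ℤ.+-inverseˡ

⊕-cancelˡ : ∀ {n} (α β : Vec ℤ n) → (⊖ α) ⊕ (α ⊕ β) ≡ β
⊕-cancelˡ α β = ≡.trans (≡.sym (⊕-assoc (⊖ α) α β))
  (≡.trans (≡.cong (_⊕ β) (⊕-inverseˡ α)) (⊕-identityˡ β))

⊕-cancelˡ′ : ∀ {n} (α β : Vec ℤ n) → α ⊕ ((⊖ α) ⊕ β) ≡ β
⊕-cancelˡ′ α β = ≡.trans (≡.sym (⊕-assoc α (⊖ α) β))
  (≡.trans (≡.cong (_⊕ β) (≡.trans (⊕-comm α (⊖ α)) (⊕-inverseˡ α))) (⊕-identityˡ β))

module Laurent {c ℓ} (R : CommutativeRing c ℓ) (n : ℕ) where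
  open CommutativeRing R hiding (isCommutativeRing; ring; zero)
  open Algebra.Properties.Ring (CommutativeRing.ring R) using (-‿distribˡ-*; -‿+-comm; -0#≈0#)
  private
    module + = Algebra.Properties.CommutativeSemigroup +-commutativeSemigroup
    module * = Algebra.Properties.CommutativeSemigroup *-commutativeSemigroup
  open Relation.Binary.Reasoning.Setoid setoid

  -- A list of terms (a , α), read as the sum of the a x^α. Exponents may
  -- repeat and coefficients may vanish, so polynomials are compared by
  -- their coefficients.
  Poly : Set c
  Poly = List (Carrier × Vec ℤ n)

  -- Linear extension of x^α ↦ φ α.
  ⟨_,_⟩ : Poly → (Vec ℤ n → Carrier) → Carrier
  ⟨ f , φ ⟩ = ∑ R f (λ (a , α) → a * φ α)

  δ : Vec ℤ n → Vec ℤ n → Carrier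
  δ μ α = if does (α ≟ᵉ μ) then 1# else 0#

  coeff : Poly → Vec ℤ n → Carrier
  coeff f μ = ⟨ f , δ μ ⟩

  infix 4 _≋_
  record _≋_ (f g : Poly) : Set ℓ where
    constructor coeffwise
    field
      at : ∀ μ → coeff f μ ≈ coeff g μ
  open _≋_ public

  monomial : Vec ℤ n → Poly
  monomial α = (1# , α) ∷ []

  const : Carrier → Poly
  const a = (a , 𝟎) ∷ []

  opaque
    add mul : Poly → Poly → Poly
    add f g = f ++ g
    mul f g = List.concatMap (λ (a , α) → List.map (λ (b , β) → (a * b , α ⊕ β)) g) f

    neg : Poly → Poly
    neg = List.map (λ (a , α) → (- a , α))

  ⟨⟩-cong : ∀ f {φ ψ} → (∀ α → φ α ≈ ψ α) → ⟨ f , φ ⟩ ≈ ⟨ f , ψ ⟩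
  ⟨⟩-cong []            p = refl
  ⟨⟩-cong ((a , α) ∷ f) p = +-cong (*-congˡ (p α)) (⟨⟩-cong f p)

  ⟨⟩-++ : ∀ f g {φ} → ⟨ f ++ g , φ ⟩ ≈ ⟨ f , φ ⟩ + ⟨ g , φ ⟩
  ⟨⟩-++ []            g = sym (+-identityˡ _)
  ⟨⟩-++ ((a , α) ∷ f) g = trans (+-congˡ (⟨⟩-++ f g)) (sym (+-assoc _ _ _))

  opaque
    unfolding add neg

    ⟨⟩-add : ∀ f g {φ} → ⟨ add f g , φ ⟩ ≈ ⟨ f , φ ⟩ + ⟨ g , φ ⟩
    ⟨⟩-add = ⟨⟩-++

    ⟨⟩-neg : ∀ f {φ} → ⟨ neg f , φ ⟩ ≈ - ⟨ f , φ ⟩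
    ⟨⟩-neg []                = sym -0#≈0#
    ⟨⟩-neg ((a , α) ∷ f) {φ} = trans (+-cong (sym (-‿distribˡ-* a (φ α))) (⟨⟩-neg f)) (-‿+-comm _ _)

  ⟨⟩-0 : ∀ f → ⟨ f , (λ _ → 0#) ⟩ ≈ 0#
  ⟨⟩-0 []            = refl
  ⟨⟩-0 ((a , α) ∷ f) = trans (+-cong (zeroʳ a) (⟨⟩-0 f)) (+-identityˡ 0#)

  ⟨⟩-+ : ∀ f φ ψ → ⟨ f , (λ α → φ α + ψ α) ⟩ ≈ ⟨ f , φ ⟩ + ⟨ f , ψ ⟩
  ⟨⟩-+ []            φ ψ = sym (+-identityˡ 0#)
  ⟨⟩-+ ((a , α) ∷ f) φ ψ = trans (+-cong (distribˡ a (φ α) (ψ α)) (⟨⟩-+ f φ ψ)) (+.interchange _ _ _ _)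

  ⟨⟩-* : ∀ f b φ → ⟨ f , (λ α → b * φ α) ⟩ ≈ b * ⟨ f , φ ⟩
  ⟨⟩-* []            b φ = sym (zeroʳ b)
  ⟨⟩-* ((a , α) ∷ f) b φ = trans (+-cong (*.x∙yz≈y∙xz a b (φ α)) (⟨⟩-* f b φ)) (sym (distribˡ b _ _))

  opaque
    unfolding mul

    ⟨⟩-mul : ∀ f g φ → ⟨ mul f g , φ ⟩ ≈ ⟨ f , (λ α → ⟨ g , (λ β → φ (α ⊕ β)) ⟩) ⟩
    ⟨⟩-mul []            g φ = refl
    ⟨⟩-mul ((a , α) ∷ f) g φ = trans (⟨⟩-++ (List.map _ g) (mul f g)) (+-cong (shift g) (⟨⟩-mul f g φ))
      where
      shift : ∀ g → ⟨ List.map (λ (b , β) → (a * b , α ⊕ β)) g , φ ⟩ ≈ a * ⟨ g , (λ β → φ (α ⊕ β)) ⟩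
      shift []            = sym (zeroʳ a)
      shift ((b , β) ∷ g) = trans (+-cong (*-assoc a b _) (shift g)) (sym (distribˡ a _ _))

  ⟨⟩-swap : ∀ f g (φ : Vec ℤ n → Vec ℤ n → Carrier) →
            ⟨ f , (λ α → ⟨ g , φ α ⟩) ⟩ ≈ ⟨ g , (λ β → ⟨ f , (λ α → φ α β) ⟩) ⟩
  ⟨⟩-swap []            g φ = sym (⟨⟩-0 g)
  ⟨⟩-swap ((a , α) ∷ f) g φ = begin
    a * ⟨ g , φ α ⟩ + ⟨ f , (λ α → ⟨ g , φ α ⟩) ⟩
      ≈⟨ +-cong (sym (⟨⟩-* g a (φ α))) (⟨⟩-swap f g φ) ⟩
    ⟨ g , (λ β → a * φ α β) ⟩ + ⟨ g , (λ β → ⟨ f , (λ α → φ α β) ⟩) ⟩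
      ≈⟨ sym (⟨⟩-+ g _ _) ⟩
    ⟨ g , (λ β → a * φ α β + ⟨ f , (λ α → φ α β) ⟩) ⟩ ∎

  δ-⊕ : ∀ μ α β → δ μ (α ⊕ β) ≡ δ ((⊖ α) ⊕ μ) β
  δ-⊕ μ α β with (α ⊕ β) ≟ᵉ μ | β ≟ᵉ ((⊖ α) ⊕ μ)
  ... | yes _ | yes _ = ≡.refl
  ... | no  _ | no  _ = ≡.refl
  ... | yes p | no ¬q = contradiction (≡.trans (≡.sym (⊕-cancelˡ α β)) (≡.cong ((⊖ α) ⊕_) p)) ¬q
  ... | no ¬p | yes q = contradiction (≡.trans (≡.cong (α ⊕_) q) (⊕-cancelˡ′ α μ)) ¬p

  opaque
    unfolding mul

    monomial-* : ∀ α β → mul (monomial α) (monomial β) ≋ monomial (α ⊕ β)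
    monomial-* α β = coeffwise λ μ → +-congʳ (*-congʳ (*-identityˡ 1#))

  coeff-mul : ∀ f g μ → coeff (mul f g) μ ≈ ⟨ f , (λ α → coeff g ((⊖ α) ⊕ μ)) ⟩
  coeff-mul f g μ = trans (⟨⟩-mul f g (δ μ))
    (⟨⟩-cong f (λ α → ⟨⟩-cong g (λ β → reflexive (δ-⊕ μ α β))))

  private
    ≋-refl : ∀ {f} → f ≋ f
    ≋-refl = coeffwise λ μ → refl

    ≋-sym : ∀ {f g} → f ≋ g → g ≋ f
    ≋-sym p = coeffwise λ μ → sym (at p μ)

    ≋-trans : ∀ {f g h} → f ≋ g → g ≋ h → f ≋ h
    ≋-trans p q = coeffwise λ μ → trans (at p μ) (at q μ)

    add-cong : ∀ {f f′ g g′} → f ≋ f′ → g ≋ g′ → add f g ≋ add f′ g′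
    add-cong {f} {f′} {g} {g′} p q = coeffwise λ μ → begin
      coeff (add f g) μ        ≈⟨ ⟨⟩-add f g ⟩
      coeff f μ + coeff g μ   ≈⟨ +-cong (at p μ) (at q μ) ⟩
      coeff f′ μ + coeff g′ μ ≈⟨ sym (⟨⟩-add f′ g′) ⟩
      coeff (add f′ g′) μ      ∎

    add-comm : ∀ f g → add f g ≋ add g f
    add-comm f g = coeffwise λ μ → trans (⟨⟩-add f g) (trans (+-comm _ _) (sym (⟨⟩-add g f)))

    add-assoc : ∀ f g h → add (add f g) h ≋ add f (add g h)
    add-assoc f g h = coeffwise λ μ → trans (trans (⟨⟩-add (add f g) h) (+-congʳ (⟨⟩-add f g)))
      (trans (+-assoc _ _ _) (sym (trans (⟨⟩-add f (add g h)) (+-congˡ (⟨⟩-add g h)))))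

    add-identityˡ : ∀ f → add [] f ≋ f
    add-identityˡ f = coeffwise λ μ → trans (⟨⟩-add [] f) (+-identityˡ _)

    neg-cong : ∀ {f g} → f ≋ g → neg f ≋ neg g
    neg-cong {f} {g} p = coeffwise λ μ → trans (⟨⟩-neg f) (trans (-‿cong (at p μ)) (sym (⟨⟩-neg g)))

    neg-inverseˡ : ∀ f → add (neg f) f ≋ []
    neg-inverseˡ f = coeffwise λ μ → trans (⟨⟩-add (neg f) f) (trans (+-congʳ (⟨⟩-neg f)) (-‿inverseˡ _))

    neg-inverseʳ : ∀ f → add f (neg f) ≋ []
    neg-inverseʳ f = ≋-trans (add-comm f (neg f)) (neg-inverseˡ f)

    mul-comm : ∀ f g → mul f g ≋ mul g f
    mul-comm f g = coeffwise λ μ → begin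
      coeff (mul f g) μ                            ≈⟨ ⟨⟩-mul f g (δ μ) ⟩
      ⟨ f , (λ α → ⟨ g , (λ β → δ μ (α ⊕ β)) ⟩) ⟩  ≈⟨ ⟨⟩-swap f g _ ⟩
      ⟨ g , (λ β → ⟨ f , (λ α → δ μ (α ⊕ β)) ⟩) ⟩
        ≈⟨ ⟨⟩-cong g (λ β → ⟨⟩-cong f (λ α → reflexive (≡.cong (δ μ) (⊕-comm α β)))) ⟩
      ⟨ g , (λ β → ⟨ f , (λ α → δ μ (β ⊕ α)) ⟩) ⟩  ≈⟨ sym (⟨⟩-mul g f (δ μ)) ⟩
      coeff (mul g f) μ                            ∎

    mul-congˡ : ∀ f {g g′} → g ≋ g′ → mul f g ≋ mul f g′
    mul-congˡ f {g} {g′} p = coeffwise λ μ → trans (coeff-mul f g μ)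
      (trans (⟨⟩-cong f (λ α → at p _)) (sym (coeff-mul f g′ μ)))

    mul-cong : ∀ {f f′ g g′} → f ≋ f′ → g ≋ g′ → mul f g ≋ mul f′ g′
    mul-cong {f} {f′} {g} {g′} p q = ≋-trans (mul-congˡ f q)
      (≋-trans (mul-comm f g′) (≋-trans (mul-congˡ g′ p) (mul-comm g′ f′)))

    mul-assoc : ∀ f g h → mul (mul f g) h ≋ mul f (mul g h)
    mul-assoc f g h = coeffwise λ μ → begin
      coeff (mul (mul f g) h) μ
        ≈⟨ ⟨⟩-mul (mul f g) h (δ μ) ⟩
      ⟨ mul f g , (λ α → ⟨ h , (λ γ → δ μ (α ⊕ γ)) ⟩) ⟩
        ≈⟨ ⟨⟩-mul f g _ ⟩
      ⟨ f , (λ α → ⟨ g , (λ β → ⟨ h , (λ γ → δ μ ((α ⊕ β) ⊕ γ)) ⟩) ⟩) ⟩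
        ≈⟨ ⟨⟩-cong f (λ α → ⟨⟩-cong g (λ β → ⟨⟩-cong h (λ γ → reflexive (≡.cong (δ μ) (⊕-assoc α β γ))))) ⟩
      ⟨ f , (λ α → ⟨ g , (λ β → ⟨ h , (λ γ → δ μ (α ⊕ (β ⊕ γ))) ⟩) ⟩) ⟩
        ≈⟨ ⟨⟩-cong f (λ α → sym (⟨⟩-mul g h _)) ⟩
      ⟨ f , (λ α → ⟨ mul g h , (λ β → δ μ (α ⊕ β)) ⟩) ⟩
        ≈⟨ sym (⟨⟩-mul f (mul g h) (δ μ)) ⟩
      coeff (mul f (mul g h)) μ ∎

    mul-identityˡ : ∀ f → mul (monomial 𝟎) f ≋ f
    mul-identityˡ f = coeffwise λ μ → begin
      coeff (mul (monomial 𝟎) f) μ                  ≈⟨ ⟨⟩-mul (monomial 𝟎) f (δ μ) ⟩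
      1# * ⟨ f , (λ β → δ μ (𝟎 ⊕ β)) ⟩ + 0#         ≈⟨ trans (+-identityʳ _) (*-identityˡ _) ⟩
      ⟨ f , (λ β → δ μ (𝟎 ⊕ β)) ⟩
        ≈⟨ ⟨⟩-cong f (λ β → reflexive (≡.cong (δ μ) (⊕-identityˡ β))) ⟩
      coeff f μ                                     ∎

    mul-distribˡ : ∀ f g h → mul f (add g h) ≋ add (mul f g) (mul f h)
    mul-distribˡ f g h = coeffwise λ μ → begin
      coeff (mul f (add g h)) μ
        ≈⟨ coeff-mul f (add g h) μ ⟩
      ⟨ f , (λ α → coeff (add g h) ((⊖ α) ⊕ μ)) ⟩
        ≈⟨ ⟨⟩-cong f (λ α → ⟨⟩-add g h) ⟩
      ⟨ f , (λ α → coeff g ((⊖ α) ⊕ μ) + coeff h ((⊖ α) ⊕ μ)) ⟩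
        ≈⟨ ⟨⟩-+ f _ _ ⟩
      ⟨ f , (λ α → coeff g ((⊖ α) ⊕ μ)) ⟩ + ⟨ f , (λ α → coeff h ((⊖ α) ⊕ μ)) ⟩
        ≈⟨ sym (+-cong (coeff-mul f g μ) (coeff-mul f h μ)) ⟩
      coeff (mul f g) μ + coeff (mul f h) μ
        ≈⟨ sym (⟨⟩-add (mul f g) (mul f h)) ⟩
      coeff (add (mul f g) (mul f h)) μ ∎

    mul-distribʳ : ∀ f g h → mul (add g h) f ≋ add (mul g f) (mul h f)
    mul-distribʳ f g h = ≋-trans (mul-comm (add g h) f)
      (≋-trans (mul-distribˡ f g h) (add-cong (mul-comm f g) (mul-comm f h)))

  abstract
    isCommutativeRing : IsCommutativeRing _≋_ add mul neg [] (monomial 𝟎)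
    isCommutativeRing = record
      { isRing = record
        { +-isAbelianGroup = record
          { isGroup = record
            { isMonoid = record
              { isSemigroup = record
                { isMagma = record
                  { isEquivalence = record { refl = ≋-refl ; sym = ≋-sym ; trans = ≋-trans }
                  ; ∙-cong = add-cong }
                ; assoc = add-assoc }
              ; identity = add-identityˡ , (λ f → ≋-trans (add-comm f []) (add-identityˡ f)) }
            ; inverse = neg-inverseˡ , neg-inverseʳ
            ; ⁻¹-cong = neg-cong }
          ; comm = add-comm }
        ; *-cong = mul-cong
        ; *-assoc = mul-assoc
        ; *-identity = mul-identityˡ , (λ f → ≋-trans (mul-comm f (monomial 𝟎)) (mul-identityˡ f))
        ; distrib = mul-distribˡ , mul-distribʳ }
      ; *-comm = mul-comm }

  ring : CommutativeRing c ℓ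
  ring = record { isCommutativeRing = isCommutativeRing }

  private
    -- Exponents of f at position r are bounded by bound f.
    bound : Fin n → Poly → ℤ
    bound r []            = 0ℤ
    bound r ((a , α) ∷ f) = lookup α r ℤ.⊔ bound r f

    coeff-above : ∀ r f ν → bound r f ℤ.< lookup ν r → coeff f ν ≈ 0#
    coeff-above r []            ν p = refl
    coeff-above r ((a , α) ∷ f) ν p = trans
      (+-cong (trans (*-congˡ (reflexive δ≡0)) (zeroʳ a))
              (coeff-above r f ν (ℤ.≤-<-trans (ℤ.i≤j⊔i (lookup α r) (bound r f)) p)))
      (+-identityˡ 0#)
      where
      δ≡0 : δ ν α ≡ 0#
      δ≡0 with α ≟ᵉ ν
      ... | no  _      = ≡.refl
      ... | yes ≡.refl = contradiction (ℤ.≤-<-trans (ℤ.i≤i⊔j (lookup α r) (bound r f)) p) (ℤ.<-irrefl ≡.refl)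

    i≤∣i∣ : ∀ i → i ℤ.≤ + ℤ.∣ i ∣
    i≤∣i∣ (+ n)        = ℤ.≤-refl
    i≤∣i∣ ℤ.-[1+ n ] = ℤ.-≤+

    periodic⇒0 : ∀ r f γ → 0ℤ ℤ.< lookup γ r → (∀ ν → coeff f ν ≈ coeff f (γ ⊕ ν)) →
                 ∀ ν → coeff f ν ≈ 0#
    periodic⇒0 r f γ γ>0 periodic ν = climb (suc ℤ.∣ d ∣) ν far
      where
      d : ℤ
      d = bound r f ℤ.- lookup ν r

      far : bound r f ℤ.< + suc ℤ.∣ d ∣ ℤ.+ lookup ν r
      far = ≡.subst (ℤ._< + suc ℤ.∣ d ∣ ℤ.+ lookup ν r)
        (≡.trans (ℤ.+-assoc (bound r f) _ _)
          (≡.trans (≡.cong (λ z → bound r f ℤ.+ z) (ℤ.+-inverseˡ (lookup ν r))) (ℤ.+-identityʳ _)))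
        (ℤ.+-monoˡ-< (lookup ν r) (ℤ.≤-<-trans (i≤∣i∣ d) (ℤ.+<+ ℕ.≤-refl)))

      climb : ∀ k ν → bound r f ℤ.< + k ℤ.+ lookup ν r → coeff f ν ≈ 0#
      climb zero    ν p = coeff-above r f ν (≡.subst (bound r f ℤ.<_) (ℤ.+-identityˡ _) p)
      climb (suc k) ν p = trans (periodic ν) (climb k (γ ⊕ ν) (ℤ.<-≤-trans p step))
        where
        step : + suc k ℤ.+ lookup ν r ℤ.≤ + k ℤ.+ lookup (γ ⊕ ν) r
        step = ≡.subst₂ ℤ._≤_
          (≡.trans (≡.sym (ℤ.+-assoc (+ k) 1ℤ (lookup ν r)))
                   (≡.cong (ℤ._+ lookup ν r) (ℤ.+-comm (+ k) 1ℤ)))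
          (≡.cong (λ z → + k ℤ.+ z) (≡.sym (Vec.lookup-zipWith ℤ._+_ r γ ν)))
          (ℤ.+-monoʳ-≤ (+ k) (ℤ.+-monoˡ-≤ (lookup ν r) (ℤ.i<j⇒suc[i]≤j γ>0)))

    shift⇒0 : ∀ r f α β → lookup β r ℤ.< lookup α r →
              (∀ μ → coeff f ((⊖ α) ⊕ μ) ≈ coeff f ((⊖ β) ⊕ μ)) → ∀ ν → coeff f ν ≈ 0#
    shift⇒0 r f α β β<α shift = periodic⇒0 r f ((⊖ β) ⊕ α) γ>0 λ ν → begin
      coeff f ν                   ≈⟨ reflexive (≡.cong (coeff f) (≡.sym (⊕-cancelˡ α ν))) ⟩
      coeff f ((⊖ α) ⊕ (α ⊕ ν))   ≈⟨ shift (α ⊕ ν) ⟩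
      coeff f ((⊖ β) ⊕ (α ⊕ ν))   ≈⟨ reflexive (≡.cong (coeff f) (≡.sym (⊕-assoc (⊖ β) α ν))) ⟩
      coeff f (((⊖ β) ⊕ α) ⊕ ν)   ∎
      where
      γ>0 : 0ℤ ℤ.< lookup ((⊖ β) ⊕ α) r
      γ>0 = ≡.subst₂ ℤ._<_ (ℤ.+-inverseˡ (lookup β r))
        (≡.sym (≡.trans (Vec.lookup-zipWith ℤ._+_ r (⊖ β) α)
                        (≡.cong (ℤ._+ lookup α r) (Vec.lookup-map r _ β))))
        (ℤ.+-monoʳ-< (ℤ.- lookup β r) β<α)

    differ : ∀ {k} (α β : Vec ℤ k) → α ≢ β → ∃[ r ] lookup α r ≢ lookup β r
    differ []      []      α≢β = contradiction ≡.refl α≢β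
    differ (a ∷ α) (b ∷ β) α≢β with a ℤ.≟ b
    ... | no a≢b     = zero , a≢b
    ... | yes ≡.refl with differ α β (α≢β ∘ ≡.cong (a ∷_))
    ...   | r , p = suc r , p

  abstract
    regular-binomial : ∀ {α β} → α ≢ β → Regular ring (add (monomial α) (neg (monomial β)))
    regular-binomial {α} {β} α≢β = mkRegular λ f p → coeffwise (vanish f p)
      where
      module _ (f : Poly) (p : mul (add (monomial α) (neg (monomial β))) f ≋ []) where
        shift : ∀ μ → coeff f ((⊖ α) ⊕ μ) ≈ coeff f ((⊖ β) ⊕ μ)
        shift μ = begin
          A             ≈⟨ sym (+-identityʳ A) ⟩
          A + 0#        ≈⟨ +-congˡ (sym (-‿inverseˡ B)) ⟩
          A + (- B + B) ≈⟨ sym (+-assoc A (- B) B) ⟩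
          (A + - B) + B ≈⟨ +-congʳ A-B≈0 ⟩
          0# + B        ≈⟨ +-identityˡ B ⟩
          B             ∎
          where
          A B : Carrier
          A = coeff f ((⊖ α) ⊕ μ)
          B = coeff f ((⊖ β) ⊕ μ)

          single : ∀ γ {φ} → ⟨ monomial γ , φ ⟩ ≈ φ γ
          single γ = trans (+-identityʳ _) (*-identityˡ _)

          A-B≈0 : A + - B ≈ 0#
          A-B≈0 = begin
            A + - B
              ≈⟨ +-cong (sym (single α {φ})) (trans (-‿cong (sym (single β {φ}))) (sym (⟨⟩-neg (monomial β)))) ⟩
            ⟨ monomial α , φ ⟩ + ⟨ neg (monomial β) , φ ⟩
              ≈⟨ sym (⟨⟩-add (monomial α) (neg (monomial β))) ⟩
            ⟨ add (monomial α) (neg (monomial β)) , φ ⟩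
              ≈⟨ sym (coeff-mul (add (monomial α) (neg (monomial β))) f μ) ⟩
            coeff (mul (add (monomial α) (neg (monomial β))) f) μ
              ≈⟨ at p μ ⟩
            0# ∎
            where
            φ : Vec ℤ n → Carrier
            φ γ = coeff f ((⊖ γ) ⊕ μ)

        vanish : ∀ ν → coeff f ν ≈ 0#
        vanish with differ α β α≢β
        ... | r , αr≢βr with ℤ.<-cmp (lookup α r) (lookup β r)
        ...   | tri< α<β _ _ = shift⇒0 r f β α α<β (λ μ → sym (shift μ))
        ...   | tri≈ _ α≡β _ = contradiction α≡β αr≢βr
        ...   | tri> _ _ β<α = shift⇒0 r f α β β<α shift

  -- w x_i = x_{w(i)}, hence w x^α = x^{w • α}
  act : Permutation′ n → Poly → Poly
  act w = List.map (λ (a , α) → (a , w • α))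

  •-⊕ : ∀ (w : Permutation′ n) (α β : Vec ℤ n) → w • (α ⊕ β) ≡ (w • α) ⊕ (w • β)
  •-⊕ w α β = ≡.trans (Vec.tabulate-cong (λ i → Vec.lookup-zipWith ℤ._+_ (w ⟨$⟩ˡ i) α β))
                      (zipWith-tabulate (λ i → lookup α (w ⟨$⟩ˡ i)) (λ i → lookup β (w ⟨$⟩ˡ i)))
    where
    zipWith-tabulate : ∀ {k} (f g : Fin k → ℤ) → tabulate (λ i → f i ℤ.+ g i) ≡ tabulate f ⊕ tabulate g
    zipWith-tabulate {zero}  f g = ≡.refl
    zipWith-tabulate {suc k} f g = ≡.cong (f zero ℤ.+ g zero ∷_) (zipWith-tabulate (f ∘ suc) (g ∘ suc))

  ⁻¹•• : ∀ (w : Permutation′ n) (α : Vec ℤ n) → (w ⁻¹) • (w • α) ≡ α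
  ⁻¹•• w α = ≡.trans
    (Vec.tabulate-cong (λ i → ≡.trans (Vec.lookup∘tabulate _ (w ⟨$⟩ʳ i)) (≡.cong (lookup α) (Perm.inverseˡ w))))
    (Vec.tabulate∘lookup α)

  •⁻¹• : ∀ (w : Permutation′ n) (α : Vec ℤ n) → w • ((w ⁻¹) • α) ≡ α
  •⁻¹• w α = ≡.trans
    (Vec.tabulate-cong (λ i → ≡.trans (Vec.lookup∘tabulate _ (w ⟨$⟩ˡ i)) (≡.cong (lookup α) (Perm.inverseʳ w))))
    (Vec.tabulate∘lookup α)

  ⟨⟩-act : ∀ w f φ → ⟨ act w f , φ ⟩ ≡ ⟨ f , (λ α → φ (w • α)) ⟩
  ⟨⟩-act w []            φ = ≡.refl
  ⟨⟩-act w ((a , α) ∷ f) φ = ≡.cong (λ z → a * φ (w • α) + z) (⟨⟩-act w f φ)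

  δ-• : ∀ w μ α → δ μ (w • α) ≡ δ ((w ⁻¹) • μ) α
  δ-• w μ α with (w • α) ≟ᵉ μ | α ≟ᵉ ((w ⁻¹) • μ)
  ... | yes _ | yes _ = ≡.refl
  ... | no  _ | no  _ = ≡.refl
  ... | yes p | no ¬q = contradiction (≡.trans (≡.sym (⁻¹•• w α)) (≡.cong ((w ⁻¹) •_) p)) ¬q
  ... | no ¬p | yes q = contradiction (≡.trans (≡.cong (w •_) q) (•⁻¹• w μ)) ¬p

  coeff-act : ∀ w f μ → coeff (act w f) μ ≈ coeff f ((w ⁻¹) • μ)
  coeff-act w f μ = trans (reflexive (⟨⟩-act w f (δ μ))) (⟨⟩-cong f (λ α → reflexive (δ-• w μ α)))

  act-cong : ∀ w {f g} → f ≋ g → act w f ≋ act w g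
  act-cong w {f} {g} p = coeffwise λ μ →
    trans (coeff-act w f μ) (trans (at p _) (sym (coeff-act w g μ)))

  act-mul : ∀ w f g → act w (mul f g) ≋ mul (act w f) (act w g)
  act-mul w f g = coeffwise λ μ → begin
    coeff (act w (mul f g)) μ
      ≈⟨ reflexive (⟨⟩-act w (mul f g) (δ μ)) ⟩
    ⟨ mul f g , (λ α → δ μ (w • α)) ⟩
      ≈⟨ ⟨⟩-mul f g _ ⟩
    ⟨ f , (λ α → ⟨ g , (λ β → δ μ (w • (α ⊕ β))) ⟩) ⟩
      ≈⟨ ⟨⟩-cong f (λ α → ⟨⟩-cong g (λ β → reflexive (≡.cong (δ μ) (•-⊕ w α β)))) ⟩
    ⟨ f , (λ α → ⟨ g , (λ β → δ μ ((w • α) ⊕ (w • β))) ⟩) ⟩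
      ≈⟨ ⟨⟩-cong f (λ α → reflexive (≡.sym (⟨⟩-act w g _))) ⟩
    ⟨ f , (λ α → ⟨ act w g , (λ β → δ μ ((w • α) ⊕ β)) ⟩) ⟩
      ≈⟨ reflexive (≡.sym (⟨⟩-act w f _)) ⟩
    ⟨ act w f , (λ α → ⟨ act w g , (λ β → δ μ (α ⊕ β)) ⟩) ⟩
      ≈⟨ sym (⟨⟩-mul (act w f) (act w g) (δ μ)) ⟩
    coeff (mul (act w f) (act w g)) μ ∎

  act-inverse : ∀ w f → act w (act (w ⁻¹) f) ≋ f
  act-inverse w f = coeffwise λ μ → begin
    coeff (act w (act (w ⁻¹) f)) μ  ≈⟨ coeff-act w (act (w ⁻¹) f) μ ⟩
    coeff (act (w ⁻¹) f) ((w ⁻¹) • μ) ≈⟨ reflexive (⟨⟩-act (w ⁻¹) f _) ⟩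
    ⟨ f , (λ α → δ ((w ⁻¹) • μ) ((w ⁻¹) • α)) ⟩
      ≈⟨ ⟨⟩-cong f (λ α → reflexive (≡.trans (≡.sym (δ-• w μ ((w ⁻¹) • α))) (≡.cong (δ μ) (•⁻¹• w α)))) ⟩
    coeff f μ                       ∎

  act-inverse′ : ∀ w f → act (w ⁻¹) (act w f) ≋ f
  act-inverse′ w f = coeffwise λ μ → begin
    coeff (act (w ⁻¹) (act w f)) μ ≈⟨ reflexive (⟨⟩-act (w ⁻¹) (act w f) (δ μ)) ⟩
    ⟨ act w f , (λ α → δ μ ((w ⁻¹) • α)) ⟩ ≈⟨ reflexive (⟨⟩-act w f _) ⟩
    ⟨ f , (λ α → δ μ ((w ⁻¹) • (w • α))) ⟩
      ≈⟨ ⟨⟩-cong f (λ α → reflexive (≡.cong (δ μ) (⁻¹•• w α))) ⟩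
    coeff f μ ∎

  abstract
    regular-act : ∀ w {d} → Regular ring d → Regular ring (act w d)
    regular-act w {d} reg = mkRegular λ y wd*y≈0 →
      S.trans (S.sym (act-inverse w y)) (act-cong w (cancel reg (act (w ⁻¹) y)
        (S.trans (S.*-congʳ (S.sym (act-inverse′ w d)))
          (S.trans (S.sym (act-mul (w ⁻¹) (act w d) y)) (act-cong (w ⁻¹) wd*y≈0)))))
      where module S = CommutativeRing ring

-- The total ring of fractions of R: its field of fractions when R is an
-- integral domain.
module Frac {c ℓ} (R : CommutativeRing c ℓ) where
  open CommutativeRing R hiding (isCommutativeRing; ring; zero)
  open Algebra.Properties.Ring (CommutativeRing.ring R) using (-‿distribˡ-*; -‿distribʳ-*)
  open Algebra.Solver.Ring.NaturalCoefficients.Default commutativeSemiring using (solve; _:=_; _:+_; _:*_)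
  open Relation.Binary.Reasoning.Setoid setoid

  record Fraction : Set (c ⊔ ℓ) where
    constructor frac
    field
      num den : Carrier
      regular : Regular R den
  open Fraction public

  infix 4 _≃_
  record _≃_ (x y : Fraction) : Set ℓ where
    constructor cross
    field
      eq : num x * den y ≈ num y * den x
  open _≃_ public

  ι : Carrier → Fraction
  ι a = frac a 1# regular-1

  opaque
    add mul : Fraction → Fraction → Fraction
    add x y = frac (num x * den y + num y * den x) (den x * den y) (regular-* (regular x) (regular y))
    mul x y = frac (num x * num y) (den x * den y) (regular-* (regular x) (regular y))

    neg : Fraction → Fraction
    neg x = frac (- num x) (den x) (regular x)

  private
    ≃-trans : ∀ {x y z} → x ≃ y → y ≃ z → x ≃ z
    ≃-trans {x} {y} {z} (cross p) (cross q) = cross (begin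
      A             ≈⟨ sym (+-identityʳ A) ⟩
      A + 0#        ≈⟨ +-congˡ (sym (-‿inverseˡ B)) ⟩
      A + (- B + B) ≈⟨ sym (+-assoc A (- B) B) ⟩
      (A + - B) + B ≈⟨ +-congʳ (cancel (regular y) (A + - B) tA-tB) ⟩
      0# + B        ≈⟨ +-identityˡ B ⟩
      B             ∎)
      where
      A B : Carrier
      A = num x * den z
      B = num z * den x

      tA-tB : den y * (A + - B) ≈ 0#
      tA-tB = begin
        den y * (A + - B)
          ≈⟨ distribˡ (den y) A (- B) ⟩
        den y * A + den y * - B
          ≈⟨ +-congˡ (sym (-‿distribʳ-* (den y) B)) ⟩
        den y * A + - (den y * B)
          ≈⟨ +-congʳ (solve 3 (λ t a u → t :* (a :* u) := (a :* t) :* u) refl (den y) (num x) (den z)) ⟩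
        (num x * den y) * den z + - (den y * B)
          ≈⟨ +-cong (*-congʳ p)
               (-‿cong (solve 3 (λ t b s → t :* (b :* s) := (b :* t) :* s) refl (den y) (num z) (den x))) ⟩
        (num y * den x) * den z + - ((num z * den y) * den x)
          ≈⟨ +-congˡ (-‿cong (*-congʳ (sym q))) ⟩
        (num y * den x) * den z + - ((num y * den z) * den x)
          ≈⟨ +-congʳ (solve 3 (λ b s u → (b :* s) :* u := (b :* u) :* s) refl (num y) (den x) (den z)) ⟩
        (num y * den z) * den x + - ((num y * den z) * den x)
          ≈⟨ -‿inverseʳ _ ⟩
        0# ∎

  opaque
    unfolding add mul neg

    private
      add-cong : ∀ {x x′ y y′} → x ≃ x′ → y ≃ y′ → add x y ≃ add x′ y′
      add-cong {x} {x′} {y} {y′} (cross p) (cross q) = cross (begin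
        (num x * den y + num y * den x) * (den x′ * den y′)
          ≈⟨ solve 6 (λ a s b t s′ t′ → (a :* t :+ b :* s) :* (s′ :* t′)
               := (a :* s′) :* (t :* t′) :+ (b :* t′) :* (s :* s′)) refl
               (num x) (den x) (num y) (den y) (den x′) (den y′) ⟩
        (num x * den x′) * (den y * den y′) + (num y * den y′) * (den x * den x′)
          ≈⟨ +-cong (*-congʳ p) (*-congʳ q) ⟩
        (num x′ * den x) * (den y * den y′) + (num y′ * den y) * (den x * den x′)
          ≈⟨ solve 6 (λ a′ s b′ t s′ t′ → (a′ :* s) :* (t :* t′) :+ (b′ :* t) :* (s :* s′)
               := (a′ :* t′ :+ b′ :* s′) :* (s :* t)) refl
               (num x′) (den x) (num y′) (den y) (den x′) (den y′) ⟩
        (num x′ * den y′ + num y′ * den x′) * (den x * den y) ∎)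

      mul-cong : ∀ {x x′ y y′} → x ≃ x′ → y ≃ y′ → mul x y ≃ mul x′ y′
      mul-cong {x} {x′} {y} {y′} (cross p) (cross q) = cross (begin
        (num x * num y) * (den x′ * den y′)
          ≈⟨ solve 4 (λ a b s t → (a :* b) :* (s :* t) := (a :* s) :* (b :* t)) refl
               (num x) (num y) (den x′) (den y′) ⟩
        (num x * den x′) * (num y * den y′)
          ≈⟨ *-cong p q ⟩
        (num x′ * den x) * (num y′ * den y)
          ≈⟨ solve 4 (λ a s b t → (a :* s) :* (b :* t) := (a :* b) :* (s :* t)) refl
               (num x′) (den x) (num y′) (den y) ⟩
        (num x′ * num y′) * (den x * den y) ∎)

      neg-cong : ∀ {x y} → x ≃ y → neg x ≃ neg y
      neg-cong (cross p) = cross (trans (sym (-‿distribˡ-* _ _)) (trans (-‿cong p) (-‿distribˡ-* _ _)))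

      add-assoc : ∀ x y z → add (add x y) z ≃ add x (add y z)
      add-assoc x y z = cross (solve 6
        (λ a s b t c u → ((a :* t :+ b :* s) :* u :+ c :* (s :* t)) :* (s :* (t :* u))
                       := (a :* (t :* u) :+ (b :* u :+ c :* t) :* s) :* ((s :* t) :* u))
        refl (num x) (den x) (num y) (den y) (num z) (den z))

      add-comm : ∀ x y → add x y ≃ add y x
      add-comm x y = cross (solve 4
        (λ a s b t → (a :* t :+ b :* s) :* (t :* s) := (b :* s :+ a :* t) :* (s :* t))
        refl (num x) (den x) (num y) (den y))

      add-identityˡ : ∀ x → add (ι 0#) x ≃ x
      add-identityˡ x = cross (begin
        (0# * den x + num x * 1#) * den x ≈⟨ *-congʳ (+-cong (zeroˡ _) (*-identityʳ _)) ⟩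
        (0# + num x) * den x              ≈⟨ *-congʳ (+-identityˡ _) ⟩
        num x * den x                     ≈⟨ *-congˡ (sym (*-identityˡ _)) ⟩
        num x * (1# * den x)              ∎)

      neg-inverseˡ : ∀ x → add (neg x) x ≃ ι 0#
      neg-inverseˡ x = cross (begin
        (- num x * den x + num x * den x) * 1# ≈⟨ *-identityʳ _ ⟩
        - num x * den x + num x * den x        ≈⟨ +-congʳ (sym (-‿distribˡ-* _ _)) ⟩
        - (num x * den x) + num x * den x      ≈⟨ -‿inverseˡ _ ⟩
        0#                                     ≈⟨ sym (zeroˡ _) ⟩
        0# * (den x * den x)                   ∎)

      mul-assoc : ∀ x y z → mul (mul x y) z ≃ mul x (mul y z)
      mul-assoc x y z = cross (*-cong (*-assoc _ _ _) (sym (*-assoc _ _ _)))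

      mul-comm : ∀ x y → mul x y ≃ mul y x
      mul-comm x y = cross (*-cong (*-comm _ _) (*-comm _ _))

      mul-identityˡ : ∀ x → mul (ι 1#) x ≃ x
      mul-identityˡ x = cross (*-cong (*-identityˡ _) (sym (*-identityˡ _)))

      mul-distribˡ : ∀ x y z → mul x (add y z) ≃ add (mul x y) (mul x z)
      mul-distribˡ x y z = cross (solve 6
        (λ a s b t c u → (a :* (b :* u :+ c :* t)) :* ((s :* t) :* (s :* u))
                       := ((a :* b) :* (s :* u) :+ (a :* c) :* (s :* t)) :* (s :* (t :* u)))
        refl (num x) (den x) (num y) (den y) (num z) (den z))

      mul-distribʳ : ∀ x y z → mul (add y z) x ≃ add (mul y x) (mul z x)
      mul-distribʳ x y z = ≃-trans (mul-comm (add y z) x)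
        (≃-trans (mul-distribˡ x y z) (add-cong (mul-comm x y) (mul-comm x z)))

  abstract
    isCommutativeRing : IsCommutativeRing _≃_ add mul neg (ι 0#) (ι 1#)
    isCommutativeRing = record
      { isRing = record
        { +-isAbelianGroup = record
          { isGroup = record
            { isMonoid = record
              { isSemigroup = record
                { isMagma = record
                  { isEquivalence = record
                    { refl = cross refl ; sym = λ (cross p) → cross (sym p) ; trans = ≃-trans }
                  ; ∙-cong = add-cong }
                ; assoc = add-assoc }
              ; identity = add-identityˡ , (λ x → ≃-trans (add-comm x (ι 0#)) (add-identityˡ x)) }
            ; inverse = neg-inverseˡ , (λ x → ≃-trans (add-comm x (neg x)) (neg-inverseˡ x))
            ; ⁻¹-cong = neg-cong }
          ; comm = add-comm }
        ; *-cong = mul-cong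
        ; *-assoc = mul-assoc
        ; *-identity = mul-identityˡ , (λ x → ≃-trans (mul-comm x (ι 1#)) (mul-identityˡ x))
        ; distrib = mul-distribˡ , mul-distribʳ }
      ; *-comm = mul-comm }

  ring : CommutativeRing (c ⊔ ℓ) ℓ
  ring = record { isCommutativeRing = isCommutativeRing }

  opaque
    unfolding add mul neg

    ι-* : ∀ a b → mul (ι a) (ι b) ≃ ι (a * b)
    ι-* a b = cross (*-congˡ (sym (*-identityˡ 1#)))

    ι-- : ∀ a b → add (ι a) (neg (ι b)) ≃ ι (a + - b)
    ι-- a b = cross (*-cong (+-cong (*-identityʳ a) (*-identityʳ (- b))) (sym (*-identityˡ 1#)))

    regular-num : ∀ {x} → Regular ring x → Regular R (num x)
    regular-num {x} reg = mkRegular λ y nx*y≈0 →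
      trans (sym (*-identityʳ y)) (trans (eq (cancel reg (ι y) (cross (begin
        (num x * y) * 1#  ≈⟨ *-identityʳ _ ⟩
        num x * y         ≈⟨ nx*y≈0 ⟩
        0#                ≈⟨ sym (zeroˡ _) ⟩
        0# * (den x * 1#) ∎)))) (zeroˡ 1#))

    regular-ι : ∀ {a} → Regular R a → Regular ring (ι a)
    regular-ι reg = mkRegular λ { y (cross p) → cross (begin
      num y * 1#  ≈⟨ *-identityʳ _ ⟩
      num y       ≈⟨ cancel reg (num y) (trans (sym (*-identityʳ _)) (trans p (zeroˡ _))) ⟩
      0#          ≈⟨ sym (zeroˡ _) ⟩
      0# * den y  ∎) }

  infixl 7 _÷_[_]
  opaque
    _÷_[_] : ∀ (x y : Fraction) → Regular ring y → Fraction
    x ÷ y [ reg ] = frac (num x * den y) (den x * num y) (regular-* (regular x) (regular-num reg))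

  ι-cong : ∀ {a b} → a ≈ b → ι a ≃ ι b
  ι-cong a≈b = cross (*-congʳ a≈b)

-- The ground field 𝔽 is arbitrary (the library has no ℂ), and n = suc m.
-- Denominators are required to be regular: the rings below are integral
-- domains, in which this means nonzero.
module Macdonald {c ℓ₁ ℓ₂} (𝔽 : HeytingField c ℓ₁ ℓ₂) (m : ℕ) where

  n : ℕ
  n = suc m

  -- The scalars K = 𝔽(q,t^½), obtained as fractions of 𝔽[q^±1,t^±½].
  module F = Laurent (HeytingCommutativeRing.commutativeRing (HeytingField.heytingCommutativeRing 𝔽)) 2
  module Scalars = Frac F.ring
  module K = CommutativeRing Scalars.ring
  open Scalars public using (_÷_[_])

  K : Set (c ⊔ ℓ₁)
  K = K.Carrier

  -- K[x₁^±1,…,x_n^±1] and its field of fractions. The variables Y_i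
  -- range over the same ring, so K⟨Y⟩ = K⟨X⟩.
  module X = Laurent Scalars.ring n
  module P = CommutativeRing X.ring
  module Rational = Frac X.ring
  module Q = CommutativeRing Rational.ring
  open X public using (coeff) renaming (const to C)
  open Rational public using (ι)

  K[X] K⟨X⟩ K⟨Y⟩ : Set (c ⊔ ℓ₁)
  K[X] = P.Carrier
  K⟨X⟩ = Q.Carrier
  K⟨Y⟩ = Q.Carrier

  open Algebra.Properties.Semiring.Exp K.semiring public using (_^_)

  -- qt a b = q^a (t^½)^b
  qt : ℤ → ℤ → K
  qt a b = Scalars.ι (F.monomial (a ∷ b ∷ []))

  infix 9 q^_ t^_ t½^_
  q^_ t^_ t½^_ : ℤ → K
  q^  a = qt a 0ℤ
  t½^ b = qt 0ℤ b
  t^  b = qt 0ℤ (+ 2 ℤ.* b)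

  t½ t : K
  t½ = t½^ 1ℤ
  t  = t½ K.* t½

  qt-* : ∀ a b a′ b′ → qt a b K.* qt a′ b′ K.≈ qt (a ℤ.+ a′) (b ℤ.+ b′)
  qt-* a b a′ b′ = K.trans (Scalars.ι-* _ _) (Scalars.ι-cong (F.monomial-* (a ∷ b ∷ []) (a′ ∷ b′ ∷ [])))

  abstract
    regular-1-qt : ∀ a {b} → b ≢ 0ℤ → Regular Scalars.ring (K.1# K.- qt a b)
    regular-1-qt a {b} b≢0 = regular-cong (K.sym (Scalars.ι-- _ _))
      (Scalars.regular-ι (F.regular-binomial λ eq → b≢0 (≡.sym (≡.cong (λ (γ : Vec ℤ 2) → lookup γ (suc zero)) eq))))

  qt[_,_,_] : Vec ℤ n → Fin n → Fin n → K
  qt[ μ , i , j ] = q^ (lookup μ i ℤ.- lookup μ j) K.* t^ (vᶻ μ i ℤ.- vᶻ μ j)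

  abstract
    regular-1-qt[] : ∀ μ {i j} → i ≢ j → Regular Scalars.ring (K.1# K.- qt[ μ , i , j ])
    regular-1-qt[] μ {i} {j} i≢j = regular-cong
      (K.+-congˡ (K.-‿cong (K.sym (K.trans (qt-* _ _ _ _)
        (K.reflexive (≡.cong₂ qt (ℤ.+-identityʳ _) (ℤ.+-identityˡ _)))))))
      (regular-1-qt (lookup μ i ℤ.- lookup μ j) λ eq → i≢j (vᶻ-injective μ
        (ℤ.i-j≡0⇒i≡j _ _ (ℤ.*-cancelˡ-≡ (+ 2) _ 0ℤ eq))))

  x : Fin n → K[X]
  x i = X.monomial (𝐞 i)

  act : Permutation′ n → K⟨X⟩ → K⟨X⟩
  act w f = Rational.frac (X.act w (num f)) (X.act w (den f)) (X.regular-act w (regular f))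
    where open Rational using (num; den; regular)

  i≢1+i : ∀ (i : Fin m) → inject₁ i ≢ suc i
  i≢1+i i eq = ℕ.<⇒≢ (ℕ.n<1+n _) (≡.trans (≡.sym (Fin.toℕ-inject₁ i)) (≡.cong toℕ eq))

  s : Fin m → Permutation′ n
  s i = Perm.transpose (inject₁ i) (suc i)

  regular-x-x : ∀ {i j} → i ≢ j → Regular X.ring (x i P.- x j)
  regular-x-x i≢j = X.regular-binomial (𝐞-injective i≢j)

  ∂ : Fin m → K[X] → K⟨X⟩
  ∂ i f = Rational.frac (f P.- X.act (s i) f) (x (inject₁ i) P.- x (suc i))
    (regular-x-x (i≢1+i i))

  -- f(x₁,…,x_n) ↦ f(x₂,…,x_n,q⁻¹x₁)
  twist : K[X] → K[X]
  twist = List.map (λ (a , α) → (a K.* q^ (ℤ.- Vec.last α) , Vec.last α ∷ Vec.init α))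

  record IsElectronic (E : Vec ℤ n → K[X]) : Set (c ⊔ ℓ₁) where
    field
      E0 : E 𝟎 P.≈ P.1#
      E1 : ∀ μ → E (Vec.last μ ℤ.+ 1ℤ ∷ Vec.init μ) P.≈ C (q^ Vec.last μ) P.* x zero P.* twist (E μ)
      E2 : ∀ μ i → let i⁻ = inject₁ i
                       i⁺ = suc i
                       a  = qt[ μ , i⁻ , i⁺ ]
                       b  = (K.1# K.- t) K.* a ÷ K.1# K.- a [ regular-1-qt[] μ (i≢1+i i) ]
                   in
           (∀ r → 0ℤ ℤ.≤ lookup μ r) → lookup μ i⁺ ℤ.< lookup μ i⁻ →
           ι (E (s i • μ)) Q.≈ ∂ i (x i⁻ P.* E μ) Q.- ι (C t P.* x i⁻) Q.* ∂ i (E μ) Q.+ ι (C b P.* E μ)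
      E3 : ∀ μ → E (Vec.map (ℤ._- 1ℤ) μ) P.≈ X.monomial (Vec.replicate n -1ℤ) P.* E μ

  -- f is P_λ, and W is the normalizing constant W_λ(t).
  record IsMacdonaldP (E : Vec ℤ n → K[X]) (lam : Vec ℤ n) (f : K[X]) : Set (c ⊔ ℓ₁) where
    field
      W           : K
      W-regular   : Regular Scalars.ring W
      symmetrized : ι f Q.≈ ι (C (K.1# ÷ W [ W-regular ])) Q.*
                      ∑ Rational.ring (Sₙ n) λ w → act w (ι (E lam) Q.*
                        ∏ Rational.ring (pairs n) λ (pair i j i<j) →
                          Rational.frac (x i P.- C t P.* x j) (x i P.- x j) (regular-x-x (Fin.<⇒≢ i<j)))
      normalized  : coeff f lam K.≈ K.1#

  -- A_{λ+ρ}
  A : (E : Vec ℤ n → K[X]) (lam : Vec ℤ n) → K⟨X⟩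
  A E lam = (∏ Rational.ring (pairs n) λ (pair i j i<j) →
               Rational.frac (x j P.- C t P.* x i) (x i P.- x j) (regular-x-x (Fin.<⇒≢ i<j)))
            Q.* ∑ Rational.ring (Sₙ n) λ w → ι (C ((K.- K.1#) ^ ℓ w)) Q.* act w (ι (E (lam ⊕ ρ)))

  x⁻¹ : Fin n → K[X]
  x⁻¹ i = X.monomial (⊖ 𝐞 i)

  private
    1-ratio-regular : ∀ {i j} → i ≢ j → Regular X.ring (P.1# P.- x i P.* x⁻¹ j)
    1-ratio-regular {i} {j} i≢j = regular-cong
      (P.+-congˡ (P.-‿cong (P.sym (X.monomial-* (𝐞 i) (⊖ 𝐞 j)))))
      (X.regular-binomial {𝟎} {𝐞 i ⊕ ⊖ 𝐞 j} nontrivial)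
      where
      nontrivial : 𝟎 ≢ 𝐞 i ⊕ ⊖ 𝐞 j
      nontrivial eq = 𝐞-injective i≢j (≡.trans (≡.sym (⊕-cancelˡ′ (𝐞 j) (𝐞 i)))
        (≡.trans (≡.cong (𝐞 j ⊕_) (≡.trans (⊕-comm (⊖ 𝐞 j) (𝐞 i)) (≡.sym eq)))
          (≡.trans (⊕-comm (𝐞 j) 𝟎) (⊕-identityˡ (𝐞 j)))))

  -- (t^-½ − t^½ Y_i Y_j⁻¹) / (1 − Y_i Y_j⁻¹)
  c[_,_] : ∀ i j → i ≢ j → K⟨Y⟩
  c[ i , j ] i≢j = Rational.frac
    (C (t½^ -1ℤ) P.- C t½ P.* (x i P.* x⁻¹ j))
    (P.1# P.- x i P.* x⁻¹ j)
    (1-ratio-regular i≢j)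

  -- c^{Y⁻¹}_{ij} = c^Y_{ji}, since Y_i⁻¹Y_j = Y_jY_i⁻¹.
  cY cY⁻¹ : Permutation′ n → K⟨Y⟩
  cY   w = ∏ Rational.ring (Inv w) λ (pair i j i<j) → c[ i , j ] (Fin.<⇒≢ i<j)
  cY⁻¹ w = ∏ Rational.ring (Inv w) λ (pair i j i<j) → c[ j , i ] (Fin.<⇒≢ i<j ∘ ≡.sym)

  module Evaluation (μ : Vec ℤ n) where

    -- ev(Y_i)^k with ev(Y_i) = q^(−μ_i) t^(−(v_μ(i)−1)+½(n−1)); here vᶻ is
    -- v_μ − 1 and m is n − 1.
    evY^ : Fin n → ℤ → K
    evY^ i k = qt (k ℤ.* ℤ.- lookup μ i) (k ℤ.* (ℤ.- (+ 2 ℤ.* vᶻ μ i) ℤ.+ + m))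

    evMonomial : Vec ℤ n → K
    evMonomial α = ∏ Scalars.ring (allFin n) λ i → evY^ i (lookup α i)

    evPoly : K[X] → K
    evPoly f = X.⟨ f , evMonomial ⟩

    Defined : K⟨Y⟩ → Set (c ⊔ ℓ₁)
    Defined r = Regular Scalars.ring (evPoly (Rational.den r))

    ev : (r : K⟨Y⟩) → Defined r → K
    ev r def = evPoly (Rational.num r) ÷ evPoly (Rational.den r) [ def ]

    open Relation.Binary.Reasoning.Setoid K.setoid

    evY^-0 : ∀ i → evY^ i 0ℤ K.≈ K.1#
    evY^-0 i = K.reflexive (≡.cong₂ qt (ℤ.*-zeroˡ (ℤ.- lookup μ i)) (ℤ.*-zeroˡ (ℤ.- (+ 2 ℤ.* vᶻ μ i) ℤ.+ + m)))

    evY^-+ : ∀ i k l → evY^ i (k ℤ.+ l) K.≈ evY^ i k K.* evY^ i l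
    evY^-+ i k l = K.trans
      (K.reflexive (≡.cong₂ qt (ℤ.*-distribʳ-+ (ℤ.- lookup μ i) k l)
                               (ℤ.*-distribʳ-+ (ℤ.- (+ 2 ℤ.* vᶻ μ i) ℤ.+ + m) k l)))
      (K.sym (qt-* _ _ _ _))

    evMonomial-⊕ : ∀ α β → evMonomial (α ⊕ β) K.≈ evMonomial α K.* evMonomial β
    evMonomial-⊕ α β = K.trans
      (∏-cong {R = Scalars.ring} (allFin n) λ i → K.trans (K.reflexive (≡.cong (evY^ i) (Vec.lookup-zipWith ℤ._+_ i α β)))
                                       (evY^-+ i (lookup α i) (lookup β i)))
      (∏-* {R = Scalars.ring} (allFin n) _ _)

    evMonomial-𝟎 : evMonomial 𝟎 K.≈ K.1#
    evMonomial-𝟎 = ∏-1 {R = Scalars.ring} (allFin n) λ i →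
      K.trans (K.reflexive (≡.cong (evY^ i) (Vec.lookup-replicate i 0ℤ))) (evY^-0 i)

    evMonomial-single : ∀ α i → (∀ j → j ≢ i → lookup α j ≡ 0ℤ) → evMonomial α K.≈ evY^ i (lookup α i)
    evMonomial-single α i zeros = ∏-single {R = Scalars.ring} id (λ j → evY^ j (lookup α j)) i λ j j≢i →
      K.trans (K.reflexive (≡.cong (evY^ j) (zeros j j≢i))) (evY^-0 j)

    evMonomial-𝐞 : ∀ i → evMonomial (𝐞 i) K.≈ evY^ i 1ℤ
    evMonomial-𝐞 i = K.trans (evMonomial-single (𝐞 i) i λ j j≢i → lookup-𝐞-≢ (j≢i ∘ ≡.sym))
      (K.reflexive (≡.cong (evY^ i) (lookup-𝐞-≡ i)))

    evMonomial-⊖𝐞 : ∀ i → evMonomial (⊖ 𝐞 i) K.≈ evY^ i -1ℤ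
    evMonomial-⊖𝐞 i = K.trans
      (evMonomial-single (⊖ 𝐞 i) i λ j j≢i →
        ≡.trans (Vec.lookup-map j _ (𝐞 i)) (≡.cong (λ k → ℤ.- k) (lookup-𝐞-≢ (j≢i ∘ ≡.sym))))
      (K.reflexive (≡.cong (evY^ i)
        (≡.trans (Vec.lookup-map i _ (𝐞 i)) (≡.cong (λ k → ℤ.- k) (lookup-𝐞-≡ i)))))

    evPoly-monomial : ∀ α → evPoly (X.monomial α) K.≈ evMonomial α
    evPoly-monomial α = K.trans (K.+-identityʳ _) (K.*-identityˡ _)

    evPoly-* : ∀ f g → evPoly (f P.* g) K.≈ evPoly f K.* evPoly g
    evPoly-* f g = begin
      evPoly (f P.* g)
        ≈⟨ X.⟨⟩-mul f g evMonomial ⟩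
      X.⟨ f , (λ α → X.⟨ g , (λ β → evMonomial (α ⊕ β)) ⟩) ⟩
        ≈⟨ X.⟨⟩-cong f (λ α → K.trans (X.⟨⟩-cong g (evMonomial-⊕ α)) (X.⟨⟩-* g (evMonomial α) evMonomial)) ⟩
      X.⟨ f , (λ α → evMonomial α K.* evPoly g) ⟩
        ≈⟨ X.⟨⟩-cong f (λ α → K.*-comm (evMonomial α) (evPoly g)) ⟩
      X.⟨ f , (λ α → evPoly g K.* evMonomial α) ⟩
        ≈⟨ X.⟨⟩-* f (evPoly g) evMonomial ⟩
      evPoly g K.* evPoly f
        ≈⟨ K.*-comm _ _ ⟩
      evPoly f K.* evPoly g ∎

    evPoly-1-ratio : ∀ i j → evPoly (P.1# P.- x i P.* x⁻¹ j) K.≈ K.1# K.- evY^ i 1ℤ K.* evY^ j -1ℤ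
    evPoly-1-ratio i j = K.trans (X.⟨⟩-add P.1# (P.- (x i P.* x⁻¹ j)))
      (K.+-cong (K.trans (evPoly-monomial 𝟎) evMonomial-𝟎)
        (K.trans (X.⟨⟩-neg (x i P.* x⁻¹ j)) (K.-‿cong (K.trans (evPoly-* (x i) (x⁻¹ j))
          (K.*-cong (K.trans (evPoly-monomial (𝐞 i)) (evMonomial-𝐞 i))
                    (K.trans (evPoly-monomial (⊖ 𝐞 j)) (evMonomial-⊖𝐞 j)))))))

    abstract
      defined-1 : Defined Q.1#
      defined-1 = regular-cong (K.sym (K.trans (evPoly-monomial 𝟎) evMonomial-𝟎)) regular-1

      defined-c : ∀ {i j} (i≢j : i ≢ j) → Defined (c[ i , j ] i≢j)
      defined-c {i} {j} i≢j = regular-cong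
        (K.sym (K.trans (evPoly-1-ratio i j) (K.+-congˡ (K.-‿cong (qt-* _ _ _ _)))))
        (regular-1-qt _ λ eq → i≢j (vᶻ-injective μ (ℤ.*-cancelˡ-≡ (+ 2) _ _ (ℤ.neg-injective
          (Algebra.Properties.Ring.+-cancelʳ ℤ.+-*-ring (+ m) _ _ (ℤ.i-j≡0⇒i≡j (b i) (b j)
            (≡.trans (≡.sym (≡.cong₂ ℤ._+_ (ℤ.*-identityˡ (b i)) (ℤ.-1*i≡-i (b j)))) eq)))))))
        where
        b : Fin n → ℤ
        b i = ℤ.- (+ 2 ℤ.* vᶻ μ i) ℤ.+ + m

    opaque
      unfolding Frac.mul

      defined-* : ∀ r r′ → Defined r → Defined r′ → Defined (r Q.* r′)
      defined-* r r′ d d′ = regular-cong (K.sym (evPoly-* (Rational.den r) (Rational.den r′))) (regular-* d d′)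

    defined-∏ : ∀ {A : Set} (xs : List A) f → (∀ y → Defined (f y)) → Defined (∏ Rational.ring xs f)
    defined-∏ []       f d = defined-1
    defined-∏ (y ∷ xs) f d = defined-* (f y) _ (d y) (defined-∏ xs f d)

    defined-cY : ∀ w → Defined (cY w)
    defined-cY w = defined-∏ (Inv w) _ λ (pair i j i<j) → defined-c (Fin.<⇒≢ i<j)

    defined-cY⁻¹ : ∀ w → Defined (cY⁻¹ w)
    defined-cY⁻¹ w = defined-∏ (Inv w) _ λ (pair i j i<j) → defined-c (Fin.<⇒≢ i<j ∘ ≡.sym)

  open Evaluation public using (ev; defined-cY; defined-cY⁻¹)

  descents : Vec ℤ n → List (Pair n)
  descents μ = List.filter (λ (pair i j _) → lookup μ j ℤ.<? lookup μ i) (pairs n)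

-- For μ_k > μ_{k+1}, relation (E2) writes E_{s_kμ} as a Hecke type operator
-- with parameter β applied to E_μ.  The symmetrizer multiplies the image of
-- such a step by 1 + β, and the antisymmetrizer by β − t.  A combination of
-- the E_μ over an orbit whose coefficients are multiplied by t − β along each
-- step is symmetric; if they are multiplied by −(1 + β), it is ∏(x_j − t x_i)
-- times a symmetric function.  Equal neighbouring entries of μ make E_μ
-- symmetric in the two variables, by a braid computation.  Symmetrizing such a
-- combination compares it with P_λ or A_{λ+ρ} up to a scalar.  For P_λ it is
-- fixed by the coefficient of the increasing exponent, which occurs in only
-- one E_μ of the orbit by triangularity; for A_{λ+ρ} it is found by applying
-- the partial fraction identity for Σ_w w ∏(αx_i + βx_j)/(x_i − x_j) both to
-- the x_i and to the spectral values of λ + ρ.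

module Submission where
open import Algebra.Apartness.Bundles using (HeytingField; HeytingCommutativeRing)
open import Algebra.Bundles using (CommutativeMonoid; CommutativeRing; RawRing)
import Algebra.Properties.AbelianGroup
import Algebra.Properties.CommutativeMonoid.Sum
import Algebra.Properties.CommutativeSemigroup
import Algebra.Properties.Ring
import Algebra.Properties.Semiring.Exp
import Algebra.Properties.Semiring.Mult.TCOptimised
import Algebra.Solver.Ring
open import Algebra.Solver.Ring.AlmostCommutativeRing using (fromCommutativeRing; _-Raw-AlmostCommutative⟶_)
open import Data.Bool.Base using (Bool; true; false; if_then_else_; T)
open import Data.Fin.Base as Fin using (Fin; zero; suc; toℕ; fromℕ<; inject₁; opposite; punchIn; punchOut)
import Data.Fin.Properties as Fin
open import Data.Fin.Permutation as Perm using (Permutation′; _⟨$⟩ʳ_; _⟨$⟩ˡ_)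
import Data.Fin.Permutation.Components as PC
import Data.Fin.Permutation.Transposition.List as Transposition
open import Data.Integer.Base as ℤ using (ℤ; +_; -[1+_]; 0ℤ; 1ℤ; -1ℤ)
import Data.Integer.Properties as ℤ
open import Data.List.Base as List using (List; []; _∷_; _++_; length; allFin)
import Data.List.Properties as List
open import Data.List.Membership.Propositional using (_∈_; lose)
import Data.List.Membership.Propositional.Properties as ∈
open import Data.List.Relation.Unary.All as All using (All; []; _∷_)
import Data.List.Relation.Unary.All.Properties as All
open import Data.List.Relation.Unary.Any using (Any; here; there)
open import Data.List.Relation.Unary.Unique.Propositional using (Unique; []; _∷_)
import Data.List.Relation.Unary.Unique.Propositional.Properties as Unique
import Data.List.Relation.Unary.Unique.DecPropositional.Properties as UniqueDec
open import Data.Maybe as Maybe using (Maybe; just; nothing; maybe′)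
open import Data.Nat.Base as ℕ using (ℕ; zero; suc)
import Data.Nat.Properties as ℕ
open import Data.Product.Base using (_×_; _,_; proj₁; proj₂; ∃; ∃-syntax)
open import Data.Sum.Base using (_⊎_; inj₁; inj₂; [_,_])
open import Data.Vec.Base as Vec using (Vec; []; _∷_; lookup; tabulate)
import Data.Vec.Properties as Vec
open import Data.Vec.N-ary using (N-ary; Eq; curryⁿ; _$ⁿ_; curryⁿ-cong)
open import Function.Base using (_∘_; id; case_of_)
open import Function.Bundles using (_⇔_; mk⇔)
open import Level using (Level; _⊔_)
open import Relation.Binary.Definitions using (Tri; tri<; tri≈; tri>)
open import Relation.Binary.PropositionalEquality as ≡ using (_≡_; _≢_)
import Relation.Binary.Reasoning.Setoid
open import Relation.Nullary.Decidable using (Dec; yes; no; does; _×-dec_; _⊎-dec_; dec⇒maybe)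
open import Relation.Nullary.Negation using (¬_; contradiction)
open import Relation.Unary using (Pred; Decidable)
open import Defs

module IntegerSolver {c ℓ} (R : CommutativeRing c ℓ) where
  open CommutativeRing R
  open Algebra.Properties.Ring ring using (-‿distribˡ-*; -‿distribʳ-*; -0#≈0#; -‿+-comm; -‿involutive)
  open Algebra.Properties.Semiring.Mult.TCOptimised semiring using (1+×; ×-homo-+; ×1-homo-*) renaming (_×_ to infixl 8 _×′_)
  open Relation.Binary.Reasoning.Setoid setoid

  private
    ⟦_⟧ : ℤ → Carrier
    ⟦ + k ⟧      = k ×′ 1#
    ⟦ -[1+ k ] ⟧ = - (suc k ×′ 1#)

    ⟦-⟧ : ∀ i → ⟦ ℤ.- i ⟧ ≈ - ⟦ i ⟧
    ⟦-⟧ (+ zero)   = sym -0#≈0#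
    ⟦-⟧ (+ suc k)  = refl
    ⟦-⟧ -[1+ k ]   = sym (-‿involutive _)

    ⟦⊖⟧ : ∀ j k → ⟦ j ℤ.⊖ k ⟧ ≈ j ×′ 1# - k ×′ 1#
    ⟦⊖⟧ zero    zero    = sym (-‿inverseʳ 0#)
    ⟦⊖⟧ zero    (suc k) = sym (+-identityˡ _)
    ⟦⊖⟧ (suc j) zero    = sym (trans (+-congˡ -0#≈0#) (+-identityʳ _))
    ⟦⊖⟧ (suc j) (suc k) = begin
      ⟦ suc j ℤ.⊖ suc k ⟧                      ≡⟨ ≡.cong ⟦_⟧ (ℤ.[1+m]⊖[1+n]≡m⊖n j k) ⟩
      ⟦ j ℤ.⊖ k ⟧                              ≈⟨ ⟦⊖⟧ j k ⟩
      j ×′ 1# - k ×′ 1#                          ≈⟨ +-congʳ (trans (sym (+-identityʳ _)) (+-congˡ (sym (-‿inverseʳ 1#)))) ⟩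
      (j ×′ 1# + (1# - 1#)) - k ×′ 1#            ≈⟨ +-congʳ (trans (sym (+-assoc _ _ _)) (+-congʳ (+-comm _ _))) ⟩
      ((1# + j ×′ 1#) - 1#) - k ×′ 1#            ≈⟨ +-assoc _ _ _ ⟩
      (1# + j ×′ 1#) + (- 1# - k ×′ 1#)          ≈⟨ +-cong (sym (1+× j 1#)) (trans (-‿+-comm 1# _) (-‿cong (sym (1+× k 1#)))) ⟩
      suc j ×′ 1# - suc k ×′ 1#                  ∎

    ⟦+⟧ : ∀ i j → ⟦ i ℤ.+ j ⟧ ≈ ⟦ i ⟧ + ⟦ j ⟧
    ⟦+⟧ (+ j)      (+ k)    = ×-homo-+ 1# j k
    ⟦+⟧ (+ j)      -[1+ k ] = ⟦⊖⟧ j (suc k)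
    ⟦+⟧ -[1+ j ]   (+ k)    = trans (⟦⊖⟧ k (suc j)) (+-comm _ _)
    ⟦+⟧ -[1+ j ]   -[1+ k ] = trans (-‿cong (trans (reflexive (≡.cong (_×′ 1#) (≡.cong suc (≡.sym (ℕ.+-suc j k)))))
      (×-homo-+ 1# (suc j) (suc k)))) (sym (-‿+-comm _ _))

    ⟦+*⟧ : ∀ j k → ⟦ + j ℤ.* + k ⟧ ≈ ⟦ + j ⟧ * ⟦ + k ⟧
    ⟦+*⟧ j k = trans (reflexive (≡.cong ⟦_⟧ (≡.sym (ℤ.pos-* j k)))) (×1-homo-* j k)

    ⟦*⟧ : ∀ i j → ⟦ i ℤ.* j ⟧ ≈ ⟦ i ⟧ * ⟦ j ⟧
    ⟦*⟧ (+ j)      (+ k)      = ⟦+*⟧ j k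
    ⟦*⟧ (+ j)      -[1+ k ]   = begin
      ⟦ + j ℤ.* -[1+ k ] ⟧       ≡⟨ ≡.cong ⟦_⟧ (≡.sym (ℤ.neg-distribʳ-* (+ j) (+ suc k))) ⟩
      ⟦ ℤ.- (+ j ℤ.* + suc k) ⟧  ≈⟨ ⟦-⟧ (+ j ℤ.* + suc k) ⟩
      - ⟦ + j ℤ.* + suc k ⟧      ≈⟨ -‿cong (⟦+*⟧ j (suc k)) ⟩
      - (⟦ + j ⟧ * ⟦ + suc k ⟧)  ≈⟨ -‿distribʳ-* _ _ ⟩
      ⟦ + j ⟧ * ⟦ -[1+ k ] ⟧     ∎
    ⟦*⟧ -[1+ j ]   (+ k)      = begin
      ⟦ -[1+ j ] ℤ.* + k ⟧       ≡⟨ ≡.cong ⟦_⟧ (≡.sym (ℤ.neg-distribˡ-* (+ suc j) (+ k))) ⟩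
      ⟦ ℤ.- (+ suc j ℤ.* + k) ⟧  ≈⟨ ⟦-⟧ (+ suc j ℤ.* + k) ⟩
      - ⟦ + suc j ℤ.* + k ⟧      ≈⟨ -‿cong (⟦+*⟧ (suc j) k) ⟩
      - (⟦ + suc j ⟧ * ⟦ + k ⟧)  ≈⟨ -‿distribˡ-* _ _ ⟩
      ⟦ -[1+ j ] ⟧ * ⟦ + k ⟧     ∎
    ⟦*⟧ -[1+ j ]   -[1+ k ]   = begin
      ⟦ + suc j ℤ.* + suc k ⟧            ≈⟨ ⟦+*⟧ (suc j) (suc k) ⟩
      ⟦ + suc j ⟧ * ⟦ + suc k ⟧          ≈⟨ sym (-‿involutive _) ⟩
      - (- (⟦ + suc j ⟧ * ⟦ + suc k ⟧))  ≈⟨ -‿cong (-‿distribˡ-* _ _) ⟩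
      - (⟦ -[1+ j ] ⟧ * ⟦ + suc k ⟧)     ≈⟨ -‿distribʳ-* _ _ ⟩
      ⟦ -[1+ j ] ⟧ * ⟦ -[1+ k ] ⟧        ∎

    ℤ-rawRing : RawRing _ _
    ℤ-rawRing = CommutativeRing.rawRing ℤ.+-*-commutativeRing

    morphism : ℤ-rawRing -Raw-AlmostCommutative⟶ fromCommutativeRing R
    morphism = record
      { ⟦_⟧ = ⟦_⟧ ; +-homo = ⟦+⟧ ; *-homo = ⟦*⟧ ; -‿homo = ⟦-⟧ ; 0-homo = refl ; 1-homo = refl }

  private
    module Solver = Algebra.Solver.Ring ℤ-rawRing (fromCommutativeRing R) morphism
      (λ i j → Maybe.map (λ eq → reflexive (≡.cong ⟦_⟧ eq)) (dec⇒maybe (i ℤ.≟ j)))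

    close : ∀ n → N-ary n (Solver.Polynomial n) (Solver.Polynomial n × Solver.Polynomial n) → Solver.Polynomial n × Solver.Polynomial n
    close n f = f $ⁿ Vec.map Solver.var (Vec.allFin n)

  open Solver public using (_:=_; _:+_; _:*_; _:-_; :-_; con)

  -- Comparing the normal forms syntactically, by evaluation of a closed
  -- term, is much cheaper than comparing their values in R.
  solve : ∀ n f → let (e₁ , e₂) = close n f in {T (Maybe.is-just (Solver.normalise e₁ Solver.≟N Solver.normalise e₂))} →
          Eq n _≈_ (curryⁿ (Solver.⟦ e₁ ⟧)) (curryⁿ (Solver.⟦ e₂ ⟧))
  solve n f {eq} = curryⁿ-cong _≈_ _ _ λ ρ → Solver.prove ρ (proj₁ (close n f)) (proj₂ (close n f))
    (Solver.⟦ Maybe.to-witness-T (Solver.normalise (proj₁ (close n f)) Solver.≟N Solver.normalise (proj₂ (close n f))) eq ⟧N-cong ρ)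

module ℤSolver = IntegerSolver ℤ.+-*-commutativeRing

data Once {a p} {A : Set a} (P : Pred A p) : List A → Set (a ⊔ p) where
  here  : ∀ {x xs} → P x → All (¬_ ∘ P) xs → Once P (x ∷ xs)
  there : ∀ {x xs} → ¬ P x → Once P xs → Once P (x ∷ xs)

module _ {a} {A : Set a} where
  once⇒∈ : ∀ {p} {P : Pred A p} {xs} → Once P xs → ∃[ x ] (x ∈ xs × P x)
  once⇒∈ (here Px _)  = _ , here ≡.refl , Px
  once⇒∈ (there _ o) with once⇒∈ o
  ... | x , x∈ , Px = x , there x∈ , Px

  once-resp : ∀ {p q} {P : Pred A p} {Q : Pred A q} → (∀ x → P x → Q x) → (∀ x → Q x → P x) →
              ∀ {xs} → Once P xs → Once Q xs
  once-resp P⊆Q Q⊆P (here Px ¬P) = here (P⊆Q _ Px) (All.map (λ ¬Px Qx → ¬Px (Q⊆P _ Qx)) ¬P)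
  once-resp P⊆Q Q⊆P (there ¬Px o) = there (¬Px ∘ Q⊆P _) (once-resp P⊆Q Q⊆P o)

  once-∈ : ∀ {xs : List A} {x} → Unique xs → x ∈ xs → Once (x ≡_) xs
  once-∈ (x∉ ∷ u) (here ≡.refl) = here ≡.refl x∉
  once-∈ (y∉ ∷ u) (there x∈)    = there (λ { ≡.refl → All.lookup y∉ x∈ ≡.refl }) (once-∈ u x∈)

  once-filter : ∀ {p q} {P : Pred A p} {Q : Pred A q} (Q? : Decidable Q) → (∀ x → P x → Q x) →
                ∀ {xs} → Once P xs → Once P (List.filter Q? xs)
  once-filter Q? P⊆Q {x ∷ xs} (here Px ¬P) with Q? x
  ... | yes _  = here Px (All.filter⁺ Q? ¬P)
  ... | no ¬Qx = contradiction (P⊆Q x Px) ¬Qx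
  once-filter Q? P⊆Q {x ∷ xs} (there ¬Px o) with Q? x
  ... | yes _ = there ¬Px (once-filter Q? P⊆Q o)
  ... | no  _ = once-filter Q? P⊆Q o

  once-++ˡ : ∀ {p} {P : Pred A p} {xs ys} → Once P xs → All (¬_ ∘ P) ys → Once P (xs ++ ys)
  once-++ˡ (here Px ¬P)  ¬P′ = here Px (All.++⁺ ¬P ¬P′)
  once-++ˡ (there ¬Px o) ¬P′ = there ¬Px (once-++ˡ o ¬P′)

  once-++ʳ : ∀ {p} {P : Pred A p} {xs ys} → All (¬_ ∘ P) xs → Once P ys → Once P (xs ++ ys)
  once-++ʳ []         o = o
  once-++ʳ (¬Px ∷ ¬P) o = there ¬Px (once-++ʳ ¬P o)

module _ {a b} {A : Set a} {B : Set b} where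
  once-map : ∀ {p} {P : Pred B p} (f : A → B) {xs} → Once (P ∘ f) xs → Once P (List.map f xs)
  once-map f (here Px ¬P)  = here Px (All.map⁺ ¬P)
  once-map f (there ¬Px o) = there ¬Px (once-map f o)

  once-concatMap : ∀ {p q} {P : Pred B p} {Q : Pred A q} (f : A → List B) →
                   (∀ x → Q x → Once P (f x)) → (∀ x → ¬ Q x → All (¬_ ∘ P) (f x)) →
                   ∀ {xs} → Once Q xs → Once P (List.concatMap f xs)
  once-concatMap {P = P} {Q} f on off (here Qx ¬Q) = once-++ˡ (on _ Qx) (all ¬Q)
    where
    all : ∀ {xs} → All (¬_ ∘ Q) xs → All (¬_ ∘ P) (List.concatMap f xs)
    all []         = []
    all (¬Qx ∷ ¬Q) = All.++⁺ (off _ ¬Qx) (all ¬Q)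
  once-concatMap f on off (there ¬Qx o) = once-++ʳ (off _ ¬Qx) (once-concatMap f on off o)

  once-mapMaybe : ∀ {p q} {P : Pred B p} {Q : Pred A q} (f : A → Maybe B) →
                  (∀ x → Q x → ∃[ y ] (f x ≡ just y × P y)) → (∀ x y → f x ≡ just y → P y → Q x) →
                  ∀ {xs} → Once Q xs → Once P (List.mapMaybe f xs)
  once-mapMaybe {P = P} {Q} f on off {x ∷ xs} (here Qx ¬Q) with f x | on x Qx
  ... | _ | y , ≡.refl , Py = here Py (all ¬Q)
    where
    all : ∀ {xs} → All (¬_ ∘ Q) xs → All (¬_ ∘ P) (List.mapMaybe f xs)
    all [] = []
    all {z ∷ zs} (¬Qz ∷ ¬Q) with f z in eq
    ... | nothing = all ¬Q
    ... | just y  = (λ Py → ¬Qz (off z y eq Py)) ∷ all ¬Q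
  once-mapMaybe f on off {x ∷ xs} (there ¬Qx o) with f x in eq
  ... | nothing = once-mapMaybe f on off o
  ... | just y  = there (λ Py → ¬Qx (off x y eq Py)) (once-mapMaybe f on off o)

-- With M the additive or multiplicative monoid of R, fold is ∑ R or ∏ R.
module Fold {c ℓ} (M : CommutativeMonoid c ℓ) where
  open CommutativeMonoid M
  open Algebra.Properties.CommutativeSemigroup commutativeSemigroup using (interchange)
  module Sum = Algebra.Properties.CommutativeMonoid.Sum M
  open Relation.Binary.Reasoning.Setoid setoid

  fold : ∀ {a} {A : Set a} → List A → (A → Carrier) → Carrier
  fold xs f = List.foldr (λ x s → f x ∙ s) ε xs

  pick : ∀ {p} {P : Set p} → Dec P → Carrier → Carrier
  pick d y = if does d then y else ε

  pick-yes : ∀ {p} {P : Set p} (d : Dec P) y → P → pick d y ≈ y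
  pick-yes (yes _) y p = refl
  pick-yes (no ¬p) y p = contradiction p ¬p

  pick-no : ∀ {p} {P : Set p} (d : Dec P) y → ¬ P → pick d y ≈ ε
  pick-no (yes p) y ¬p = contradiction p ¬p
  pick-no (no _)  y ¬p = refl

  pick-cong : ∀ {p q} {P : Set p} {Q : Set q} (d : Dec P) (e : Dec Q) → (P → Q) → (Q → P) →
              ∀ y z → (P → y ≈ z) → pick d y ≈ pick e z
  pick-cong (yes p) (yes q) P→Q Q→P y z eq = eq p
  pick-cong (yes p) (no ¬q) P→Q Q→P y z eq = contradiction (P→Q p) ¬q
  pick-cong (no ¬p) (yes q) P→Q Q→P y z eq = contradiction (Q→P q) ¬p
  pick-cong (no _)  (no _)  P→Q Q→P y z eq = refl

  module _ {a} {A : Set a} where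
    fold-cong-∈ : ∀ (xs : List A) {f g} → (∀ x → x ∈ xs → f x ≈ g x) → fold xs f ≈ fold xs g
    fold-cong-∈ []       eq = refl
    fold-cong-∈ (x ∷ xs) eq = ∙-cong (eq x (here ≡.refl)) (fold-cong-∈ xs λ y y∈ → eq y (there y∈))

    fold-cong : ∀ (xs : List A) {f g} → (∀ x → f x ≈ g x) → fold xs f ≈ fold xs g
    fold-cong xs eq = fold-cong-∈ xs λ x _ → eq x

    fold-ε : ∀ (xs : List A) → fold xs (λ _ → ε) ≈ ε
    fold-ε []       = refl
    fold-ε (x ∷ xs) = trans (identityˡ _) (fold-ε xs)

    fold-∙ : ∀ (xs : List A) (f g : A → Carrier) → fold xs (λ x → f x ∙ g x) ≈ fold xs f ∙ fold xs g
    fold-∙ []       f g = sym (identityˡ ε)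
    fold-∙ (x ∷ xs) f g = trans (∙-congˡ (fold-∙ xs f g)) (interchange _ _ _ _)

    fold-++ : ∀ (xs ys : List A) f → fold (xs ++ ys) f ≈ fold xs f ∙ fold ys f
    fold-++ []       ys f = sym (identityˡ _)
    fold-++ (x ∷ xs) ys f = trans (∙-congˡ (fold-++ xs ys f)) (sym (assoc _ _ _))

    fold-filter : ∀ {p} {P : Pred A p} (P? : Decidable P) xs f →
                  fold (List.filter P? xs) f ≈ fold xs (λ x → pick (P? x) (f x))
    fold-filter P? []       f = refl
    fold-filter P? (x ∷ xs) f with P? x
    ... | yes _ = ∙-congˡ (fold-filter P? xs f)
    ... | no  _ = trans (fold-filter P? xs f) (sym (identityˡ _))

    fold-once : ∀ {p} {P : Pred A p} (P? : Decidable P) {xs} (f : A → Carrier) y → Once P xs → (∀ x → P x → f x ≈ y) →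
                fold xs (λ x → pick (P? x) (f x)) ≈ y
    fold-once {P = P} P? f y (here {x} {xs} Px ¬P) eq =
      trans (∙-cong (trans (pick-yes (P? x) (f x) Px) (eq x Px)) (none ¬P)) (identityʳ _)
      where
      none : ∀ {xs} → All (¬_ ∘ P) xs → fold xs (λ x → pick (P? x) (f x)) ≈ ε
      none []         = refl
      none (¬Px ∷ ¬P) = trans (∙-cong (pick-no (P? _) (f _) ¬Px) (none ¬P)) (identityˡ _)
    fold-once P? f y (there ¬Px o) eq = trans (∙-cong (pick-no (P? _) (f _) ¬Px) (fold-once P? f y o eq)) (identityˡ _)

  module _ {a b} {A : Set a} {B : Set b} where
    fold-map : ∀ (f : A → B) xs (g : B → Carrier) → fold (List.map f xs) g ≡ fold xs (g ∘ f)
    fold-map f []       g = ≡.refl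
    fold-map f (x ∷ xs) g = ≡.cong (g (f x) ∙_) (fold-map f xs g)

    fold-concatMap : ∀ (f : A → List B) xs g → fold (List.concatMap f xs) g ≈ fold xs (λ x → fold (f x) g)
    fold-concatMap f []       g = refl
    fold-concatMap f (x ∷ xs) g = trans (fold-++ (f x) _ g) (∙-congˡ (fold-concatMap f xs g))

    fold-mapMaybe : ∀ (f : A → Maybe B) xs g → fold (List.mapMaybe f xs) g ≈ fold xs (λ x → maybe′ g ε (f x))
    fold-mapMaybe f []       g = refl
    fold-mapMaybe f (x ∷ xs) g with f x
    ... | just y  = ∙-congˡ (fold-mapMaybe f xs g)
    ... | nothing = trans (fold-mapMaybe f xs g) (sym (identityˡ _))

    fold-swap : ∀ (xs : List A) (ys : List B) (f : A → B → Carrier) →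
                fold xs (λ x → fold ys (f x)) ≈ fold ys (λ y → fold xs (λ x → f x y))
    fold-swap []       ys f = sym (fold-ε ys)
    fold-swap (x ∷ xs) ys f = trans (∙-congˡ (fold-swap xs ys f)) (sym (fold-∙ ys (f x) (λ y → fold xs λ x → f x y)))

    -- Double counting of the pairs (x , y) with x ~ y.
    fold-bijection : ∀ {r} {_~_ : A → B → Set r} (_~?_ : ∀ x y → Dec (x ~ y)) {xs ys f g} →
                     (∀ x → x ∈ xs → Once (x ~_) ys) → (∀ y → y ∈ ys → Once (_~ y) xs) →
                     (∀ x y → x ∈ xs → x ~ y → f x ≈ g y) → fold xs f ≈ fold ys g
    fold-bijection _~?_ {xs} {ys} {f} {g} onceʳ onceˡ eq = begin
      fold xs f
        ≈⟨ fold-cong-∈ xs (λ x x∈ → fold-once (x ~?_) (λ _ → f x) (f x) (onceʳ x x∈) λ _ _ → refl) ⟨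
      fold xs (λ x → fold ys λ y → pick (x ~? y) (f x))
        ≈⟨ fold-cong-∈ xs (λ x x∈ → fold-cong ys λ y → pick-cong (x ~? y) (x ~? y) id id (f x) (g y) (eq x y x∈)) ⟩
      fold xs (λ x → fold ys λ y → pick (x ~? y) (g y))
        ≈⟨ fold-swap xs ys (λ x y → pick (x ~? y) (g y)) ⟩
      fold ys (λ y → fold xs λ x → pick (x ~? y) (g y))
        ≈⟨ fold-cong-∈ ys (λ y y∈ → fold-once (_~? y) (λ _ → g y) (g y) (onceˡ y y∈) λ _ _ → refl) ⟩
      fold ys g ∎

  fold-tabulate : ∀ {a} {A : Set a} {k} (h : Fin k → A) f → fold (List.tabulate h) f ≡ Sum.sum (f ∘ h)
  fold-tabulate {k = zero}  h f = ≡.refl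
  fold-tabulate {k = suc k} h f = ≡.cong (f (h zero) ∙_) (fold-tabulate (h ∘ suc) f)

  fold-permute : ∀ {k} (w : Permutation′ k) (f : Fin k → Carrier) → fold (allFin k) (λ i → f (w ⟨$⟩ʳ i)) ≈ fold (allFin k) f
  fold-permute {k} w f = begin
    fold (allFin k) (λ i → f (w ⟨$⟩ʳ i)) ≡⟨ fold-tabulate {k = k} id (λ i → f (w ⟨$⟩ʳ i)) ⟩
    Sum.sum (λ i → f (w ⟨$⟩ʳ i))         ≈⟨ Sum.sum-permute f w ⟨
    Sum.sum f                            ≡⟨ fold-tabulate id f ⟨
    fold (allFin k) f                    ∎

module _ {c ℓ c′ ℓ′} (M : CommutativeMonoid c ℓ) (N : CommutativeMonoid c′ ℓ′) where
  private
    module M = CommutativeMonoid M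
    module N = CommutativeMonoid N

  fold-homo : ∀ (φ : M.Carrier → N.Carrier) → φ M.ε N.≈ N.ε → (∀ y z → φ (y M.∙ z) N.≈ φ y N.∙ φ z) →
              ∀ {a} {A : Set a} (xs : List A) f → φ (Fold.fold M xs f) N.≈ Fold.fold N xs (φ ∘ f)
  fold-homo φ φ-ε φ-∙ []       f = φ-ε
  fold-homo φ φ-ε φ-∙ (x ∷ xs) f = N.trans (φ-∙ _ _) (N.∙-congˡ (fold-homo φ φ-ε φ-∙ xs f))

-- Permutations and pairs of indices

perm-injective : ∀ {n} (w : Permutation′ n) {i j} → w ⟨$⟩ʳ i ≡ w ⟨$⟩ʳ j → i ≡ j
perm-injective w eq = ≡.trans (≡.sym (Perm.inverseˡ w)) (≡.trans (≡.cong (w ⟨$⟩ˡ_) eq) (Perm.inverseˡ w))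

perm-inverse-cong : ∀ {n} {w u : Permutation′ n} → w Perm.≈ u → ∀ i → w ⟨$⟩ˡ i ≡ u ⟨$⟩ˡ i
perm-inverse-cong {w = w} {u} w≈u i = perm-injective u
  (≡.trans (≡.sym (w≈u (w ⟨$⟩ˡ i))) (≡.trans (Perm.inverseʳ w) (≡.sym (Perm.inverseʳ u))))

_≈?_ : ∀ {n} (w u : Permutation′ n) → Dec (w Perm.≈ u)
w ≈? u = Fin.all? λ i → (w ⟨$⟩ʳ i) Fin.≟ (u ⟨$⟩ʳ i)

vec-ext : ∀ {a} {A : Set a} {n} {u v : Vec A n} → (∀ i → lookup u i ≡ lookup v i) → u ≡ v
vec-ext {u = u} {v} eq = ≡.trans (≡.sym (Vec.tabulate∘lookup u)) (≡.trans (Vec.tabulate-cong eq) (Vec.tabulate∘lookup v))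

module _ {n : ℕ} {a} {A : Set a} where
  lookup-• : ∀ (w : Permutation′ n) (μ : Vec A n) i → lookup (w • μ) i ≡ lookup μ (w ⟨$⟩ˡ i)
  lookup-• w μ i = Vec.lookup∘tabulate _ i

  lookup-•ʳ : ∀ (w : Permutation′ n) (μ : Vec A n) i → lookup (w • μ) (w ⟨$⟩ʳ i) ≡ lookup μ i
  lookup-•ʳ w μ i = ≡.trans (lookup-• w μ _) (≡.cong (lookup μ) (Perm.inverseˡ w))

  •-cong : ∀ {w u : Permutation′ n} → w Perm.≈ u → (μ : Vec A n) → w • μ ≡ u • μ
  •-cong {w} {u} w≈u μ = Vec.tabulate-cong λ i → ≡.cong (lookup μ) (perm-inverse-cong {w = w} {u} w≈u i)

  •-id : ∀ (μ : Vec A n) → Perm.id • μ ≡ μ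
  •-id μ = Vec.tabulate∘lookup μ

  •-· : ∀ (w u : Permutation′ n) (μ : Vec A n) → (w · u) • μ ≡ w • (u • μ)
  •-· w u μ = Vec.tabulate-cong λ i → ≡.sym (lookup-• u μ (w ⟨$⟩ˡ i))

transpose-fst : ∀ {n} (i j : Fin n) → PC.transpose i j i ≡ j
transpose-fst i j with i Fin.≟ i
... | yes _  = ≡.refl
... | no i≢i = contradiction ≡.refl i≢i

transpose-snd : ∀ {n} (i j : Fin n) → PC.transpose i j j ≡ i
transpose-snd i j with j Fin.≟ i
... | yes j≡i = j≡i
... | no  _ with j Fin.≟ j
...   | yes _  = ≡.refl
...   | no j≢j = contradiction ≡.refl j≢j

transpose-off : ∀ {n} (i j : Fin n) {k} → k ≢ i → k ≢ j → PC.transpose i j k ≡ k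
transpose-off i j {k} k≢i k≢j with k Fin.≟ i
... | yes k≡i = contradiction k≡i k≢i
... | no  _ with k Fin.≟ j
...   | yes k≡j = contradiction k≡j k≢j
...   | no  _   = ≡.refl

transpose-comm : ∀ {n} (i j k : Fin n) → PC.transpose i j k ≡ PC.transpose j i k
transpose-comm i j k = compare (k Fin.≟ i) (k Fin.≟ j)
  where
  compare : Dec (k ≡ i) → Dec (k ≡ j) → PC.transpose i j k ≡ PC.transpose j i k
  compare (yes ≡.refl) _            = ≡.trans (transpose-fst k j) (≡.sym (transpose-snd j k))
  compare (no _)       (yes ≡.refl) = ≡.trans (transpose-snd i k) (≡.sym (transpose-fst k i))
  compare (no k≢i)     (no k≢j)     = ≡.trans (transpose-off i j k≢i k≢j) (≡.sym (transpose-off j i k≢j k≢i))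

unlessEqual : ∀ {a n} {A : Set a} {i j : Fin n} → A → Dec (i ≡ j) → (i ≢ j → A) → A
unlessEqual z (yes _)  f = z
unlessEqual z (no i≢j) f = f i≢j

unlessEqual-elim : ∀ {a p n} {A : Set a} (P : A → Set p) {i j : Fin n} {z} (d : Dec (i ≡ j)) f →
                   i ≢ j → (∀ i≢j → P (f i≢j)) → P (unlessEqual z d f)
unlessEqual-elim P (yes i≡j) f i≢j Pf = contradiction i≡j i≢j
unlessEqual-elim P (no i≢j)  f _   Pf = Pf i≢j

inject₁≢suc : ∀ {m} (k : Fin m) → inject₁ k ≢ suc k
inject₁≢suc k eq = ℕ.<⇒≢ (ℕ.n<1+n _) (≡.trans (≡.sym (Fin.toℕ-inject₁ k)) (≡.cong toℕ eq))

opaque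
  adj : ∀ {m} → Fin m → Permutation′ (suc m)
  adj k = Perm.transpose (inject₁ k) (suc k)

  adj-≡ : ∀ {m} (k : Fin m) → adj k ≡ Perm.transpose (inject₁ k) (suc k)
  adj-≡ k = ≡.refl

module _ {m : ℕ} (k : Fin m) where
  opaque
    unfolding adj

    adj-transpose : ∀ a → adj k ⟨$⟩ʳ a ≡ PC.transpose (inject₁ k) (suc k) a
    adj-transpose a = ≡.refl

    adj-inverse : ∀ a → adj k ⟨$⟩ˡ a ≡ adj k ⟨$⟩ʳ a
    adj-inverse a = transpose-comm (suc k) (inject₁ k) a

  adj-involutive : ∀ a → adj k ⟨$⟩ʳ (adj k ⟨$⟩ʳ a) ≡ a
  adj-involutive a = ≡.trans (≡.sym (adj-inverse _)) (Perm.inverseˡ (adj k))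

  adj-lo : adj k ⟨$⟩ʳ inject₁ k ≡ suc k
  adj-lo = ≡.trans (adj-transpose _) (transpose-fst (inject₁ k) (suc k))

  adj-hi : adj k ⟨$⟩ʳ suc k ≡ inject₁ k
  adj-hi = ≡.trans (adj-transpose _) (transpose-snd (inject₁ k) (suc k))

  adj-off : ∀ {a} → a ≢ inject₁ k → a ≢ suc k → adj k ⟨$⟩ʳ a ≡ a
  adj-off a≢lo a≢hi = ≡.trans (adj-transpose _) (transpose-off (inject₁ k) (suc k) a≢lo a≢hi)

  lookup-adj : ∀ {a} {A : Set a} (μ : Vec A (suc m)) i → lookup (adj k • μ) i ≡ lookup μ (adj k ⟨$⟩ʳ i)
  lookup-adj μ i = ≡.trans (lookup-• (adj k) μ i) (≡.cong (lookup μ) (adj-inverse i))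

  adj•adj• : ∀ {a} {A : Set a} (μ : Vec A (suc m)) → adj k • (adj k • μ) ≡ μ
  adj•adj• μ = vec-ext λ i → ≡.trans (lookup-adj (adj k • μ) i)
    (≡.trans (lookup-adj μ _) (≡.cong (lookup μ) (adj-involutive i)))

  lookup-adj-lo : ∀ {a} {A : Set a} (μ : Vec A (suc m)) → lookup (adj k • μ) (inject₁ k) ≡ lookup μ (suc k)
  lookup-adj-lo μ = ≡.trans (lookup-adj μ _) (≡.cong (lookup μ) adj-lo)

  lookup-adj-hi : ∀ {a} {A : Set a} (μ : Vec A (suc m)) → lookup (adj k • μ) (suc k) ≡ lookup μ (inject₁ k)
  lookup-adj-hi μ = ≡.trans (lookup-adj μ _) (≡.cong (lookup μ) adj-hi)

  lookup-adj-off : ∀ {a} {A : Set a} (μ : Vec A (suc m)) {i} → i ≢ inject₁ k → i ≢ suc k →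
                   lookup (adj k • μ) i ≡ lookup μ i
  lookup-adj-off μ i≢lo i≢hi = ≡.trans (lookup-adj μ _) (≡.cong (lookup μ) (adj-off i≢lo i≢hi))

  data AdjView : Fin (suc m) → Set where
    lo  : AdjView (inject₁ k)
    hi  : AdjView (suc k)
    off : ∀ {a} → a ≢ inject₁ k → a ≢ suc k → AdjView a

  adjView : ∀ a → AdjView a
  adjView a with a Fin.≟ inject₁ k | a Fin.≟ suc k
  ... | yes ≡.refl | _          = lo
  ... | no _       | yes ≡.refl = hi
  ... | no a≢lo    | no a≢hi    = off a≢lo a≢hi

  lo<hi : inject₁ k Fin.< suc k
  lo<hi = ℕ.s≤s (ℕ.≤-reflexive (Fin.toℕ-inject₁ k))

  adj•-equal : ∀ {a} {A : Set a} (μ : Vec A (suc m)) → lookup μ (inject₁ k) ≡ lookup μ (suc k) → adj k • μ ≡ μ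
  adj•-equal μ eq = vec-ext λ i → case adjView i of λ where
    lo              → ≡.trans (lookup-adj-lo μ) (≡.sym eq)
    hi              → ≡.trans (lookup-adj-hi μ) eq
    (off i≢lo i≢hi) → lookup-adj-off μ i≢lo i≢hi

  adj-mono : ∀ {a b} → a Fin.< b → ¬ (a ≡ inject₁ k × b ≡ suc k) → adj k ⟨$⟩ʳ a Fin.< adj k ⟨$⟩ʳ b
  adj-mono {a} {b} a<b ¬lohi with adjView a | adjView b
  ... | lo | lo = contradiction a<b (ℕ.<-irrefl ≡.refl)
  ... | lo | hi = contradiction (≡.refl , ≡.refl) ¬lohi
  ... | lo | off b≢lo b≢hi rewrite adj-lo | adj-off b≢lo b≢hi =
    ℕ.≤∧≢⇒< (≡.subst (ℕ._< toℕ b) (Fin.toℕ-inject₁ k) a<b) (b≢hi ∘ Fin.toℕ-injective ∘ ≡.sym)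
  ... | hi | lo = contradiction (ℕ.<-trans a<b lo<hi) (ℕ.<-irrefl ≡.refl)
  ... | hi | hi = contradiction a<b (ℕ.<-irrefl ≡.refl)
  ... | hi | off b≢lo b≢hi rewrite adj-hi | adj-off b≢lo b≢hi = ℕ.<-trans lo<hi a<b
  ... | off a≢lo a≢hi | lo rewrite adj-lo | adj-off a≢lo a≢hi = ℕ.<-trans a<b lo<hi
  ... | off a≢lo a≢hi | hi rewrite adj-hi | adj-off a≢lo a≢hi =
    ℕ.≤∧≢⇒< (≡.subst (toℕ a ℕ.≤_) (≡.sym (Fin.toℕ-inject₁ k)) (ℕ.s≤s⁻¹ a<b)) (a≢lo ∘ Fin.toℕ-injective)
  ... | off a≢lo a≢hi | off b≢lo b≢hi rewrite adj-off a≢lo a≢hi | adj-off b≢lo b≢hi = a<b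

module _ {m p} (P : Permutation′ (suc m) → Set p) (resp : ∀ {w u} → w Perm.≈ u → P w → P u)
         (step : ∀ k {w} → P w → P (adj k · w)) where
  private
    swap< : ∀ d i j → toℕ j ≡ suc d ℕ.+ toℕ i → ∀ {w} → P w → P (Perm.transpose i j · w)
    swap< zero i (suc j) eq {w} Pw with Fin.toℕ-injective (≡.trans (Fin.toℕ-inject₁ j) (ℕ.suc-injective eq))
    ... | ≡.refl = resp (λ x → adj-transpose j (w ⟨$⟩ʳ x)) (step j Pw)
    swap< (suc d) i (suc j) eq {w} Pw = resp conj
      (step j (swap< d i (inject₁ j) (≡.trans (Fin.toℕ-inject₁ j) (ℕ.suc-injective eq)) (step j Pw)))
      where
      i<j : i Fin.< inject₁ j
      i<j = ≡.subst (toℕ i ℕ.<_) (≡.sym (≡.trans (Fin.toℕ-inject₁ j) (ℕ.suc-injective eq))) (ℕ.s≤s (ℕ.m≤n+m (toℕ i) d))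

      i≢lo : i ≢ inject₁ j
      i≢lo = Fin.<⇒≢ i<j

      i≢hi : i ≢ suc j
      i≢hi = Fin.<⇒≢ (ℕ.<-trans i<j (lo<hi j))

      at : ∀ {c} → AdjView j c → Dec (c ≡ i) → adj j ⟨$⟩ʳ PC.transpose i (inject₁ j) (adj j ⟨$⟩ʳ c) ≡ PC.transpose i (suc j) c
      at lo (yes lo≡i) = contradiction (≡.sym lo≡i) i≢lo
      at lo (no _) = begin
        adj j ⟨$⟩ʳ PC.transpose i (inject₁ j) (adj j ⟨$⟩ʳ inject₁ j)
          ≡⟨ ≡.cong (λ z → adj j ⟨$⟩ʳ PC.transpose i (inject₁ j) z) (adj-lo j) ⟩
        adj j ⟨$⟩ʳ PC.transpose i (inject₁ j) (suc j)
          ≡⟨ ≡.cong (adj j ⟨$⟩ʳ_) (transpose-off i (inject₁ j) (i≢hi ∘ ≡.sym) (inject₁≢suc j ∘ ≡.sym)) ⟩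
        adj j ⟨$⟩ʳ suc j
          ≡⟨ adj-hi j ⟩
        inject₁ j
          ≡⟨ transpose-off i (suc j) (i≢lo ∘ ≡.sym) (inject₁≢suc j) ⟨
        PC.transpose i (suc j) (inject₁ j) ∎
        where open ≡.≡-Reasoning
      at hi _ = begin
        adj j ⟨$⟩ʳ PC.transpose i (inject₁ j) (adj j ⟨$⟩ʳ suc j)
          ≡⟨ ≡.cong (λ z → adj j ⟨$⟩ʳ PC.transpose i (inject₁ j) z) (adj-hi j) ⟩
        adj j ⟨$⟩ʳ PC.transpose i (inject₁ j) (inject₁ j)
          ≡⟨ ≡.cong (adj j ⟨$⟩ʳ_) (transpose-snd i (inject₁ j)) ⟩
        adj j ⟨$⟩ʳ i
          ≡⟨ adj-off j i≢lo i≢hi ⟩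
        i
          ≡⟨ transpose-snd i (suc j) ⟨
        PC.transpose i (suc j) (suc j) ∎
        where open ≡.≡-Reasoning
      at (off _ _) (yes ≡.refl) = begin
        adj j ⟨$⟩ʳ PC.transpose i (inject₁ j) (adj j ⟨$⟩ʳ i)
          ≡⟨ ≡.cong (λ z → adj j ⟨$⟩ʳ PC.transpose i (inject₁ j) z) (adj-off j i≢lo i≢hi) ⟩
        adj j ⟨$⟩ʳ PC.transpose i (inject₁ j) i
          ≡⟨ ≡.cong (adj j ⟨$⟩ʳ_) (transpose-fst i (inject₁ j)) ⟩
        adj j ⟨$⟩ʳ inject₁ j
          ≡⟨ adj-lo j ⟩
        suc j
          ≡⟨ transpose-fst i (suc j) ⟨
        PC.transpose i (suc j) i ∎
        where open ≡.≡-Reasoning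
      at {c} (off c≢lo c≢hi) (no c≢i) = begin
        adj j ⟨$⟩ʳ PC.transpose i (inject₁ j) (adj j ⟨$⟩ʳ c)
          ≡⟨ ≡.cong (λ z → adj j ⟨$⟩ʳ PC.transpose i (inject₁ j) z) (adj-off j c≢lo c≢hi) ⟩
        adj j ⟨$⟩ʳ PC.transpose i (inject₁ j) c
          ≡⟨ ≡.cong (adj j ⟨$⟩ʳ_) (transpose-off i (inject₁ j) c≢i c≢lo) ⟩
        adj j ⟨$⟩ʳ c
          ≡⟨ adj-off j c≢lo c≢hi ⟩
        c
          ≡⟨ transpose-off i (suc j) c≢i c≢hi ⟨
        PC.transpose i (suc j) c ∎
        where open ≡.≡-Reasoning

      conj : (adj j · (Perm.transpose i (inject₁ j) · (adj j · w))) Perm.≈ (Perm.transpose i (suc j) · w)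
      conj x = at (adjView j (w ⟨$⟩ʳ x)) ((w ⟨$⟩ʳ x) Fin.≟ i)

    swap : ∀ i j {w} → P w → P (Perm.transpose i j · w)
    swap i j {w} Pw with ℕ.<-cmp (toℕ i) (toℕ j)
    ... | tri< i<j _ _ = swap< (toℕ j ℕ.∸ suc (toℕ i)) i j
      (≡.trans (≡.sym (ℕ.m∸n+n≡m i<j)) (ℕ.+-suc _ (toℕ i))) Pw
    ... | tri> _ _ j<i = resp (λ x → transpose-comm j i (w ⟨$⟩ʳ x)) (swap< (toℕ i ℕ.∸ suc (toℕ j)) j i
      (≡.trans (≡.sym (ℕ.m∸n+n≡m j<i)) (ℕ.+-suc _ (toℕ j))) Pw)
    ... | tri≈ _ i≡j _ with Fin.toℕ-injective i≡j
    ...   | ≡.refl = resp (λ x → ≡.sym (fix (w ⟨$⟩ʳ x))) Pw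
      where
      fix : ∀ c → PC.transpose i i c ≡ c
      fix c = case c Fin.≟ i of λ where
        (yes ≡.refl) → transpose-fst i i
        (no c≢i)     → transpose-off i i c≢i c≢i

    eval : ∀ xs {w} → P w → P (Transposition.eval xs · w)
    eval []             Pw = resp (λ _ → ≡.refl) Pw
    eval ((i , j) ∷ xs) Pw = resp (λ _ → ≡.refl) (eval xs (swap i j Pw))

  perm-induction : P Perm.id → ∀ w → P w
  perm-induction Pid w = resp (Transposition.eval-decompose w) (eval (Transposition.decompose w) Pid)

once-Sₙ : ∀ {n} (w : Permutation′ n) → Once (Perm._≈ w) (Sₙ n)
once-Sₙ {zero}  w = here (λ ()) []
once-Sₙ {suc n} w = once-concatMap (λ j → List.map (Perm.insert zero j) (Sₙ n))
  (λ { j ≡.refl → once-map (Perm.insert zero j)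
       (once-resp (λ u u≈ → λ { zero → ≡.refl ; (suc i) → ≡.trans (≡.cong (punchIn j) (u≈ i)) (≡.sym (Perm.punchIn-permute w zero i)) })
                  (λ u u≈ i → Fin.punchIn-injective j _ _ (≡.trans (u≈ (suc i)) (Perm.punchIn-permute w zero i)))
                  (once-Sₙ (Perm.remove zero w))) })
  (λ j w0≢j → All.map⁺ (All.universal (λ u u≈ → w0≢j (≡.sym (u≈ zero))) (Sₙ n)))
  (once-∈ (Unique.allFin⁺ (suc n)) (∈.∈-allFin (w ⟨$⟩ʳ zero)))

module _ {n : ℕ} where
  open Pair

  pair-≡ : ∀ {p p′ : Pair n} → fst p ≡ fst p′ → snd p ≡ snd p′ → p ≡ p′
  pair-≡ {pair i j i<j} {pair _ _ i<j′} ≡.refl ≡.refl = ≡.cong (pair i j) (ℕ.<-irrelevant i<j i<j′)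

  Joins : Pair n → Fin n → Fin n → Set
  Joins p i j = (fst p ≡ i × snd p ≡ j) ⊎ (fst p ≡ j × snd p ≡ i)

  joins? : ∀ p i j → Dec (Joins p i j)
  joins? p i j = ((fst p Fin.≟ i) ×-dec (snd p Fin.≟ j)) ⊎-dec ((fst p Fin.≟ j) ×-dec (snd p Fin.≟ i))

  join : ∀ {i j} → i ≢ j → ∃[ p ] Joins p i j
  join {i} {j} i≢j with ℕ.<-cmp (toℕ i) (toℕ j)
  ... | tri< i<j _ _ = pair i j i<j , inj₁ (≡.refl , ≡.refl)
  ... | tri≈ _ i≡j _ = contradiction (Fin.toℕ-injective i≡j) i≢j
  ... | tri> _ _ j<i = pair j i j<i , inj₂ (≡.refl , ≡.refl)

  joins-unique : ∀ {p p′ i j} → Joins p i j → Joins p′ i j → p ≡ p′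
  joins-unique (inj₁ (≡.refl , ≡.refl)) (inj₁ (eq , eq′)) = pair-≡ (≡.sym eq) (≡.sym eq′)
  joins-unique (inj₂ (≡.refl , ≡.refl)) (inj₂ (eq , eq′)) = pair-≡ (≡.sym eq) (≡.sym eq′)
  joins-unique {p} {p′} (inj₁ (≡.refl , ≡.refl)) (inj₂ (≡.refl , ≡.refl)) =
    contradiction (fst<snd p) (ℕ.<-asym (fst<snd p′))
  joins-unique {p} {p′} (inj₂ (≡.refl , ≡.refl)) (inj₁ (≡.refl , ≡.refl)) =
    contradiction (fst<snd p) (ℕ.<-asym (fst<snd p′))

  mk-pair : Fin n × Fin n → Maybe (Pair n)
  mk-pair (i , j) = Maybe.map (pair i j) (dec⇒maybe (i Fin.<? j))

  once-pairs : ∀ p → Once (p ≡_) (pairs n)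
  once-pairs p = once-mapMaybe mk-pair forward back
    (once-∈ (Unique.cartesianProduct⁺ (Unique.allFin⁺ n) (Unique.allFin⁺ n))
      (∈.∈-cartesianProduct⁺ (∈.∈-allFin (fst p)) (∈.∈-allFin (snd p))))
    where
    forward : ∀ ij → (fst p , snd p) ≡ ij → ∃[ p′ ] (mk-pair ij ≡ just p′ × p ≡ p′)
    forward _ ≡.refl with fst p Fin.<? snd p
    ... | yes i<j = _ , ≡.refl , pair-≡ ≡.refl ≡.refl
    ... | no  i≮j = contradiction (fst<snd p) i≮j

    back : ∀ ij p′ → mk-pair ij ≡ just p′ → p ≡ p′ → (fst p , snd p) ≡ ij
    back (i , j) p′ eq ≡.refl with i Fin.<? j
    back (i , j) _ ≡.refl ≡.refl | yes _ = ≡.refl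
    back (i , j) _ ()     ≡.refl | no  _

  once-joins : ∀ {i j} → i ≢ j → Once (λ p → Joins p i j) (pairs n)
  once-joins i≢j with join i≢j
  ... | p , joins = once-resp (λ { _ ≡.refl → joins }) (λ p′ joins′ → joins-unique joins joins′) (once-pairs p)

module FoldPairs {c ℓ} (M : CommutativeMonoid c ℓ) where
  open CommutativeMonoid M
  open Relation.Binary.Reasoning.Setoid setoid
  open Fold M

  fold-pairs-permute : ∀ {n} (w : Permutation′ n) (g : Fin n → Fin n → Carrier) → (∀ i j → g i j ≈ g j i) →
    fold (pairs n) (λ (pair i j _) → g (w ⟨$⟩ʳ i) (w ⟨$⟩ʳ j)) ≈ fold (pairs n) (λ (pair i j _) → g i j)
  fold-pairs-permute {n} w g g-sym = fold-bijection (λ p p′ → joins? p′ (w ⟨$⟩ʳ fst p) (w ⟨$⟩ʳ snd p))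
    (λ p _ → once-joins (fst≢snd p ∘ perm-injective w))
    (λ p′ _ → once-resp (λ p → λ { (inj₁ (≡.refl , ≡.refl)) → inj₁ (≡.sym (Perm.inverseʳ w) , ≡.sym (Perm.inverseʳ w))
                                 ; (inj₂ (≡.refl , ≡.refl)) → inj₂ (≡.sym (Perm.inverseʳ w) , ≡.sym (Perm.inverseʳ w)) })
                        (λ p → λ { (inj₁ (eq , eq′)) → inj₁ (to-inverse eq , to-inverse eq′)
                                 ; (inj₂ (eq , eq′)) → inj₂ (to-inverse eq′ , to-inverse eq) })
                        (once-joins (fst≢snd p′ ∘ perm-injective (w ⁻¹))))
    (λ { p p′ _ (inj₁ (≡.refl , ≡.refl)) → refl ; p p′ _ (inj₂ (≡.refl , ≡.refl)) → g-sym _ _ })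
    where
    open Pair

    to-inverse : ∀ {i j} → j ≡ w ⟨$⟩ʳ i → i ≡ w ⟨$⟩ˡ j
    to-inverse ≡.refl = ≡.sym (Perm.inverseˡ w)

  module _ {m : ℕ} (k : Fin m) where
    private
      n = suc m

      top : Pair n
      top = pair (inject₁ k) (suc k) (lo<hi k)

      top? : (i j : Fin n) → Dec (inject₁ k ≡ i × suc k ≡ j)
      top? i j = (inject₁ k Fin.≟ i) ×-dec (suc k Fin.≟ j)

      skip : ∀ {p} {P : Set p} → Dec P → Carrier → Carrier
      skip d y = if does d then ε else y

      pick∙skip : ∀ {p} {P : Set p} (d : Dec P) y → y ≈ pick d y ∙ skip d y
      pick∙skip (yes _) y = sym (identityʳ y)
      pick∙skip (no _)  y = sym (identityˡ y)

    other-pairs : (Fin n → Fin n → Carrier) → Carrier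
    other-pairs ψ = fold (pairs n) λ (pair i j _) → skip (top? i j) (ψ i j)

    fold-pairs-split : ∀ (ψ : Fin n → Fin n → Carrier) →
      fold (pairs n) (λ (pair i j _) → ψ i j) ≈ ψ (inject₁ k) (suc k) ∙ other-pairs ψ
    fold-pairs-split ψ = trans (fold-cong (pairs n) λ (pair i j _) → pick∙skip (top? i j) (ψ i j))
      (trans (fold-∙ (pairs n) (λ (pair i j _) → pick (top? i j) (ψ i j)) _)
        (∙-congʳ (fold-once (λ (pair i j _) → top? i j) (λ (pair i j _) → ψ i j) (ψ (inject₁ k) (suc k))
          (once-resp (λ { _ ≡.refl → ≡.refl , ≡.refl }) (λ { p (eq , eq′) → pair-≡ eq eq′ }) (once-pairs top))
          λ { p (≡.refl , ≡.refl) → refl })))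

    other-pairs-cong : ∀ {ψ ψ′} → (∀ i j → i Fin.< j → ψ i j ≈ ψ′ i j) → other-pairs ψ ≈ other-pairs ψ′
    other-pairs-cong {ψ} {ψ′} eq = fold-cong (pairs n) λ (pair i j i<j) → skip-cong (top? i j) (eq i j i<j)
      where
      skip-cong : ∀ {p} {P : Set p} (d : Dec P) {y z} → y ≈ z → skip d y ≈ skip d z
      skip-cong (yes _) eq = refl
      skip-cong (no _)  eq = eq

    other-pairs-adj : ∀ ψ → other-pairs (λ i j → ψ (adj k ⟨$⟩ʳ i) (adj k ⟨$⟩ʳ j)) ≈ other-pairs ψ
    other-pairs-adj ψ = begin
      fold (pairs n) (λ (pair i j _) → skip (top? i j) (ψ (s i) (s j)))
        ≈⟨ fold-cong (pairs n) (λ (pair i j i<j) → sorted-adj i j i<j (top? i j)) ⟩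
      fold (pairs n) (λ (pair i j _) → sorted (s i) (s j))
        ≈⟨ fold-pairs-permute (adj k) sorted sorted-sym ⟩
      fold (pairs n) (λ (pair i j _) → sorted i j)
        ≈⟨ fold-cong (pairs n) (λ (pair i j i<j) → sorted-< i j i<j) ⟩
      fold (pairs n) (λ (pair i j _) → skip (top? i j) (ψ i j)) ∎
      where
      s : Fin n → Fin n
      s i = adj k ⟨$⟩ʳ i

      sorted : Fin n → Fin n → Carrier
      sorted i j with ℕ.<-cmp (toℕ i) (toℕ j)
      ... | tri< _ _ _ = skip (top? i j) (ψ i j)
      ... | tri≈ _ _ _ = ε
      ... | tri> _ _ _ = skip (top? j i) (ψ j i)

      sorted-< : ∀ i j → i Fin.< j → sorted i j ≈ skip (top? i j) (ψ i j)
      sorted-< i j i<j with ℕ.<-cmp (toℕ i) (toℕ j)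
      ... | tri< _ _ _   = refl
      ... | tri≈ i≮j _ _ = contradiction i<j i≮j
      ... | tri> i≮j _ _ = contradiction i<j i≮j

      sorted-sym : ∀ i j → sorted i j ≈ sorted j i
      sorted-sym i j with ℕ.<-cmp (toℕ i) (toℕ j) | ℕ.<-cmp (toℕ j) (toℕ i)
      ... | tri< _ _ _     | tri> _ _ _     = refl
      ... | tri> _ _ _     | tri< _ _ _     = refl
      ... | tri≈ _ _ _     | tri≈ _ _ _     = refl
      ... | tri< i<j _ _   | tri< _ _ i≮j   = contradiction i<j i≮j
      ... | tri< i<j _ _   | tri≈ _ _ i≮j   = contradiction i<j i≮j
      ... | tri> _ _ j<i   | tri> j≮i _ _   = contradiction j<i j≮i
      ... | tri> _ _ j<i   | tri≈ j≮i _ _   = contradiction j<i j≮i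
      ... | tri≈ i≮j _ _   | tri> _ _ i<j   = contradiction i<j i≮j
      ... | tri≈ _ _ j≮i   | tri< j<i _ _   = contradiction j<i j≮i

      skip-yes : ∀ {p} {P : Set p} (d : Dec P) y → P → skip d y ≈ ε
      skip-yes (yes _) y p = refl
      skip-yes (no ¬p) y p = contradiction p ¬p

      skip-no : ∀ {p} {P : Set p} (d : Dec P) y → ¬ P → skip d y ≈ y
      skip-no (yes p) y ¬p = contradiction p ¬p
      skip-no (no _)  y ¬p = refl

      sorted-adj : ∀ i j → i Fin.< j → (d : Dec (inject₁ k ≡ i × suc k ≡ j)) →
                   skip d (ψ (s i) (s j)) ≈ sorted (s i) (s j)
      sorted-adj _ _ _ (yes (≡.refl , ≡.refl)) = sym (begin
        sorted (s (inject₁ k)) (s (suc k))        ≡⟨ ≡.cong₂ sorted (adj-lo k) (adj-hi k) ⟩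
        sorted (suc k) (inject₁ k)                ≈⟨ sorted-sym (suc k) (inject₁ k) ⟩
        sorted (inject₁ k) (suc k)                ≈⟨ sorted-< (inject₁ k) (suc k) (lo<hi k) ⟩
        skip (top? (inject₁ k) (suc k)) _         ≈⟨ skip-yes (top? (inject₁ k) (suc k)) _ (≡.refl , ≡.refl) ⟩
        ε                                         ∎)
      sorted-adj i j i<j (no ¬top) = sym (begin
        sorted (s i) (s j)                        ≈⟨ sorted-< (s i) (s j) si<sj ⟩
        skip (top? (s i) (s j)) (ψ (s i) (s j))   ≈⟨ skip-no (top? (s i) (s j)) _ ¬top′ ⟩
        ψ (s i) (s j)                             ∎)
        where
        si<sj : s i Fin.< s j
        si<sj = adj-mono k i<j λ (eq , eq′) → ¬top (≡.sym eq , ≡.sym eq′)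

        ¬top′ : ¬ (inject₁ k ≡ s i × suc k ≡ s j)
        ¬top′ (eq , eq′) = contradiction i<j (ℕ.<-asym (≡.subst₂ Fin._<_
          (≡.trans (≡.sym (adj-hi k)) (≡.trans (≡.cong s eq′) (adj-involutive k j)))
          (≡.trans (≡.sym (adj-lo k)) (≡.trans (≡.cong s eq) (adj-involutive k i)))
          (lo<hi k)))

-- Hecke symmetrizers over a ring with an action of the symmetric group

record Action {c ℓ} (A : CommutativeRing c ℓ) (m : ℕ) : Set (c ⊔ ℓ) where
  open CommutativeRing A hiding (zero)
  infixr 8 _▹_
  field
    _▹_    : Permutation′ (suc m) → Carrier → Carrier
    ▹-cong : ∀ w {f g} → f ≈ g → w ▹ f ≈ w ▹ g
    ▹-resp : ∀ {w u} f → w Perm.≈ u → w ▹ f ≈ u ▹ f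
    ▹-·    : ∀ w u f → (w · u) ▹ f ≈ w ▹ u ▹ f
    ▹-id   : ∀ f → Perm.id ▹ f ≈ f
    ▹-+    : ∀ w f g → w ▹ (f + g) ≈ w ▹ f + w ▹ g
    ▹-*    : ∀ w f g → w ▹ (f * g) ≈ w ▹ f * w ▹ g
    ▹-1    : ∀ w → w ▹ 1# ≈ 1#
    x      : Fin (suc m) → Carrier
    ▹-x    : ∀ w i → w ▹ x i ≈ x (w ⟨$⟩ʳ i)
    t      : Carrier
    ▹-t    : ∀ w → w ▹ t ≈ t
    -- inverses of x_i − x_j and x_j − t x_i; junk on the diagonal
    recip  : Fin (suc m) → Fin (suc m) → Carrier
    trecip : Fin (suc m) → Fin (suc m) → Carrier
    x-recip  : ∀ {i j} → i ≢ j → (x i - x j) * recip i j ≈ 1#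
    x-trecip : ∀ {i j} → i ≢ j → (x j - t * x i) * trecip i j ≈ 1#

module RingLemmas {c ℓ} (A : CommutativeRing c ℓ) where
  open CommutativeRing A hiding (zero)
  open Algebra.Properties.Ring ring using (-‿distribˡ-*; -‿distribʳ-*; -0#≈0#)
  open Relation.Binary.Reasoning.Setoid setoid
  open IntegerSolver A

  inverse-unique : ∀ {a y z} → a * y ≈ 1# → a * z ≈ 1# → y ≈ z
  inverse-unique {a} {y} {z} ay≈1 az≈1 = begin
    y           ≈⟨ *-identityʳ y ⟨
    y * 1#      ≈⟨ *-congˡ az≈1 ⟨
    y * (a * z) ≈⟨ solve 3 (λ a y z → y :* (a :* z) := (a :* y) :* z) a y z ⟩
    a * y * z   ≈⟨ *-congʳ ay≈1 ⟩
    1# * z      ≈⟨ *-identityˡ z ⟩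
    z           ∎

  x-y≈0⇒x≈y : ∀ {a b} → a - b ≈ 0# → a ≈ b
  x-y≈0⇒x≈y {a} {b} eq = begin
    a           ≈⟨ solve 2 (λ a b → a := (a :- b) :+ b) a b ⟩
    a - b + b   ≈⟨ +-congʳ eq ⟩
    0# + b      ≈⟨ +-identityˡ b ⟩
    b           ∎

  regular-cancel : ∀ {b y z} → Regular A b → y * b ≈ z * b → y ≈ z
  regular-cancel {b} {y} {z} reg eq = x-y≈0⇒x≈y (cancel reg (y - z)
    (trans (solve 3 (λ b y z → b :* (y :- z) := y :* b :- z :* b) b y z)
      (trans (+-congʳ eq) (-‿inverseʳ _))))

  ∑-distribˡ : ∀ {a} {I : Set a} (xs : List I) b (f : I → Carrier) → b * ∑ A xs f ≈ ∑ A xs (λ i → b * f i)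
  ∑-distribˡ xs b f = fold-homo +-commutativeMonoid +-commutativeMonoid (b *_) (zeroʳ b) (distribˡ b) xs f

  ∑-neg : ∀ {a} {I : Set a} (xs : List I) (f : I → Carrier) → - ∑ A xs f ≈ ∑ A xs (λ i → - f i)
  ∑-neg xs f = fold-homo +-commutativeMonoid +-commutativeMonoid -_ -0#≈0#
    (λ y z → solve 2 (λ y z → :- (y :+ z) := :- y :+ :- z) y z) xs f

module Hecke {c ℓ} {A : CommutativeRing c ℓ} {m : ℕ} (act : Action A m) where
  open CommutativeRing A hiding (zero)
  open Action act
  open RingLemmas A
  open Algebra.Properties.Ring ring using (-0#≈0#; -1*x≈-x; +-cancelʳ)
  open Algebra.Properties.Semiring.Exp semiring using (_^_)
  open Relation.Binary.Reasoning.Setoid setoid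
  open IntegerSolver A
  private
    module ∑′ = Fold +-commutativeMonoid
    module ∏′ = Fold *-commutativeMonoid
    module ∏ᵖ = FoldPairs *-commutativeMonoid

    n = suc m

  ▹-0 : ∀ w → w ▹ 0# ≈ 0#
  ▹-0 w = +-cancelʳ (w ▹ 0#) _ _ (trans (sym (▹-+ w 0# 0#)) (trans (▹-cong w (+-identityˡ 0#)) (sym (+-identityˡ _))))

  ▹-neg : ∀ w f → w ▹ (- f) ≈ - (w ▹ f)
  ▹-neg w f = +-cancelʳ (w ▹ f) _ _ (trans (sym (▹-+ w (- f) f))
    (trans (▹-cong w (-‿inverseˡ f)) (trans (▹-0 w) (sym (-‿inverseˡ _)))))

  ▹-- : ∀ w f g → w ▹ (f - g) ≈ w ▹ f - w ▹ g
  ▹-- w f g = trans (▹-+ w f (- g)) (+-congˡ (▹-neg w g))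

  ▹-∑ : ∀ w {a} {I : Set a} (xs : List I) (f : I → Carrier) → w ▹ ∑ A xs f ≈ ∑ A xs (λ i → w ▹ f i)
  ▹-∑ w = fold-homo +-commutativeMonoid +-commutativeMonoid (w ▹_) (▹-0 w) (▹-+ w)

  ▹-∏ : ∀ w {a} {I : Set a} (xs : List I) (f : I → Carrier) → w ▹ ∏ A xs f ≈ ∏ A xs (λ i → w ▹ f i)
  ▹-∏ w = fold-homo *-commutativeMonoid *-commutativeMonoid (w ▹_) (▹-1 w) (▹-* w)

  ▹-recip : ∀ w {i j} → i ≢ j → w ▹ recip i j ≈ recip (w ⟨$⟩ʳ i) (w ⟨$⟩ʳ j)
  ▹-recip w {i} {j} i≢j = inverse-unique (begin
    (x (w ⟨$⟩ʳ i) - x (w ⟨$⟩ʳ j)) * w ▹ recip i j ≈⟨ *-congʳ (trans (▹-- w _ _) (+-cong (▹-x w i) (-‿cong (▹-x w j)))) ⟨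
    w ▹ (x i - x j) * w ▹ recip i j               ≈⟨ ▹-* w _ _ ⟨
    w ▹ ((x i - x j) * recip i j)                 ≈⟨ ▹-cong w (x-recip i≢j) ⟩
    w ▹ 1#                                        ≈⟨ ▹-1 w ⟩
    1#                                            ∎) (x-recip (i≢j ∘ perm-injective w))

  recip-neg : ∀ {i j} → i ≢ j → recip j i ≈ - recip i j
  recip-neg {i} {j} i≢j = inverse-unique (x-recip (i≢j ∘ ≡.sym)) (begin
    (x j - x i) * - recip i j ≈⟨ solve 3 (λ a b u → (b :- a) :* :- u := (a :- b) :* u) (x i) (x j) (recip i j) ⟩
    (x i - x j) * recip i j   ≈⟨ x-recip i≢j ⟩
    1#                        ∎)

  Invariant : Carrier → Set ℓ
  Invariant f = ∀ w → w ▹ f ≈ f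

  adj-invariant⇒invariant : ∀ {f} → (∀ k → adj k ▹ f ≈ f) → Invariant f
  adj-invariant⇒invariant {f} inv = perm-induction (λ w → w ▹ f ≈ f)
    (λ {w} {u} w≈u eq → trans (sym (▹-resp {w} {u} f w≈u)) eq)
    (λ k {w} eq → trans (▹-· (adj k) w f) (trans (▹-cong (adj k) eq) (inv k)))
    (▹-id f)

  ▹-adj-adj : ∀ k f → adj k ▹ adj k ▹ f ≈ f
  ▹-adj-adj k f = trans (sym (▹-· (adj k) (adj k) f))
    (trans (▹-resp {adj k · adj k} {Perm.id} f (adj-involutive k)) (▹-id f))

  module _ (k : Fin m) where
    xₗ xₕ u : Carrier
    xₗ = x (inject₁ k)
    xₕ = x (suc k)
    u  = recip (inject₁ k) (suc k)

    s : Carrier → Carrier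
    s f = adj k ▹ f

    [xₗ-xₕ]u : (xₗ - xₕ) * u ≈ 1#
    [xₗ-xₕ]u = x-recip (inject₁≢suc k)

    s-xₗ : s xₗ ≈ xₕ
    s-xₗ = trans (▹-x (adj k) _) (reflexive (≡.cong x (adj-lo k)))

    s-xₕ : s xₕ ≈ xₗ
    s-xₕ = trans (▹-x (adj k) _) (reflexive (≡.cong x (adj-hi k)))

    s-u : s u ≈ - u
    s-u = trans (▹-recip (adj k) (inject₁≢suc k))
      (trans (reflexive (≡.cong₂ recip (adj-lo k) (adj-hi k))) (recip-neg (inject₁≢suc k)))

    s-xₗ-txₕ : s (xₗ - t * xₕ) ≈ xₕ - t * xₗ
    s-xₗ-txₕ = trans (▹-- (adj k) xₗ (t * xₕ))
      (+-cong s-xₗ (-‿cong (trans (▹-* (adj k) t xₕ) (*-cong (▹-t (adj k)) s-xₕ))))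

    s-xₕ-txₗ : s (xₕ - t * xₗ) ≈ xₗ - t * xₕ
    s-xₕ-txₗ = trans (▹-- (adj k) xₕ (t * xₗ))
      (+-cong s-xₕ (-‿cong (trans (▹-* (adj k) t xₗ) (*-cong (▹-t (adj k)) s-xₗ))))

    s-txₗ-xₕ : s (t * xₗ - xₕ) ≈ t * xₕ - xₗ
    s-txₗ-xₕ = trans (▹-- (adj k) (t * xₗ) xₕ)
      (+-cong (trans (▹-* (adj k) t xₗ) (*-cong (▹-t (adj k)) s-xₗ)) (-‿cong s-xₕ))

    -- The right-hand side of (E2), collected in f and s f.
    step : Carrier → Carrier → Carrier
    step β f = ((1# - t + β) * xₗ - β * xₕ) * u * f + (t * xₗ - xₕ) * u * s f

    half : Carrier → Carrier
    half f = (xₗ - t * xₕ) * u * f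

    step-half : ∀ β f → step β f + (t - β) * f ≈ half f + s (half f)
    step-half β f = begin
      step β f + (t - β) * f
        ≈⟨ +-congˡ (*-congˡ (trans (sym (*-identityˡ f)) (*-congʳ (sym [xₗ-xₕ]u)))) ⟩
      step β f + (t - β) * ((xₗ - xₕ) * u * f)
        ≈⟨ solve 7 (λ t β l h u f f′ →
             ((con 1ℤ :- t :+ β) :* l :- β :* h) :* u :* f :+ (t :* l :- h) :* u :* f′ :+ (t :- β) :* ((l :- h) :* u :* f)
             := (l :- t :* h) :* u :* f :+ (h :- t :* l) :* :- u :* f′) t β xₗ xₕ u f (s f) ⟩
      half f + (xₕ - t * xₗ) * - u * s f
        ≈⟨ +-congˡ (trans (▹-* (adj k) _ f) (*-congʳ (trans (▹-* (adj k) _ u) (*-cong s-xₗ-txₕ s-u)))) ⟨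
      half f + s (half f) ∎

    step-diff : ∀ β f → step β f ≈ (1# + β) * f + (t * xₗ - xₕ) * u * (s f - f)
    step-diff β f = sym (begin
      (1# + β) * f + (t * xₗ - xₕ) * u * (s f - f)
        ≈⟨ +-congʳ (*-congˡ (trans (sym (*-identityˡ f)) (*-congʳ (sym [xₗ-xₕ]u)))) ⟩
      (1# + β) * ((xₗ - xₕ) * u * f) + (t * xₗ - xₕ) * u * (s f - f)
        ≈⟨ solve 7 (λ t β l h u f f′ →
             (con 1ℤ :+ β) :* ((l :- h) :* u :* f) :+ (t :* l :- h) :* u :* (f′ :- f)
             := ((con 1ℤ :- t :+ β) :* l :- β :* h) :* u :* f :+ (t :* l :- h) :* u :* f′) t β xₗ xₕ u f (s f) ⟩
      step β f ∎)

    half-invariant : ∀ f → s (half f + s (half f)) ≈ half f + s (half f)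
    half-invariant f = trans (▹-+ (adj k) _ _) (trans (+-congˡ (▹-adj-adj k _)) (+-comm _ _))

  ∑-▹-adj : ∀ k f → ∑ A (Sₙ n) (λ w → w ▹ adj k ▹ f) ≈ ∑ A (Sₙ n) (λ w → w ▹ f)
  ∑-▹-adj k f = ∑′.fold-bijection (λ w w′ → w′ ≈? (w · adj k))
    (λ w _ → once-Sₙ (w · adj k))
    (λ w′ _ → once-resp (λ w eq i → ≡.trans (≡.cong (w′ ⟨$⟩ʳ_) (≡.sym (adj-involutive k i))) (≡.sym (eq (adj k ⟨$⟩ʳ i))))
                        (λ w eq i → ≡.trans (≡.cong (w ⟨$⟩ʳ_) (≡.sym (adj-involutive k i))) (≡.sym (eq (adj k ⟨$⟩ʳ i))))
                        (once-Sₙ (w′ · adj k)))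
    (λ w w′ _ eq → sym (trans (▹-resp {w′} {w · adj k} f eq) (▹-· w (adj k) f)))

  ∑-▹-invariant : ∀ {f g} → Invariant f → ∑ A (Sₙ n) (λ w → w ▹ (f * g)) ≈ f * ∑ A (Sₙ n) (λ w → w ▹ g)
  ∑-▹-invariant {f} {g} f-inv = trans
    (∑′.fold-cong (Sₙ n) λ w → trans (▹-* w f g) (*-congʳ (f-inv w)))
    (sym (∑-distribˡ (Sₙ n) f (λ w → w ▹ g)))

  ∏ₚ : (Fin n → Fin n → Carrier) → Carrier
  ∏ₚ ψ = ∏ A (pairs n) λ (pair i j _) → ψ i j

  ▹-∏ₚ : ∀ w ψ → w ▹ ∏ₚ ψ ≈ ∏ A (pairs n) (λ (pair i j _) → w ▹ ψ i j)
  ▹-∏ₚ w ψ = ▹-∏ w (pairs n) λ (pair i j _) → ψ i j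

  module _ (k : Fin m) where
    others : (Fin n → Fin n → Carrier) → Carrier
    others = ∏ᵖ.other-pairs k

    ∏ₚ-split : ∀ ψ → ∏ₚ ψ ≈ ψ (inject₁ k) (suc k) * others ψ
    ∏ₚ-split = ∏ᵖ.fold-pairs-split k

  Equivariant : (Fin n → Fin n → Carrier) → Set ℓ
  Equivariant ψ = ∀ w {i j} → i ≢ j → w ▹ ψ i j ≈ ψ (w ⟨$⟩ʳ i) (w ⟨$⟩ʳ j)

  s-others : ∀ k {ψ} → Equivariant ψ → adj k ▹ others k ψ ≈ others k ψ
  s-others k {ψ} eqv = begin
    adj k ▹ others k ψ
      ≈⟨ ▹-others ⟩
    others k (λ i j → adj k ▹ ψ i j)
      ≈⟨ ∏ᵖ.other-pairs-cong k (λ i j i<j → eqv (adj k) (Fin.<⇒≢ i<j)) ⟩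
    others k (λ i j → ψ (adj k ⟨$⟩ʳ i) (adj k ⟨$⟩ʳ j))
      ≈⟨ ∏ᵖ.other-pairs-adj k ψ ⟩
    others k ψ ∎
    where
    ▹-if : ∀ b {y} → adj k ▹ (if b then 1# else y) ≈ (if b then 1# else adj k ▹ y)
    ▹-if true  = ▹-1 (adj k)
    ▹-if false = refl

    ▹-others : adj k ▹ others k ψ ≈ others k (λ i j → adj k ▹ ψ i j)
    ▹-others = trans (▹-∏ (adj k) (pairs n) _) (∏′.fold-cong (pairs n) λ p → ▹-if _)

  δ ν : Fin n → Fin n → Carrier
  δ i j = (x i - t * x j) * recip i j
  ν i j = x j - t * x i

  δ-equivariant : Equivariant δ
  δ-equivariant w {i} {j} i≢j = trans (▹-* w _ _) (*-cong
    (trans (▹-- w _ _) (+-cong (▹-x w i) (-‿cong (trans (▹-* w t _) (*-cong (▹-t w) (▹-x w j))))))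
    (▹-recip w i≢j))

  ν-equivariant : Equivariant ν
  ν-equivariant w {i} {j} i≢j =
    trans (▹-- w _ _) (+-cong (▹-x w j) (-‿cong (trans (▹-* w t _) (*-cong (▹-t w) (▹-x w i)))))

  Δ N V : Carrier
  Δ = ∏ₚ δ
  N = ∏ₚ ν
  V = ∏ₚ recip

  symmetrize antisymmetrize : Carrier → Carrier
  symmetrize     f = ∑ A (Sₙ n) λ w → w ▹ (Δ * f)
  antisymmetrize f = ∑ A (Sₙ n) λ w → w ▹ (f * V)

  s-V : ∀ k → adj k ▹ V ≈ - V
  s-V k = begin
    adj k ▹ V                                   ≈⟨ ▹-cong (adj k) (∏ₚ-split k recip) ⟩
    adj k ▹ (u k * others k recip)              ≈⟨ ▹-* (adj k) _ _ ⟩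
    adj k ▹ u k * adj k ▹ others k recip        ≈⟨ *-cong (s-u k) (s-others k ▹-recip) ⟩
    - u k * others k recip                      ≈⟨ solve 2 (λ u o → :- u :* o := :- (u :* o)) (u k) _ ⟩
    - (u k * others k recip)                    ≈⟨ -‿cong (∏ₚ-split k recip) ⟨
    - V                                         ∎

  s-N : ∀ k → (xₕ k - t * xₗ k) * adj k ▹ N ≈ (xₗ k - t * xₕ k) * N
  s-N k = begin
    (xₕ k - t * xₗ k) * adj k ▹ N
      ≈⟨ *-congˡ (trans (▹-cong (adj k) (∏ₚ-split k ν)) (trans (▹-* (adj k) _ _) (*-cong (s-xₕ-txₗ k) (s-others k ν-equivariant)))) ⟩
    (xₕ k - t * xₗ k) * ((xₗ k - t * xₕ k) * others k ν)
      ≈⟨ solve 3 (λ a b o → a :* (b :* o) := b :* (a :* o)) _ _ _ ⟩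
    (xₗ k - t * xₕ k) * ((xₕ k - t * xₗ k) * others k ν)
      ≈⟨ *-congˡ (∏ₚ-split k ν) ⟨
    (xₗ k - t * xₕ k) * N ∎

  symmetrize-cong : ∀ {f g} → f ≈ g → symmetrize f ≈ symmetrize g
  symmetrize-cong f≈g = ∑′.fold-cong (Sₙ n) λ w → ▹-cong w (*-congˡ f≈g)

  antisymmetrize-cong : ∀ {f g} → f ≈ g → antisymmetrize f ≈ antisymmetrize g
  antisymmetrize-cong f≈g = ∑′.fold-cong (Sₙ n) λ w → ▹-cong w (*-congʳ f≈g)

  symmetrize-scalar : ∀ {b} f → Invariant b → symmetrize (b * f) ≈ b * symmetrize f
  symmetrize-scalar {b} f b-inv = trans
    (∑′.fold-cong (Sₙ n) λ w → ▹-cong w (solve 3 (λ a b f → a :* (b :* f) := b :* (a :* f)) Δ b f))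
    (∑-▹-invariant b-inv)

  antisymmetrize-scalar : ∀ {b} f → Invariant b → antisymmetrize (b * f) ≈ b * antisymmetrize f
  antisymmetrize-scalar {b} f b-inv = trans
    (∑′.fold-cong (Sₙ n) λ w → ▹-cong w (*-assoc b f V))
    (∑-▹-invariant b-inv)

  symmetrize-+ : ∀ f g → symmetrize (f + g) ≈ symmetrize f + symmetrize g
  symmetrize-+ f g = trans (∑′.fold-cong (Sₙ n) λ w → trans (▹-cong w (distribˡ Δ f g)) (▹-+ w _ _))
    (∑′.fold-∙ (Sₙ n) _ _)

  antisymmetrize-+ : ∀ f g → antisymmetrize (f + g) ≈ antisymmetrize f + antisymmetrize g
  antisymmetrize-+ f g = trans (∑′.fold-cong (Sₙ n) λ w → trans (▹-cong w (distribʳ V f g)) (▹-+ w _ _))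
    (∑′.fold-∙ (Sₙ n) _ _)

  symmetrize-0 : symmetrize 0# ≈ 0#
  symmetrize-0 = trans (∑′.fold-cong (Sₙ n) λ w → trans (▹-cong w (zeroʳ Δ)) (▹-0 w)) (∑′.fold-ε (Sₙ n))

  antisymmetrize-0 : antisymmetrize 0# ≈ 0#
  antisymmetrize-0 = trans (∑′.fold-cong (Sₙ n) λ w → trans (▹-cong w (zeroˡ V)) (▹-0 w)) (∑′.fold-ε (Sₙ n))

  symmetrize-step : ∀ k {β} f → Invariant β → symmetrize (step k β f) ≈ (1# + β) * symmetrize f
  symmetrize-step k {β} f β-inv = begin
    symmetrize (step k β f)
      ≈⟨ symmetrize-cong (step-diff k β f) ⟩
    symmetrize ((1# + β) * f + (t * xₗ k - xₕ k) * u k * (s k f - f))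
      ≈⟨ symmetrize-+ _ _ ⟩
    symmetrize ((1# + β) * f) + symmetrize ((t * xₗ k - xₕ k) * u k * (s k f - f))
      ≈⟨ +-cong (symmetrize-scalar f λ w → trans (▹-+ w 1# β) (+-cong (▹-1 w) (β-inv w))) vanish ⟩
    (1# + β) * symmetrize f + 0#
      ≈⟨ +-identityʳ _ ⟩
    (1# + β) * symmetrize f ∎
    where
    D : Carrier
    D = (xₗ k - t * xₕ k) * u k * ((t * xₗ k - xₕ k) * u k) * others k δ

    s-D : s k D ≈ D
    s-D = begin
      s k D
        ≈⟨ trans (▹-* (adj k) _ _) (*-cong (trans (▹-* (adj k) _ _)
             (*-cong (trans (▹-* (adj k) _ _) (*-cong (s-xₗ-txₕ k) (s-u k)))
                     (trans (▹-* (adj k) _ _) (*-cong (s-txₗ-xₕ k) (s-u k))))) (s-others k δ-equivariant)) ⟩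
      (xₕ k - t * xₗ k) * - u k * ((t * xₕ k - xₗ k) * - u k) * others k δ
        ≈⟨ solve 5 (λ t l h u o → (h :- t :* l) :* :- u :* ((t :* h :- l) :* :- u) :* o
             := (l :- t :* h) :* u :* ((t :* l :- h) :* u) :* o) t (xₗ k) (xₕ k) (u k) (others k δ) ⟩
      D ∎

    expand : ∀ w → w ▹ (Δ * ((t * xₗ k - xₕ k) * u k * (s k f - f))) ≈ w ▹ s k (D * f) - w ▹ (D * f)
    expand w = trans (▹-cong w (begin
      Δ * ((t * xₗ k - xₕ k) * u k * (s k f - f))
        ≈⟨ *-congʳ (∏ₚ-split k δ) ⟩
      (xₗ k - t * xₕ k) * u k * others k δ * ((t * xₗ k - xₕ k) * u k * (s k f - f))
        ≈⟨ solve 5 (λ a o b g f → a :* o :* (b :* (g :- f)) := a :* b :* o :* g :- a :* b :* o :* f) _ _ _ _ _ ⟩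
      D * s k f - D * f
        ≈⟨ +-congʳ (trans (▹-* (adj k) D f) (*-congʳ s-D)) ⟨
      s k (D * f) - D * f ∎)) (▹-- w _ _)

    vanish : symmetrize ((t * xₗ k - xₕ k) * u k * (s k f - f)) ≈ 0#
    vanish = begin
      symmetrize ((t * xₗ k - xₕ k) * u k * (s k f - f))
        ≈⟨ ∑′.fold-cong (Sₙ n) expand ⟩
      ∑ A (Sₙ n) (λ w → w ▹ s k (D * f) - w ▹ (D * f))
        ≈⟨ ∑′.fold-∙ (Sₙ n) _ _ ⟩
      ∑ A (Sₙ n) (λ w → w ▹ s k (D * f)) + ∑ A (Sₙ n) (λ w → - (w ▹ (D * f)))
        ≈⟨ +-cong (∑-▹-adj k (D * f)) (sym (∑-neg (Sₙ n) λ w → w ▹ (D * f))) ⟩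
      ∑ A (Sₙ n) (λ w → w ▹ (D * f)) - ∑ A (Sₙ n) (λ w → w ▹ (D * f))
        ≈⟨ -‿inverseʳ _ ⟩
      0# ∎

  antisymmetrize-step : ∀ k {β} f → Invariant β → antisymmetrize (step k β f) ≈ (β - t) * antisymmetrize f
  antisymmetrize-step k {β} f β-inv = begin
    antisymmetrize (step k β f)
      ≈⟨ antisymmetrize-cong (solve 3 (λ a b d → a := b :* d :+ (a :+ :- b :* d)) (step k β f) (β - t) f) ⟩
    antisymmetrize ((β - t) * f + (step k β f + - (β - t) * f))
      ≈⟨ antisymmetrize-cong (+-congˡ (+-congˡ (solve 3 (λ β t f → :- (β :- t) :* f := (t :- β) :* f) β t f))) ⟩
    antisymmetrize ((β - t) * f + (step k β f + (t - β) * f))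
      ≈⟨ antisymmetrize-cong (+-congˡ (step-half k β f)) ⟩
    antisymmetrize ((β - t) * f + (half k f + s k (half k f)))
      ≈⟨ antisymmetrize-+ _ _ ⟩
    antisymmetrize ((β - t) * f) + antisymmetrize (half k f + s k (half k f))
      ≈⟨ +-cong (antisymmetrize-scalar f λ w → trans (▹-- w β t) (+-cong (β-inv w) (-‿cong (▹-t w)))) vanish ⟩
    (β - t) * antisymmetrize f + 0#
      ≈⟨ +-identityʳ _ ⟩
    (β - t) * antisymmetrize f ∎
    where
    h : Carrier
    h = half k f

    expand : ∀ w → w ▹ ((h + s k h) * V) ≈ w ▹ (h * V) - w ▹ s k (h * V)
    expand w = trans (▹-cong w (begin
      (h + s k h) * V          ≈⟨ solve 3 (λ h g v → (h :+ g) :* v := h :* v :- g :* :- v) h (s k h) V ⟩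
      h * V - s k h * - V      ≈⟨ +-congˡ (-‿cong (*-congˡ (s-V k))) ⟨
      h * V - s k h * s k V    ≈⟨ +-congˡ (-‿cong (▹-* (adj k) h V)) ⟨
      h * V - s k (h * V)      ∎)) (▹-- w _ _)

    vanish : antisymmetrize (h + s k h) ≈ 0#
    vanish = begin
      antisymmetrize (h + s k h)
        ≈⟨ ∑′.fold-cong (Sₙ n) expand ⟩
      ∑ A (Sₙ n) (λ w → w ▹ (h * V) - w ▹ s k (h * V))
        ≈⟨ ∑′.fold-∙ (Sₙ n) _ _ ⟩
      ∑ A (Sₙ n) (λ w → w ▹ (h * V)) + ∑ A (Sₙ n) (λ w → - (w ▹ s k (h * V)))
        ≈⟨ +-congˡ (trans (sym (∑-neg (Sₙ n) λ w → w ▹ s k (h * V))) (-‿cong (∑-▹-adj k (h * V)))) ⟩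
      ∑ A (Sₙ n) (λ w → w ▹ (h * V)) - ∑ A (Sₙ n) (λ w → w ▹ (h * V))
        ≈⟨ -‿inverseʳ _ ⟩
      0# ∎

  ▹-V : ∀ w → w ▹ V ≈ (- 1#) ^ Defs.ℓ w * V
  ▹-V w = begin
    w ▹ V
      ≈⟨ ▹-∏ₚ w recip ⟩
    ∏ A (pairs n) (λ (pair i j _) → w ▹ recip i j)
      ≈⟨ ∏′.fold-cong (pairs n) signed ⟩
    ∏ A (pairs n) (λ p → ∏′.pick (inv? p) (- 1#) * sorted (w ⟨$⟩ʳ fst p) (w ⟨$⟩ʳ snd p))
      ≈⟨ ∏′.fold-∙ (pairs n) _ _ ⟩
    ∏ A (pairs n) (λ p → ∏′.pick (inv? p) (- 1#)) * ∏ A (pairs n) (λ p → sorted (w ⟨$⟩ʳ fst p) (w ⟨$⟩ʳ snd p))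
      ≈⟨ *-cong (trans (sym (∏′.fold-filter inv? (pairs n) λ _ → - 1#)) (∏-const (Inv w)))
                (∏ᵖ.fold-pairs-permute w sorted sorted-sym) ⟩
    (- 1#) ^ Defs.ℓ w * ∏ A (pairs n) (λ p → sorted (fst p) (snd p))
      ≈⟨ *-congˡ (∏′.fold-cong (pairs n) λ (pair i j i<j) → sorted-< i j i<j) ⟩
    (- 1#) ^ Defs.ℓ w * V ∎
    where
    open Pair

    inv? : (p : Pair n) → Dec (w ⟨$⟩ʳ snd p Fin.< w ⟨$⟩ʳ fst p)
    inv? p = (w ⟨$⟩ʳ snd p) Fin.<? (w ⟨$⟩ʳ fst p)

    ∏-const : ∀ (ps : List (Pair n)) → ∏ A ps (λ _ → - 1#) ≈ (- 1#) ^ length ps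
    ∏-const []       = refl
    ∏-const (p ∷ ps) = *-congˡ (∏-const ps)

    sorted : Fin n → Fin n → Carrier
    sorted i j with ℕ.<-cmp (toℕ i) (toℕ j)
    ... | tri< _ _ _ = recip i j
    ... | tri≈ _ _ _ = 1#
    ... | tri> _ _ _ = recip j i

    sorted-< : ∀ i j → i Fin.< j → sorted i j ≈ recip i j
    sorted-< i j i<j with ℕ.<-cmp (toℕ i) (toℕ j)
    ... | tri< _ _ _   = refl
    ... | tri≈ i≮j _ _ = contradiction i<j i≮j
    ... | tri> i≮j _ _ = contradiction i<j i≮j

    sorted-> : ∀ i j → j Fin.< i → sorted i j ≈ recip j i
    sorted-> i j j<i with ℕ.<-cmp (toℕ i) (toℕ j)
    ... | tri< _ _ j≮i = contradiction j<i j≮i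
    ... | tri≈ _ _ j≮i = contradiction j<i j≮i
    ... | tri> _ _ _   = refl

    sorted-sym : ∀ i j → sorted i j ≈ sorted j i
    sorted-sym i j with ℕ.<-cmp (toℕ i) (toℕ j)
    ... | tri< i<j _ _ = sym (sorted-> j i i<j)
    ... | tri> _ _ j<i = sym (sorted-< j i j<i)
    ... | tri≈ _ i≡j _ with Fin.toℕ-injective i≡j
    ...   | ≡.refl with ℕ.<-cmp (toℕ i) (toℕ i)
    ...     | tri< i<i _ _ = contradiction i<i (ℕ.<-irrefl ≡.refl)
    ...     | tri≈ _ _ _   = refl
    ...     | tri> _ _ i<i = contradiction i<i (ℕ.<-irrefl ≡.refl)

    signed : ∀ p → w ▹ recip (fst p) (snd p) ≈ ∏′.pick (inv? p) (- 1#) * sorted (w ⟨$⟩ʳ fst p) (w ⟨$⟩ʳ snd p)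
    signed p = trans (▹-recip w (fst≢snd p)) (by (inv? p))
      where
      i j : Fin n
      i = w ⟨$⟩ʳ fst p
      j = w ⟨$⟩ʳ snd p

      i≢j : i ≢ j
      i≢j = fst≢snd p ∘ perm-injective w

      by : (d : Dec (j Fin.< i)) → recip i j ≈ ∏′.pick d (- 1#) * sorted i j
      by (yes j<i) = trans (recip-neg (i≢j ∘ ≡.sym)) (trans (sym (-1*x≈-x _)) (*-congˡ (sym (sorted-> i j j<i))))
      by (no j≮i)  = trans (sym (sorted-< i j (ℕ.≤∧≢⇒< (ℕ.≮⇒≥ j≮i) (i≢j ∘ Fin.toℕ-injective)))) (sym (*-identityˡ _))

  antisymmetrize-signs : ∀ f → V * ∑ A (Sₙ n) (λ w → (- 1#) ^ Defs.ℓ w * w ▹ f) ≈ antisymmetrize f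
  antisymmetrize-signs f = trans (∑-distribˡ (Sₙ n) V _) (∑′.fold-cong (Sₙ n) λ w → begin
    V * ((- 1#) ^ Defs.ℓ w * w ▹ f)   ≈⟨ solve 3 (λ v e g → v :* (e :* g) := g :* (e :* v)) V _ (w ▹ f) ⟩
    w ▹ f * ((- 1#) ^ Defs.ℓ w * V)   ≈⟨ *-congˡ (▹-V w) ⟨
    w ▹ f * w ▹ V                     ≈⟨ ▹-* w f V ⟨
    w ▹ (f * V)                       ∎)

module FoldPairsSuc {c ℓ} (M : CommutativeMonoid c ℓ) where
  open CommutativeMonoid M
  open Fold M
  open Relation.Binary.Reasoning.Setoid setoid

  fold-pairs : ∀ {n} (h : Fin n → Fin n → Carrier) →
    fold (pairs n) (λ (pair i j _) → h i j) ≈ Sum.sum (λ i → Sum.sum λ j → pick (i Fin.<? j) (h i j))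
  fold-pairs {n} h = begin
    fold (pairs n) (λ (pair i j _) → h i j)
      ≈⟨ fold-mapMaybe mk-pair (List.cartesianProduct (allFin n) (allFin n)) _ ⟩
    fold (List.cartesianProduct (allFin n) (allFin n)) (λ ij → maybe′ (λ (pair i j _) → h i j) ε (mk-pair ij))
      ≈⟨ fold-cong (List.cartesianProduct (allFin n) (allFin n)) (λ (i , j) → mk-pick (i Fin.<? j)) ⟩
    fold (List.cartesianProduct (allFin n) (allFin n)) (λ (i , j) → pick (i Fin.<? j) (h i j))
      ≈⟨ fold-product (allFin n) (allFin n) ⟩
    fold (allFin n) (λ i → fold (allFin n) λ j → pick (i Fin.<? j) (h i j))
      ≈⟨ fold-cong (allFin n) (λ i → reflexive (fold-tabulate {k = n} id _)) ⟩
    fold (allFin n) (λ i → Sum.sum λ j → pick (i Fin.<? j) (h i j))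
      ≡⟨ fold-tabulate {k = n} id _ ⟩
    Sum.sum (λ i → Sum.sum λ j → pick (i Fin.<? j) (h i j)) ∎
    where
    mk-pick : ∀ {i j} (d : Dec (i Fin.< j)) →
              maybe′ (λ (pair i j _) → h i j) ε (Maybe.map (pair i j) (dec⇒maybe d)) ≈ pick d (h i j)
    mk-pick (yes _) = refl
    mk-pick (no _)  = refl

    fold-product : ∀ is js → fold (List.cartesianProduct is js) (λ (i , j) → pick (i Fin.<? j) (h i j))
                           ≈ fold is (λ i → fold js λ j → pick (i Fin.<? j) (h i j))
    fold-product []       js = refl
    fold-product (i ∷ is) js = trans (fold-++ (List.map (i ,_) js) (List.cartesianProduct is js) _)
      (∙-cong (reflexive (fold-map (i ,_) js _)) (fold-product is js))

  fold-pairs-suc : ∀ {n} (h : Fin (suc n) → Fin (suc n) → Carrier) →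
    fold (pairs (suc n)) (λ (pair i j _) → h i j)
      ≈ Sum.sum (λ j → h zero (suc j)) ∙ fold (pairs n) (λ (pair i j _) → h (suc i) (suc j))
  fold-pairs-suc {n} h = trans (fold-pairs h) (∙-cong
    (trans (identityˡ _) (Sum.sum-cong-≋ {n} λ j → refl))
    (trans (Sum.sum-cong-≋ {n} λ i → trans (identityˡ _) (Sum.sum-cong-≋ {n} λ j →
        pick-cong (suc i Fin.<? suc j) (i Fin.<? j) ℕ.s≤s⁻¹ ℕ.s≤s (h (suc i) (suc j)) (h (suc i) (suc j)) λ _ → refl))
      (sym (fold-pairs λ i j → h (suc i) (suc j)))))

-- The sum over Sₙ of the w-images of ∏ (α x_i + β x_j)/(x_i − x_j) is constant: by
-- partial fractions, adjoining one variable at a time.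
module SymmetrizedProduct {c ℓ} (A : CommutativeRing c ℓ) {N : ℕ} where
  open CommutativeRing A hiding (zero)
  open RingLemmas A
  open IntegerSolver A
  open Relation.Binary.Reasoning.Setoid setoid
  private
    module ∑′ = Fold +-commutativeMonoid
    module ∏′ = Fold *-commutativeMonoid

  module _ (α β : Carrier) where
    power : ℕ → Carrier
    power zero    = 1#
    power (suc k) = - β * power k

    geometric : ℕ → Carrier
    geometric zero    = 0#
    geometric (suc k) = α * geometric k + power k

    geometric! : ℕ → Carrier
    geometric! zero    = 1#
    geometric! (suc k) = geometric (suc k) * geometric! k

  module _ (α β : Carrier) (x : Fin N → Carrier) (r : Fin N → Fin N → Carrier)
           (x-r : ∀ {i j} → i ≢ j → (x i - x j) * r i j ≈ 1#) where
    g : Fin N → Fin N → Carrier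
    g i j = (α * x i + β * x j) * r i j

    private
      residue : ∀ {k} → (Fin k → Fin N) → Fin k → Carrier
      residue {suc k} f a = ∏′.Sum.sum {k} λ b → g (f a) (f (punchIn a b))

      residue-suc : ∀ {k} (f : Fin (suc k) → Fin N) a → residue f (suc a) ≈ g (f (suc a)) (f zero) * residue (f ∘ suc) a
      residue-suc {suc k} f a = refl

      ∑′-* : ∀ {k} b (h : Fin k → Carrier) → b * ∑′.Sum.sum h ≈ ∑′.Sum.sum λ a → b * h a
      ∑′-* {zero}  b h = zeroʳ b
      ∑′-* {suc k} b h = trans (distribˡ b _ _) (+-congˡ (∑′-* b (h ∘ suc)))

      Inj : ∀ {k} → (Fin k → Fin N) → Set
      Inj f = ∀ {a b} → f a ≡ f b → a ≡ b

      partial-fractions : ∀ {k} (f : Fin k → Fin N) → Inj f → ∀ z → (∀ a → z ≢ f a) →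
        ∏′.Sum.sum (λ a → g z (f a)) ≈ power α β k + (α + β) * x z * ∑′.Sum.sum (λ a → residue f a * r z (f a))
      partial-fractions {zero} f inj z z∉ = sym (trans (+-congˡ (zeroʳ _)) (+-identityʳ _))
      partial-fractions {suc k} f inj z z∉ = begin
        g z y * F z
          ≈⟨ solve 6 (λ α β z y r F → (α :* z :+ β :* y) :* r :* F
               := :- β :* ((z :- y) :* r) :* F :+ (α :+ β) :* z :* r :* F) α β (x z) (x y) (r z y) (F z) ⟩
        - β * ((x z - x y) * r z y) * F z + (α + β) * x z * r z y * F z
          ≈⟨ +-cong (*-congʳ (trans (*-congˡ (x-r (z∉ zero))) (*-identityʳ _))) (*-congˡ F-diff) ⟩
        - β * F z + (α + β) * x z * r z y * (F y + (α + β) * (x z - x y) * S₂)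
          ≈⟨ +-congʳ (*-congˡ (Fx z (z∉ ∘ suc))) ⟩
        - β * (power α β k + (α + β) * x z * S₁) + (α + β) * x z * r z y * (F y + (α + β) * (x z - x y) * S₂)
          ≈⟨ solve 9 (λ α β z y r F S₁ S₂ p → :- β :* (p :+ (α :+ β) :* z :* S₁) :+ (α :+ β) :* z :* r :* (F :+ (α :+ β) :* (z :- y) :* S₂)
               := :- β :* p :+ (α :+ β) :* z :* (F :* r :+ (:- β :* S₁ :+ (α :+ β) :* ((z :- y) :* r) :* S₂))) α β (x z) (x y) (r z y) (F y) S₁ S₂ (power α β k) ⟩
        - β * power α β k + (α + β) * x z * (F y * r z y + (- β * S₁ + (α + β) * ((x z - x y) * r z y) * S₂))
          ≈⟨ +-congˡ (*-congˡ (+-congˡ (trans (+-congˡ (*-congʳ (trans (*-congˡ (x-r (z∉ zero))) (*-identityʳ _)))) combine))) ⟩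
        - β * power α β k + (α + β) * x z * (F y * r z y + ∑′.Sum.sum (λ a → residue f (suc a) * r z (f (suc a)))) ∎
        where
        y : Fin N
        y = f zero

        y∉ : ∀ a → y ≢ f (suc a)
        y∉ a eq = case inj eq of λ ()

        F : Fin N → Carrier
        F z = ∏′.Sum.sum λ a → g z (f (suc a))

        Fx : ∀ z → (∀ a → z ≢ f (suc a)) →
             F z ≈ power α β k + (α + β) * x z * ∑′.Sum.sum (λ a → residue (f ∘ suc) a * r z (f (suc a)))
        Fx = partial-fractions (f ∘ suc) (λ eq → Fin.suc-injective (inj eq))

        S₁ S₂ S₃ : Carrier
        S₁ = ∑′.Sum.sum λ a → residue (f ∘ suc) a * r z (f (suc a))
        S₂ = ∑′.Sum.sum λ a → residue (f ∘ suc) a * (x (f (suc a)) * r z (f (suc a)) * r (f (suc a)) y)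
        S₃ = ∑′.Sum.sum λ a → residue (f ∘ suc) a * r y (f (suc a))

        zS₁-yS₃ : x z * S₁ - x y * S₃ ≈ (x z - x y) * S₂
        zS₁-yS₃ = begin
          x z * S₁ - x y * S₃
            ≈⟨ solve 4 (λ z S y T → z :* S :- y :* T := z :* S :+ :- y :* T) (x z) S₁ (x y) S₃ ⟩
          x z * S₁ + - x y * S₃
            ≈⟨ +-cong (∑′-* {k} (x z) _) (∑′-* {k} (- x y) _) ⟩
          ∑′.Sum.sum {k} (λ a → x z * (residue (f ∘ suc) a * r z (f (suc a))))
            + ∑′.Sum.sum {k} (λ a → - x y * (residue (f ∘ suc) a * r y (f (suc a))))
            ≈⟨ ∑′.Sum.∑-distrib-+ {k} _ _ ⟨
          ∑′.Sum.sum {k} (λ a → x z * (residue (f ∘ suc) a * r z (f (suc a))) + - x y * (residue (f ∘ suc) a * r y (f (suc a))))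
            ≈⟨ ∑′.Sum.sum-cong-≋ {k} term ⟩
          ∑′.Sum.sum {k} (λ a → (x z - x y) * (residue (f ∘ suc) a * (x (f (suc a)) * r z (f (suc a)) * r (f (suc a)) y)))
            ≈⟨ ∑′-* {k} (x z - x y) _ ⟨
          (x z - x y) * S₂ ∎
          where
          -- z/(z − x) − y/(y − x) = (z − y) x/((z − x)(x − y))
          term : ∀ a → x z * (residue (f ∘ suc) a * r z (f (suc a))) + - x y * (residue (f ∘ suc) a * r y (f (suc a)))
                     ≈ (x z - x y) * (residue (f ∘ suc) a * (x (f (suc a)) * r z (f (suc a)) * r (f (suc a)) y))
          term a = begin
            x z * (p * r z b) + - x y * (p * r y b)
              ≈⟨ +-cong (*-congˡ (*-congˡ (trans (sym (*-identityʳ _)) (*-congˡ (sym (x-r b≢y))))))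
                        (*-congˡ (*-congˡ (trans (sym (*-identityʳ _)) (*-cong r-neg (sym (x-r (z∉ (suc a)))))))) ⟩
            x z * (p * (r z b * ((x b - x y) * r b y))) + - x y * (p * (- r b y * ((x z - x b) * r z b)))
              ≈⟨ solve 6 (λ z y b p r q → z :* (p :* (r :* ((b :- y) :* q))) :+ :- y :* (p :* (:- q :* ((z :- b) :* r)))
                   := (z :- y) :* (p :* (b :* r :* q))) (x z) (x y) (x b) p (r z b) (r b y) ⟩
            (x z - x y) * (p * (x b * r z b * r b y)) ∎
            where
            b : Fin N
            b = f (suc a)

            b≢y : b ≢ y
            b≢y = y∉ a ∘ ≡.sym

            p : Carrier
            p = residue (f ∘ suc) a

            r-neg : r y b ≈ - r b y
            r-neg = inverse-unique (x-r (y∉ a))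
              (trans (solve 3 (λ b y q → (y :- b) :* :- q := (b :- y) :* q) (x b) (x y) (r b y)) (x-r b≢y))

        F-diff : F z ≈ F y + (α + β) * (x z - x y) * S₂
        F-diff = begin
          F z
            ≈⟨ Fx z (z∉ ∘ suc) ⟩
          power α β k + (α + β) * x z * S₁
            ≈⟨ solve 6 (λ p c z S y T → p :+ c :* z :* S := (p :+ c :* y :* T) :+ c :* (z :* S :- y :* T)) (power α β k) (α + β) (x z) S₁ (x y) S₃ ⟩
          (power α β k + (α + β) * x y * S₃) + (α + β) * (x z * S₁ - x y * S₃)
            ≈⟨ +-cong (sym (Fx y y∉)) (trans (*-congˡ zS₁-yS₃) (sym (*-assoc _ _ _))) ⟩
          F y + (α + β) * (x z - x y) * S₂ ∎

        combine : - β * S₁ + (α + β) * S₂ ≈ ∑′.Sum.sum (λ a → residue f (suc a) * r z (f (suc a)))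
        combine = begin
          - β * S₁ + (α + β) * S₂
            ≈⟨ +-cong (∑′-* {k} (- β) _) (∑′-* {k} (α + β) _) ⟩
          ∑′.Sum.sum {k} (λ a → - β * (residue (f ∘ suc) a * r z (f (suc a))))
            + ∑′.Sum.sum {k} (λ a → (α + β) * (residue (f ∘ suc) a * (x (f (suc a)) * r z (f (suc a)) * r (f (suc a)) y)))
            ≈⟨ ∑′.Sum.∑-distrib-+ {k} _ _ ⟨
          ∑′.Sum.sum {k} (λ a → - β * (residue (f ∘ suc) a * r z (f (suc a)))
            + (α + β) * (residue (f ∘ suc) a * (x (f (suc a)) * r z (f (suc a)) * r (f (suc a)) y)))
            ≈⟨ ∑′.Sum.sum-cong-≋ {k} term ⟩
          ∑′.Sum.sum {k} (λ a → residue f (suc a) * r z (f (suc a))) ∎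
          where
          term : ∀ a → - β * (residue (f ∘ suc) a * r z (f (suc a)))
                         + (α + β) * (residue (f ∘ suc) a * (x (f (suc a)) * r z (f (suc a)) * r (f (suc a)) y))
                     ≈ residue f (suc a) * r z (f (suc a))
          term a = begin
            - β * (p * r z b) + (α + β) * (p * (x b * r z b * r b y))
              ≈⟨ +-congʳ (*-congˡ (*-congˡ (trans (sym (*-identityʳ _)) (*-congˡ (sym (x-r (y∉ a ∘ ≡.sym))))))) ⟩
            - β * (p * (r z b * ((x b - x y) * r b y))) + (α + β) * (p * (x b * r z b * r b y))
              ≈⟨ solve 7 (λ α β b y p r q → :- β :* (p :* (r :* ((b :- y) :* q))) :+ (α :+ β) :* (p :* (b :* r :* q))
                   := ((α :* b :+ β :* y) :* q :* p) :* r) α β (x b) (x y) p (r z b) (r b y) ⟩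
            g b y * p * r z b
              ≈⟨ *-congʳ (residue-suc f a) ⟨
            residue f (suc a) * r z b ∎
            where
            b : Fin N
            b = f (suc a)

            p : Carrier
            p = residue (f ∘ suc) a

      ∑-residue : ∀ {k} (f : Fin k → Fin N) → Inj f → ∑′.Sum.sum (residue f) ≈ geometric α β k
      ∑-residue {zero}  f inj = refl
      ∑-residue {suc k} f inj = begin
        F + ∑′.Sum.sum {k} (λ a → residue f (suc a))
          ≈⟨ +-cong (partial-fractions (f ∘ suc) (λ eq → Fin.suc-injective (inj eq)) y y∉) (∑′.Sum.sum-cong-≋ {k} term) ⟩
        (power α β k + (α + β) * x y * S) + ∑′.Sum.sum {k} (λ a → α * residue (f ∘ suc) a + - ((α + β) * x y) * (residue (f ∘ suc) a * r y (f (suc a))))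
          ≈⟨ +-congˡ (trans (∑′.Sum.∑-distrib-+ {k} _ _) (+-cong (sym (∑′-* {k} α _)) (sym (∑′-* {k} (- ((α + β) * x y)) _)))) ⟩
        (power α β k + (α + β) * x y * S) + (α * ∑′.Sum.sum (residue (f ∘ suc)) + - ((α + β) * x y) * S)
          ≈⟨ solve 4 (λ p c S a → (p :+ c :* S) :+ (a :+ :- c :* S) := a :+ p) (power α β k) ((α + β) * x y) S _ ⟩
        α * ∑′.Sum.sum (residue (f ∘ suc)) + power α β k
          ≈⟨ +-congʳ (*-congˡ (∑-residue (f ∘ suc) λ eq → Fin.suc-injective (inj eq))) ⟩
        α * geometric α β k + power α β k ∎
        where
        y : Fin N
        y = f zero

        y∉ : ∀ a → y ≢ f (suc a)
        y∉ a eq = case inj eq of λ ()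

        F S : Carrier
        F = ∏′.Sum.sum λ a → g y (f (suc a))
        S = ∑′.Sum.sum λ a → residue (f ∘ suc) a * r y (f (suc a))

        term : ∀ a → residue f (suc a) ≈ α * residue (f ∘ suc) a + - ((α + β) * x y) * (residue (f ∘ suc) a * r y (f (suc a)))
        term a = begin
          residue f (suc a)
            ≈⟨ residue-suc f a ⟩
          (α * x b + β * x y) * r b y * p
            ≈⟨ *-congʳ (*-congˡ (inverse-unique (x-r (y∉ a ∘ ≡.sym))
                 (trans (solve 3 (λ b y q → (b :- y) :* :- q := (y :- b) :* q) (x b) (x y) (r y b)) (x-r (y∉ a))))) ⟩
          (α * x b + β * x y) * - r y b * p
            ≈⟨ solve 6 (λ α β b y q p → (α :* b :+ β :* y) :* :- q :* p
                 := α :* p :* ((y :- b) :* q) :+ :- ((α :+ β) :* y) :* (p :* q)) α β (x b) (x y) (r y b) p ⟩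
          α * p * ((x y - x b) * r y b) + - ((α + β) * x y) * (p * r y b)
            ≈⟨ +-congʳ (trans (*-congˡ (x-r (y∉ a))) (*-identityʳ _)) ⟩
          α * p + - ((α + β) * x y) * (p * r y b) ∎
          where
          b : Fin N
          b = f (suc a)

          p : Carrier
          p = residue (f ∘ suc) a

      symmetrized : ∀ {k} (f : Fin k → Fin N) → Inj f →
        ∑ A (Sₙ k) (λ w → ∏ A (pairs k) λ (pair i j _) → g (f (w ⟨$⟩ʳ i)) (f (w ⟨$⟩ʳ j))) ≈ geometric! α β k
      symmetrized {zero}  f inj = +-identityʳ 1#
      symmetrized {suc k} f inj = begin
        ∑ A (Sₙ (suc k)) (λ w → ∏ A (pairs (suc k)) λ (pair i j _) → g (f (w ⟨$⟩ʳ i)) (f (w ⟨$⟩ʳ j)))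
          ≈⟨ ∑′.fold-concatMap (λ a → List.map (Perm.insert zero a) (Sₙ k)) (allFin (suc k)) _ ⟩
        ∑ A (allFin (suc k)) (λ a → ∑ A (List.map (Perm.insert zero a) (Sₙ k))
          λ w → ∏ A (pairs (suc k)) λ (pair i j _) → g (f (w ⟨$⟩ʳ i)) (f (w ⟨$⟩ʳ j)))
          ≈⟨ ∑′.fold-cong (allFin (suc k)) (λ a → trans (reflexive (∑′.fold-map (Perm.insert zero a) (Sₙ k) _))
               (∑′.fold-cong (Sₙ k) (split a))) ⟩
        ∑ A (allFin (suc k)) (λ a → ∑ A (Sₙ k)
          λ w → residue f a * ∏ A (pairs k) λ (pair i j _) → g (f (punchIn a (w ⟨$⟩ʳ i))) (f (punchIn a (w ⟨$⟩ʳ j))))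
          ≈⟨ ∑′.fold-cong (allFin (suc k)) (λ a → trans (sym (∑-distribˡ (Sₙ k) (residue f a) _))
               (trans (*-congˡ (symmetrized (f ∘ punchIn a) λ eq → Fin.punchIn-injective a _ _ (inj eq))) (*-comm _ _))) ⟩
        ∑ A (allFin (suc k)) (λ a → geometric! α β k * residue f a)
          ≈⟨ ∑-distribˡ (allFin (suc k)) (geometric! α β k) (residue f) ⟨
        geometric! α β k * ∑ A (allFin (suc k)) (residue f)
          ≈⟨ *-congˡ (trans (reflexive (∑′.fold-tabulate {k = suc k} id (residue f))) (∑-residue f inj)) ⟩
        geometric! α β k * geometric α β (suc k)
          ≈⟨ *-comm _ _ ⟩
        geometric α β (suc k) * geometric! α β k ∎
        where
        split : ∀ a w → ∏ A (pairs (suc k)) (λ (pair i j _) → g (f (Perm.insert zero a w ⟨$⟩ʳ i)) (f (Perm.insert zero a w ⟨$⟩ʳ j)))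
                      ≈ residue f a * ∏ A (pairs k) λ (pair i j _) → g (f (punchIn a (w ⟨$⟩ʳ i))) (f (punchIn a (w ⟨$⟩ʳ j)))
        split a w = trans (FoldPairsSuc.fold-pairs-suc *-commutativeMonoid λ i j → g (f (Perm.insert zero a w ⟨$⟩ʳ i)) (f (Perm.insert zero a w ⟨$⟩ʳ j)))
          (*-congʳ (sym (∏′.Sum.sum-permute {k} (λ b → g (f a) (f (punchIn a b))) w)))

    symmetrized-product : ∑ A (Sₙ N) (λ w → ∏ A (pairs N) λ (pair i j _) → g (w ⟨$⟩ʳ i) (w ⟨$⟩ʳ j)) ≈ geometric! α β N
    symmetrized-product = symmetrized id id

-- Sums over an orbit of a family satisfying (E2)

module OrbitSum {c ℓ} {A : CommutativeRing c ℓ} {m : ℕ} (act : Action A m) where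
  open CommutativeRing A hiding (zero)
  open Action act
  open Hecke act
  open RingLemmas A
  open IntegerSolver A
  open Relation.Binary.Reasoning.Setoid setoid
  private
    module ∑′ = Fold +-commutativeMonoid

    n = suc m

  Descent Ascent : Fin m → Vec ℤ n → Set
  Descent k μ = lookup μ (suc k) ℤ.< lookup μ (inject₁ k)
  Ascent  k μ = lookup μ (inject₁ k) ℤ.< lookup μ (suc k)

  descent-adj : ∀ k μ → Ascent k μ → Descent k (adj k • μ)
  descent-adj k μ = ≡.subst₂ ℤ._<_ (≡.sym (lookup-adj-hi k μ)) (≡.sym (lookup-adj-lo k μ))

  ascent-adj : ∀ k μ → Descent k μ → Ascent k (adj k • μ)
  ascent-adj k μ = ≡.subst₂ ℤ._<_ (≡.sym (lookup-adj-lo k μ)) (≡.sym (lookup-adj-hi k μ))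

  record Family : Set (c ⊔ ℓ) where
    field
      E       : Vec ℤ n → Carrier
      β       : Fin m → Vec ℤ n → Carrier
      β-inv   : ∀ k μ → Invariant (β k μ)
      E-step  : ∀ k μ → Descent k μ → E (adj k • μ) ≈ step k (β k μ) (E μ)
      E-equal : ∀ k μ → lookup μ (inject₁ k) ≡ lookup μ (suc k) → adj k ▹ E μ ≈ E μ

  record Orbit (Ω : List (Vec ℤ n)) : Set where
    field
      unique : Unique Ω
      closed : ∀ k {μ} → μ ∈ Ω → adj k • μ ∈ Ω

  module _ {Ω : List (Vec ℤ n)} (orb : Orbit Ω) where
    open Orbit orb

    ∑-adj-cancel : ∀ k (D : Vec ℤ n → Carrier) →
      (∀ μ → μ ∈ Ω → lookup μ (inject₁ k) ≡ lookup μ (suc k) → D μ ≈ 0#) →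
      (∀ μ → μ ∈ Ω → Descent k μ → D μ + D (adj k • μ) ≈ 0#) → ∑ A Ω D ≈ 0#
    ∑-adj-cancel k D D-equal D-descent = begin
      ∑ A Ω D
        ≈⟨ ∑′.fold-cong-∈ Ω (λ μ μ∈ → split μ μ∈ (ℤ.<-cmp (lookup μ (suc k)) (lookup μ (inject₁ k)))) ⟩
      ∑ A Ω (λ μ → ∑′.pick (desc? μ) (D μ) + ∑′.pick (asc? μ) (D μ))
        ≈⟨ ∑′.fold-∙ Ω (λ μ → ∑′.pick (desc? μ) (D μ)) (λ μ → ∑′.pick (asc? μ) (D μ)) ⟩
      ∑ A Ω (λ μ → ∑′.pick (desc? μ) (D μ)) + ∑ A Ω (λ μ → ∑′.pick (asc? μ) (D μ))
        ≈⟨ +-congˡ (∑′.fold-bijection (λ μ μ′ → (adj k • μ) ≟ᵉ μ′)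
             (λ μ μ∈ → once-∈ unique (closed k μ∈))
             (λ μ μ∈ → once-resp (λ { _ ≡.refl → adj•adj• k μ }) (λ { _ ≡.refl → adj•adj• k _ }) (once-∈ unique (closed k μ∈)))
             reindex) ⟩
      ∑ A Ω (λ μ → ∑′.pick (desc? μ) (D μ)) + ∑ A Ω (λ μ → ∑′.pick (desc? μ) (D (adj k • μ)))
        ≈⟨ ∑′.fold-∙ Ω (λ μ → ∑′.pick (desc? μ) (D μ)) (λ μ → ∑′.pick (desc? μ) (D (adj k • μ))) ⟨
      ∑ A Ω (λ μ → ∑′.pick (desc? μ) (D μ) + ∑′.pick (desc? μ) (D (adj k • μ)))
        ≈⟨ ∑′.fold-cong-∈ Ω (λ μ μ∈ → annihilate μ μ∈ (desc? μ)) ⟩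
      ∑ A Ω (λ μ → 0#)
        ≈⟨ ∑′.fold-ε Ω ⟩
      0# ∎
      where
      desc? : ∀ μ → Dec (Descent k μ)
      desc? μ = lookup μ (suc k) ℤ.<? lookup μ (inject₁ k)

      asc? : ∀ μ → Dec (Ascent k μ)
      asc? μ = lookup μ (inject₁ k) ℤ.<? lookup μ (suc k)

      split : ∀ μ → μ ∈ Ω → _ → D μ ≈ ∑′.pick (desc? μ) (D μ) + ∑′.pick (asc? μ) (D μ)
      split μ μ∈ (tri< d _ ¬a) = sym (trans (+-cong (∑′.pick-yes (desc? μ) _ d) (∑′.pick-no (asc? μ) _ ¬a)) (+-identityʳ _))
      split μ μ∈ (tri> ¬d _ a) = sym (trans (+-cong (∑′.pick-no (desc? μ) _ ¬d) (∑′.pick-yes (asc? μ) _ a)) (+-identityˡ _))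
      split μ μ∈ (tri≈ ¬d eq ¬a) = trans (D-equal μ μ∈ (≡.sym eq))
        (sym (trans (+-cong (∑′.pick-no (desc? μ) _ ¬d) (∑′.pick-no (asc? μ) _ ¬a)) (+-identityˡ _)))

      reindex : ∀ μ μ′ → μ ∈ Ω → adj k • μ ≡ μ′ → ∑′.pick (asc? μ) (D μ) ≈ ∑′.pick (desc? μ′) (D (adj k • μ′))
      reindex μ _ _ ≡.refl = ∑′.pick-cong (asc? μ) (desc? (adj k • μ)) (descent-adj k μ)
        (λ d → ≡.subst (Ascent k) (adj•adj• k μ) (ascent-adj k (adj k • μ) d)) (D μ) (D (adj k • adj k • μ))
        λ _ → reflexive (≡.cong D (≡.sym (adj•adj• k μ)))

      annihilate : ∀ μ → μ ∈ Ω → (d : Dec (Descent k μ)) → ∑′.pick d (D μ) + ∑′.pick d (D (adj k • μ)) ≈ 0#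
      annihilate μ μ∈ (yes d) = D-descent μ μ∈ d
      annihilate μ μ∈ (no _)  = +-identityˡ 0#

  module _ (fam : Family) where
    open Family fam

    -- θ is an eigenvalue (1 or −t) of the operators on the right-hand side of (E2).
    expansion-eigenvalue : ∀ (L : Carrier → Carrier) (L-cong : ∀ {f g} → f ≈ g → L f ≈ L g) θ →
      (∀ k {b} f → Invariant b → L (step k b f) ≈ (θ + b) * L f) →
      ∀ (d : Vec ℤ n → Carrier) lam → d lam ≈ 1# →
      (∀ k μ → Descent k μ → d (adj k • μ) ≈ (θ + β k μ) * d μ) →
      (∀ k μ → Descent k μ → Regular A (θ + β k μ)) →
      ∀ w → L (E (w • lam)) ≈ d (w • lam) * L (E lam)
    expansion-eigenvalue L L-cong θ L-step d lam d-lam d-step reg = perm-induction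
      (λ w → L (E (w • lam)) ≈ d (w • lam) * L (E lam))
      (λ {w} {u} w≈u → ≡.subst (λ μ → L (E μ) ≈ d μ * L (E lam)) (•-cong {w = w} {u} w≈u lam))
      (λ k {w} eq → ≡.subst (λ μ → L (E μ) ≈ d μ * L (E lam)) (≡.sym (•-· (adj k) w lam)) (next k (w • lam) eq))
      (≡.subst (λ μ → L (E μ) ≈ d μ * L (E lam)) (≡.sym (•-id lam)) (sym (trans (*-congʳ d-lam) (*-identityˡ _))))
      where
      down : ∀ k μ → Descent k μ → L (E (adj k • μ)) ≈ (θ + β k μ) * L (E μ)
      down k μ desc = trans (L-cong (E-step k μ desc)) (L-step k (E μ) (β-inv k μ))

      next : ∀ k μ → L (E μ) ≈ d μ * L (E lam) → L (E (adj k • μ)) ≈ d (adj k • μ) * L (E lam)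
      next k μ eq with ℤ.<-cmp (lookup μ (suc k)) (lookup μ (inject₁ k))
      ... | tri≈ _ equal _ rewrite adj•-equal k μ (≡.sym equal) = eq
      ... | tri< desc _ _ = begin
        L (E (adj k • μ))                ≈⟨ down k μ desc ⟩
        (θ + β k μ) * L (E μ)            ≈⟨ *-congˡ eq ⟩
        (θ + β k μ) * (d μ * L (E lam))  ≈⟨ *-assoc _ _ _ ⟨
        (θ + β k μ) * d μ * L (E lam)    ≈⟨ *-congʳ (d-step k μ desc) ⟨
        d (adj k • μ) * L (E lam)        ∎
      ... | tri> _ _ asc = x-y≈0⇒x≈y (Regular.cancel (reg k μ′ desc) _ (begin
        σ * (L (E μ′) - d μ′ * L (E lam))
          ≈⟨ solve 4 (λ σ a d b → σ :* (a :- d :* b) := σ :* a :- σ :* d :* b) σ (L (E μ′)) (d μ′) (L (E lam)) ⟩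
        σ * L (E μ′) - σ * d μ′ * L (E lam)
          ≈⟨ +-cong (sym (down k μ′ desc)) (-‿cong (*-congʳ (sym (d-step k μ′ desc)))) ⟩
        L (E (adj k • μ′)) - d (adj k • μ′) * L (E lam)
          ≈⟨ reflexive (≡.cong (λ ν → L (E ν) - d ν * L (E lam)) (adj•adj• k μ)) ⟩
        L (E μ) - d μ * L (E lam)
          ≈⟨ +-congʳ eq ⟩
        d μ * L (E lam) - d μ * L (E lam)
          ≈⟨ -‿inverseʳ _ ⟩
        0# ∎))
        where
        μ′ : Vec ℤ n
        μ′ = adj k • μ

        desc : Descent k μ′
        desc = descent-adj k μ asc

        σ : Carrier
        σ = θ + β k μ′

    module _ {Ω : List (Vec ℤ n)} (orb : Orbit Ω) (cf : Vec ℤ n → Carrier) (cf-inv : ∀ μ → Invariant (cf μ)) where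
      open Orbit orb

      combination : Carrier
      combination = ∑ A Ω λ μ → cf μ * E μ

      private
        F : Vec ℤ n → Carrier
        F μ = cf μ * E μ

      ∑-expansion : ∀ (L : Carrier → Carrier) → (∀ {f g} → f ≈ g → L f ≈ L g) → L 0# ≈ 0# →
        (∀ f g → L (f + g) ≈ L f + L g) → (∀ {b} f → Invariant b → L (b * f) ≈ b * L f) →
        ∀ {d : Vec ℤ n → Carrier} {lam} → (∀ μ → μ ∈ Ω → L (E μ) ≈ d μ * L (E lam)) →
        L combination ≈ ∑ A Ω (λ μ → cf μ * d μ) * L (E lam)
      ∑-expansion L L-cong L-0 L-+ L-* {d} {lam} L-E = begin
        L combination
          ≈⟨ homo Ω ⟩
        ∑ A Ω (λ μ → L (cf μ * E μ))
          ≈⟨ ∑′.fold-cong-∈ Ω (λ μ μ∈ → trans (L-* (E μ) (cf-inv μ)) (trans (*-congˡ (L-E μ μ∈))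
               (solve 3 (λ c d b → c :* (d :* b) := b :* (c :* d)) (cf μ) (d μ) (L (E lam))))) ⟩
        ∑ A Ω (λ μ → L (E lam) * (cf μ * d μ))
          ≈⟨ ∑-distribˡ Ω (L (E lam)) (λ μ → cf μ * d μ) ⟨
        L (E lam) * ∑ A Ω (λ μ → cf μ * d μ)
          ≈⟨ *-comm _ _ ⟩
        ∑ A Ω (λ μ → cf μ * d μ) * L (E lam) ∎
        where
        homo : ∀ Ω → L (∑ A Ω F) ≈ ∑ A Ω (λ μ → L (F μ))
        homo []      = L-0
        homo (μ ∷ Ω) = trans (L-+ _ _) (+-congˡ (homo Ω))

      combination-adj : ∀ k a b →
        (∀ μ → μ ∈ Ω → lookup μ (inject₁ k) ≡ lookup μ (suc k) → a * adj k ▹ F μ ≈ b * F μ) →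
        (∀ μ → μ ∈ Ω → Descent k μ → a * adj k ▹ (F μ + F (adj k • μ)) ≈ b * (F μ + F (adj k • μ))) →
        a * adj k ▹ combination ≈ b * combination
      combination-adj k a b F-equal F-descent = x-y≈0⇒x≈y (begin
        a * adj k ▹ combination - b * combination
          ≈⟨ +-cong (trans (*-congˡ (▹-∑ (adj k) Ω F)) (∑-distribˡ Ω a (λ μ → adj k ▹ F μ)))
                    (trans (-‿cong (∑-distribˡ Ω b F)) (∑-neg Ω (λ μ → b * F μ))) ⟩
        ∑ A Ω (λ μ → a * adj k ▹ F μ) + ∑ A Ω (λ μ → - (b * F μ))
          ≈⟨ ∑′.fold-∙ Ω _ _ ⟨
        ∑ A Ω (λ μ → a * adj k ▹ F μ - b * F μ)
          ≈⟨ ∑-adj-cancel orb k _ (λ μ μ∈ eq → trans (+-congʳ (F-equal μ μ∈ eq)) (-‿inverseʳ _)) (λ μ μ∈ desc → begin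
               (a * adj k ▹ F μ - b * F μ) + (a * adj k ▹ F (adj k • μ) - b * F (adj k • μ))
                 ≈⟨ solve 6 (λ a b f g f′ g′ → (a :* f′ :- b :* f) :+ (a :* g′ :- b :* g) := a :* (f′ :+ g′) :- b :* (f :+ g)) a b (F μ) (F (adj k • μ)) (adj k ▹ F μ) (adj k ▹ F (adj k • μ)) ⟩
               a * (adj k ▹ F μ + adj k ▹ F (adj k • μ)) - b * (F μ + F (adj k • μ))
                 ≈⟨ +-congʳ (trans (*-congˡ (sym (▹-+ (adj k) _ _))) (F-descent μ μ∈ desc)) ⟩
               b * (F μ + F (adj k • μ)) - b * (F μ + F (adj k • μ))
                 ≈⟨ -‿inverseʳ _ ⟩
               0# ∎) ⟩
        0# ∎)

      combination-invariant : (∀ k μ → Descent k μ → cf μ ≈ (t - β k μ) * cf (adj k • μ)) → Invariant combination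
      combination-invariant cf-step = adj-invariant⇒invariant λ k →
        trans (sym (*-identityˡ _)) (trans (combination-adj k 1# 1#
          (λ μ _ eq → *-congˡ (trans (▹-* (adj k) _ _) (*-cong (cf-inv μ (adj k)) (E-equal k μ eq))))
          (λ μ _ desc → *-congˡ (descent k μ desc)))
          (*-identityˡ _))
        where
        descent : ∀ k μ → Descent k μ → adj k ▹ (F μ + F (adj k • μ)) ≈ F μ + F (adj k • μ)
        descent k μ desc = begin
          adj k ▹ (F μ + F (adj k • μ))  ≈⟨ ▹-cong (adj k) pair-sum ⟩
          adj k ▹ (c′ * Y)               ≈⟨ trans (▹-* (adj k) _ _) (*-cong (cf-inv (adj k • μ) (adj k)) (half-invariant k (E μ))) ⟩
          c′ * Y                         ≈⟨ pair-sum ⟨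
          F μ + F (adj k • μ)            ∎
          where
          c′ Y : Carrier
          c′ = cf (adj k • μ)
          Y  = half k (E μ) + adj k ▹ half k (E μ)

          pair-sum : F μ + F (adj k • μ) ≈ c′ * Y
          pair-sum = begin
            cf μ * E μ + c′ * E (adj k • μ)
              ≈⟨ +-cong (*-congʳ (cf-step k μ desc)) (*-congˡ (E-step k μ desc)) ⟩
            (t - β k μ) * c′ * E μ + c′ * step k (β k μ) (E μ)
              ≈⟨ solve 4 (λ b c e f → b :* c :* e :+ c :* f := c :* (f :+ b :* e)) (t - β k μ) c′ (E μ) _ ⟩
            c′ * (step k (β k μ) (E μ) + (t - β k μ) * E μ)
              ≈⟨ *-congˡ (step-half k (β k μ) (E μ)) ⟩
            c′ * Y ∎

      combination-anti : (∀ k μ → Descent k μ → cf μ ≈ - (1# + β k μ) * cf (adj k • μ)) →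
        (∀ k μ → μ ∈ Ω → lookup μ (inject₁ k) ≢ lookup μ (suc k)) →
        ∃[ g ] (Invariant g × combination ≈ N * g)
      combination-anti cf-step no-equal = combination * N⁻¹ , adj-invariant⇒invariant inv , (begin
        combination               ≈⟨ *-identityʳ _ ⟨
        combination * 1#          ≈⟨ *-congˡ N-inverse ⟨
        combination * (N * N⁻¹)   ≈⟨ solve 3 (λ a b d → a :* (b :* d) := b :* (a :* d)) combination N N⁻¹ ⟩
        N * (combination * N⁻¹)   ∎)
        where
        N⁻¹ : Carrier
        N⁻¹ = ∏ₚ trecip

        N-inverse : N * N⁻¹ ≈ 1#
        N-inverse = trans (sym (∏-* {R = A} (pairs n) _ _))
          (∏-1 {R = A} (pairs n) λ p → x-trecip (Pair.fst≢snd p))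

        exchange : ∀ k → (xₕ k - t * xₗ k) * adj k ▹ combination ≈ (xₗ k - t * xₕ k) * combination
        exchange k = combination-adj k _ _ (λ μ μ∈ eq → contradiction eq (no-equal k μ μ∈)) λ μ _ desc → descent μ desc
          where
          descent : ∀ μ → Descent k μ →
                    (xₕ k - t * xₗ k) * adj k ▹ (F μ + F (adj k • μ)) ≈ (xₗ k - t * xₕ k) * (F μ + F (adj k • μ))
          descent μ desc = begin
            (xₕ k - t * xₗ k) * adj k ▹ (F μ + F (adj k • μ))
              ≈⟨ *-congˡ (trans (▹-cong (adj k) pair-sum) (trans (▹-* (adj k) _ _) (*-cong (s-xₕ-txₗ k) s-Y))) ⟩
            (xₕ k - t * xₗ k) * ((xₗ k - t * xₕ k) * Y)
              ≈⟨ solve 3 (λ a b y → a :* (b :* y) := b :* (a :* y)) _ _ Y ⟩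
            (xₗ k - t * xₕ k) * ((xₕ k - t * xₗ k) * Y)
              ≈⟨ *-congˡ pair-sum ⟨
            (xₗ k - t * xₕ k) * (F μ + F (adj k • μ)) ∎
            where
            c′ Y : Carrier
            c′ = cf (adj k • μ)
            Y  = u k * (E μ - adj k ▹ E μ) * c′

            s-Y : adj k ▹ Y ≈ Y
            s-Y = begin
              adj k ▹ Y
                ≈⟨ trans (▹-* (adj k) _ _) (*-cong (trans (▹-* (adj k) _ _) (*-cong (s-u k)
                     (trans (▹-- (adj k) _ _) (+-congˡ (-‿cong (▹-adj-adj k (E μ))))))) (cf-inv (adj k • μ) (adj k))) ⟩
              - u k * (adj k ▹ E μ - E μ) * c′
                ≈⟨ solve 4 (λ u e e′ c → :- u :* (e′ :- e) :* c := u :* (e :- e′) :* c) (u k) (E μ) (adj k ▹ E μ) c′ ⟩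
              Y ∎

            pair-sum : F μ + F (adj k • μ) ≈ (xₕ k - t * xₗ k) * Y
            pair-sum = begin
              cf μ * E μ + c′ * E (adj k • μ)
                ≈⟨ +-cong (*-congʳ (cf-step k μ desc)) (*-congˡ (trans (E-step k μ desc) (step-diff k (β k μ) (E μ)))) ⟩
              - (1# + β k μ) * c′ * E μ + c′ * ((1# + β k μ) * E μ + (t * xₗ k - xₕ k) * u k * (adj k ▹ E μ - E μ))
                ≈⟨ solve 8 (λ b c e e′ u t l h → :- b :* c :* e :+ c :* (b :* e :+ (t :* l :- h) :* u :* (e′ :- e))
                     := (h :- t :* l) :* (u :* (e :- e′) :* c)) (1# + β k μ) c′ (E μ) (adj k ▹ E μ) (u k) t (xₗ k) (xₕ k) ⟩
              (xₕ k - t * xₗ k) * Y ∎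

        inv : ∀ k → adj k ▹ (combination * N⁻¹) ≈ combination * N⁻¹
        inv k = begin
          adj k ▹ (R * N⁻¹)
            ≈⟨ ▹-* (adj k) _ _ ⟩
          sR * sN⁻¹
            ≈⟨ trans (sym (*-identityʳ _)) (*-congˡ (sym N-inverse)) ⟩
          sR * sN⁻¹ * (N * N⁻¹)
            ≈⟨ trans (sym (*-identityʳ _)) (*-congˡ (sym (x-trecip (inject₁≢suc k ∘ ≡.sym)))) ⟩
          sR * sN⁻¹ * (N * N⁻¹) * (b * τ)
            ≈⟨ solve 6 (λ r q N M b τ → r :* q :* (N :* M) :* (b :* τ) := r :* q :* M :* τ :* (b :* N)) sR sN⁻¹ N N⁻¹ b τ ⟩
          sR * sN⁻¹ * N⁻¹ * τ * (b * N)
            ≈⟨ *-congˡ (s-N k) ⟨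
          sR * sN⁻¹ * N⁻¹ * τ * (a * sN)
            ≈⟨ solve 6 (λ r q M τ a sN → r :* q :* M :* τ :* (a :* sN) := a :* r :* τ :* M :* (sN :* q)) sR sN⁻¹ N⁻¹ τ a sN ⟩
          a * sR * τ * N⁻¹ * (sN * sN⁻¹)
            ≈⟨ *-cong (*-congʳ (*-congʳ (exchange k))) (trans (sym (▹-* (adj k) N N⁻¹)) (trans (▹-cong (adj k) N-inverse) (▹-1 (adj k)))) ⟩
          b * R * τ * N⁻¹ * 1#
            ≈⟨ solve 4 (λ b R τ M → b :* R :* τ :* M :* con 1ℤ := R :* M :* (b :* τ)) b R τ N⁻¹ ⟩
          R * N⁻¹ * (b * τ)
            ≈⟨ trans (*-congˡ (x-trecip (inject₁≢suc k ∘ ≡.sym))) (*-identityʳ _) ⟩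
          R * N⁻¹ ∎
          where
          R sR sN sN⁻¹ a b τ : Carrier
          R    = combination
          sR   = adj k ▹ R
          sN   = adj k ▹ N
          sN⁻¹ = adj k ▹ N⁻¹
          a    = xₕ k - t * xₗ k
          b    = xₗ k - t * xₕ k
          τ    = trecip (suc k) (inject₁ k)

  symmetrize-invariant : ∀ {f} → Invariant f → symmetrize f ≈ f * symmetrize 1#
  symmetrize-invariant {f} f-inv = trans (symmetrize-cong (sym (*-identityʳ f))) (symmetrize-scalar 1# f-inv)

  antisymmetrize-invariant : ∀ {f g} → Invariant g → f ≈ N * g → N * antisymmetrize f ≈ f * antisymmetrize N
  antisymmetrize-invariant {f} {g} g-inv f≈Ng = begin
    N * antisymmetrize f          ≈⟨ *-congˡ (trans (antisymmetrize-cong (trans f≈Ng (*-comm N g))) (antisymmetrize-scalar N g-inv)) ⟩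
    N * (g * antisymmetrize N)    ≈⟨ *-assoc _ _ _ ⟨
    N * g * antisymmetrize N      ≈⟨ *-congʳ f≈Ng ⟨
    f * antisymmetrize N          ∎

-- Ranks, lengths and minimal coset representatives

module ∑ℕ = Fold ℕ.+-0-commutativeMonoid
module ∑ℕᵖ = FoldPairs ℕ.+-0-commutativeMonoid

once-resp-∈ : ∀ {a p q} {A : Set a} {P : Pred A p} {Q : Pred A q} {xs} →
  (∀ x → P x → Q x) → (∀ x → x ∈ xs → Q x → P x) → Once P xs → Once Q xs
once-resp-∈ P⊆Q Q⊆P (here Px ¬P) = here (P⊆Q _ Px)
  (All.tabulate λ y∈ Qy → All.lookup ¬P y∈ (Q⊆P _ (there y∈) Qy))
once-resp-∈ P⊆Q Q⊆P (there ¬Px o) = there (¬Px ∘ Q⊆P _ (here ≡.refl))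
  (once-resp-∈ P⊆Q (λ x x∈ → Q⊆P x (there x∈)) o)

length-filter : ∀ {a p} {A : Set a} {P : Pred A p} (P? : Decidable P) xs →
                length (List.filter P? xs) ≡ ∑ℕ.fold xs (λ x → ∑ℕ.pick (P? x) 1)
length-filter P? []       = ≡.refl
length-filter P? (x ∷ xs) with P? x
... | yes _ = ≡.cong suc (length-filter P? xs)
... | no  _ = length-filter P? xs

module _ {n : ℕ} where
  rank-cong : ∀ {μ ν : Vec ℤ n} (w : Permutation′ n) {i j} →
    (∀ s → Before μ s i → Before ν (w ⟨$⟩ʳ s) j) → (∀ s → Before ν (w ⟨$⟩ʳ s) j → Before μ s i) →
    rank ν j ≡ rank μ i
  rank-cong {μ} {ν} w {i} {j} to from = begin
    rank ν j
      ≡⟨ length-filter (λ s → before? ν s j) (allFin n) ⟩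
    ∑ℕ.fold (allFin n) (λ s → ∑ℕ.pick (before? ν s j) 1)
      ≡⟨ ∑ℕ.fold-permute w (λ s → ∑ℕ.pick (before? ν s j) 1) ⟨
    ∑ℕ.fold (allFin n) (λ s → ∑ℕ.pick (before? ν (w ⟨$⟩ʳ s) j) 1)
      ≡⟨ ∑ℕ.fold-cong (allFin n) (λ s → ∑ℕ.pick-cong (before? ν (w ⟨$⟩ʳ s) j) (before? μ s i) (from s) (to s) 1 1 λ _ → ≡.refl) ⟩
    ∑ℕ.fold (allFin n) (λ s → ∑ℕ.pick (before? μ s i) 1)
      ≡⟨ length-filter (λ s → before? μ s i) (allFin n) ⟨
    rank μ i ∎
    where open ≡.≡-Reasoning

  vᶻ-rank : ∀ μ r → vᶻ {n} μ r ≡ + rank μ r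
  vᶻ-rank μ r = ≡.cong +_ (Fin.toℕ-fromℕ< (rank<n μ r))

  BlockIncreasing : Vec ℤ n → Permutation′ n → Set
  BlockIncreasing μ z = ∀ {i j} → lookup μ i ≡ lookup μ j → i Fin.< j → z ⟨$⟩ʳ i Fin.< z ⟨$⟩ʳ j

  rank-• : ∀ μ z → BlockIncreasing μ z → ∀ i → rank (z • μ) (z ⟨$⟩ʳ i) ≡ rank μ i
  rank-• μ z inc i = rank-cong {μ} {z • μ} z to from
    where
    Z : Fin n → Fin n
    Z j = z ⟨$⟩ʳ j

    to< : ∀ s → lookup μ s ℤ.< lookup μ i → Before (z • μ) (Z s) (Z i)
    to< s μs<μi with ℕ.<-cmp (toℕ (Z s)) (toℕ (Z i)) | ≡.subst₂ ℤ._<_ (≡.sym (lookup-•ʳ z μ s)) (≡.sym (lookup-•ʳ z μ i)) μs<μi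
    ... | tri< zs<zi _ _ | lt = inj₁ (zs<zi , ℤ.<⇒≤ lt)
    ... | tri> _ _ zi<zs | lt = inj₂ (zi<zs , lt)
    ... | tri≈ _ zs≡zi _ | _ = contradiction μs<μi (ℤ.<-irrefl (≡.cong (lookup μ) (perm-injective z (Fin.toℕ-injective zs≡zi))))

    to : ∀ s → Before μ s i → Before (z • μ) (Z s) (Z i)
    to s (inj₂ (_ , μs<μi)) = to< s μs<μi
    to s (inj₁ (s<i , μs≤μi)) with lookup μ s ℤ.≟ lookup μ i
    ... | no μs≢μi  = to< s (ℤ.≤∧≢⇒< μs≤μi μs≢μi)
    ... | yes μs≡μi = inj₁ (inc μs≡μi s<i , ≡.subst₂ ℤ._≤_ (≡.sym (lookup-•ʳ z μ s)) (≡.sym (lookup-•ʳ z μ i)) μs≤μi)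

    from : ∀ s → Before (z • μ) (Z s) (Z i) → Before μ s i
    from s b with ℕ.<-cmp (toℕ s) (toℕ i)
    from s (inj₁ (zs<zi , le)) | tri< s<i _ _ = inj₁ (s<i , ≡.subst₂ ℤ._≤_ (lookup-•ʳ z μ s) (lookup-•ʳ z μ i) le)
    from s (inj₂ (zi<zs , lt)) | tri< s<i _ _ = inj₁ (s<i , ≡.subst₂ ℤ._≤_ (lookup-•ʳ z μ s) (lookup-•ʳ z μ i) (ℤ.<⇒≤ lt))
    from s b                   | tri≈ _ s≡i _ with Fin.toℕ-injective s≡i
    ... | ≡.refl = contradiction b (before-irrefl (z • μ))
    from s (inj₂ (zi<zs , lt)) | tri> _ _ i<s = inj₂ (i<s , ≡.subst₂ ℤ._<_ (lookup-•ʳ z μ s) (lookup-•ʳ z μ i) lt)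
    from s (inj₁ (zs<zi , le)) | tri> _ _ i<s with lookup μ s ℤ.≟ lookup μ i
    ... | no μs≢μi  = inj₂ (i<s , ℤ.≤∧≢⇒< (≡.subst₂ ℤ._≤_ (lookup-•ʳ z μ s) (lookup-•ʳ z μ i) le) μs≢μi)
    ... | yes μs≡μi = contradiction zs<zi (ℕ.<-asym (inc (≡.sym μs≡μi) i<s))

  v-• : ∀ μ z → BlockIncreasing μ z → ∀ i → v (z • μ) ⟨$⟩ʳ (z ⟨$⟩ʳ i) ≡ v μ ⟨$⟩ʳ i
  v-• μ z inc i = Fin.toℕ-injective (≡.trans (Fin.toℕ-fromℕ< (rank<n (z • μ) (z ⟨$⟩ʳ i)))
    (≡.trans (rank-• μ z inc i) (≡.sym (Fin.toℕ-fromℕ< (rank<n μ i)))))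

  blockIncreasing-unique : ∀ μ {z z′} → BlockIncreasing μ z → BlockIncreasing μ z′ → z • μ ≡ z′ • μ → z Perm.≈ z′
  blockIncreasing-unique μ {z} {z′} inc inc′ eq i = perm-injective (v (z • μ)) (≡.trans (v-• μ z inc i)
    (≡.trans (≡.sym (v-• μ z′ inc′ i)) (≡.cong (λ ν → v ν ⟨$⟩ʳ (z′ ⟨$⟩ʳ i)) (≡.sym eq))))

  inversion-v : ∀ (μ : Vec ℤ n) {i j} → i Fin.< j → (v μ ⟨$⟩ʳ j Fin.< v μ ⟨$⟩ʳ i → lookup μ j ℤ.< lookup μ i)
                                       × (lookup μ j ℤ.< lookup μ i → v μ ⟨$⟩ʳ j Fin.< v μ ⟨$⟩ʳ i)
  inversion-v μ {i} {j} i<j = to , from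
    where
    rank-v : ∀ r → toℕ (v μ ⟨$⟩ʳ r) ≡ rank μ r
    rank-v r = Fin.toℕ-fromℕ< (rank<n μ r)

    from : lookup μ j ℤ.< lookup μ i → v μ ⟨$⟩ʳ j Fin.< v μ ⟨$⟩ʳ i
    from lt = ≡.subst₂ ℕ._<_ (≡.sym (rank-v j)) (≡.sym (rank-v i)) (before⇒rank< μ (inj₂ (i<j , lt)))

    to : v μ ⟨$⟩ʳ j Fin.< v μ ⟨$⟩ʳ i → lookup μ j ℤ.< lookup μ i
    to vj<vi with lookup μ j ℤ.<? lookup μ i
    ... | yes lt = lt
    ... | no ¬lt = contradiction (≡.subst₂ ℕ._<_ (rank-v j) (rank-v i) vj<vi)
      (ℕ.<-asym (before⇒rank< μ (inj₁ (i<j , ℤ.≮⇒≥ ¬lt))))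

  vᶻ-map : ∀ (f : ℤ → ℤ) → (∀ {a b} → a ℤ.≤ b → f a ℤ.≤ f b) → (∀ {a b} → f a ℤ.≤ f b → a ℤ.≤ b) →
           ∀ μ r → vᶻ (Vec.map f μ) r ≡ vᶻ μ r
  vᶻ-map f mono cancel μ r = ≡.trans (vᶻ-rank (Vec.map f μ) r)
    (≡.trans (≡.cong +_ (rank-cong {μ} {Vec.map f μ} Perm.id to from)) (≡.sym (vᶻ-rank μ r)))
    where
    at : ∀ s → lookup (Vec.map f μ) s ≡ f (lookup μ s)
    at s = Vec.lookup-map s f μ

    to : ∀ s → Before μ s r → Before (Vec.map f μ) s r
    to s (inj₁ (s<r , le)) = inj₁ (s<r , ≡.subst₂ ℤ._≤_ (≡.sym (at s)) (≡.sym (at r)) (mono le))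
    to s (inj₂ (r<s , lt)) = inj₂ (r<s , ≡.subst₂ ℤ._<_ (≡.sym (at s)) (≡.sym (at r))
      (ℤ.≰⇒> (λ le → ℤ.<⇒≱ lt (cancel le))))

    from : ∀ s → Before (Vec.map f μ) s r → Before μ s r
    from s (inj₁ (s<r , le)) = inj₁ (s<r , cancel (≡.subst₂ ℤ._≤_ (at s) (at r) le))
    from s (inj₂ (r<s , lt)) = inj₂ (r<s , ℤ.≰⇒> λ le → ℤ.<⇒≱ (≡.subst₂ ℤ._<_ (at s) (at r) lt) (mono le))

  ℓ-sum : ∀ (w : Permutation′ n) → ℓ w ≡ ∑ℕ.fold (pairs n) λ (pair i j _) → ∑ℕ.pick ((w ⟨$⟩ʳ j) Fin.<? (w ⟨$⟩ʳ i)) 1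
  ℓ-sum w = length-filter _ (pairs n)

  ℓ-cong : ∀ {w u : Permutation′ n} → w Perm.≈ u → ℓ w ≡ ℓ u
  ℓ-cong {w} {u} w≈u = ≡.trans (ℓ-sum w) (≡.trans
    (∑ℕ.fold-cong (pairs n) λ (pair i j _) → ∑ℕ.pick-cong ((w ⟨$⟩ʳ j) Fin.<? (w ⟨$⟩ʳ i)) ((u ⟨$⟩ʳ j) Fin.<? (u ⟨$⟩ʳ i))
      (≡.subst₂ Fin._<_ (w≈u j) (w≈u i)) (≡.subst₂ Fin._<_ (≡.sym (w≈u j)) (≡.sym (w≈u i))) 1 1 λ _ → ≡.refl)
    (≡.sym (ℓ-sum u)))

  module _ (lam : Vec ℤ n) (dec : WeaklyDecreasing lam) where
    private
      gap : Vec ℤ n → Fin n → Fin n → ℕ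
      gap ν a b = ∑ℕ.pick ((a Fin.<? b) ×-dec (lookup ν a ℤ.<? lookup ν b)) 1

      ascents : Vec ℤ n → ℕ
      ascents ν = ∑ℕ.fold (pairs n) λ (pair a b _) → gap ν a b ℕ.+ gap ν b a

      inBlock : Permutation′ n → ℕ
      inBlock z = ∑ℕ.fold (pairs n) λ (pair i j _) →
        ∑ℕ.pick ((z ⟨$⟩ʳ j Fin.<? z ⟨$⟩ʳ i) ×-dec (lookup lam j ℤ.≟ lookup lam i)) 1

      ℓ-split : ∀ z → ℓ z ≡ ascents (z • lam) ℕ.+ inBlock z
      ℓ-split z = begin
        ℓ z
          ≡⟨ ℓ-sum z ⟩
        ∑ℕ.fold (pairs n) (λ (pair i j _) → ∑ℕ.pick ((z ⟨$⟩ʳ j) Fin.<? (z ⟨$⟩ʳ i)) 1)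
          ≡⟨ ∑ℕ.fold-cong (pairs n) (λ (pair i j i<j) → split i j i<j) ⟩
        ∑ℕ.fold (pairs n) (λ (pair i j _) → (gap ν (Z i) (Z j) ℕ.+ gap ν (Z j) (Z i))
          ℕ.+ ∑ℕ.pick ((Z j Fin.<? Z i) ×-dec (lookup lam j ℤ.≟ lookup lam i)) 1)
          ≡⟨ ∑ℕ.fold-∙ (pairs n) _ _ ⟩
        ∑ℕ.fold (pairs n) (λ (pair i j _) → gap ν (Z i) (Z j) ℕ.+ gap ν (Z j) (Z i)) ℕ.+ inBlock z
          ≡⟨ ≡.cong (ℕ._+ inBlock z) (∑ℕᵖ.fold-pairs-permute z (λ a b → gap ν a b ℕ.+ gap ν b a) λ a b → ℕ.+-comm (gap ν a b) _) ⟩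
        ascents ν ℕ.+ inBlock z ∎
        where
        open ≡.≡-Reasoning

        ν : Vec ℤ n
        ν = z • lam

        Z : Fin n → Fin n
        Z i = z ⟨$⟩ʳ i

        split : ∀ i j → i Fin.< j → ∑ℕ.pick (Z j Fin.<? Z i) 1
          ≡ (gap ν (Z i) (Z j) ℕ.+ gap ν (Z j) (Z i)) ℕ.+ ∑ℕ.pick ((Z j Fin.<? Z i) ×-dec (lookup lam j ℤ.≟ lookup lam i)) 1
        split i j i<j = ≡.sym (≡.trans
          (≡.cong (λ y → (y ℕ.+ gap ν (Z j) (Z i)) ℕ.+ ∑ℕ.pick ((Z j Fin.<? Z i) ×-dec (lookup lam j ℤ.≟ lookup lam i)) 1)
            (∑ℕ.pick-no ((Z i Fin.<? Z j) ×-dec (lookup ν (Z i) ℤ.<? lookup ν (Z j))) 1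
              λ (_ , lt) → ℤ.<⇒≱ (≡.subst₂ ℤ._<_ (lookup-•ʳ z lam i) (lookup-•ʳ z lam j) lt) (dec (ℕ.<⇒≤ i<j))))
          (by (Z j Fin.<? Z i) (lookup ν (Z j) ℤ.<? lookup ν (Z i)) (lookup lam j ℤ.≟ lookup lam i)))
          where
          by : (d : Dec (Z j Fin.< Z i)) (e : Dec (lookup ν (Z j) ℤ.< lookup ν (Z i))) (f : Dec (lookup lam j ≡ lookup lam i)) →
               ∑ℕ.pick (d ×-dec e) 1 ℕ.+ ∑ℕ.pick (d ×-dec f) 1 ≡ ∑ℕ.pick d 1
          by (no _)  e       f       = ≡.refl
          by (yes _) (yes _) (no _)  = ≡.refl
          by (yes _) (no _)  (yes _) = ≡.refl
          by (yes _) (yes l) (yes q) = contradiction q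
            (ℤ.<⇒≢ (≡.subst₂ ℤ._<_ (lookup-•ʳ z lam j) (lookup-•ʳ z lam i) l))
          by (yes _) (no ¬l) (no ¬q) = contradiction
            (≡.subst₂ ℤ._<_ (≡.sym (lookup-•ʳ z lam j)) (≡.sym (lookup-•ʳ z lam i)) (ℤ.≤∧≢⇒< (dec (ℕ.<⇒≤ i<j)) ¬q)) ¬l

      inBlock-0 : ∀ z → BlockIncreasing lam z → inBlock z ≡ 0
      inBlock-0 z inc = ≡.trans (∑ℕ.fold-cong (pairs n) λ (pair i j i<j) →
          ∑ℕ.pick-no ((z ⟨$⟩ʳ j Fin.<? z ⟨$⟩ʳ i) ×-dec (lookup lam j ℤ.≟ lookup lam i)) 1
            λ (lt , eq) → ℕ.<-asym lt (inc (≡.sym eq) i<j))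
        (∑ℕ.fold-ε (pairs n))

    blockIncreasing⇒minRep : ∀ z → BlockIncreasing lam z → IsMinRep lam z
    blockIncreasing⇒minRep z inc = All.universal (λ w stab → begin
      ℓ z                                            ≡⟨ ℓ-split z ⟩
      ascents (z • lam) ℕ.+ inBlock z                ≡⟨ ≡.cong (ascents (z • lam) ℕ.+_) (inBlock-0 z inc) ⟩
      ascents (z • lam) ℕ.+ 0                        ≤⟨ ℕ.+-monoʳ-≤ (ascents (z • lam)) ℕ.z≤n ⟩
      ascents (z • lam) ℕ.+ inBlock (z · w)          ≡⟨ ≡.cong (λ ν → ascents ν ℕ.+ inBlock (z · w))
                                                          (≡.trans (≡.cong (z •_) (≡.sym stab)) (≡.sym (•-· z w lam))) ⟩
      ascents ((z · w) • lam) ℕ.+ inBlock (z · w)    ≡⟨ ℓ-split (z · w) ⟨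
      ℓ (z · w)                                      ∎) (Sₙ n)
      where open ℕ.≤-Reasoning

module _ {m : ℕ} where
  private
    n = suc m

  ℓ-·adj : ∀ k (z : Permutation′ n) → z ⟨$⟩ʳ suc k Fin.< z ⟨$⟩ʳ inject₁ k → ℓ z ≡ suc (ℓ (z · adj k))
  ℓ-·adj k z inv = begin
    ℓ z
      ≡⟨ ≡.trans (ℓ-sum z) (∑ℕᵖ.fold-pairs-split k ψ) ⟩
    ψ (inject₁ k) (suc k) ℕ.+ ∑ℕᵖ.other-pairs k ψ
      ≡⟨ ≡.cong₂ ℕ._+_ (∑ℕ.pick-yes (z ⟨$⟩ʳ suc k Fin.<? z ⟨$⟩ʳ inject₁ k) 1 inv) (≡.sym (∑ℕᵖ.other-pairs-adj k ψ)) ⟩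
    suc (∑ℕᵖ.other-pairs k ψ′)
      ≡⟨ ≡.cong (λ y → suc (y ℕ.+ ∑ℕᵖ.other-pairs k ψ′)) (∑ℕ.pick-no (_ Fin.<? _) 1 ¬inv) ⟨
    suc (ψ′ (inject₁ k) (suc k) ℕ.+ ∑ℕᵖ.other-pairs k ψ′)
      ≡⟨ ≡.cong suc (≡.trans (ℓ-sum (z · adj k)) (∑ℕᵖ.fold-pairs-split k ψ′)) ⟨
    suc (ℓ (z · adj k)) ∎
    where
    open ≡.≡-Reasoning

    ψ ψ′ : Fin n → Fin n → ℕ
    ψ i j  = ∑ℕ.pick ((z ⟨$⟩ʳ j) Fin.<? (z ⟨$⟩ʳ i)) 1
    ψ′ i j = ψ (adj k ⟨$⟩ʳ i) (adj k ⟨$⟩ʳ j)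

    ¬inv : ¬ (z ⟨$⟩ʳ (adj k ⟨$⟩ʳ suc k) Fin.< z ⟨$⟩ʳ (adj k ⟨$⟩ʳ inject₁ k))
    ¬inv lt = ℕ.<-asym inv (≡.subst₂ (λ a b → z ⟨$⟩ʳ a Fin.< z ⟨$⟩ʳ b) (adj-hi k) (adj-lo k) lt)

  module _ (lam : Vec ℤ n) (dec : WeaklyDecreasing lam) where
    private
      AdjIncreasing : Permutation′ n → Set
      AdjIncreasing z = ∀ k → lookup lam (inject₁ k) ≡ lookup lam (suc k) → z ⟨$⟩ʳ inject₁ k Fin.< z ⟨$⟩ʳ suc k

      adjIncreasing⇒blockIncreasing : ∀ z → AdjIncreasing z → BlockIncreasing lam z
      adjIncreasing⇒blockIncreasing z inc {i} {j} eq i<j = go (toℕ j) j ≡.refl eq i<j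
        where
        go : ∀ d j → toℕ j ≡ d → lookup lam i ≡ lookup lam j → i Fin.< j → z ⟨$⟩ʳ i Fin.< z ⟨$⟩ʳ j
        go (suc d) (suc j) toℕj≡ eq i<j = by (ℕ.m<1+n⇒m<n∨m≡n i<j)
          where
          i≤lo : i Fin.≤ inject₁ j
          i≤lo = ≡.subst (toℕ i ℕ.≤_) (≡.sym (Fin.toℕ-inject₁ j)) (ℕ.s≤s⁻¹ i<j)

          lo≡hi : lookup lam (inject₁ j) ≡ lookup lam (suc j)
          lo≡hi = ℤ.≤-antisym (≡.subst (lookup lam (inject₁ j) ℤ.≤_) eq (dec i≤lo)) (dec (ℕ.<⇒≤ (lo<hi j)))

          by : toℕ i ℕ.< toℕ j ⊎ toℕ i ≡ toℕ j → z ⟨$⟩ʳ i Fin.< z ⟨$⟩ʳ suc j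
          by (inj₁ i<j) = ℕ.<-trans
            (go d (inject₁ j) (≡.trans (Fin.toℕ-inject₁ j) (ℕ.suc-injective toℕj≡)) (≡.trans eq (≡.sym lo≡hi))
              (≡.subst (toℕ i ℕ.<_) (≡.sym (Fin.toℕ-inject₁ j)) i<j))
            (inc j lo≡hi)
          by (inj₂ i≡j) = ≡.subst (λ a → z ⟨$⟩ʳ a Fin.< z ⟨$⟩ʳ suc j)
            (≡.sym (Fin.toℕ-injective (≡.trans i≡j (≡.sym (Fin.toℕ-inject₁ j))))) (inc j lo≡hi)

      search : ∀ z → (∃[ k ] (lookup lam (inject₁ k) ≡ lookup lam (suc k) × z ⟨$⟩ʳ suc k Fin.< z ⟨$⟩ʳ inject₁ k)) ⊎ BlockIncreasing lam z
      search z with Fin.any? (λ k → (lookup lam (inject₁ k) ℤ.≟ lookup lam (suc k)) ×-dec (z ⟨$⟩ʳ suc k Fin.<? z ⟨$⟩ʳ inject₁ k))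
      ... | yes found = inj₁ found
      ... | no ¬found = inj₂ (adjIncreasing⇒blockIncreasing z λ k eq → ℕ.≤∧≢⇒<
        (ℕ.≮⇒≥ λ lt → ¬found (k , eq , lt)) λ toℕ≡ → inject₁≢suc k (perm-injective z (Fin.toℕ-injective toℕ≡)))

    minRep⇒blockIncreasing : ∀ z → IsMinRep lam z → BlockIncreasing lam z
    minRep⇒blockIncreasing z min with search z
    ... | inj₂ inc = inc
    ... | inj₁ (k , eq , inv) with once⇒∈ (once-Sₙ (adj k))
    ...   | w , w∈ , w≈ = contradiction
      (All.lookup min w∈ (≡.trans (•-cong {w = w} {adj k} w≈ lam) (adj•-equal k lam eq)))
      (ℕ.<⇒≱ (≡.subst₂ ℕ._<_ (ℓ-cong {w = z · adj k} {z · w} λ i → ≡.cong (z ⟨$⟩ʳ_) (≡.sym (w≈ i))) (≡.sym (ℓ-·adj k z inv)) (ℕ.n<1+n _)))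

    blockIncreasing-exists : ∀ w → ∃[ z ] (BlockIncreasing lam z × z • lam ≡ w • lam)
    blockIncreasing-exists w = go (ℓ w) w ≡.refl
      where
      go : ∀ d w → ℓ w ≡ d → ∃[ z ] (BlockIncreasing lam z × z • lam ≡ w • lam)
      go d w ℓ≡d with search w
      ... | inj₂ inc = w , inc , ≡.refl
      go zero w ℓ≡0 | inj₁ (k , eq , inv) = case ≡.trans (≡.sym ℓ≡0) (ℓ-·adj k w inv) of λ ()
      go (suc d) w ℓ≡d | inj₁ (k , eq , inv) with go d (w · adj k) (ℕ.suc-injective (≡.trans (≡.sym (ℓ-·adj k w inv)) ℓ≡d))
      ... | z , inc , z•≡ = z , inc , ≡.trans z•≡ (≡.trans (•-· w (adj k) lam) (≡.cong (w •_) (adj•-equal k lam eq)))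

    once-W^ : ∀ w → Once (λ z → z • lam ≡ w • lam) (W^ lam)
    once-W^ w with blockIncreasing-exists w
    ... | z₀ , inc₀ , eq₀ = once-resp-∈
      (λ z z≈ → ≡.trans (•-cong {w = z} {z₀} z≈ lam) eq₀)
      (λ z z∈ eq → blockIncreasing-unique lam {z} {z₀}
        (minRep⇒blockIncreasing z (proj₂ (∈.∈-filter⁻ (isMinRep? lam) {xs = Sₙ n} z∈))) inc₀ (≡.trans eq (≡.sym eq₀)))
      (once-filter (isMinRep? lam) (λ z z≈ → blockIncreasing⇒minRep lam dec z
        λ {i} {j} eq i<j → ≡.subst₂ Fin._<_ (≡.sym (z≈ i)) (≡.sym (z≈ j)) (inc₀ eq i<j)) (once-Sₙ z₀))

  module _ (k : Fin m) (μ : Vec ℤ n) where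
    adj-blockIncreasing : lookup μ (inject₁ k) ≢ lookup μ (suc k) → BlockIncreasing μ (adj k)
    adj-blockIncreasing lo≢hi eq i<j = adj-mono k i<j λ { (≡.refl , ≡.refl) → lo≢hi eq }

    vᶻ-adj : lookup μ (inject₁ k) ≢ lookup μ (suc k) → ∀ i → vᶻ (adj k • μ) (adj k ⟨$⟩ʳ i) ≡ vᶻ μ i
    vᶻ-adj lo≢hi i = ≡.cong (λ r → + toℕ r) (v-• μ (adj k) (adj-blockIncreasing lo≢hi) i)

    vᶻ-equal : lookup μ (inject₁ k) ≡ lookup μ (suc k) → vᶻ μ (suc k) ≡ 1ℤ ℤ.+ vᶻ μ (inject₁ k)
    vᶻ-equal lo≡hi = ≡.trans (vᶻ-rank μ (suc k)) (≡.trans (≡.cong +_ rank-hi) (≡.cong (λ y → 1ℤ ℤ.+ y) (≡.sym (vᶻ-rank μ (inject₁ k)))))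
      where
      open ≡.≡-Reasoning

      lo? : (s : Fin n) → Dec (inject₁ k ≡ s)
      lo? s = inject₁ k Fin.≟ s

      step : ∀ s → (d : Dec (inject₁ k ≡ s)) →
             ∑ℕ.pick (before? μ s (suc k)) 1 ≡ ∑ℕ.pick d 1 ℕ.+ ∑ℕ.pick (before? μ s (inject₁ k)) 1
      step s (yes ≡.refl) = ≡.trans (∑ℕ.pick-yes (before? μ (inject₁ k) (suc k)) 1 (inj₁ (lo<hi k , ℤ.≤-reflexive lo≡hi)))
        (≡.cong suc (≡.sym (∑ℕ.pick-no (before? μ (inject₁ k) (inject₁ k)) 1 (before-irrefl μ))))
      step s (no lo≢s) = ∑ℕ.pick-cong (before? μ s (suc k)) (before? μ s (inject₁ k)) to from 1 1 λ _ → ≡.refl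
        where
        to : Before μ s (suc k) → Before μ s (inject₁ k)
        to (inj₁ (s<hi , le)) = inj₁ (ℕ.≤∧≢⇒< (≡.subst (toℕ s ℕ.≤_) (≡.sym (Fin.toℕ-inject₁ k)) (ℕ.s≤s⁻¹ s<hi))
          (lo≢s ∘ ≡.sym ∘ Fin.toℕ-injective) , ≡.subst (lookup μ s ℤ.≤_) (≡.sym lo≡hi) le)
        to (inj₂ (hi<s , lt)) = inj₂ (ℕ.<-trans (lo<hi k) hi<s , ≡.subst (lookup μ s ℤ.<_) (≡.sym lo≡hi) lt)

        from : Before μ s (inject₁ k) → Before μ s (suc k)
        from (inj₁ (s<lo , le)) = inj₁ (ℕ.<-trans s<lo (lo<hi k) , ≡.subst (lookup μ s ℤ.≤_) lo≡hi le)
        from (inj₂ (lo<s , lt)) = inj₂ (ℕ.≤∧≢⇒< (≡.subst (ℕ._≤ toℕ s) (≡.cong suc (Fin.toℕ-inject₁ k)) lo<s)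
          (λ eq → ℤ.<-irrefl (≡.trans (≡.cong (lookup μ) (≡.sym (Fin.toℕ-injective {i = suc k} {s} eq))) (≡.sym lo≡hi)) lt)
          , ≡.subst (lookup μ s ℤ.<_) lo≡hi lt)

      rank-hi : rank μ (suc k) ≡ suc (rank μ (inject₁ k))
      rank-hi = begin
        rank μ (suc k)
          ≡⟨ length-filter (λ s → before? μ s (suc k)) (allFin n) ⟩
        ∑ℕ.fold (allFin n) (λ s → ∑ℕ.pick (before? μ s (suc k)) 1)
          ≡⟨ ∑ℕ.fold-cong (allFin n) (λ s → step s (lo? s)) ⟩
        ∑ℕ.fold (allFin n) (λ s → ∑ℕ.pick (lo? s) 1 ℕ.+ ∑ℕ.pick (before? μ s (inject₁ k)) 1)
          ≡⟨ ∑ℕ.fold-∙ (allFin n) (λ s → ∑ℕ.pick (lo? s) 1) (λ s → ∑ℕ.pick (before? μ s (inject₁ k)) 1) ⟩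
        ∑ℕ.fold (allFin n) (λ s → ∑ℕ.pick (lo? s) 1) ℕ.+ ∑ℕ.fold (allFin n) (λ s → ∑ℕ.pick (before? μ s (inject₁ k)) 1)
          ≡⟨ ≡.cong₂ ℕ._+_ (∑ℕ.fold-once lo? (λ _ → 1) 1 (once-∈ (Unique.allFin⁺ n) (∈.∈-allFin (inject₁ k))) λ _ _ → ≡.refl)
               (≡.sym (length-filter (λ s → before? μ s (inject₁ k)) (allFin n))) ⟩
        suc (rank μ (inject₁ k)) ∎

module _ {n : ℕ} (μ : Vec ℤ n) where
  ∈-orbit⁺ : ∀ w → w • μ ∈ orbit μ
  ∈-orbit⁺ w with once⇒∈ (once-Sₙ w)
  ... | u , u∈ , u≈w = ∈.∈-deduplicate⁺ _≟ᵉ_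
    (≡.subst (_∈ List.map (_• μ) (Sₙ n)) (•-cong {w = u} {w} u≈w μ) (∈.∈-map⁺ (_• μ) u∈))

  ∈-orbit⁻ : ∀ {ν} → ν ∈ orbit μ → ∃[ w ] ν ≡ w • μ
  ∈-orbit⁻ ν∈ with ∈.∈-map⁻ (_• μ) (∈.∈-deduplicate⁻ _≟ᵉ_ (List.map (_• μ) (Sₙ n)) ν∈)
  ... | w , _ , eq = w , eq

  orbit-unique : Unique (orbit μ)
  orbit-unique = UniqueDec.deduplicate-! _≟ᵉ_ _

-- Consecutive steps of (E2) preserve the symmetry of E_μ in x_j and
-- x_{j+1} when μ_j = μ_{j+1}.

module Braid {c ℓ} {A : CommutativeRing c ℓ} {m : ℕ} (act : Action A m) where
  open CommutativeRing A hiding (zero)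
  open Action act
  open Hecke act
  open RingLemmas A
  open IntegerSolver A
  open Relation.Binary.Reasoning.Setoid setoid

  ▹-affine : ∀ w {β} → Invariant β → ∀ i j →
    w ▹ ((1# - t + β) * x i - β * x j) ≈ (1# - t + β) * x (w ⟨$⟩ʳ i) - β * x (w ⟨$⟩ʳ j)
  ▹-affine w {β} β-inv i j = trans (▹-- w _ _) (+-cong
    (trans (▹-* w _ _) (*-cong (trans (▹-+ w _ _) (+-cong (trans (▹-- w 1# t) (+-cong (▹-1 w) (-‿cong (▹-t w)))) (β-inv w))) (▹-x w i)))
    (-‿cong (trans (▹-* w _ _) (*-cong (β-inv w) (▹-x w j)))))

  ▹-tx-x : ∀ w i j → w ▹ (t * x i - x j) ≈ t * x (w ⟨$⟩ʳ i) - x (w ⟨$⟩ʳ j)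
  ▹-tx-x w i j = trans (▹-- w _ _) (+-cong (trans (▹-* w _ _) (*-cong (▹-t w) (▹-x w i))) (-‿cong (▹-x w j)))

  a-coeff b-coeff : Carrier → Fin (suc m) → Fin (suc m) → Carrier
  a-coeff β i j = ((1# - t + β) * x i - β * x j) * recip i j
  b-coeff β i j = (t * x i - x j) * recip i j

  ▹-a : ∀ w {β} → Invariant β → ∀ {i j} → i ≢ j → w ▹ a-coeff β i j ≈ a-coeff β (w ⟨$⟩ʳ i) (w ⟨$⟩ʳ j)
  ▹-a w β-inv {i} {j} i≢j = trans (▹-* w _ _) (*-cong (▹-affine w β-inv i j) (▹-recip w i≢j))

  ▹-b : ∀ w {β} → ∀ {i j} → i ≢ j → w ▹ b-coeff β i j ≈ b-coeff β (w ⟨$⟩ʳ i) (w ⟨$⟩ʳ j)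
  ▹-b w {i = i} {j} i≢j = trans (▹-* w _ _) (*-cong (▹-tx-x w i j) (▹-recip w i≢j))

  step-disjoint : ∀ j k {β f} → Invariant β →
    inject₁ k ≢ inject₁ j → inject₁ k ≢ suc j → suc k ≢ inject₁ j → suc k ≢ suc j →
    adj j ▹ f ≈ f → adj j ▹ step k β f ≈ step k β f
  step-disjoint j k {β} {f} β-inv ll lh hl hh s-f = begin
    adj j ▹ step k β f
      ≈⟨ trans (▹-+ (adj j) _ _) (+-cong (▹-* (adj j) _ _) (▹-* (adj j) _ _)) ⟩
    adj j ▹ a-coeff β (inject₁ k) (suc k) * adj j ▹ f + adj j ▹ b-coeff β (inject₁ k) (suc k) * adj j ▹ adj k ▹ f
      ≈⟨ +-cong (*-cong (trans (▹-a (adj j) β-inv (inject₁≢suc k)) (reflexive (≡.cong₂ (a-coeff β) lo-fixed hi-fixed))) s-f)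
                (*-cong (trans (▹-b (adj j) {β} (inject₁≢suc k)) (reflexive (≡.cong₂ (b-coeff β) lo-fixed hi-fixed)))
                  (trans (sym (▹-· (adj j) (adj k) f)) (trans (▹-resp {adj j · adj k} {adj k · adj j} f commute)
                    (trans (▹-· (adj k) (adj j) f) (▹-cong (adj k) s-f))))) ⟩
    step k β f ∎
    where
    lo-fixed : adj j ⟨$⟩ʳ inject₁ k ≡ inject₁ k
    lo-fixed = adj-off j ll lh

    hi-fixed : adj j ⟨$⟩ʳ suc k ≡ suc k
    hi-fixed = adj-off j hl hh

    commute : (adj j · adj k) Perm.≈ (adj k · adj j)
    commute i with adjView k i | adjView j i
    ... | lo | _ = ≡.trans (≡.cong (adj j ⟨$⟩ʳ_) (adj-lo k)) (≡.trans hi-fixed (≡.sym (≡.trans (≡.cong (adj k ⟨$⟩ʳ_) lo-fixed) (adj-lo k))))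
    ... | hi | _ = ≡.trans (≡.cong (adj j ⟨$⟩ʳ_) (adj-hi k)) (≡.trans lo-fixed (≡.sym (≡.trans (≡.cong (adj k ⟨$⟩ʳ_) hi-fixed) (adj-hi k))))
    ... | off i≢ i≢′ | lo = ≡.trans (≡.cong (adj j ⟨$⟩ʳ_) (adj-off k i≢ i≢′)) (≡.trans (adj-lo j)
      (≡.sym (≡.trans (≡.cong (adj k ⟨$⟩ʳ_) (adj-lo j)) (adj-off k (lh ∘ ≡.sym) (hh ∘ ≡.sym)))))
    ... | off i≢ i≢′ | hi = ≡.trans (≡.cong (adj j ⟨$⟩ʳ_) (adj-off k i≢ i≢′)) (≡.trans (adj-hi j)
      (≡.sym (≡.trans (≡.cong (adj k ⟨$⟩ʳ_) (adj-hi j)) (adj-off k (ll ∘ ≡.sym) (hl ∘ ≡.sym)))))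
    ... | off i≢ i≢′ | off i≢₂ i≢₂′ = ≡.trans (≡.cong (adj j ⟨$⟩ʳ_) (adj-off k i≢ i≢′)) (≡.trans (adj-off j i≢₂ i≢₂′)
      (≡.sym (≡.trans (≡.cong (adj k ⟨$⟩ʳ_) (adj-off j i≢₂ i≢₂′)) (adj-off k i≢ i≢′))))

  -- k and j are neighbours: the steps k and j move positions a, b and b, c.
  module _ (k j : Fin m) (sk≡lj : suc k ≡ inject₁ j) where
    private
      pa pb pc : Fin (suc m)
      pa = inject₁ k
      pb = suc k
      pc = suc j

      s₁ s₂ : Carrier → Carrier
      s₁ = adj k ▹_
      s₂ = adj j ▹_

      a≢b : pa ≢ pb
      a≢b = inject₁≢suc k

      a<b : pa Fin.< pb
      a<b = lo<hi k

      b<c : pb Fin.< pc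
      b<c = ≡.subst (Fin._< pc) (≡.sym sk≡lj) (lo<hi j)

      b≢c : pb ≢ pc
      b≢c = Fin.<⇒≢ b<c

      a≢c : pa ≢ pc
      a≢c = Fin.<⇒≢ (ℕ.<-trans a<b b<c)

      s₁a : adj k ⟨$⟩ʳ pa ≡ pb
      s₁a = adj-lo k

      s₁b : adj k ⟨$⟩ʳ pb ≡ pa
      s₁b = adj-hi k

      s₁c : adj k ⟨$⟩ʳ pc ≡ pc
      s₁c = adj-off k (a≢c ∘ ≡.sym) (b≢c ∘ ≡.sym)

      s₂a : adj j ⟨$⟩ʳ pa ≡ pa
      s₂a = adj-off j (≡.subst (pa ≢_) sk≡lj a≢b) a≢c

      s₂b : adj j ⟨$⟩ʳ pb ≡ pc
      s₂b = ≡.trans (≡.cong (adj j ⟨$⟩ʳ_) sk≡lj) (adj-lo j)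

      s₂c : adj j ⟨$⟩ʳ pc ≡ pb
      s₂c = ≡.trans (adj-hi j) (≡.sym sk≡lj)

      braid : (adj j · (adj k · adj j)) Perm.≈ (adj k · (adj j · adj k))
      braid i with adjView k i | adjView j i
      ... | lo | _ rewrite s₂a | s₁a | s₂b | s₁c = ≡.refl
      ... | hi | _ rewrite s₂b | s₁b | s₁c | s₂c | s₂a | s₁a = ≡.refl
      ... | off _ i≢b | lo = contradiction (≡.sym sk≡lj) i≢b
      ... | off _ _ | hi rewrite s₂c | s₁c | s₁b | s₂a | s₂c | s₁b = ≡.refl
      ... | off i≢ i≢′ | off i≢₂ i≢₂′
        rewrite adj-off j i≢₂ i≢₂′ | adj-off k i≢ i≢′ | adj-off j i≢₂ i≢₂′ | adj-off k i≢ i≢′ = ≡.refl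

      ▹-braid : ∀ f → s₂ (s₁ (s₂ f)) ≈ s₁ (s₂ (s₁ f))
      ▹-braid f = trans (sym (unfold (adj j) (adj k) (adj j))) (trans (▹-resp {adj j · (adj k · adj j)} {adj k · (adj j · adj k)} f braid)
        (unfold (adj k) (adj j) (adj k)))
        where
        unfold : ∀ w w′ w″ → (w · (w′ · w″)) ▹ f ≈ w ▹ w′ ▹ w″ ▹ f
        unfold w w′ w″ = trans (▹-· w (w′ · w″) f) (▹-cong w (▹-· w′ w″ f))

      -- sums of three fractions over the common denominator (x_a − x_b)(x_b − x_c)(x_a − x_c)
      common : ∀ p q r → p * (recip pa pb * recip pb pc) + q * (recip pa pb * recip pa pc) + r * (recip pa pc * recip pb pc)
        ≈ (p * (x pa - x pc) + q * (x pb - x pc) + r * (x pa - x pb)) * (recip pa pb * recip pb pc * recip pa pc)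
      common p q r = begin
        p * (uab * ubc) + q * (uab * uac) + r * (uac * ubc)
          ≈⟨ +-cong (+-cong (*-congˡ (unit (x-recip a≢c))) (*-congˡ (unit (x-recip b≢c)))) (*-congˡ (unit (x-recip a≢b))) ⟩
        p * (uab * ubc * ((x pa - x pc) * uac)) + q * (uab * uac * ((x pb - x pc) * ubc)) + r * (uac * ubc * ((x pa - x pb) * uab))
          ≈⟨ solve 9 (λ p q r a b c u v w → p :* (u :* v :* ((a :- c) :* w)) :+ q :* (u :* w :* ((b :- c) :* v)) :+ r :* (w :* v :* ((a :- b) :* u))
               := (p :* (a :- c) :+ q :* (b :- c) :+ r :* (a :- b)) :* (u :* v :* w)) p q r (x pa) (x pb) (x pc) uab ubc uac ⟩
        (p * (x pa - x pc) + q * (x pb - x pc) + r * (x pa - x pb)) * (uab * ubc * uac) ∎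
        where
        uab ubc uac : Carrier
        uab = recip pa pb
        ubc = recip pb pc
        uac = recip pa pc

        unit : ∀ {y e} → e ≈ 1# → y ≈ y * e
        unit e≈1 = sym (trans (*-congˡ e≈1) (*-identityʳ _))

      step₂ : ∀ β f → step j β f ≈ a-coeff β pb pc * f + b-coeff β pb pc * s₂ f
      step₂ β f = reflexive (≡.cong (λ i → a-coeff β i pc * f + b-coeff β i pc * s₂ f) (≡.sym sk≡lj))

      ▹-three : ∀ w y₁ z₁ y₂ z₂ y₃ z₃ → w ▹ (y₁ * z₁ + y₂ * z₂ + y₃ * z₃) ≈ w ▹ y₁ * w ▹ z₁ + w ▹ y₂ * w ▹ z₂ + w ▹ y₃ * w ▹ z₃
      ▹-three w y₁ z₁ y₂ z₂ y₃ z₃ = trans (▹-+ w _ _) (+-cong (trans (▹-+ w _ _) (+-cong (▹-* w _ _) (▹-* w _ _))) (▹-* w _ _))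

    step-step-symmetric : ∀ {β₁ β₂ f} → Invariant β₁ → Invariant β₂ → β₂ * (1# + β₁) ≈ t * β₁ →
      adj k ▹ f ≈ f → adj j ▹ step k β₁ (step j β₂ f) ≈ step k β₁ (step j β₂ f)
    step-step-symmetric {β₁} {β₂} {f} inv₁ inv₂ rel s₁f = begin
      s₂ h
        ≈⟨ trans (▹-cong (adj j) h-expand) (▹-three (adj j) C₃ f C₂ f₂ C₁ f₁) ⟩
      s₂ C₃ * f₂ + s₂ C₂ * s₂ f₂ + s₂ C₁ * s₂ f₁
        ≈⟨ +-cong (+-cong (*-congʳ (trans (▹-cong (adj j) key) (▹-adj-adj j C₂))) (*-cong (sym key) (▹-adj-adj j f)))
                  (*-cong s₂C₁ (trans (▹-braid f) (▹-cong (adj k) (▹-cong (adj j) s₁f)))) ⟩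
      C₂ * f₂ + C₃ * f + C₁ * f₁
        ≈⟨ +-congʳ (+-comm _ _) ⟩
      C₃ * f + C₂ * f₂ + C₁ * f₁
        ≈⟨ h-expand ⟨
      h ∎
      where
      h f₂ f₁ A₁ B₁ A₂ B₂ A₂′ B₂′ C₁ C₂ C₃ : Carrier
      h   = step k β₁ (step j β₂ f)
      f₂  = s₂ f
      f₁  = s₁ (s₂ f)
      A₁  = a-coeff β₁ pa pb
      B₁  = b-coeff β₁ pa pb
      A₂  = a-coeff β₂ pb pc
      B₂  = b-coeff β₂ pb pc
      A₂′ = a-coeff β₂ pa pc
      B₂′ = b-coeff β₂ pa pc
      C₁  = B₁ * B₂′
      C₂  = A₁ * B₂
      C₃  = A₁ * A₂ + B₁ * A₂′

      s₁-step : s₁ (step j β₂ f) ≈ A₂′ * f + B₂′ * f₁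
      s₁-step = trans (▹-cong (adj k) (step₂ β₂ f)) (trans (▹-+ (adj k) _ _) (+-cong
        (trans (▹-* (adj k) _ _) (*-cong (trans (▹-a (adj k) inv₂ b≢c) (reflexive (≡.cong₂ (a-coeff β₂) s₁b s₁c))) s₁f))
        (trans (▹-* (adj k) _ _) (*-congʳ (trans (▹-b (adj k) {β₂} b≢c) (reflexive (≡.cong₂ (b-coeff β₂) s₁b s₁c)))))))

      h-expand : h ≈ C₃ * f + C₂ * f₂ + C₁ * f₁
      h-expand = trans (+-cong (*-congˡ (step₂ β₂ f)) (*-congˡ s₁-step))
        (solve 9 (λ A B A₂ B₂ A₂′ B₂′ f f₂ f₁ → A :* (A₂ :* f :+ B₂ :* f₂) :+ B :* (A₂′ :* f :+ B₂′ :* f₁)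
          := (A :* A₂ :+ B :* A₂′) :* f :+ A :* B₂ :* f₂ :+ B :* B₂′ :* f₁) A₁ B₁ A₂ B₂ A₂′ B₂′ f f₂ f₁)

      s₂C₁ : s₂ C₁ ≈ C₁
      s₂C₁ = trans (▹-* (adj j) _ _) (trans (*-cong
        (trans (▹-b (adj j) {β₁} a≢b) (reflexive (≡.cong₂ (b-coeff β₁) s₂a s₂b)))
        (trans (▹-b (adj j) {β₂} a≢c) (reflexive (≡.cong₂ (b-coeff β₂) s₂a s₂c)))) (*-comm _ _))

      s₂C₂ : s₂ C₂ ≈ a-coeff β₁ pa pc * b-coeff β₂ pc pb
      s₂C₂ = trans (▹-* (adj j) _ _) (*-cong
        (trans (▹-a (adj j) inv₁ a≢b) (reflexive (≡.cong₂ (a-coeff β₁) s₂a s₂b)))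
        (trans (▹-b (adj j) {β₂} b≢c) (reflexive (≡.cong₂ (b-coeff β₂) s₂b s₂c))))

      key : C₃ ≈ s₂ C₂
      key = x-y≈0⇒x≈y (begin
        C₃ - s₂ C₂
          ≈⟨ +-congˡ (-‿cong (trans s₂C₂ (*-congˡ (*-congˡ (recip-neg b≢c))))) ⟩
        C₃ - a-coeff β₁ pa pc * ((t * xc - xb) * - ubc)
          ≈⟨ solve 9 (λ a b c t β₁ β₂ u v w →
               ((con 1ℤ :- t :+ β₁) :* a :- β₁ :* b) :* u :* (((con 1ℤ :- t :+ β₂) :* b :- β₂ :* c) :* v)
                 :+ (t :* a :- b) :* u :* (((con 1ℤ :- t :+ β₂) :* a :- β₂ :* c) :* w)
                 :- ((con 1ℤ :- t :+ β₁) :* a :- β₁ :* c) :* w :* ((t :* c :- b) :* :- v)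
               := (((con 1ℤ :- t :+ β₁) :* a :- β₁ :* b) :* ((con 1ℤ :- t :+ β₂) :* b :- β₂ :* c)) :* (u :* v)
                 :+ ((t :* a :- b) :* ((con 1ℤ :- t :+ β₂) :* a :- β₂ :* c)) :* (u :* w)
                 :+ (((con 1ℤ :- t :+ β₁) :* a :- β₁ :* c) :* (t :* c :- b)) :* (w :* v)) xa xb xc t β₁ β₂ uab ubc uac ⟩
        p * (uab * ubc) + q * (uab * uac) + r * (uac * ubc)
          ≈⟨ common p q r ⟩
        (p * (xa - xc) + q * (xb - xc) + r * (xa - xb)) * (uab * ubc * uac)
          ≈⟨ *-congʳ (solve 6 (λ a b c t β₁ β₂ →
               ((con 1ℤ :- t :+ β₁) :* a :- β₁ :* b) :* ((con 1ℤ :- t :+ β₂) :* b :- β₂ :* c) :* (a :- c)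
                 :+ (t :* a :- b) :* ((con 1ℤ :- t :+ β₂) :* a :- β₂ :* c) :* (b :- c)
                 :+ ((con 1ℤ :- t :+ β₁) :* a :- β₁ :* c) :* (t :* c :- b) :* (a :- b)
               := (β₂ :* (con 1ℤ :+ β₁) :- t :* β₁) :* ((a :- b) :* (b :- c) :* (a :- c))) xa xb xc t β₁ β₂) ⟩
        (β₂ * (1# + β₁) - t * β₁) * ((xa - xb) * (xb - xc) * (xa - xc)) * (uab * ubc * uac)
          ≈⟨ *-congʳ (*-congʳ (trans (+-congʳ rel) (-‿inverseʳ _))) ⟩
        0# * ((xa - xb) * (xb - xc) * (xa - xc)) * (uab * ubc * uac)
          ≈⟨ trans (*-congʳ (zeroˡ _)) (zeroˡ _) ⟩
        0# ∎)
        where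
        xa xb xc uab ubc uac p q r : Carrier
        xa = x pa
        xb = x pb
        xc = x pc
        uab = recip pa pb
        ubc = recip pb pc
        uac = recip pa pc
        p = ((1# - t + β₁) * xa - β₁ * xb) * ((1# - t + β₂) * xb - β₂ * xc)
        q = (t * xa - xb) * ((1# - t + β₂) * xa - β₂ * xc)
        r = ((1# - t + β₁) * xa - β₁ * xc) * (t * xc - xb)

    step-step-symmetric′ : ∀ {β₁ β₂ f} → Invariant β₁ → Invariant β₂ → β₁ * (1# + β₂) ≈ t * β₂ →
      adj j ▹ f ≈ f → adj k ▹ step j β₂ (step k β₁ f) ≈ step j β₂ (step k β₁ f)
    step-step-symmetric′ {β₁} {β₂} {f} inv₁ inv₂ rel s₂f = begin
      s₁ h
        ≈⟨ trans (▹-cong (adj k) h-expand) (▹-three (adj k) C₃ f C₂ f₂ C₁ f₁) ⟩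
      s₁ C₃ * f₂ + s₁ C₂ * s₁ f₂ + s₁ C₁ * s₁ f₁
        ≈⟨ +-cong (+-cong (*-congʳ (trans (▹-cong (adj k) key) (▹-adj-adj k C₂))) (*-cong (sym key) (▹-adj-adj k f)))
                  (*-cong s₁C₁ (trans (sym (▹-braid f)) (▹-cong (adj j) (▹-cong (adj k) s₂f)))) ⟩
      C₂ * f₂ + C₃ * f + C₁ * f₁
        ≈⟨ +-congʳ (+-comm _ _) ⟩
      C₃ * f + C₂ * f₂ + C₁ * f₁
        ≈⟨ h-expand ⟨
      h ∎
      where
      h f₂ f₁ A₁ B₁ A₂ B₂ A₁′ B₁′ C₁ C₂ C₃ : Carrier
      h   = step j β₂ (step k β₁ f)
      f₂  = s₁ f
      f₁  = s₂ (s₁ f)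
      A₁  = a-coeff β₁ pa pb
      B₁  = b-coeff β₁ pa pb
      A₂  = a-coeff β₂ pb pc
      B₂  = b-coeff β₂ pb pc
      A₁′ = a-coeff β₁ pa pc
      B₁′ = b-coeff β₁ pa pc
      C₁  = B₂ * B₁′
      C₂  = A₂ * B₁
      C₃  = A₂ * A₁ + B₂ * A₁′

      s₂-step : s₂ (step k β₁ f) ≈ A₁′ * f + B₁′ * f₁
      s₂-step = trans (▹-+ (adj j) _ _) (+-cong
        (trans (▹-* (adj j) _ _) (*-cong (trans (▹-a (adj j) inv₁ a≢b) (reflexive (≡.cong₂ (a-coeff β₁) s₂a s₂b))) s₂f))
        (trans (▹-* (adj j) _ _) (*-congʳ (trans (▹-b (adj j) {β₁} a≢b) (reflexive (≡.cong₂ (b-coeff β₁) s₂a s₂b))))))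

      h-expand : h ≈ C₃ * f + C₂ * f₂ + C₁ * f₁
      h-expand = trans (step₂ β₂ (step k β₁ f)) (trans (+-congˡ (*-congˡ s₂-step))
        (solve 9 (λ A B A₂ B₂ A₂′ B₂′ f f₂ f₁ → A :* (A₂ :* f :+ B₂ :* f₂) :+ B :* (A₂′ :* f :+ B₂′ :* f₁)
          := (A :* A₂ :+ B :* A₂′) :* f :+ A :* B₂ :* f₂ :+ B :* B₂′ :* f₁) A₂ B₂ A₁ B₁ A₁′ B₁′ f f₂ f₁))

      s₁C₁ : s₁ C₁ ≈ C₁
      s₁C₁ = trans (▹-* (adj k) _ _) (trans (*-cong
        (trans (▹-b (adj k) {β₂} b≢c) (reflexive (≡.cong₂ (b-coeff β₂) s₁b s₁c)))
        (trans (▹-b (adj k) {β₁} a≢c) (reflexive (≡.cong₂ (b-coeff β₁) s₁a s₁c)))) (*-comm _ _))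

      s₁C₂ : s₁ C₂ ≈ a-coeff β₂ pa pc * b-coeff β₁ pb pa
      s₁C₂ = trans (▹-* (adj k) _ _) (*-cong
        (trans (▹-a (adj k) inv₂ b≢c) (reflexive (≡.cong₂ (a-coeff β₂) s₁b s₁c)))
        (trans (▹-b (adj k) {β₁} a≢b) (reflexive (≡.cong₂ (b-coeff β₁) s₁a s₁b))))

      key : C₃ ≈ s₁ C₂
      key = x-y≈0⇒x≈y (begin
        C₃ - s₁ C₂
          ≈⟨ +-congˡ (-‿cong (trans s₁C₂ (*-congˡ (*-congˡ (recip-neg a≢b))))) ⟩
        C₃ - a-coeff β₂ pa pc * ((t * xb - xa) * - uab)
          ≈⟨ solve 9 (λ a b c t β₁ β₂ u v w →
               ((con 1ℤ :- t :+ β₂) :* b :- β₂ :* c) :* v :* (((con 1ℤ :- t :+ β₁) :* a :- β₁ :* b) :* u)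
                 :+ (t :* b :- c) :* v :* (((con 1ℤ :- t :+ β₁) :* a :- β₁ :* c) :* w)
                 :- ((con 1ℤ :- t :+ β₂) :* a :- β₂ :* c) :* w :* ((t :* b :- a) :* :- u)
               := (((con 1ℤ :- t :+ β₂) :* b :- β₂ :* c) :* ((con 1ℤ :- t :+ β₁) :* a :- β₁ :* b)) :* (u :* v)
                 :+ (((con 1ℤ :- t :+ β₂) :* a :- β₂ :* c) :* (t :* b :- a)) :* (u :* w)
                 :+ ((t :* b :- c) :* ((con 1ℤ :- t :+ β₁) :* a :- β₁ :* c)) :* (w :* v)) xa xb xc t β₁ β₂ uab ubc uac ⟩
        p * (uab * ubc) + q * (uab * uac) + r * (uac * ubc)
          ≈⟨ common p q r ⟩
        (p * (xa - xc) + q * (xb - xc) + r * (xa - xb)) * (uab * ubc * uac)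
          ≈⟨ *-congʳ (solve 6 (λ a b c t β₁ β₂ →
               ((con 1ℤ :- t :+ β₂) :* b :- β₂ :* c) :* ((con 1ℤ :- t :+ β₁) :* a :- β₁ :* b) :* (a :- c)
                 :+ ((con 1ℤ :- t :+ β₂) :* a :- β₂ :* c) :* (t :* b :- a) :* (b :- c)
                 :+ (t :* b :- c) :* ((con 1ℤ :- t :+ β₁) :* a :- β₁ :* c) :* (a :- b)
               := (β₁ :* (con 1ℤ :+ β₂) :- t :* β₂) :* ((a :- b) :* (b :- c) :* (a :- c))) xa xb xc t β₁ β₂) ⟩
        (β₁ * (1# + β₂) - t * β₂) * ((xa - xb) * (xb - xc) * (xa - xc)) * (uab * ubc * uac)
          ≈⟨ *-congʳ (*-congʳ (trans (+-congʳ rel) (-‿inverseʳ _))) ⟩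
        0# * ((xa - xb) * (xb - xc) * (xa - xc)) * (uab * ubc * uac)
          ≈⟨ trans (*-congʳ (zeroˡ _)) (zeroˡ _) ⟩
        0# ∎)
        where
        xa xb xc uab ubc uac p q r : Carrier
        xa = x pa
        xb = x pb
        xc = x pc
        uab = recip pa pb
        ubc = recip pb pc
        uac = recip pa pc
        p = ((1# - t + β₂) * xb - β₂ * xc) * ((1# - t + β₁) * xa - β₁ * xb)
        q = ((1# - t + β₂) * xa - β₂ * xc) * (t * xb - xa)
        r = (t * xb - xc) * ((1# - t + β₁) * xa - β₁ * xc)

-- Relations for the electronic Macdonald polynomials

Nonnegative : ∀ {n} → Vec ℤ n → Set
Nonnegative μ = ∀ r → 0ℤ ℤ.≤ lookup μ r

pred* suc* : ∀ {n} → Vec ℤ n → Vec ℤ n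
pred* = Vec.map (ℤ._- 1ℤ)
suc*  = Vec.map (ℤ._+ 1ℤ)

pred*-suc* : ∀ {n} (μ : Vec ℤ n) → pred* (suc* μ) ≡ μ
pred*-suc* μ = vec-ext λ i → ≡.trans (Vec.lookup-map i _ (suc* μ))
  (≡.trans (≡.cong (ℤ._- 1ℤ) (Vec.lookup-map i _ μ)) (solve 1 (λ a → (a :+ con 1ℤ) :- con 1ℤ := a) (lookup μ i)))
  where open ℤSolver

decrement-induction : ∀ {n p} (P : Vec ℤ n → Set p) → (∀ μ → Nonnegative μ → P μ) → (∀ μ → P μ → P (pred* μ)) → ∀ μ → P μ
decrement-induction P base down μ = go (proj₁ (offset μ)) μ (proj₂ (offset μ))
  where
  0≤∣i∣+i : ∀ i → 0ℤ ℤ.≤ + ℤ.∣ i ∣ ℤ.+ i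
  0≤∣i∣+i (+ k)    = ℤ.+≤+ ℕ.z≤n
  0≤∣i∣+i -[1+ k ] = ℤ.≤-reflexive (≡.sym (ℤ.+-inverseʳ (+ suc k)))

  offset : ∀ {n} (μ : Vec ℤ n) → ∃[ d ] (∀ r → 0ℤ ℤ.≤ + d ℤ.+ lookup μ r)
  offset []      = 0 , λ ()
  offset (a ∷ μ) with offset μ
  ... | d , ge = ℤ.∣ a ∣ ℕ.+ d , λ where
    zero    → ℤ.≤-trans (0≤∣i∣+i a) (ℤ.+-monoˡ-≤ a (ℤ.+≤+ (ℕ.m≤m+n ℤ.∣ a ∣ d)))
    (suc r) → ℤ.≤-trans (ge r) (ℤ.+-monoˡ-≤ (lookup μ r) (ℤ.+≤+ (ℕ.m≤n+m d ℤ.∣ a ∣)))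

  go : ∀ d μ → (∀ r → 0ℤ ℤ.≤ + d ℤ.+ lookup μ r) → P μ
  go zero    μ ge = base μ λ r → ≡.subst (0ℤ ℤ.≤_) (ℤ.+-identityˡ _) (ge r)
  go (suc d) μ ge = ≡.subst P (pred*-suc* μ) (down (suc* μ) (go d (suc* μ) λ r → ≡.subst (0ℤ ℤ.≤_)
    (≡.trans (≡.cong (ℤ._+ lookup μ r) (ℤ.+-comm 1ℤ (+ d)))
      (≡.trans (≡.trans (ℤ.+-assoc (+ d) 1ℤ (lookup μ r)) (≡.cong (λ y → + d ℤ.+ y) (ℤ.+-comm 1ℤ (lookup μ r))))
        (≡.cong (λ y → + d ℤ.+ y) (≡.sym (Vec.lookup-map r _ μ))))) (ge r)))

rotate : ∀ {m} → Vec ℤ (suc m) → Vec ℤ (suc m)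
rotate μ = Vec.last μ ℤ.+ 1ℤ ∷ Vec.init μ

unrotate : ∀ {m} → Vec ℤ (suc m) → Vec ℤ (suc m)
unrotate (a ∷ μ) = μ Vec.∷ʳ (a ℤ.- 1ℤ)

rotate-unrotate : ∀ {m} (μ : Vec ℤ (suc m)) → rotate (unrotate μ) ≡ μ
rotate-unrotate (a ∷ μ) = ≡.cong₂ _∷_
  (≡.trans (≡.cong (ℤ._+ 1ℤ) (Vec.last-∷ʳ _ μ)) (solve 1 (λ a → (a :- con 1ℤ) :+ con 1ℤ := a) a))
  (Vec.init-∷ʳ _ μ)
  where open ℤSolver

size : ∀ {n} → Vec ℤ n → ℕ
size []      = 0
size (a ∷ μ) = ℤ.∣ a ∣ ℕ.+ size μ

size-sum : ∀ {n} (μ : Vec ℤ n) → size μ ≡ ∑ℕ.Sum.sum (λ i → ℤ.∣ lookup μ i ∣)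
size-sum []      = ≡.refl
size-sum (a ∷ μ) = ≡.cong (ℤ.∣ a ∣ ℕ.+_) (size-sum μ)

size-adj : ∀ {m} (k : Fin m) μ → size (adj k • μ) ≡ size μ
size-adj k μ = ≡.trans (size-sum (adj k • μ))
  (≡.trans (∑ℕ.Sum.sum-cong-≗ λ i → ≡.cong ℤ.∣_∣ (lookup-adj k μ i))
    (≡.trans (≡.sym (∑ℕ.Sum.sum-permute (λ i → ℤ.∣ lookup μ i ∣) (adj k))) (≡.sym (size-sum μ))))

size-∷ʳ : ∀ {n} (μ : Vec ℤ n) a → size (μ Vec.∷ʳ a) ≡ size μ ℕ.+ ℤ.∣ a ∣
size-∷ʳ []      a = ℕ.+-comm _ 0
size-∷ʳ (b ∷ μ) a = ≡.trans (≡.cong (ℤ.∣ b ∣ ℕ.+_) (size-∷ʳ μ a)) (≡.sym (ℕ.+-assoc ℤ.∣ b ∣ _ _))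

size-unrotate : ∀ {m} (μ : Vec ℤ (suc m)) → 0ℤ ℤ.< lookup μ zero → size (unrotate μ) ℕ.< size μ
size-unrotate (+ suc a ∷ μ) (ℤ.+<+ _) = ℕ.≤-reflexive (≡.cong suc (≡.trans (size-∷ʳ μ _) (ℕ.+-comm (size μ) _)))

lookup-∷ʳ : ∀ {p n} (P : ℤ → Set p) (μ : Vec ℤ n) {a} → (∀ i → P (lookup μ i)) → P a → ∀ i → P (lookup (μ Vec.∷ʳ a) i)
lookup-∷ʳ P []      Pμ Pa zero    = Pa
lookup-∷ʳ P (b ∷ μ) Pμ Pa zero    = Pμ zero
lookup-∷ʳ P (b ∷ μ) Pμ Pa (suc i) = lookup-∷ʳ P μ (Pμ ∘ suc) Pa i

nonnegative-unrotate : ∀ {m} (μ : Vec ℤ (suc m)) → Nonnegative μ → 0ℤ ℤ.< lookup μ zero → Nonnegative (unrotate μ)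
nonnegative-unrotate (a ∷ μ) nn a>0 = lookup-∷ʳ (0ℤ ℤ.≤_) μ (nn ∘ suc)
  (≡.subst (ℤ._≤ a ℤ.- 1ℤ) (ℤ.+-inverseʳ 1ℤ) (ℤ.+-monoˡ-≤ -1ℤ (ℤ.i<j⇒suc[i]≤j a>0)))

nonnegative-adj : ∀ {m} (k : Fin m) μ → Nonnegative μ → Nonnegative (adj k • μ)
nonnegative-adj k μ nn r = ≡.subst (0ℤ ℤ.≤_) (≡.sym (lookup-adj k μ r)) (nn _)

-- E_μ is reached from E_0 by (E1) when μ_1 > 0, and otherwise by (E2) at the
-- last zero before a positive entry.
module _ {m p} (P : Vec ℤ (suc m) → Set p) (P-0 : P 𝟎)
  (P-rotate : ∀ μ → Nonnegative μ → 0ℤ ℤ.< lookup μ zero → (∀ ν → Nonnegative ν → size ν ℕ.< size μ → P ν) → P μ)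
  (P-ascent : ∀ k μ → Nonnegative μ → lookup μ (inject₁ k) ℤ.< lookup μ (suc k) →
    (∀ ν → Nonnegative ν → size ν ≡ size μ → ∀ q → toℕ q ℕ.≤ toℕ k → 0ℤ ℤ.< lookup ν q → P ν) → P μ) where
  private
    all-0 : ∀ (μ : Vec ℤ (suc m)) → Nonnegative μ → ¬ (∃[ q ] 0ℤ ℤ.< lookup μ q) → μ ≡ 𝟎
    all-0 μ nn none = vec-ext λ i → ≡.trans (ℤ.≤-antisym (ℤ.≮⇒≥ λ lt → none (i , lt)) (nn i)) (≡.sym (Vec.lookup-replicate i 0ℤ))

    module _ (N : ℕ) (smaller : ∀ μ → Nonnegative μ → size μ ℕ.< N → P μ) where
      scan : ∀ d μ → Nonnegative μ → size μ ℕ.< suc N → ∀ q → toℕ q ℕ.< d → 0ℤ ℤ.< lookup μ q → P μ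
      scan (suc d) μ nn sz zero q<d pos = P-rotate μ nn pos λ ν nn′ sz′ → smaller ν nn′ (ℕ.<-≤-trans sz′ (ℕ.s≤s⁻¹ sz))
      scan (suc d) μ nn sz (suc k) (ℕ.s≤s k<d) pos with 0ℤ ℤ.<? lookup μ (inject₁ k)
      ... | yes pos′ = scan d μ nn sz (inject₁ k) (≡.subst (ℕ._< d) (≡.sym (Fin.toℕ-inject₁ k)) k<d) pos′
      ... | no ¬pos  = P-ascent k μ nn (ℤ.≤-<-trans (ℤ.≮⇒≥ ¬pos) pos) λ ν nn′ sz′ q q≤k pos′ →
        scan d ν nn′ (≡.subst (ℕ._< suc N) (≡.sym sz′) sz) q (ℕ.≤-<-trans q≤k k<d) pos′

    go : ∀ N μ → Nonnegative μ → size μ ℕ.< N → P μ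
    go (suc N) μ nn sz with Fin.any? (λ q → 0ℤ ℤ.<? lookup μ q)
    ... | yes (q , pos) = scan N (go N) (suc m) μ nn sz q (Fin.toℕ<n q) pos
    ... | no none rewrite all-0 μ nn none = P-0

  nonnegative-induction : ∀ μ → Nonnegative μ → P μ
  nonnegative-induction μ nn = go (suc (size μ)) μ nn ℕ.≤-refl

-- Triangularity of the electronic Macdonald polynomials

module ∑ℤ = Fold ℤ.+-0-commutativeMonoid

∑ᶻ : ∀ {n} → (Fin n → ℤ) → ℤ
∑ᶻ {zero}  f = 0ℤ
∑ᶻ {suc n} f = f zero ℤ.+ ∑ᶻ (f ∘ suc)

∑ᶻ-sum : ∀ {n} (f : Fin n → ℤ) → ∑ᶻ f ≡ ∑ℤ.Sum.sum f
∑ᶻ-sum {zero}  f = ≡.refl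
∑ᶻ-sum {suc n} f = ≡.cong (λ y → f zero ℤ.+ y) (∑ᶻ-sum (f ∘ suc))

∑ᶻ-cong : ∀ {n} {f g : Fin n → ℤ} → (∀ i → f i ≡ g i) → ∑ᶻ f ≡ ∑ᶻ g
∑ᶻ-cong {zero}  eq = ≡.refl
∑ᶻ-cong {suc n} eq = ≡.cong₂ ℤ._+_ (eq zero) (∑ᶻ-cong (eq ∘ suc))

∑ᶻ-mono : ∀ {n} {f g : Fin n → ℤ} → (∀ i → f i ℤ.≤ g i) → ∑ᶻ f ℤ.≤ ∑ᶻ g
∑ᶻ-mono {zero}  le = ℤ.≤-refl
∑ᶻ-mono {suc n} le = ℤ.+-mono-≤ (le zero) (∑ᶻ-mono (le ∘ suc))

∑ᶻ-strict : ∀ {n} {f g : Fin n → ℤ} → (∀ i → f i ℤ.≤ g i) → ∀ i → f i ℤ.< g i → ∑ᶻ f ℤ.< ∑ᶻ g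
∑ᶻ-strict le zero    lt = ℤ.+-mono-<-≤ lt (∑ᶻ-mono (le ∘ suc))
∑ᶻ-strict le (suc i) lt = ℤ.+-mono-≤-< (le zero) (∑ᶻ-strict (le ∘ suc) i lt)

∑ᶻ-• : ∀ {n} (w : Permutation′ n) (f : ℤ → ℤ) (μ : Vec ℤ n) → ∑ᶻ (λ i → f (lookup (w • μ) i)) ≡ ∑ᶻ (λ i → f (lookup μ i))
∑ᶻ-• w f μ = ≡.trans (∑ᶻ-cong λ i → ≡.cong f (lookup-• w μ i)) (≡.trans (∑ᶻ-sum (λ i → f (lookup μ (w ⟨$⟩ˡ i))))
  (≡.trans (≡.sym (∑ℤ.Sum.sum-permute (λ i → f (lookup μ i)) (w ⁻¹))) (≡.sym (∑ᶻ-sum (λ i → f (lookup μ i))))))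

∑ᶻ-last : ∀ {m} (f : Fin (suc m) → ℤ) → ∑ᶻ f ≡ f (Fin.fromℕ m) ℤ.+ ∑ᶻ (f ∘ inject₁)
∑ᶻ-last {zero}  f = ≡.refl
∑ᶻ-last {suc m} f = ≡.trans (≡.cong (λ y → f zero ℤ.+ y) (∑ᶻ-last (f ∘ suc)))
  (solve 3 (λ a b c → a :+ (b :+ c) := b :+ (a :+ c)) (f zero) (f (suc (Fin.fromℕ m))) _)
  where open ℤSolver

∑ᶻ-others : ∀ {m} → Fin m → (Fin (suc m) → ℤ) → ℤ
∑ᶻ-others zero    f = ∑ᶻ (λ i → f (suc (suc i)))
∑ᶻ-others (suc k) f = f zero ℤ.+ ∑ᶻ-others k (f ∘ suc)

∑ᶻ-split : ∀ {m} (k : Fin m) f → ∑ᶻ f ≡ (f (inject₁ k) ℤ.+ f (suc k)) ℤ.+ ∑ᶻ-others k f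
∑ᶻ-split zero    f = ≡.sym (ℤ.+-assoc (f zero) (f (suc zero)) (∑ᶻ (λ i → f (suc (suc i)))))
∑ᶻ-split (suc k) f = ≡.trans (≡.cong (λ y → f zero ℤ.+ y) (∑ᶻ-split k (f ∘ suc)))
  (solve 4 (λ a b c d → a :+ ((b :+ c) :+ d) := (b :+ c) :+ (a :+ d)) (f zero) (f (suc (inject₁ k))) (f (suc (suc k))) _)
  where open ℤSolver

∑ᶻ-others-cong : ∀ {m} (k : Fin m) {f g} → (∀ i → i ≢ inject₁ k → i ≢ suc k → f i ≡ g i) → ∑ᶻ-others k f ≡ ∑ᶻ-others k g
∑ᶻ-others-cong zero {f} {g} eq = ∑ᶻ-cong {f = λ i → f (suc (suc i))} {λ i → g (suc (suc i))} λ i → eq (suc (suc i)) (λ ()) (λ ())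
∑ᶻ-others-cong (suc k) eq = ≡.cong₂ ℤ._+_ (eq zero (λ ()) (λ ()))
  (∑ᶻ-others-cong k λ i ≢lo ≢hi → eq (suc i) (≢lo ∘ Fin.suc-injective) (≢hi ∘ Fin.suc-injective))

infix 9 _⁺
opaque
  _⁺ : ℤ → ℤ
  i ⁺ = 0ℤ ℤ.⊔ i

  ⁺-mono : ∀ {i j} → i ℤ.≤ j → i ⁺ ℤ.≤ j ⁺
  ⁺-mono = ℤ.⊔-monoʳ-≤ 0ℤ

  ⁺-nonpos : ∀ {i} → i ℤ.≤ 0ℤ → i ⁺ ≡ 0ℤ
  ⁺-nonpos = ℤ.i≥j⇒i⊔j≡i

  ⁺-nonneg : ∀ {i} → 0ℤ ℤ.≤ i → i ⁺ ≡ i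
  ⁺-nonneg = ℤ.i≤j⇒i⊔j≡j

i≤1+i : ∀ i → i ℤ.≤ 1ℤ ℤ.+ i
i≤1+i i = ℤ.i≤j+i i 1ℤ

⁺-suc-≤ : ∀ i → (1ℤ ℤ.+ i) ⁺ ℤ.≤ 1ℤ ℤ.+ i ⁺
⁺-suc-≤ i with ℤ.≤-total 0ℤ i
... | inj₁ 0≤i = ℤ.≤-reflexive (≡.trans (⁺-nonneg (ℤ.≤-trans 0≤i (i≤1+i i))) (≡.cong (λ y → 1ℤ ℤ.+ y) (≡.sym (⁺-nonneg 0≤i))))
... | inj₂ i≤0 = ℤ.≤-trans (⁺-mono (ℤ.+-monoʳ-≤ 1ℤ i≤0)) (ℤ.≤-reflexive
  (≡.trans (⁺-nonneg {1ℤ} (ℤ.+≤+ ℕ.z≤n)) (≡.cong (λ y → 1ℤ ℤ.+ y) (≡.sym (⁺-nonpos i≤0)))))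

⁺-convex : ∀ {i j} → j ℤ.≤ i → i ⁺ ℤ.+ (1ℤ ℤ.+ j) ⁺ ℤ.≤ (1ℤ ℤ.+ i) ⁺ ℤ.+ j ⁺
⁺-convex {i} {j} j≤i with ℤ.≤-total 0ℤ i
... | inj₂ i≤0 with ℤ.≤-total 0ℤ j
...   | inj₁ 0≤j with ℤ.≤-antisym (ℤ.≤-trans j≤i i≤0) 0≤j | ℤ.≤-antisym i≤0 (ℤ.≤-trans 0≤j j≤i)
...     | ≡.refl | ≡.refl = ℤ.≤-reflexive (ℤ.+-comm (0ℤ ⁺) (1ℤ ⁺))
⁺-convex {i} {j} j≤i | inj₂ i≤0 | inj₂ j≤0 = ≡.subst₂ ℤ._≤_
  (≡.trans (ℤ.+-comm ((1ℤ ℤ.+ j) ⁺) 0ℤ) (≡.cong (λ y → y ℤ.+ (1ℤ ℤ.+ j) ⁺) (≡.sym (⁺-nonpos i≤0))))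
  (≡.cong (λ y → (1ℤ ℤ.+ i) ⁺ ℤ.+ y) (≡.sym (⁺-nonpos j≤0)))
  (ℤ.+-monoˡ-≤ 0ℤ (⁺-mono (ℤ.+-monoʳ-≤ 1ℤ j≤i)))
⁺-convex {i} {j} j≤i | inj₁ 0≤i = ≡.subst (i ⁺ ℤ.+ (1ℤ ℤ.+ j) ⁺ ℤ.≤_)
  (≡.trans (solve 2 (λ a b → a :+ (con 1ℤ :+ b) := (con 1ℤ :+ a) :+ b) (i ⁺) (j ⁺))
    (≡.cong (ℤ._+ j ⁺) (≡.trans (≡.cong (λ y → 1ℤ ℤ.+ y) (⁺-nonneg 0≤i)) (≡.sym (⁺-nonneg (ℤ.≤-trans 0≤i (i≤1+i i)))))))
  (ℤ.+-monoʳ-≤ (i ⁺) (⁺-suc-≤ j))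
  where open ℤSolver

⁺-convex-strict : ∀ {i j} → 0ℤ ℤ.≤ i → 1ℤ ℤ.+ j ℤ.≤ 0ℤ → i ⁺ ℤ.+ (1ℤ ℤ.+ j) ⁺ ℤ.< (1ℤ ℤ.+ i) ⁺ ℤ.+ j ⁺
⁺-convex-strict {i} {j} 0≤i j<0 = ≡.subst₂ ℤ._<_
  (≡.cong₂ ℤ._+_ (≡.sym (⁺-nonneg 0≤i)) (≡.sym (⁺-nonpos j<0)))
  (≡.cong₂ ℤ._+_ (≡.sym (⁺-nonneg (ℤ.≤-trans 0≤i (i≤1+i i)))) (≡.sym (⁺-nonpos (ℤ.≤-trans (i≤1+i j) j<0))))
  (ℤ.+-monoˡ-< 0ℤ (ℤ.suc[i]≤j⇒i<j {i} (ℤ.≤-refl {1ℤ ℤ.+ i})))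

threshold : ℕ → ℤ → ℕ → ℤ
threshold r d i = if i ℕ.<ᵇ r then 1ℤ ℤ.+ d else d

threshold-< : ∀ {r} d {i} → i ℕ.< r → threshold r d i ≡ 1ℤ ℤ.+ d
threshold-< {suc r} d {zero}  _  = ≡.refl
threshold-< {suc r} d {suc i} lt = threshold-< {r} d {i} (ℕ.s≤s⁻¹ lt)

threshold-≥ : ∀ {r} d {i} → r ℕ.≤ i → threshold r d i ≡ d
threshold-≥ {zero}  d {zero}  _  = ≡.refl
threshold-≥ {zero}  d {suc i} _  = ≡.refl
threshold-≥ {suc r} d {suc i} le = threshold-≥ {r} d {i} (ℕ.s≤s⁻¹ le)

excess : ∀ {n} → ℕ → ℤ → Vec ℤ n → Fin n → ℤ
excess r d ν i = (lookup ν i ℤ.- threshold r d (toℕ i)) ⁺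

-- The compositions ν with height r d ν ≤ height r d μ for all r ≤ n and all
-- d are those below μ in the Bruhat order of the affine symmetric group.
height : ∀ {n} → ℕ → ℤ → Vec ℤ n → ℤ
height r d ν = ∑ᶻ (excess r d ν)

last-lookup : ∀ {m} (ν : Vec ℤ (suc m)) → lookup ν (Fin.fromℕ m) ≡ Vec.last ν
last-lookup ν with Vec.initLast ν
... | (ν′ , a , ≡.refl) = go ν′
  where
  go : ∀ {m} (ν′ : Vec ℤ m) → lookup (ν′ Vec.∷ʳ a) (Fin.fromℕ m) ≡ a
  go []       = ≡.refl
  go (_ ∷ ν′) = go ν′

init-lookup : ∀ {m} (ν : Vec ℤ (suc m)) i → lookup ν (inject₁ i) ≡ lookup (Vec.init ν) i
init-lookup ν i with Vec.initLast ν
... | (ν′ , a , ≡.refl) = go ν′ i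
  where
  go : ∀ {m} (ν′ : Vec ℤ m) i → lookup (ν′ Vec.∷ʳ a) (inject₁ i) ≡ lookup ν′ i
  go (_ ∷ ν′) zero    = ≡.refl
  go (_ ∷ ν′) (suc i) = go ν′ i

height-rotate-suc : ∀ {m} r d (ν : Vec ℤ (suc m)) → r ℕ.≤ m → height (suc r) d (rotate ν) ≡ height r d ν
height-rotate-suc {m} r d ν r≤m = ≡.sym (≡.trans (∑ᶻ-last (excess r d ν)) (≡.cong₂ (λ a b → a ⁺ ℤ.+ b)
  (≡.trans (≡.cong₂ ℤ._-_ (last-lookup ν) (threshold-≥ {r} d (≡.subst (r ℕ.≤_) (≡.sym (Fin.toℕ-fromℕ m)) r≤m)))
    (solve 2 (λ a d → a :- d := (a :+ con 1ℤ) :- (con 1ℤ :+ d)) (Vec.last ν) d))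
  (∑ᶻ-cong λ i → ≡.cong₂ (λ a j → (a ℤ.- threshold r d j) ⁺) (init-lookup ν i) (Fin.toℕ-inject₁ i))))
  where open ℤSolver

height-rotate-zero : ∀ {m} d (ν : Vec ℤ (suc m)) → height 0 d (rotate ν) ≡ height m (d ℤ.- 1ℤ) ν
height-rotate-zero {m} d ν = ≡.sym (≡.trans (∑ᶻ-last (excess m (d ℤ.- 1ℤ) ν)) (≡.cong₂ (λ a b → a ⁺ ℤ.+ b)
  (≡.trans (≡.cong₂ ℤ._-_ (last-lookup ν) (threshold-≥ {m} (d ℤ.- 1ℤ) (ℕ.≤-reflexive (≡.sym (Fin.toℕ-fromℕ m)))))
    (solve 2 (λ a d → a :- (d :- con 1ℤ) := (a :+ con 1ℤ) :- d) (Vec.last ν) d))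
  (∑ᶻ-cong λ i → ≡.cong₂ (λ a b → (a ℤ.- b) ⁺) (init-lookup ν i)
    (≡.trans (threshold-< {m} (d ℤ.- 1ℤ) (≡.subst (ℕ._< m) (≡.sym (Fin.toℕ-inject₁ i)) (Fin.toℕ<n i)))
      (solve 1 (λ d → con 1ℤ :+ (d :- con 1ℤ) := d) d)))))
  where open ℤSolver

height-pred* : ∀ {n} r d (ν : Vec ℤ n) → height r d (pred* ν) ≡ height r (1ℤ ℤ.+ d) ν
height-pred* r d ν = ∑ᶻ-cong λ i → ≡.cong _⁺ (≡.trans (≡.cong (ℤ._- threshold r d (toℕ i)) (Vec.lookup-map i _ ν))
  (shift (lookup ν i) (toℕ i ℕ.<ᵇ r)))
  where
  open ℤSolver
  shift : ∀ a b → (a ℤ.- 1ℤ) ℤ.- (if b then 1ℤ ℤ.+ d else d) ≡ a ℤ.- (if b then 1ℤ ℤ.+ (1ℤ ℤ.+ d) else 1ℤ ℤ.+ d)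
  shift a true  = solve 2 (λ a d → (a :- con 1ℤ) :- (con 1ℤ :+ d) := a :- (con 1ℤ :+ (con 1ℤ :+ d))) a d
  shift a false = solve 2 (λ a d → (a :- con 1ℤ) :- d := a :- (con 1ℤ :+ d)) a d

module _ {m : ℕ} (k : Fin m) where
  private
    n = suc m

    top : ℕ
    top = suc (toℕ k)

    toℕ-lo : toℕ (inject₁ k) ≡ toℕ k
    toℕ-lo = Fin.toℕ-inject₁ k

    c : ℕ → ℤ → Fin n → ℤ
    c r d i = threshold r d (toℕ i)

  rest : ℕ → ℤ → Vec ℤ n → ℤ
  rest r d ν = ∑ᶻ-others k (excess r d ν)

  height-split : ∀ r d ν → height r d ν ≡
    ((lookup ν (inject₁ k) ℤ.- c r d (inject₁ k)) ⁺ ℤ.+ (lookup ν (suc k) ℤ.- c r d (suc k)) ⁺) ℤ.+ rest r d ν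
  height-split r d ν = ∑ᶻ-split k (excess r d ν)

  height-adj : ∀ r d ν → height r d (adj k • ν) ≡
    ((lookup ν (suc k) ℤ.- c r d (inject₁ k)) ⁺ ℤ.+ (lookup ν (inject₁ k) ℤ.- c r d (suc k)) ⁺) ℤ.+ rest r d ν
  height-adj r d ν = ≡.trans (height-split r d (adj k • ν)) (≡.cong₂ ℤ._+_
    (≡.cong₂ (λ a b → (a ℤ.- c r d (inject₁ k)) ⁺ ℤ.+ (b ℤ.- c r d (suc k)) ⁺) (lookup-adj-lo k ν) (lookup-adj-hi k ν))
    (∑ᶻ-others-cong k {excess r d (adj k • ν)} {excess r d ν} λ i ≢lo ≢hi → ≡.cong (λ a → (a ℤ.- c r d i) ⁺) (lookup-adj-off k ν ≢lo ≢hi)))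

  private
    c-equal : ∀ {r} d → r ≢ top → c r d (inject₁ k) ≡ c r d (suc k)
    c-equal {r} d r≢top with ℕ.<-cmp r top
    ... | tri≈ _ r≡top _ = contradiction r≡top r≢top
    ... | tri< r<top _ _ = ≡.trans (threshold-≥ {r} d (≡.subst (r ℕ.≤_) (≡.sym toℕ-lo) (ℕ.s≤s⁻¹ r<top)))
      (≡.sym (threshold-≥ {r} d (ℕ.<⇒≤ r<top)))
    ... | tri> _ _ top<r = ≡.trans (threshold-< {r} d (≡.subst (ℕ._< r) (≡.sym toℕ-lo) (ℕ.<-trans (ℕ.n<1+n _) top<r)))
      (≡.sym (threshold-< {r} d top<r))

    c-top-lo : ∀ d → c top d (inject₁ k) ≡ 1ℤ ℤ.+ d
    c-top-lo d = threshold-< {top} d (ℕ.s≤s (ℕ.≤-reflexive toℕ-lo))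

    c-top-hi : ∀ d → c top d (suc k) ≡ d
    c-top-hi d = threshold-≥ {top} d ℕ.≤-refl

    c-off : ∀ {r r′} d {i} → toℕ k ℕ.≤ r → r ℕ.≤ suc top → toℕ k ℕ.≤ r′ → r′ ℕ.≤ suc top →
            i ≢ inject₁ k → i ≢ suc k → c r d i ≡ c r′ d i
    c-off {r} {r′} d {i} k≤r r≤ k≤r′ r′≤ ≢lo ≢hi with ℕ.<-cmp (toℕ i) (toℕ k)
    ... | tri< i<k _ _ = ≡.trans (threshold-< {r} d (ℕ.<-≤-trans i<k k≤r)) (≡.sym (threshold-< {r′} d (ℕ.<-≤-trans i<k k≤r′)))
    ... | tri≈ _ i≡k _ = contradiction (Fin.toℕ-injective (≡.trans i≡k (≡.sym toℕ-lo))) ≢lo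
    ... | tri> _ _ k<i = ≡.trans (threshold-≥ {r} d (ℕ.≤-trans r≤ top<i)) (≡.sym (threshold-≥ {r′} d (ℕ.≤-trans r′≤ top<i)))
      where
      top<i : top ℕ.< toℕ i
      top<i = ℕ.≤∧≢⇒< k<i (≢hi ∘ ≡.sym ∘ Fin.toℕ-injective)

  height-adj-equal : ∀ {r} d ν → r ≢ top → height r d (adj k • ν) ≡ height r d ν
  height-adj-equal {r} d ν r≢top = ≡.trans (height-adj r d ν) (≡.trans (≡.cong (ℤ._+ rest r d ν)
    (≡.trans (ℤ.+-comm ((lookup ν (suc k) ℤ.- c r d (inject₁ k)) ⁺) _)
      (≡.cong₂ (λ a b → (lookup ν (inject₁ k) ℤ.- a) ⁺ ℤ.+ (lookup ν (suc k) ℤ.- b) ⁺) (≡.sym (c-equal d r≢top)) (c-equal d r≢top))))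
    (≡.sym (height-split r d ν)))

  height-top : ∀ d ν → height top d ν ≡ ((lookup ν (inject₁ k) ℤ.- (1ℤ ℤ.+ d)) ⁺ ℤ.+ (lookup ν (suc k) ℤ.- d) ⁺) ℤ.+ rest top d ν
  height-top d ν = ≡.trans (height-split top d ν) (≡.cong₂ (λ a b → ((lookup ν (inject₁ k) ℤ.- a) ⁺ ℤ.+ (lookup ν (suc k) ℤ.- b) ⁺) ℤ.+ rest top d ν) (c-top-lo d) (c-top-hi d))

  height-adj-top : ∀ d ν → height top d (adj k • ν) ≡ ((lookup ν (suc k) ℤ.- (1ℤ ℤ.+ d)) ⁺ ℤ.+ (lookup ν (inject₁ k) ℤ.- d) ⁺) ℤ.+ rest top d ν
  height-adj-top d ν = ≡.trans (height-adj top d ν) (≡.cong₂ (λ a b → ((lookup ν (suc k) ℤ.- a) ⁺ ℤ.+ (lookup ν (inject₁ k) ℤ.- b) ⁺) ℤ.+ rest top d ν) (c-top-lo d) (c-top-hi d))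

  private
    rest-cong : ∀ {r r′} d ν → toℕ k ℕ.≤ r → r ℕ.≤ suc top → toℕ k ℕ.≤ r′ → r′ ℕ.≤ suc top → rest r d ν ≡ rest r′ d ν
    rest-cong {r} {r′} d ν p q p′ q′ = ∑ᶻ-others-cong k {excess r d ν} {excess r′ d ν} λ i ≢lo ≢hi → ≡.cong (λ a → (lookup ν i ℤ.- a) ⁺) (c-off d p q p′ q′ ≢lo ≢hi)

    k≤top : toℕ k ℕ.≤ top
    k≤top = ℕ.n≤1+n _

    top≤ : top ℕ.≤ suc top
    top≤ = ℕ.n≤1+n _

    height-below : ∀ d ν → height (toℕ k) d ν ≡ ((lookup ν (inject₁ k) ℤ.- d) ⁺ ℤ.+ (lookup ν (suc k) ℤ.- d) ⁺) ℤ.+ rest top d ν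
    height-below d ν = ≡.trans (height-split (toℕ k) d ν) (≡.cong₂ ℤ._+_
      (≡.cong₂ (λ a b → (lookup ν (inject₁ k) ℤ.- a) ⁺ ℤ.+ (lookup ν (suc k) ℤ.- b) ⁺)
        (threshold-≥ {toℕ k} d (ℕ.≤-reflexive (≡.sym toℕ-lo))) (threshold-≥ {toℕ k} d (ℕ.n≤1+n _)))
      (rest-cong d ν ℕ.≤-refl (ℕ.≤-trans k≤top top≤) k≤top top≤))

    height-above : ∀ d ν → height (suc top) d ν ≡ ((lookup ν (inject₁ k) ℤ.- (1ℤ ℤ.+ d)) ⁺ ℤ.+ (lookup ν (suc k) ℤ.- (1ℤ ℤ.+ d)) ⁺) ℤ.+ rest top d ν
    height-above d ν = ≡.trans (height-split (suc top) d ν) (≡.cong₂ ℤ._+_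
      (≡.cong₂ (λ a b → (lookup ν (inject₁ k) ℤ.- a) ⁺ ℤ.+ (lookup ν (suc k) ℤ.- b) ⁺)
        (threshold-< {suc top} d (ℕ.s≤s (ℕ.≤-trans (ℕ.≤-reflexive toℕ-lo) k≤top))) (threshold-< {suc top} d ℕ.≤-refl))
      (rest-cong d ν (ℕ.≤-trans k≤top top≤) ℕ.≤-refl k≤top top≤))

    minus-suc : ∀ a d → a ℤ.- d ≡ 1ℤ ℤ.+ (a ℤ.- (1ℤ ℤ.+ d))
    minus-suc a d = solve 2 (λ a d → a :- d := con 1ℤ :+ (a :- (con 1ℤ :+ d))) a d
      where open ℤSolver

  height-≤-adj : ∀ r d μ → lookup μ (suc k) ℤ.< lookup μ (inject₁ k) → height r d μ ℤ.≤ height r d (adj k • μ)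
  height-≤-adj r d μ desc with r ℕ.≟ top
  ... | no r≢top   = ℤ.≤-reflexive (≡.sym (height-adj-equal d μ r≢top))
  ... | yes ≡.refl = ≡.subst₂ ℤ._≤_
    (≡.sym (≡.trans (height-top d μ) (≡.cong (λ y → ((a ℤ.- (1ℤ ℤ.+ d)) ⁺ ℤ.+ y ⁺) ℤ.+ rest top d μ) (minus-suc b d))))
    (≡.sym (≡.trans (height-adj-top d μ) (≡.cong (ℤ._+ rest top d μ) (≡.trans (ℤ.+-comm ((b ℤ.- (1ℤ ℤ.+ d)) ⁺) _)
      (≡.cong (λ y → y ⁺ ℤ.+ (b ℤ.- (1ℤ ℤ.+ d)) ⁺) (minus-suc a d))))))
    (ℤ.+-monoˡ-≤ (rest top d μ) (⁺-convex (ℤ.+-monoˡ-≤ (ℤ.- (1ℤ ℤ.+ d)) (ℤ.<⇒≤ desc))))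
    where
    a b : ℤ
    a = lookup μ (inject₁ k)
    b = lookup μ (suc k)

  height-<-adj : ∀ μ → lookup μ (suc k) ℤ.< lookup μ (inject₁ k) → height top (lookup μ (suc k)) μ ℤ.< height top (lookup μ (suc k)) (adj k • μ)
  height-<-adj μ desc = ≡.subst₂ ℤ._<_
    (≡.sym (≡.trans (height-top b μ) (≡.cong (λ y → ((a ℤ.- (1ℤ ℤ.+ b)) ⁺ ℤ.+ y ⁺) ℤ.+ rest top b μ) (minus-suc b b))))
    (≡.sym (≡.trans (height-adj-top b μ) (≡.cong (ℤ._+ rest top b μ) (≡.trans (ℤ.+-comm ((b ℤ.- (1ℤ ℤ.+ b)) ⁺) _)
      (≡.cong (λ y → y ⁺ ℤ.+ (b ℤ.- (1ℤ ℤ.+ b)) ⁺) (minus-suc a b))))))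
    (ℤ.+-monoˡ-< (rest top b μ) (⁺-convex-strict (ℤ.i≤j⇒0≤j-i (ℤ.i<j⇒suc[i]≤j desc))
      (ℤ.≤-reflexive (≡.trans (≡.sym (minus-suc b b)) (ℤ.+-inverseʳ b)))))
    where
    a b : ℤ
    a = lookup μ (inject₁ k)
    b = lookup μ (suc k)

  height-lift : ∀ {r} d μ ν → lookup μ (suc k) ℤ.< lookup μ (inject₁ k) → r ℕ.≤ n → height r d (adj k • μ) ℤ.< height r d ν →
                ∃[ r′ ] (r′ ℕ.≤ n × height r′ d μ ℤ.< height r′ d (adj k • ν))
  height-lift {r} d μ ν desc r≤n lt with r ℕ.≟ top
  ... | no r≢top = r , r≤n , ≡.subst₂ ℤ._<_ (height-adj-equal d μ r≢top) (≡.sym (height-adj-equal d ν r≢top)) lt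
  ... | yes ≡.refl with lookup μ (suc k) ℤ.≤? d
  ...   | yes b≤d = toℕ k , ℕ.≤-trans k≤top r≤n , (begin-strict
    height (toℕ k) d μ
      ≡⟨ height-below d μ ⟩
    ((a ℤ.- d) ⁺ ℤ.+ (b ℤ.- d) ⁺) ℤ.+ rest top d μ
      ≡⟨ ≡.cong (ℤ._+ rest top d μ) (≡.trans (ℤ.+-comm ((a ℤ.- d) ⁺) _) (≡.cong (ℤ._+ (a ℤ.- d) ⁺)
           (≡.trans (⁺-nonpos (ℤ.i≤j⇒i-j≤0 b≤d)) (≡.sym (⁺-nonpos (ℤ.i≤j⇒i-j≤0 (ℤ.≤-trans b≤d (i≤1+i d)))))))) ⟩
    ((b ℤ.- (1ℤ ℤ.+ d)) ⁺ ℤ.+ (a ℤ.- d) ⁺) ℤ.+ rest top d μ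
      ≡⟨ height-adj-top d μ ⟨
    height top d (adj k • μ)
      <⟨ lt ⟩
    height top d ν
      ≡⟨ height-top d ν ⟩
    ((lookup ν (inject₁ k) ℤ.- (1ℤ ℤ.+ d)) ⁺ ℤ.+ (lookup ν (suc k) ℤ.- d) ⁺) ℤ.+ rest top d ν
      ≤⟨ ℤ.+-monoˡ-≤ (rest top d ν) (ℤ.+-monoˡ-≤ ((lookup ν (suc k) ℤ.- d) ⁺) (⁺-mono (ℤ.≤-trans (i≤1+i _) (ℤ.≤-reflexive (≡.sym (minus-suc (lookup ν (inject₁ k)) d)))))) ⟩
    ((lookup ν (inject₁ k) ℤ.- d) ⁺ ℤ.+ (lookup ν (suc k) ℤ.- d) ⁺) ℤ.+ rest top d ν
      ≡⟨ height-below d ν ⟨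
    height (toℕ k) d ν
      ≡⟨ height-adj-equal d ν (λ eq → ℕ.<⇒≢ (ℕ.n<1+n (toℕ k)) eq) ⟨
    height (toℕ k) d (adj k • ν) ∎)
    where
    open ℤ.≤-Reasoning
    a b : ℤ
    a = lookup μ (inject₁ k)
    b = lookup μ (suc k)
  ...   | no b≰d = suc top , ℕ.s≤s (Fin.toℕ<n k) , ≡.subst (height (suc top) d μ ℤ.<_)
      (≡.sym (height-adj-equal d ν (λ eq → ℕ.<⇒≢ (ℕ.n<1+n top) (≡.sym eq))))
      (≡.subst₂ ℤ._<_ (pred-suc _) (pred-suc _) (ℤ.+-monoʳ-< -1ℤ (begin-strict
    1ℤ ℤ.+ height (suc top) d μ
      ≡⟨ ≡.cong (λ y → 1ℤ ℤ.+ y) (height-above d μ) ⟩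
    1ℤ ℤ.+ (((a ℤ.- (1ℤ ℤ.+ d)) ⁺ ℤ.+ (b ℤ.- (1ℤ ℤ.+ d)) ⁺) ℤ.+ rest top d μ)
      ≡⟨ solve 3 (λ a b r → con 1ℤ :+ ((a :+ b) :+ r) := (b :+ (con 1ℤ :+ a)) :+ r) ((a ℤ.- (1ℤ ℤ.+ d)) ⁺) ((b ℤ.- (1ℤ ℤ.+ d)) ⁺) (rest top d μ) ⟩
    ((b ℤ.- (1ℤ ℤ.+ d)) ⁺ ℤ.+ (1ℤ ℤ.+ (a ℤ.- (1ℤ ℤ.+ d)) ⁺)) ℤ.+ rest top d μ
      ≡⟨ ≡.cong (λ y → ((b ℤ.- (1ℤ ℤ.+ d)) ⁺ ℤ.+ y) ℤ.+ rest top d μ)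
           (≡.trans (≡.cong (λ y → 1ℤ ℤ.+ y) (⁺-nonneg (ℤ.i≤j⇒0≤j-i d<a)))
             (≡.trans (≡.sym (minus-suc a d)) (≡.sym (⁺-nonneg (ℤ.i≤j⇒0≤j-i (ℤ.≤-trans (i≤1+i d) d<a)))))) ⟩
    ((b ℤ.- (1ℤ ℤ.+ d)) ⁺ ℤ.+ (a ℤ.- d) ⁺) ℤ.+ rest top d μ
      ≡⟨ height-adj-top d μ ⟨
    height top d (adj k • μ)
      <⟨ lt ⟩
    height top d ν
      ≡⟨ height-top d ν ⟩
    (e ℤ.+ (lookup ν (suc k) ℤ.- d) ⁺) ℤ.+ rest top d ν
      ≤⟨ ℤ.+-monoˡ-≤ (rest top d ν) (ℤ.+-monoʳ-≤ e (ℤ.≤-trans (ℤ.≤-reflexive (≡.cong _⁺ (minus-suc (lookup ν (suc k)) d))) (⁺-suc-≤ _))) ⟩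
    (e ℤ.+ (1ℤ ℤ.+ (lookup ν (suc k) ℤ.- (1ℤ ℤ.+ d)) ⁺)) ℤ.+ rest top d ν
      ≡⟨ solve 3 (λ a b r → (a :+ (con 1ℤ :+ b)) :+ r := con 1ℤ :+ ((a :+ b) :+ r)) e ((lookup ν (suc k) ℤ.- (1ℤ ℤ.+ d)) ⁺) (rest top d ν) ⟩
    1ℤ ℤ.+ ((e ℤ.+ (lookup ν (suc k) ℤ.- (1ℤ ℤ.+ d)) ⁺) ℤ.+ rest top d ν)
      ≡⟨ ≡.cong (λ y → 1ℤ ℤ.+ y) (height-above d ν) ⟨
    1ℤ ℤ.+ height (suc top) d ν ∎)))
    where
    open ℤ.≤-Reasoning
    open ℤSolver
    a b e : ℤ
    a = lookup μ (inject₁ k)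
    b = lookup μ (suc k)
    e = (lookup ν (inject₁ k) ℤ.- (1ℤ ℤ.+ d)) ⁺

    d<a : 1ℤ ℤ.+ d ℤ.≤ a
    d<a = ℤ.i<j⇒suc[i]≤j (ℤ.<-trans (ℤ.≰⇒> b≰d) desc)

    pred-suc : ∀ y → -1ℤ ℤ.+ (1ℤ ℤ.+ y) ≡ y
    pred-suc y = solve 1 (λ y → :- con 1ℤ :+ (con 1ℤ :+ y) := y) y

-- Symmetry of E_μ at equal neighbouring entries

adj-cons : ∀ {m} (k : Fin m) a (ν : Vec ℤ (suc m)) → adj (suc k) • (a ∷ ν) ≡ a ∷ (adj k • ν)
adj-cons k a ν = vec-ext λ where
  zero    → lookup-adj-off (suc k) (a ∷ ν) {zero} (λ ()) (λ ())
  (suc i) → case adjView k i of λ where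
    lo              → ≡.trans (lookup-adj-lo (suc k) (a ∷ ν)) (≡.sym (lookup-adj-lo k ν))
    hi              → ≡.trans (lookup-adj-hi (suc k) (a ∷ ν)) (≡.sym (lookup-adj-hi k ν))
    (off ≢lo ≢hi) → ≡.trans (lookup-adj-off (suc k) (a ∷ ν) (≢lo ∘ Fin.suc-injective) (≢hi ∘ Fin.suc-injective))
      (≡.sym (lookup-adj-off k ν ≢lo ≢hi))

adj-swap : ∀ {m} a b (ν : Vec ℤ m) → adj zero • (a ∷ b ∷ ν) ≡ b ∷ a ∷ ν
adj-swap a b ν = vec-ext λ where
  zero          → lookup-adj-lo zero (a ∷ b ∷ ν)
  (suc zero)    → lookup-adj-hi zero (a ∷ b ∷ ν)
  (suc (suc i)) → lookup-adj-off zero (a ∷ b ∷ ν) {suc (suc i)} (λ ()) (λ ())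

adj-snoc : ∀ {m} (k : Fin m) (ν : Vec ℤ (suc m)) z → adj (inject₁ k) • (ν Vec.∷ʳ z) ≡ (adj k • ν) Vec.∷ʳ z
adj-snoc zero    (a ∷ b ∷ ν) z = ≡.trans (adj-swap a b (ν Vec.∷ʳ z)) (≡.cong (Vec._∷ʳ z) (≡.sym (adj-swap a b ν)))
adj-snoc (suc k) (a ∷ ν)     z = ≡.trans (adj-cons (inject₁ k) a (ν Vec.∷ʳ z))
  (≡.trans (≡.cong (a ∷_) (adj-snoc k ν z)) (≡.cong (Vec._∷ʳ z) (≡.sym (adj-cons k a ν))))

adj-last : ∀ {m} (ν : Vec ℤ m) y z → adj (Fin.fromℕ m) • ((ν Vec.∷ʳ y) Vec.∷ʳ z) ≡ (ν Vec.∷ʳ z) Vec.∷ʳ y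
adj-last []      y z = adj-swap y z []
adj-last {suc m} (a ∷ ν) y z = ≡.trans (adj-cons (Fin.fromℕ m) a ((ν Vec.∷ʳ y) Vec.∷ʳ z)) (≡.cong (a ∷_) (adj-last ν y z))

rotate-snoc : ∀ {m} (ν : Vec ℤ m) z → rotate (ν Vec.∷ʳ z) ≡ z ℤ.+ 1ℤ ∷ ν
rotate-snoc ν z = ≡.cong₂ (λ a b → a ℤ.+ 1ℤ ∷ b) (Vec.last-∷ʳ z ν) (Vec.init-∷ʳ z ν)

-- How rotations carry the simple transpositions to one another: s_k Φ = Φ s_k′
-- for k > 0, and s_0 Φ² = Φ² s_{n−2}.
record Rotation₁ {m} (k k′ : Fin m) : Set where
  field
    adj-rotate : ∀ ν → adj k • rotate ν ≡ rotate (adj k′ • ν)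
    last-fixed : ∀ (ν : Vec ℤ (suc m)) → Vec.last (adj k′ • ν) ≡ Vec.last ν
    entries    : ∀ μ → lookup μ (inject₁ k) ≡ lookup μ (suc k) →
                 lookup (unrotate μ) (inject₁ k′) ≡ lookup (unrotate μ) (suc k′)

record Rotation₂ {m} (k k′ : Fin m) : Set where
  field
    adj-rotate : ∀ ν → adj k • rotate (rotate ν) ≡ rotate (rotate (adj k′ • ν))
    last-swap  : ∀ (ν : Vec ℤ (suc m)) → Vec.last (adj k′ • ν) ≡ Vec.last (rotate ν)
    last-swap′ : ∀ (ν : Vec ℤ (suc m)) → Vec.last (rotate (adj k′ • ν)) ≡ Vec.last ν
    entries    : ∀ μ → lookup μ (inject₁ k) ≡ lookup μ (suc k) →
                 lookup (unrotate (unrotate μ)) (inject₁ k′) ≡ lookup (unrotate (unrotate μ)) (suc k′)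
    positive   : ∀ μ → lookup μ (inject₁ k) ≡ lookup μ (suc k) → 0ℤ ℤ.< lookup μ zero → 0ℤ ℤ.< lookup (unrotate μ) zero

lookup-∷ʳ-inject₁ : ∀ {m} (ν : Vec ℤ m) z i → lookup (ν Vec.∷ʳ z) (inject₁ i) ≡ lookup ν i
lookup-∷ʳ-inject₁ ν z i = ≡.trans (init-lookup (ν Vec.∷ʳ z) i) (≡.cong (λ γ → lookup γ i) (Vec.init-∷ʳ z ν))

lookup-∷ʳ-fromℕ : ∀ {m} (ν : Vec ℤ m) z → lookup (ν Vec.∷ʳ z) (Fin.fromℕ m) ≡ z
lookup-∷ʳ-fromℕ ν z = ≡.trans (last-lookup (ν Vec.∷ʳ z)) (Vec.last-∷ʳ z ν)

rotation : ∀ {m} (k : Fin m) → (∃[ k′ ] Rotation₁ k k′) ⊎ (∃[ k′ ] Rotation₂ k k′)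
rotation (suc k) = inj₁ (inject₁ k , record
  { adj-rotate = λ ν → case Vec.initLast ν of λ where
      (ν₀ , z , ≡.refl) → ≡.trans (≡.cong (adj (suc k) •_) (rotate-snoc ν₀ z)) (≡.trans (adj-cons k (z ℤ.+ 1ℤ) ν₀)
        (≡.sym (≡.trans (≡.cong rotate (adj-snoc k ν₀ z)) (rotate-snoc (adj k • ν₀) z))))
  ; last-fixed = λ ν → case Vec.initLast ν of λ where
      (ν₀ , z , ≡.refl) → ≡.trans (≡.cong Vec.last (adj-snoc k ν₀ z)) (≡.trans (Vec.last-∷ʳ z (adj k • ν₀)) (≡.sym (Vec.last-∷ʳ z ν₀)))
  ; entries = λ { (a ∷ μ) eq → ≡.trans (lookup-∷ʳ-inject₁ μ (a ℤ.- 1ℤ) (inject₁ k)) (≡.trans eq (≡.sym (lookup-∷ʳ-inject₁ μ (a ℤ.- 1ℤ) (suc k)))) }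
  })
rotation {suc m} zero = inj₂ (Fin.fromℕ m , record
  { adj-rotate = λ ν → case snoc² ν of λ where
      (ν₀ , y , z , ≡.refl) → ≡.trans (≡.cong (adj zero •_) (rotate² ν₀ y z)) (≡.trans (adj-swap (y ℤ.+ 1ℤ) (z ℤ.+ 1ℤ) ν₀)
        (≡.sym (≡.trans (≡.cong (rotate ∘ rotate) (adj-last ν₀ y z)) (rotate² ν₀ z y))))
  ; last-swap = λ ν → case snoc² ν of λ where
      (ν₀ , y , z , ≡.refl) → ≡.trans (≡.cong Vec.last (adj-last ν₀ y z)) (≡.trans (Vec.last-∷ʳ y (ν₀ Vec.∷ʳ z)) (≡.sym (last-rotate ν₀ y z)))
  ; last-swap′ = λ ν → case snoc² ν of λ where
      (ν₀ , y , z , ≡.refl) → ≡.trans (≡.cong (Vec.last ∘ rotate) (adj-last ν₀ y z)) (≡.trans (last-rotate ν₀ z y) (≡.sym (Vec.last-∷ʳ z (ν₀ Vec.∷ʳ y))))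
  ; entries = λ { (a ∷ b ∷ μ) eq → ≡.trans (lookup-∷ʳ-inject₁ (μ Vec.∷ʳ (a ℤ.- 1ℤ)) (b ℤ.- 1ℤ) (Fin.fromℕ m))
      (≡.trans (lookup-∷ʳ-fromℕ μ (a ℤ.- 1ℤ)) (≡.trans (≡.cong (ℤ._- 1ℤ) eq) (≡.sym (lookup-∷ʳ-fromℕ (μ Vec.∷ʳ (a ℤ.- 1ℤ)) (b ℤ.- 1ℤ))))) }
  ; positive = λ { (a ∷ b ∷ μ) eq pos → ≡.subst (0ℤ ℤ.<_) eq pos }
  })
  where
  snoc² : ∀ (ν : Vec ℤ (suc (suc m))) → ∃[ ν₀ ] ∃[ y ] ∃[ z ] ν ≡ (ν₀ Vec.∷ʳ y) Vec.∷ʳ z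
  snoc² ν with Vec.initLast ν
  ... | ν₁ , z , ≡.refl with Vec.initLast ν₁
  ...   | ν₀ , y , ≡.refl = ν₀ , y , z , ≡.refl

  last-rotate : ∀ (ν : Vec ℤ m) y z → Vec.last (rotate ((ν Vec.∷ʳ y) Vec.∷ʳ z)) ≡ y
  last-rotate ν y z = ≡.trans (≡.cong Vec.last (rotate-snoc (ν Vec.∷ʳ y) z)) (Vec.last-∷ʳ y (z ℤ.+ 1ℤ ∷ ν))

  rotate² : ∀ (ν : Vec ℤ m) y z → rotate (rotate ((ν Vec.∷ʳ y) Vec.∷ʳ z)) ≡ y ℤ.+ 1ℤ ∷ z ℤ.+ 1ℤ ∷ ν
  rotate² ν y z = ≡.trans (≡.cong rotate (rotate-snoc (ν Vec.∷ʳ y) z)) (rotate-snoc (z ℤ.+ 1ℤ ∷ ν) y)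

opposite-anti : ∀ {n} {i j : Fin n} → i Fin.< j → opposite j Fin.< opposite i
opposite-anti {n} {i} {j} i<j = ≡.subst₂ ℕ._<_ (≡.sym (Fin.opposite-prop j)) (≡.sym (Fin.opposite-prop i))
  (ℕ.∸-monoʳ-< (ℕ.s≤s i<j) (Fin.toℕ<n j))

opposite-anti⁻¹ : ∀ {n} {i j : Fin n} → opposite j Fin.< opposite i → i Fin.< j
opposite-anti⁻¹ {i = i} {j} lt = ≡.subst₂ Fin._<_ (Fin.opposite-involutive i) (Fin.opposite-involutive j) (opposite-anti lt)

⊕ρ-strict : ∀ {n} (lam : Vec ℤ n) → WeaklyDecreasing lam → ∀ {i j} → i Fin.< j → lookup (lam ⊕ ρ) j ℤ.< lookup (lam ⊕ ρ) i
⊕ρ-strict lam dec {i} {j} i<j = ≡.subst₂ ℤ._<_ (≡.sym (at j)) (≡.sym (at i))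
  (ℤ.+-mono-≤-< (dec (ℕ.<⇒≤ i<j)) (ℤ.+<+ (opposite-anti {i = i} {j} i<j)))
  where
  at : ∀ r → lookup (lam ⊕ ρ) r ≡ lookup lam r ℤ.+ + toℕ (opposite r)
  at r = ≡.trans (Vec.lookup-zipWith ℤ._+_ r lam ρ) (≡.cong (λ y → lookup lam r ℤ.+ y) (Vec.lookup∘tabulate _ r))

inversions-min : ∀ {n} (lam : Vec ℤ n) z → BlockIncreasing lam z → ∀ {i j} → i Fin.< j →
  ((v lam · z ⁻¹) ⟨$⟩ʳ j Fin.< (v lam · z ⁻¹) ⟨$⟩ʳ i → lookup (z • lam) j ℤ.< lookup (z • lam) i)
  × (lookup (z • lam) j ℤ.< lookup (z • lam) i → (v lam · z ⁻¹) ⟨$⟩ʳ j Fin.< (v lam · z ⁻¹) ⟨$⟩ʳ i)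
inversions-min lam z inc {i} {j} i<j =
  (λ lt → proj₁ (inversion-v (z • lam) i<j) (≡.subst₂ Fin._<_ (v-z j) (v-z i) lt)) ,
  (λ lt → ≡.subst₂ Fin._<_ (≡.sym (v-z j)) (≡.sym (v-z i)) (proj₂ (inversion-v (z • lam) i<j) lt))
  where
  v-z : ∀ r → v lam ⟨$⟩ʳ (z ⟨$⟩ˡ r) ≡ v (z • lam) ⟨$⟩ʳ r
  v-z r = ≡.trans (≡.sym (v-• lam z inc (z ⟨$⟩ˡ r))) (≡.cong (v (z • lam) ⟨$⟩ʳ_) (Perm.inverseʳ z))

inversions-w₀ : ∀ {n} (μ₀ : Vec ℤ n) → (∀ {i j} → i Fin.< j → lookup μ₀ j ℤ.< lookup μ₀ i) → ∀ z {i j} → i Fin.< j →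
  ((w₀ · z ⁻¹) ⟨$⟩ʳ j Fin.< (w₀ · z ⁻¹) ⟨$⟩ʳ i → lookup (z • μ₀) j ℤ.< lookup (z • μ₀) i)
  × (lookup (z • μ₀) j ℤ.< lookup (z • μ₀) i → (w₀ · z ⁻¹) ⟨$⟩ʳ j Fin.< (w₀ · z ⁻¹) ⟨$⟩ʳ i)
inversions-w₀ μ₀ strict z {i} {j} i<j = to , from
  where
  to : opposite (z ⟨$⟩ˡ j) Fin.< opposite (z ⟨$⟩ˡ i) → lookup (z • μ₀) j ℤ.< lookup (z • μ₀) i
  to lt = ≡.subst₂ ℤ._<_ (≡.sym (lookup-• z μ₀ j)) (≡.sym (lookup-• z μ₀ i)) (strict (opposite-anti⁻¹ {i = z ⟨$⟩ˡ i} {z ⟨$⟩ˡ j} lt))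

  from : lookup (z • μ₀) j ℤ.< lookup (z • μ₀) i → opposite (z ⟨$⟩ˡ j) Fin.< opposite (z ⟨$⟩ˡ i)
  from lt with ℕ.<-cmp (toℕ (z ⟨$⟩ˡ i)) (toℕ (z ⟨$⟩ˡ j)) | ≡.subst₂ ℤ._<_ (lookup-• z μ₀ j) (lookup-• z μ₀ i) lt
  ... | tri< zi<zj _ _ | _   = opposite-anti {i = z ⟨$⟩ˡ i} {z ⟨$⟩ˡ j} zi<zj
  ... | tri≈ _ eq _    | lt′ = contradiction (≡.cong (lookup μ₀) (Fin.toℕ-injective (≡.sym eq))) (ℤ.<⇒≢ lt′)
  ... | tri> _ _ zj<zi | lt′ = contradiction (strict zj<zi) (ℤ.<-asym lt′)

-- The symmetric group action on the field of fractions

module FractionLemmas {c ℓ} (R : CommutativeRing c ℓ) where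
  open CommutativeRing R hiding (zero)
  open IntegerSolver R
  open Relation.Binary.Reasoning.Setoid setoid
  private
    module F = Frac R
    module Q = CommutativeRing F.ring
  open F using (Fraction; num; den; cross; ι; _÷_[_])

  opaque
    unfolding Frac.add Frac.mul

    ι-+ : ∀ a b → ι (a + b) Q.≈ ι a Q.+ ι b
    ι-+ a b = cross (solve 2 (λ a b → (a :+ b) :* (con 1ℤ :* con 1ℤ) := (a :* con 1ℤ :+ b :* con 1ℤ) :* con 1ℤ) a b)

    recip-inverse : ∀ {d} (reg : Regular R d) → ι d Q.* F.frac 1# d reg Q.≈ Q.1#
    recip-inverse {d} reg = cross (solve 1 (λ d → (d :* con 1ℤ) :* con 1ℤ := con 1ℤ :* (con 1ℤ :* d)) d)

    frac-split : ∀ a {d} (reg : Regular R d) → F.frac a d reg Q.≈ ι a Q.* F.frac 1# d reg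
    frac-split a {d} reg = cross (solve 2 (λ a d → a :* (con 1ℤ :* d) := (a :* con 1ℤ) :* d) a d)

  opaque
    unfolding Frac.mul Frac._÷_[_]

    ÷-* : ∀ a b (reg : Regular F.ring b) → (a ÷ b [ reg ]) Q.* b Q.≈ a
    ÷-* a b reg = cross (solve 4 (λ a b c d → ((a :* d) :* c) :* b := a :* ((b :* c) :* d)) (num a) (den a) (num b) (den b))

  ι-injective : ∀ {a b} → ι a Q.≈ ι b → a ≈ b
  ι-injective (cross eq) = trans (sym (*-identityʳ _)) (trans eq (*-identityʳ _))

  open RingLemmas F.ring using (regular-cancel) public

module _ {c ℓ} {R : CommutativeRing c ℓ} where
  open CommutativeRing R
  open Relation.Binary.Reasoning.Setoid setoid

  invertible⇒regular : ∀ {a b} → a * b ≈ 1# → Regular R a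
  invertible⇒regular {a} {b} ab≈1 = mkRegular λ y ay≈0 → begin
    y           ≈⟨ *-identityˡ y ⟨
    1# * y      ≈⟨ *-congʳ (trans (*-comm b a) ab≈1) ⟨
    b * a * y   ≈⟨ *-assoc b a y ⟩
    b * (a * y) ≈⟨ *-congˡ ay≈0 ⟩
    b * 0#      ≈⟨ zeroʳ b ⟩
    0#          ∎

  regular-factor : ∀ {a b} → Regular R (a * b) → Regular R a
  regular-factor {a} {b} reg = mkRegular λ y ay≈0 → cancel reg y (begin
    a * b * y   ≈⟨ *-congʳ (*-comm a b) ⟩
    b * a * y   ≈⟨ *-assoc b a y ⟩
    b * (a * y) ≈⟨ *-congˡ ay≈0 ⟩
    b * 0#      ≈⟨ zeroʳ b ⟩
    0#          ∎)

module LaurentLemmas {c ℓ} (R : CommutativeRing c ℓ) (n : ℕ) where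
  open CommutativeRing R hiding (zero)
  private
    module L = Laurent R n
    module P = CommutativeRing L.ring
  open L using (Poly; coeff; monomial; const; coeffwise; at; ⟨_,_⟩)
  open Relation.Binary.Reasoning.Setoid setoid

  ⊖𝟎⊕ : ∀ {n} (μ : Vec ℤ n) → (⊖ 𝟎) ⊕ μ ≡ μ
  ⊖𝟎⊕ μ = ≡.trans (≡.cong ((⊖ 𝟎) ⊕_) (≡.sym (⊕-identityˡ μ))) (⊕-cancelˡ 𝟎 μ)

  coeff-+ : ∀ f g μ → coeff (f P.+ g) μ ≈ coeff f μ + coeff g μ
  coeff-+ f g μ = L.⟨⟩-add f g

  coeff-neg : ∀ f μ → coeff (P.- f) μ ≈ - coeff f μ
  coeff-neg f μ = L.⟨⟩-neg f

  coeff-term : ∀ a α f μ → coeff (((a , α) ∷ []) P.* f) μ ≈ a * coeff f ((⊖ α) ⊕ μ)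
  coeff-term a α f μ = trans (L.coeff-mul ((a , α) ∷ []) f μ) (+-identityʳ _)

  coeff-monomial-* : ∀ α f μ → coeff (monomial α P.* f) μ ≈ coeff f ((⊖ α) ⊕ μ)
  coeff-monomial-* α f μ = trans (coeff-term 1# α f μ) (*-identityˡ _)

  coeff-const-* : ∀ a f μ → coeff (const a P.* f) μ ≈ a * coeff f μ
  coeff-const-* a f μ = trans (coeff-term a 𝟎 f μ) (*-congˡ (reflexive (≡.cong (coeff f) (⊖𝟎⊕ μ))))

  δ-refl : ∀ μ → L.δ μ μ ≈ 1#
  δ-refl μ with μ ≟ᵉ μ
  ... | yes _  = refl
  ... | no μ≢μ = contradiction ≡.refl μ≢μ

  δ-≢ : ∀ {μ α} → α ≢ μ → L.δ μ α ≈ 0#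
  δ-≢ {μ} {α} α≢μ with α ≟ᵉ μ
  ... | yes α≡μ = contradiction α≡μ α≢μ
  ... | no _    = refl

  const-cong : ∀ {a b} → a ≈ b → const a P.≈ const b
  const-cong a≈b = coeffwise λ μ → +-congʳ (*-congʳ a≈b)

  const-+ : ∀ a b → const (a + b) P.≈ const a P.+ const b
  const-+ a b = coeffwise λ μ → trans (trans (+-identityʳ _) (distribʳ _ a b))
    (sym (trans (coeff-+ (const a) (const b) μ) (+-cong (+-identityʳ _) (+-identityʳ _))))

  const-* : ∀ a b → const (a * b) P.≈ const a P.* const b
  const-* a b = coeffwise λ μ → sym (trans (coeff-const-* a (const b) μ)
    (trans (*-congˡ (+-identityʳ _)) (trans (sym (*-assoc a b _)) (sym (+-identityʳ _)))))

  bounded : ∀ r f → ∃[ B ] (∀ ν → B ℤ.< lookup ν r → coeff f ν ≈ 0#)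
  bounded r []            = 0ℤ , λ _ _ → refl
  bounded r ((a , α) ∷ f) with bounded r f
  ... | B , vanish = lookup α r ℤ.⊔ B , λ ν lt → trans
    (+-cong (trans (*-congˡ (δ-≢ {ν} {α} λ { ≡.refl → ℤ.<-irrefl ≡.refl (ℤ.≤-<-trans (ℤ.i≤i⊔j (lookup α r) B) lt) })) (zeroʳ a))
            (vanish ν (ℤ.≤-<-trans (ℤ.i≤j⊔i (lookup α r) B) lt)))
    (+-identityˡ 0#)

  -- Climbing along a direction with positive r-th entry eventually leaves the support.
  climb : ∀ r f α → 0ℤ ℤ.< lookup α r → (Z : Vec ℤ n → Set) → (∀ ν → Z ν → Z (α ⊕ ν)) →
          (∀ ν → Z ν → coeff f (α ⊕ ν) ≈ 0# → coeff f ν ≈ 0#) → ∀ ν → Z ν → coeff f ν ≈ 0#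
  climb r f α α>0 Z Z-step back ν Zν with bounded r f
  ... | B , vanish = go (suc ℤ.∣ B ℤ.- lookup ν r ∣) ν Zν far
    where
    i≤∣i∣ : ∀ i → i ℤ.≤ + ℤ.∣ i ∣
    i≤∣i∣ (+ _)    = ℤ.≤-refl
    i≤∣i∣ -[1+ _ ] = ℤ.-≤+

    far : B ℤ.< + suc ℤ.∣ B ℤ.- lookup ν r ∣ ℤ.+ lookup ν r
    far = ≡.subst (ℤ._< + suc ℤ.∣ B ℤ.- lookup ν r ∣ ℤ.+ lookup ν r)
      (≡.trans (ℤ.+-assoc B _ _) (≡.trans (≡.cong (λ y → B ℤ.+ y) (ℤ.+-inverseˡ (lookup ν r))) (ℤ.+-identityʳ B)))
      (ℤ.+-monoˡ-< (lookup ν r) (ℤ.≤-<-trans (i≤∣i∣ (B ℤ.- lookup ν r)) (ℤ.+<+ ℕ.≤-refl)))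

    go : ∀ d ν → Z ν → B ℤ.< + d ℤ.+ lookup ν r → coeff f ν ≈ 0#
    go zero    ν Zν lt = vanish ν (≡.subst (B ℤ.<_) (ℤ.+-identityˡ _) lt)
    go (suc d) ν Zν lt = back ν Zν (go d (α ⊕ ν) (Z-step ν Zν) (ℤ.<-≤-trans lt (≡.subst₂ ℤ._≤_
      (≡.trans (≡.sym (ℤ.+-assoc (+ d) 1ℤ (lookup ν r))) (≡.cong (ℤ._+ lookup ν r) (ℤ.+-comm (+ d) 1ℤ)))
      (≡.cong (λ y → + d ℤ.+ y) (≡.sym (Vec.lookup-zipWith ℤ._+_ r α ν)))
      (ℤ.+-monoʳ-≤ (+ d) (ℤ.+-monoˡ-≤ (lookup ν r) (ℤ.i<j⇒suc[i]≤j α>0))))))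

  act-+ : ∀ w f g → L.act w (f P.+ g) P.≈ L.act w f P.+ L.act w g
  act-+ w f g = coeffwise λ μ → begin
    coeff (L.act w (f P.+ g)) μ                         ≈⟨ L.coeff-act w (f P.+ g) μ ⟩
    coeff (f P.+ g) (w ⁻¹ • μ)                          ≈⟨ coeff-+ f g _ ⟩
    coeff f (w ⁻¹ • μ) + coeff g (w ⁻¹ • μ)             ≈⟨ +-cong (L.coeff-act w f μ) (L.coeff-act w g μ) ⟨
    coeff (L.act w f) μ + coeff (L.act w g) μ           ≈⟨ coeff-+ (L.act w f) (L.act w g) μ ⟨
    coeff (L.act w f P.+ L.act w g) μ                   ∎

  act-resp : ∀ {w u} f → w Perm.≈ u → L.act w f P.≈ L.act u f
  act-resp {w} {u} f w≈u = coeffwise λ μ → trans (reflexive (L.⟨⟩-act w f _))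
    (trans (L.⟨⟩-cong f λ α → reflexive (≡.cong (L.δ μ) (•-cong {w = w} {u} w≈u α))) (sym (reflexive (L.⟨⟩-act u f _))))

  act-· : ∀ w u f → L.act (w · u) f P.≈ L.act w (L.act u f)
  act-· w u f = coeffwise λ μ → begin
    coeff (L.act (w · u) f) μ                  ≡⟨ L.⟨⟩-act (w · u) f _ ⟩
    ⟨ f , (λ α → L.δ μ ((w · u) • α)) ⟩        ≈⟨ L.⟨⟩-cong f (λ α → reflexive (≡.cong (L.δ μ) (•-· w u α))) ⟩
    ⟨ f , (λ α → L.δ μ (w • (u • α))) ⟩        ≡⟨ L.⟨⟩-act u f _ ⟨
    ⟨ L.act u f , (λ α → L.δ μ (w • α)) ⟩      ≡⟨ L.⟨⟩-act w (L.act u f) _ ⟨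
    coeff (L.act w (L.act u f)) μ              ∎

  act-id : ∀ f → L.act Perm.id f P.≈ f
  act-id f = coeffwise λ μ → trans (reflexive (L.⟨⟩-act Perm.id f _))
    (L.⟨⟩-cong f λ α → reflexive (≡.cong (L.δ μ) (•-id α)))

  act-const : ∀ w a → L.act w (const a) P.≈ const a
  act-const w a = P.reflexive (≡.cong (λ α → (a , α) ∷ []) (vec-ext λ i →
    ≡.trans (lookup-• w 𝟎 i) (≡.trans (Vec.lookup-replicate (w ⟨$⟩ˡ i) 0ℤ) (≡.sym (Vec.lookup-replicate i 0ℤ)))))

  act-variable : ∀ w i → L.act w (monomial (𝐞 i)) P.≈ monomial (𝐞 (w ⟨$⟩ʳ i))
  act-variable w i = P.reflexive (≡.cong monomial (vec-ext λ j → ≡.trans (lookup-• w (𝐞 i) j) (entry j (i Fin.≟ (w ⟨$⟩ˡ j)))))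
    where
    entry : ∀ j → Dec (i ≡ w ⟨$⟩ˡ j) → lookup (𝐞 i) (w ⟨$⟩ˡ j) ≡ lookup (𝐞 (w ⟨$⟩ʳ i)) j
    entry j (yes ≡.refl) = ≡.trans (lookup-𝐞-≡ (w ⟨$⟩ˡ j)) (≡.sym (≡.trans
      (≡.cong (λ a → lookup (𝐞 a) j) (Perm.inverseʳ w)) (lookup-𝐞-≡ j)))
    entry j (no i≢) = ≡.trans (lookup-𝐞-≢ i≢) (≡.sym (lookup-𝐞-≢ λ eq → i≢ (≡.trans (≡.sym (Perm.inverseˡ w)) (≡.cong (w ⟨$⟩ˡ_) eq))))

-- The coefficients of the expansions

module _ {c ℓ} (A : CommutativeRing c ℓ) {N : ℕ} where
  open CommutativeRing A hiding (zero)
  open IntegerSolver A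
  open Algebra.Properties.Semiring.Exp semiring using (_^_)
  open SymmetrizedProduct A {N} using (geometric; power)
  open Relation.Binary.Reasoning.Setoid setoid

  geometric-sum : ∀ α β k → (α + β) * geometric α β k ≈ α ^ k - power α β k
  geometric-sum α β zero    = solve 2 (λ a b → (a :+ b) :* con 0ℤ := con 1ℤ :- con 1ℤ) α β
  geometric-sum α β (suc k) = begin
    (α + β) * (α * geometric α β k + power α β k)
      ≈⟨ solve 4 (λ a b g p → (a :+ b) :* (a :* g :+ p) := a :* ((a :+ b) :* g) :+ (a :* p :+ b :* p)) α β (geometric α β k) (power α β k) ⟩
    α * ((α + β) * geometric α β k) + (α * power α β k + β * power α β k)
      ≈⟨ +-congʳ (*-congˡ (geometric-sum α β k)) ⟩
    α * (α ^ k - power α β k) + (α * power α β k + β * power α β k)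
      ≈⟨ solve 4 (λ a b e p → a :* (e :- p) :+ (a :* p :+ b :* p) := a :* e :- :- b :* p) α β (α ^ k) (power α β k) ⟩
    α * α ^ k - - β * power α β k ∎

-- A ring with elements q^a t^½b; in the theorem it is the field of fractions of 𝔽[q^±1,t^±½].
record Parameters {c ℓ} (R : CommutativeRing c ℓ) : Set (c ⊔ ℓ) where
  open CommutativeRing R
  infixl 7 _÷_[_]
  field
    qt         : ℤ → ℤ → Carrier
    qt-0       : qt 0ℤ 0ℤ ≈ 1#
    qt-*       : ∀ a b a′ b′ → qt a b * qt a′ b′ ≈ qt (a ℤ.+ a′) (b ℤ.+ b′)
    regular-qt : ∀ {a b a′ b′} → a ≢ a′ ⊎ b ≢ b′ → Regular R (qt a b - qt a′ b′)
    _÷_[_]     : ∀ a b → Regular R b → Carrier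
    ÷-*        : ∀ a b (reg : Regular R b) → (a ÷ b [ reg ]) * b ≈ a

module MacdonaldPolynomials {c ℓ₁} (𝕂 : CommutativeRing c ℓ₁) (parameters : Parameters 𝕂) (m : ℕ) where
  n : ℕ
  n = suc m

  module K = CommutativeRing 𝕂
  module X = Laurent 𝕂 n
  module P = CommutativeRing X.ring
  module Rational = Frac X.ring
  module Q = CommutativeRing Rational.ring
  open Parameters parameters
  open X using (coeff) renaming (const to C)
  open Rational using (ι)
  open Algebra.Properties.Semiring.Exp K.semiring using (_^_)
  open LaurentLemmas 𝕂 n
  private
    module FX = FractionLemmas X.ring
    module K-Reasoning = Relation.Binary.Reasoning.Setoid K.setoid
    module P-Reasoning = Relation.Binary.Reasoning.Setoid P.setoid
    module Q-Reasoning = Relation.Binary.Reasoning.Setoid Q.setoid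
    module SK = IntegerSolver 𝕂
    module SP = IntegerSolver X.ring
    module SQ = IntegerSolver Rational.ring
    module SPK = SymmetrizedProduct 𝕂 {n}
    module SPQ = SymmetrizedProduct Rational.ring {n}
    module ∑K = Fold K.+-commutativeMonoid
    module ∑P = Fold P.+-commutativeMonoid
    module ∑Q = Fold Q.+-commutativeMonoid
    module ∏K = Fold K.*-commutativeMonoid
    module ∏Q = Fold Q.*-commutativeMonoid
    module ∏Kᵖ = FoldPairs K.*-commutativeMonoid

    K : Set c
    K = K.Carrier

    K[X] : Set c
    K[X] = P.Carrier

    K⟨X⟩ : Set (c ⊔ ℓ₁)
    K⟨X⟩ = Q.Carrier

    infix 9 q^_ t^_
    q^_ t^_ : ℤ → K
    q^ a = qt a 0ℤ
    t^ b = qt 0ℤ (+ 2 ℤ.* b)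

    t½ t : K
    t½ = qt 0ℤ 1ℤ
    t  = t½ K.* t½

    qt[_,_,_] : Vec ℤ n → Fin n → Fin n → K
    qt[ μ , i , j ] = q^ (lookup μ i ℤ.- lookup μ j) K.* t^ (vᶻ μ i ℤ.- vᶻ μ j)

    x : Fin n → K[X]
    x i = X.monomial (𝐞 i)

    act : Permutation′ n → K⟨X⟩ → K⟨X⟩
    act w f = Rational.frac (X.act w (Rational.num f)) (X.act w (Rational.den f)) (X.regular-act w (Rational.regular f))

    regular-x-x : ∀ {i j} → i ≢ j → Regular X.ring (x i P.- x j)
    regular-x-x i≢j = X.regular-binomial (𝐞-injective i≢j)

    regular-1-qt : ∀ a {b} → b ≢ 0ℤ → Regular 𝕂 (K.1# K.- qt a b)
    regular-1-qt a b≢0 = regular-cong (K.+-congʳ qt-0) (regular-qt (inj₂ (b≢0 ∘ ≡.sym)))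

    regular-1-qt[] : ∀ μ {i j} → i ≢ j → Regular 𝕂 (K.1# K.- qt[ μ , i , j ])
    regular-1-qt[] μ {i} {j} i≢j = regular-cong
      (K.+-congˡ (K.-‿cong (K.sym (K.trans (qt-* _ _ _ _)
        (K.reflexive (≡.cong₂ qt (ℤ.+-identityʳ _) (ℤ.+-identityˡ _)))))))
      (regular-1-qt (lookup μ i ℤ.- lookup μ j) λ eq → i≢j (vᶻ-injective μ
        (ℤ.i-j≡0⇒i≡j _ _ (ℤ.*-cancelˡ-≡ (+ 2) _ 0ℤ eq))))

    descents : Vec ℤ n → List (Pair n)
    descents μ = List.filter (λ (pair i j _) → lookup μ j ℤ.<? lookup μ i) (pairs n)

    open RingLemmas 𝕂 using (regular-cancel)

  ÷-unique : ∀ {a b y} (reg : Regular 𝕂 b) → y K.* b K.≈ a → a ÷ b [ reg ] K.≈ y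
  ÷-unique {a} {b} reg eq = regular-cancel reg (K.trans (÷-* a b reg) (K.sym eq))

  module FieldAction where
    open Rational using (num; den; cross; frac)

    κ : K → K⟨X⟩
    κ a = ι (C a)

    κ-cong : ∀ {a b} → a K.≈ b → κ a Q.≈ κ b
    κ-cong a≈b = Rational.ι-cong (const-cong a≈b)

    κ-+ : ∀ a b → κ (a K.+ b) Q.≈ κ a Q.+ κ b
    κ-+ a b = Q.trans (Rational.ι-cong (const-+ a b)) (FX.ι-+ (C a) (C b))

    κ-* : ∀ a b → κ (a K.* b) Q.≈ κ a Q.* κ b
    κ-* a b = Q.trans (Rational.ι-cong (const-* a b)) (Q.sym (Rational.ι-* (C a) (C b)))

    κ-0 : κ K.0# Q.≈ Q.0#
    κ-0 = Rational.ι-cong (X.coeffwise λ μ → K.trans (K.+-identityʳ _) (K.zeroˡ _))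

    κ-neg : ∀ a → κ (K.- a) Q.≈ Q.- κ a
    κ-neg a = +-cancelʳ (κ a) _ _ (Q.trans (Q.sym (κ-+ (K.- a) a))
      (Q.trans (κ-cong (K.-‿inverseˡ a)) (Q.trans κ-0 (Q.sym (Q.-‿inverseˡ _)))))
      where open Algebra.Properties.Ring Q.ring using (+-cancelʳ)

    κ-- : ∀ a b → κ (a K.- b) Q.≈ κ a Q.- κ b
    κ-- a b = Q.trans (κ-+ a (K.- b)) (Q.+-congˡ (κ-neg b))

    κ-∑ : ∀ {a} {I : Set a} (is : List I) f → κ (∑ 𝕂 is f) Q.≈ ∑ Rational.ring is (κ ∘ f)
    κ-∑ = fold-homo K.+-commutativeMonoid Q.+-commutativeMonoid κ κ-0 κ-+

    ι-∑ : ∀ {a} {I : Set a} (is : List I) f → ι (∑ X.ring is f) Q.≈ ∑ Rational.ring is (ι ∘ f)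
    ι-∑ = fold-homo P.+-commutativeMonoid Q.+-commutativeMonoid ι Q.refl FX.ι-+

    regular-κ : ∀ {a} → Regular 𝕂 a → Regular Rational.ring (κ a)
    regular-κ {a} reg = invertible⇒regular {R = Rational.ring} {b = κ (K.1# ÷ a [ reg ])}
      (Q.trans (Q.sym (κ-* _ _)) (κ-cong (K.trans (K.*-comm _ _) (÷-* K.1# a reg))))

    act-cong : ∀ w {f g} → f Q.≈ g → act w f Q.≈ act w g
    act-cong w {f} {g} (cross eq) = cross (P.trans (P.sym (X.act-mul w (num f) (den g)))
      (P.trans (X.act-cong w eq) (X.act-mul w (num g) (den f))))

    opaque
      unfolding Frac.add Frac.mul

      act-Q+ : ∀ w f g → act w (f Q.+ g) Q.≈ act w f Q.+ act w g
      act-Q+ w f g = cross (P.*-cong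
        (P.trans (act-+ w _ _) (P.+-cong (X.act-mul w (num f) (den g)) (X.act-mul w (num g) (den f))))
        (P.sym (X.act-mul w (den f) (den g))))

      act-Q* : ∀ w f g → act w (f Q.* g) Q.≈ act w f Q.* act w g
      act-Q* w f g = cross (P.*-cong (X.act-mul w (num f) (num g)) (P.sym (X.act-mul w (den f) (den g))))

    act-ι : ∀ w f → act w (ι f) Q.≈ ι (X.act w f)
    act-ι w f = cross (P.*-congˡ (P.sym (act-const w K.1#)))

    x-tx-regular : ∀ {i j} → i ≢ j → Regular X.ring (x j P.- C t P.* x i)
    x-tx-regular {i} {j} i≢j = mkRegular λ f eq → X.coeffwise λ ν →
      climb j f (𝐞 j ⊕ ⊖ 𝐞 i) up (λ _ → ℤ.+ 0 ≡ ℤ.+ 0) (λ _ _ → ≡.refl) (λ ν _ → back f eq ν) ν ≡.refl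
      where
      open K-Reasoning

      up : 0ℤ ℤ.< lookup (𝐞 j ⊕ ⊖ 𝐞 i) j
      up = ≡.subst (0ℤ ℤ.<_) (≡.sym (≡.trans (Vec.lookup-zipWith ℤ._+_ j (𝐞 j) (⊖ 𝐞 i))
        (≡.cong₂ ℤ._+_ (lookup-𝐞-≡ j) (≡.trans (Vec.lookup-map j _ (𝐞 i)) (≡.cong (λ y → ℤ.- y) (lookup-𝐞-≢ i≢j))))))
        (ℤ.+<+ (ℕ.s≤s ℕ.z≤n))

      module _ (f : K[X]) (eq : (x j P.- C t P.* x i) P.* f P.≈ P.0#) (ν : Vec ℤ n) where
        shift : (⊖ 𝐞 i) ⊕ (𝐞 j ⊕ ν) ≡ (𝐞 j ⊕ ⊖ 𝐞 i) ⊕ ν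
        shift = ≡.trans (≡.sym (⊕-assoc (⊖ 𝐞 i) (𝐞 j) ν)) (≡.cong (_⊕ ν) (⊕-comm (⊖ 𝐞 i) (𝐞 j)))

        relation : coeff f ν K.- t K.* coeff f ((𝐞 j ⊕ ⊖ 𝐞 i) ⊕ ν) K.≈ K.0#
        relation = begin
          coeff f ν K.- t K.* coeff f ((𝐞 j ⊕ ⊖ 𝐞 i) ⊕ ν)
            ≡⟨ ≡.cong₂ (λ a b → coeff f a K.- t K.* coeff f b) (⊕-cancelˡ (𝐞 j) ν) shift ⟨
          coeff f ((⊖ 𝐞 j) ⊕ μ) K.- t K.* coeff f ((⊖ 𝐞 i) ⊕ μ)
            ≈⟨ K.+-cong (coeff-monomial-* (𝐞 j) f μ) (K.-‿cong (K.trans (coeff-const-* t (x i P.* f) μ) (K.*-congˡ (coeff-monomial-* (𝐞 i) f μ)))) ⟨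
          coeff (x j P.* f) μ K.- coeff (C t P.* (x i P.* f)) μ
            ≈⟨ K.+-congˡ (coeff-neg (C t P.* (x i P.* f)) μ) ⟨
          coeff (x j P.* f) μ K.+ coeff (P.- (C t P.* (x i P.* f))) μ
            ≈⟨ coeff-+ (x j P.* f) (P.- (C t P.* (x i P.* f))) μ ⟨
          coeff (x j P.* f P.- C t P.* (x i P.* f)) μ
            ≈⟨ X.at (SP.solve 4 (λ a c b f → a SP.:* f SP.:- c SP.:* (b SP.:* f) SP.:= (a SP.:- c SP.:* b) SP.:* f) (x j) (C t) (x i) f) μ ⟩
          coeff ((x j P.- C t P.* x i) P.* f) μ
            ≈⟨ X.at eq μ ⟩
          K.0# ∎
          where
          μ : Vec ℤ n
          μ = 𝐞 j ⊕ ν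

        back : coeff f ((𝐞 j ⊕ ⊖ 𝐞 i) ⊕ ν) K.≈ K.0# → coeff f ν K.≈ K.0#
        back zero-above = K.trans (RingLemmas.x-y≈0⇒x≈y 𝕂 relation) (K.trans (K.*-congˡ zero-above) (K.zeroʳ t))

    ι-- : ∀ a b → ι (a P.- b) Q.≈ ι a Q.- ι b
    ι-- a b = Q.sym (Rational.ι-- a b)

    action : Action Rational.ring m
    action = record
      { _▹_    = act
      ; ▹-cong = act-cong
      ; ▹-resp = λ {w} {u} f w≈u → cross (P.*-cong (act-resp {w} {u} (num f) w≈u) (P.sym (act-resp {w} {u} (den f) w≈u)))
      ; ▹-·    = λ w u f → cross (P.*-cong (act-· w u (num f)) (P.sym (act-· w u (den f))))
      ; ▹-id   = λ f → cross (P.*-cong (act-id (num f)) (P.sym (act-id (den f))))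
      ; ▹-+    = act-Q+
      ; ▹-*    = act-Q*
      ; ▹-1    = λ w → Q.trans (act-ι w P.1#) (Rational.ι-cong (act-const w K.1#))
      ; x      = λ i → ι (x i)
      ; ▹-x    = λ w i → Q.trans (act-ι w (x i)) (Rational.ι-cong (act-variable w i))
      ; t      = κ t
      ; ▹-t    = λ w → Q.trans (act-ι w (C t)) (Rational.ι-cong (act-const w t))
      ; recip  = λ i j → unlessEqual Q.0# (i Fin.≟ j) λ i≢j → frac P.1# (x i P.- x j) (regular-x-x i≢j)
      ; trecip = λ i j → unlessEqual Q.0# (i Fin.≟ j) λ i≢j → frac P.1# (x j P.- C t P.* x i) (x-tx-regular i≢j)
      ; x-recip = λ {i} {j} i≢j → unlessEqual-elim (λ r → (ι (x i) Q.- ι (x j)) Q.* r Q.≈ Q.1#) (i Fin.≟ j) _ i≢j λ i≢j →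
          Q.trans (Q.*-congʳ (Q.sym (ι-- (x i) (x j)))) (FX.recip-inverse (regular-x-x i≢j))
      ; x-trecip = λ {i} {j} i≢j → unlessEqual-elim (λ r → (ι (x j) Q.- κ t Q.* ι (x i)) Q.* r Q.≈ Q.1#) (i Fin.≟ j) _ i≢j λ i≢j →
          Q.trans (Q.*-congʳ (Q.sym (Q.trans (ι-- (x j) (C t P.* x i)) (Q.+-congˡ (Q.-‿cong (Q.sym (Rational.ι-* (C t) (x i))))))))
            (FX.recip-inverse (x-tx-regular i≢j))
      }

    κ-invariant : ∀ a w → act w (κ a) Q.≈ κ a
    κ-invariant a w = Q.trans (act-ι w (C a)) (Rational.ι-cong (act-const w a))

    t^-suc : ∀ a b → q^ a K.* t^ (1ℤ ℤ.+ b) K.≈ t K.* (q^ a K.* t^ b)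
    t^-suc a b = begin
      q^ a K.* t^ (1ℤ ℤ.+ b)
        ≈⟨ K.*-congˡ (K.reflexive (≡.cong (qt 0ℤ) (ℤSolver.solve 1 (λ b → ℤSolver.con (+ 2) ℤSolver.:* (ℤSolver.con 1ℤ ℤSolver.:+ b) ℤSolver.:= (ℤSolver.con 1ℤ ℤSolver.:+ ℤSolver.con 1ℤ) ℤSolver.:+ ℤSolver.con (+ 2) ℤSolver.:* b) b))) ⟩
      q^ a K.* qt 0ℤ ((1ℤ ℤ.+ 1ℤ) ℤ.+ + 2 ℤ.* b)
        ≈⟨ K.*-congˡ (K.trans (K.*-congʳ (qt-* 0ℤ 1ℤ 0ℤ 1ℤ)) (qt-* 0ℤ (1ℤ ℤ.+ 1ℤ) 0ℤ (+ 2 ℤ.* b))) ⟨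
      q^ a K.* (t K.* t^ b)
        ≈⟨ SK.solve 3 (λ q t b → q SK.:* (t SK.:* b) SK.:= t SK.:* (q SK.:* b)) (q^ a) t (t^ b) ⟩
      t K.* (q^ a K.* t^ b) ∎
      where
      open K-Reasoning

  open FieldAction
  open Action action using (_▹_; ▹-cong; recip; x-recip)
  module Symmetrizers = Hecke action
  module Orbits = OrbitSum action
  module Braids = Braid action

  module Coefficients where
    opaque
      -- (1 − t) Q/(1 − Q) with Q = q^(μ_i − μ_j) t^(v_μ(i) − v_μ(j)); junk for i = j
      B : Vec ℤ n → Fin n → Fin n → K
      B μ i j = unlessEqual K.0# (i Fin.≟ j) λ i≢j → (K.1# K.- t) K.* qt[ μ , i , j ] ÷ K.1# K.- qt[ μ , i , j ] [ regular-1-qt[] μ i≢j ]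

      B-eq : ∀ μ {i j} → i ≢ j → B μ i j K.* (K.1# K.- qt[ μ , i , j ]) K.≈ (K.1# K.- t) K.* qt[ μ , i , j ]
      B-eq μ {i} {j} i≢j = unlessEqual-elim (λ b → b K.* (K.1# K.- qt[ μ , i , j ]) K.≈ (K.1# K.- t) K.* qt[ μ , i , j ])
        (i Fin.≟ j) _ i≢j λ i≢j → ÷-* _ _ (regular-1-qt[] μ i≢j)

    B-transport : ∀ {μ ν} (w : Permutation′ n) → (∀ i → lookup ν (w ⟨$⟩ʳ i) ≡ lookup μ i) → (∀ i → vᶻ ν (w ⟨$⟩ʳ i) ≡ vᶻ μ i) →
      ∀ {i j} → i ≢ j → B ν (w ⟨$⟩ʳ i) (w ⟨$⟩ʳ j) K.≈ B μ i j
    B-transport {μ} {ν} w entries ranks {i} {j} i≢j = regular-cancel (regular-1-qt[] μ i≢j)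
      (K.trans (K.*-congˡ (K.+-congˡ (K.-‿cong (K.reflexive (≡.sym same))))) (K.trans (B-eq ν (i≢j ∘ perm-injective w))
        (K.trans (K.*-congˡ (K.reflexive same)) (K.sym (B-eq μ i≢j)))))
      where
      same : qt[ ν , w ⟨$⟩ʳ i , w ⟨$⟩ʳ j ] ≡ qt[ μ , i , j ]
      same = ≡.cong₂ (λ a b → q^ a K.* t^ b) (≡.cong₂ ℤ._-_ (entries i) (entries j)) (≡.cong₂ ℤ._-_ (ranks i) (ranks j))

    descent-factor ascent-factor : (K → K) → Vec ℤ n → Fin n → Fin n → K
    descent-factor f μ i j = ∏K.pick (lookup μ j ℤ.<? lookup μ i) (f (B μ i j))
    ascent-factor  f μ i j = ∏K.pick (lookup μ i ℤ.<? lookup μ j) (f (B μ j i))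

    descent-product ascent-product : (K → K) → Vec ℤ n → K
    descent-product f μ = ∏ 𝕂 (pairs n) λ (pair i j _) → descent-factor f μ i j
    ascent-product  f μ = ∏ 𝕂 (pairs n) λ (pair i j _) → ascent-factor f μ i j

    module _ (f : K → K) (f-cong : ∀ {a b} → a K.≈ b → f a K.≈ f b) where
      descent-product-list : ∀ μ (g : Pair n → K) → (∀ p → g p K.≈ f (B μ (Pair.fst p) (Pair.snd p))) →
        ∏ 𝕂 (descents μ) g K.≈ descent-product f μ
      descent-product-list μ g eq = K.trans (∏-cong {R = 𝕂} (descents μ) eq)
        (∏K.fold-filter (λ (pair i j _) → lookup μ j ℤ.<? lookup μ i) (pairs n) (λ p → f (B μ (Pair.fst p) (Pair.snd p))))

      module _ (k : Fin m) (μ : Vec ℤ n) (desc : lookup μ (suc k) ℤ.< lookup μ (inject₁ k)) where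
        private
          ν : Vec ℤ n
          ν = adj k • μ

          entries : ∀ i → lookup ν (adj k ⟨$⟩ʳ i) ≡ lookup μ i
          entries = lookup-•ʳ (adj k) μ

          ranks : ∀ i → vᶻ ν (adj k ⟨$⟩ʳ i) ≡ vᶻ μ i
          ranks = vᶻ-adj k μ (ℤ.<⇒≢ desc ∘ ≡.sym)

          others : ∀ (ψ : Vec ℤ n → Fin n → Fin n → K) → (∀ i j → i ≢ j → ψ ν (adj k ⟨$⟩ʳ i) (adj k ⟨$⟩ʳ j) K.≈ ψ μ i j) →
            ∏Kᵖ.other-pairs k (ψ μ) K.≈ ∏Kᵖ.other-pairs k (ψ ν)
          others ψ eq = K.trans (∏Kᵖ.other-pairs-cong k λ i j i<j → K.sym (eq i j (Fin.<⇒≢ i<j))) (∏Kᵖ.other-pairs-adj k (ψ ν))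

          asc : lookup ν (inject₁ k) ℤ.< lookup ν (suc k)
          asc = ≡.subst₂ ℤ._<_ (≡.sym (lookup-adj-lo k μ)) (≡.sym (lookup-adj-hi k μ)) desc

        private
          value-adj : ∀ i j → i ≢ j → f (B ν (adj k ⟨$⟩ʳ i) (adj k ⟨$⟩ʳ j)) K.≈ f (B μ i j)
          value-adj i j i≢j = f-cong (B-transport {μ} {ν} (adj k) entries ranks {i} {j} i≢j)

          descent-adj : ∀ i j → i ≢ j → descent-factor f ν (adj k ⟨$⟩ʳ i) (adj k ⟨$⟩ʳ j) K.≈ descent-factor f μ i j
          descent-adj i j i≢j = ∏K.pick-cong
            (lookup ν (adj k ⟨$⟩ʳ j) ℤ.<? lookup ν (adj k ⟨$⟩ʳ i)) (lookup μ j ℤ.<? lookup μ i)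
            (≡.subst₂ ℤ._<_ (entries j) (entries i)) (≡.subst₂ ℤ._<_ (≡.sym (entries j)) (≡.sym (entries i)))
            (f (B ν (adj k ⟨$⟩ʳ i) (adj k ⟨$⟩ʳ j))) (f (B μ i j)) λ _ → value-adj i j i≢j

          ascent-adj : ∀ i j → i ≢ j → ascent-factor f ν (adj k ⟨$⟩ʳ i) (adj k ⟨$⟩ʳ j) K.≈ ascent-factor f μ i j
          ascent-adj i j i≢j = ∏K.pick-cong
            (lookup ν (adj k ⟨$⟩ʳ i) ℤ.<? lookup ν (adj k ⟨$⟩ʳ j)) (lookup μ i ℤ.<? lookup μ j)
            (≡.subst₂ ℤ._<_ (entries i) (entries j)) (≡.subst₂ ℤ._<_ (≡.sym (entries i)) (≡.sym (entries j)))
            (f (B ν (adj k ⟨$⟩ʳ j) (adj k ⟨$⟩ʳ i))) (f (B μ j i)) λ _ → value-adj j i (i≢j ∘ ≡.sym)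

          b : K
          b = f (B μ (inject₁ k) (suc k))

          open K-Reasoning

        descent-product-step : descent-product f μ K.≈ f (B μ (inject₁ k) (suc k)) K.* descent-product f ν
        descent-product-step = begin
          descent-product f μ
            ≈⟨ ∏Kᵖ.fold-pairs-split k (descent-factor f μ) ⟩
          descent-factor f μ (inject₁ k) (suc k) K.* ∏Kᵖ.other-pairs k (descent-factor f μ)
            ≈⟨ K.*-cong (∏K.pick-yes (lookup μ (suc k) ℤ.<? lookup μ (inject₁ k)) b desc) (others (descent-factor f) descent-adj) ⟩
          b K.* ∏Kᵖ.other-pairs k (descent-factor f ν)
            ≈⟨ K.*-congˡ (K.*-identityˡ _) ⟨
          b K.* (K.1# K.* ∏Kᵖ.other-pairs k (descent-factor f ν))
            ≈⟨ K.*-congˡ (K.*-congʳ (∏K.pick-no (lookup ν (suc k) ℤ.<? lookup ν (inject₁ k)) (f (B ν (inject₁ k) (suc k))) (ℤ.<-asym asc))) ⟨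
          b K.* (descent-factor f ν (inject₁ k) (suc k) K.* ∏Kᵖ.other-pairs k (descent-factor f ν))
            ≈⟨ K.*-congˡ (∏Kᵖ.fold-pairs-split k (descent-factor f ν)) ⟨
          b K.* descent-product f ν ∎

        ascent-product-step : ascent-product f ν K.≈ f (B μ (inject₁ k) (suc k)) K.* ascent-product f μ
        ascent-product-step = begin
          ascent-product f ν
            ≈⟨ ∏Kᵖ.fold-pairs-split k (ascent-factor f ν) ⟩
          ascent-factor f ν (inject₁ k) (suc k) K.* ∏Kᵖ.other-pairs k (ascent-factor f ν)
            ≈⟨ K.*-cong (K.trans (∏K.pick-yes (lookup ν (inject₁ k) ℤ.<? lookup ν (suc k)) (f (B ν (suc k) (inject₁ k))) asc) top)
                 (K.sym (others (ascent-factor f) ascent-adj)) ⟩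
          b K.* ∏Kᵖ.other-pairs k (ascent-factor f μ)
            ≈⟨ K.*-congˡ (K.*-identityˡ _) ⟨
          b K.* (K.1# K.* ∏Kᵖ.other-pairs k (ascent-factor f μ))
            ≈⟨ K.*-congˡ (K.*-congʳ (∏K.pick-no (lookup μ (inject₁ k) ℤ.<? lookup μ (suc k)) (f (B μ (suc k) (inject₁ k))) (ℤ.<-asym desc))) ⟨
          b K.* (ascent-factor f μ (inject₁ k) (suc k) K.* ∏Kᵖ.other-pairs k (ascent-factor f μ))
            ≈⟨ K.*-congˡ (∏Kᵖ.fold-pairs-split k (ascent-factor f μ)) ⟨
          b K.* ascent-product f μ ∎
          where
          top : f (B ν (suc k) (inject₁ k)) K.≈ b
          top = K.trans (K.reflexive (≡.cong₂ (λ i j → f (B ν i j)) (≡.sym (adj-lo k)) (≡.sym (adj-hi k)))) (value-adj (inject₁ k) (suc k) (inject₁≢suc k))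

      ascent-product-decreasing : ∀ μ → WeaklyDecreasing μ → ascent-product f μ K.≈ K.1#
      ascent-product-decreasing μ dec = ∏-1 {R = 𝕂} (pairs n) λ (pair i j i<j) →
        ∏K.pick-no (lookup μ i ℤ.<? lookup μ j) _ λ lt → ℤ.<⇒≱ lt (dec (ℕ.<⇒≤ i<j))

      descent-product-increasing : ∀ μ → (∀ {i j} → i Fin.≤ j → lookup μ i ℤ.≤ lookup μ j) → descent-product f μ K.≈ K.1#
      descent-product-increasing μ inc = ∏-1 {R = 𝕂} (pairs n) λ (pair i j i<j) →
        ∏K.pick-no (lookup μ j ℤ.<? lookup μ i) _ λ lt → ℤ.<⇒≱ lt (inc (ℕ.<⇒≤ i<j))

    module _ (μ : Vec ℤ n) {i j : Fin n} (i≢j : i ≢ j) where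
      private
        Q b : K
        Q = qt[ μ , i , j ]
        b = B μ i j

        a e : ℤ
        a = lookup μ i ℤ.- lookup μ j
        e = vᶻ μ i ℤ.- vᶻ μ j

      symmetric-coefficient : ∀ (reg : Regular 𝕂 (K.1# K.- Q)) → t K.* ((K.1# K.- q^ a K.* t^ (e ℤ.- 1ℤ)) ÷ K.1# K.- q^ a K.* t^ e [ reg ]) K.≈ t K.- b
      symmetric-coefficient reg = regular-cancel reg (begin
        t K.* (num ÷ K.1# K.- Q [ reg ]) K.* (K.1# K.- Q)
          ≈⟨ K.trans (K.*-assoc _ _ _) (K.*-congˡ (÷-* num _ reg)) ⟩
        t K.* num
          ≈⟨ SK.solve 2 (λ t r → t SK.:* (SK.con 1ℤ SK.:- r) SK.:= t SK.:- t SK.:* r) t _ ⟩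
        t K.- t K.* (q^ a K.* t^ (e ℤ.- 1ℤ))
          ≈⟨ K.+-congˡ (K.-‿cong (K.trans (K.sym (t^-suc a (e ℤ.- 1ℤ))) (K.*-congˡ (K.reflexive (≡.cong t^_
               (ℤSolver.solve 1 (λ e → ℤSolver.con 1ℤ ℤSolver.:+ (e ℤSolver.:- ℤSolver.con 1ℤ) ℤSolver.:= e) e)))))) ⟩
        t K.- Q
          ≈⟨ SK.solve 2 (λ t Q → t SK.:- Q SK.:= t SK.:* (SK.con 1ℤ SK.:- Q) SK.:- (SK.con 1ℤ SK.:- t) SK.:* Q) t Q ⟩
        t K.* (K.1# K.- Q) K.- (K.1# K.- t) K.* Q
          ≈⟨ K.+-congˡ (K.-‿cong (B-eq μ i≢j)) ⟨
        t K.* (K.1# K.- Q) K.- b K.* (K.1# K.- Q)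
          ≈⟨ SK.solve 3 (λ t b r → t SK.:* r SK.:- b SK.:* r SK.:= (t SK.:- b) SK.:* r) t b _ ⟩
        (t K.- b) K.* (K.1# K.- Q) ∎)
        where
        open K-Reasoning
        num = K.1# K.- q^ a K.* t^ (e ℤ.- 1ℤ)

      antisymmetric-coefficient : ∀ (reg : Regular 𝕂 (K.1# K.- Q)) → (K.- K.1#) K.* ((K.1# K.- q^ a K.* t^ (e ℤ.+ 1ℤ)) ÷ K.1# K.- q^ a K.* t^ e [ reg ]) K.≈ K.- (K.1# K.+ b)
      antisymmetric-coefficient reg = regular-cancel reg (begin
        (K.- K.1#) K.* (num ÷ K.1# K.- Q [ reg ]) K.* (K.1# K.- Q)
          ≈⟨ K.trans (K.*-assoc _ _ _) (K.*-congˡ (÷-* num _ reg)) ⟩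
        (K.- K.1#) K.* num
          ≈⟨ K.*-congˡ (K.+-congˡ (K.-‿cong (K.trans (K.*-congˡ (K.reflexive (≡.cong t^_ (ℤ.+-comm e 1ℤ)))) (t^-suc a e)))) ⟩
        (K.- K.1#) K.* (K.1# K.- t K.* Q)
          ≈⟨ SK.solve 2 (λ t Q → (SK.:- SK.con 1ℤ) SK.:* (SK.con 1ℤ SK.:- t SK.:* Q)
               SK.:= SK.:- ((SK.con 1ℤ SK.:- Q) SK.:+ (SK.con 1ℤ SK.:- t) SK.:* Q)) t Q ⟩
        K.- ((K.1# K.- Q) K.+ (K.1# K.- t) K.* Q)
          ≈⟨ K.-‿cong (K.+-congˡ (B-eq μ i≢j)) ⟨
        K.- ((K.1# K.- Q) K.+ b K.* (K.1# K.- Q))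
          ≈⟨ SK.solve 2 (λ b r → SK.:- (r SK.:+ b SK.:* r) SK.:= (SK.:- (SK.con 1ℤ SK.:+ b)) SK.:* r) b _ ⟩
        (K.- (K.1# K.+ b)) K.* (K.1# K.- Q) ∎)
        where
        open K-Reasoning
        num = K.1# K.- q^ a K.* t^ (e ℤ.+ 1ℤ)

      -- 1 + B = (1 − tQ)/(1 − Q) and B − t = (Q − t)/(1 − Q)
      regular-1+B : lookup μ j ℤ.< lookup μ i → Regular 𝕂 (K.1# K.+ b)
      regular-1+B lt = regular-factor {R = 𝕂} (regular-cong (K.sym (begin
        (K.1# K.+ b) K.* (K.1# K.- Q)
          ≈⟨ SK.solve 2 (λ b r → (SK.con 1ℤ SK.:+ b) SK.:* r SK.:= r SK.:+ b SK.:* r) b _ ⟩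
        (K.1# K.- Q) K.+ b K.* (K.1# K.- Q)
          ≈⟨ K.+-congˡ (B-eq μ i≢j) ⟩
        (K.1# K.- Q) K.+ (K.1# K.- t) K.* Q
          ≈⟨ SK.solve 2 (λ t Q → (SK.con 1ℤ SK.:- Q) SK.:+ (SK.con 1ℤ SK.:- t) SK.:* Q SK.:= SK.con 1ℤ SK.:- t SK.:* Q) t Q ⟩
        K.1# K.- t K.* Q
          ≈⟨ K.+-congˡ (K.-‿cong (K.trans (K.*-cong (qt-* 0ℤ 1ℤ 0ℤ 1ℤ) (qt-* a 0ℤ 0ℤ (+ 2 ℤ.* e))) (qt-* 0ℤ (1ℤ ℤ.+ 1ℤ) (a ℤ.+ 0ℤ) (0ℤ ℤ.+ + 2 ℤ.* e)))) ⟩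
        K.1# K.- qt (0ℤ ℤ.+ (a ℤ.+ 0ℤ)) ((1ℤ ℤ.+ 1ℤ) ℤ.+ (0ℤ ℤ.+ + 2 ℤ.* e))
          ≈⟨ K.+-congʳ qt-0 ⟨
        qt 0ℤ 0ℤ K.- qt (0ℤ ℤ.+ (a ℤ.+ 0ℤ)) ((1ℤ ℤ.+ 1ℤ) ℤ.+ (0ℤ ℤ.+ + 2 ℤ.* e)) ∎)) (regular-qt (inj₁ λ eq → ℤ.<⇒≢ lt (≡.sym (ℤ.i-j≡0⇒i≡j _ _
          (≡.trans (ℤSolver.solve 1 (λ a → a ℤSolver.:= ℤSolver.con 0ℤ ℤSolver.:+ (a ℤSolver.:+ ℤSolver.con 0ℤ)) a) (≡.sym eq)))))))
        where open K-Reasoning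

      regular-B-t : lookup μ j ℤ.< lookup μ i → Regular 𝕂 (b K.- t)
      regular-B-t lt = regular-factor {R = 𝕂} (regular-cong (K.sym (begin
        (b K.- t) K.* (K.1# K.- Q)
          ≈⟨ SK.solve 3 (λ b t r → (b SK.:- t) SK.:* r SK.:= b SK.:* r SK.:- t SK.:* r) b t _ ⟩
        b K.* (K.1# K.- Q) K.- t K.* (K.1# K.- Q)
          ≈⟨ K.+-congʳ (B-eq μ i≢j) ⟩
        (K.1# K.- t) K.* Q K.- t K.* (K.1# K.- Q)
          ≈⟨ SK.solve 2 (λ t Q → (SK.con 1ℤ SK.:- t) SK.:* Q SK.:- t SK.:* (SK.con 1ℤ SK.:- Q) SK.:= Q SK.:- t) t Q ⟩
        Q K.- t
          ≈⟨ K.+-cong (qt-* a 0ℤ 0ℤ (+ 2 ℤ.* e)) (K.-‿cong (qt-* 0ℤ 1ℤ 0ℤ 1ℤ)) ⟩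
        qt (a ℤ.+ 0ℤ) (0ℤ ℤ.+ + 2 ℤ.* e) K.- qt (0ℤ ℤ.+ 0ℤ) (1ℤ ℤ.+ 1ℤ) ∎)) (regular-qt (inj₁ λ eq → ℤ.<⇒≢ lt (≡.sym (ℤ.i-j≡0⇒i≡j _ _
          (≡.trans (≡.sym (ℤ.+-identityʳ a)) eq))))))
        where open K-Reasoning

    private
      power-t : ∀ k → SPK.power K.1# (K.- t) k K.≈ qt 0ℤ (+ 2 ℤ.* + k)
      power-t zero    = K.sym qt-0
      power-t (suc k) = K.trans (K.*-cong (K.trans (SK.solve 1 (λ t → SK.:- (SK.:- t) SK.:= t) t) (qt-* 0ℤ 1ℤ 0ℤ 1ℤ)) (power-t k))
        (K.trans (qt-* 0ℤ (1ℤ ℤ.+ 1ℤ) 0ℤ (+ 2 ℤ.* + k)) (K.reflexive (≡.cong (qt 0ℤ)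
          (ℤSolver.solve 1 (λ k → (ℤSolver.con 1ℤ ℤSolver.:+ ℤSolver.con 1ℤ) ℤSolver.:+ ℤSolver.con (+ 2) ℤSolver.:* k ℤSolver.:= ℤSolver.con (+ 2) ℤSolver.:* (ℤSolver.con 1ℤ ℤSolver.:+ k)) (+ k)))))

      regular-1-power : ∀ k → Regular 𝕂 (K.1# K.- SPK.power K.1# (K.- t) (suc k))
      regular-1-power k = regular-cong (K.+-congˡ (K.-‿cong (K.sym (power-t (suc k))))) (regular-1-qt 0ℤ λ ())

      1^ : ∀ k → K.1# ^ k K.≈ K.1#
      1^ zero    = K.refl
      1^ (suc k) = K.trans (K.*-identityˡ _) (1^ k)

      regular-geometric : ∀ k → Regular 𝕂 (SPK.geometric K.1# (K.- t) (suc k))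
      regular-geometric k = regular-factor {R = 𝕂} (regular-cong (K.trans
        (K.+-congʳ (K.sym (1^ (suc k)))) (K.trans (K.sym (geometric-sum 𝕂 {n} K.1# (K.- t) (suc k))) (K.*-comm _ _)))
        (regular-1-power k))

      -- (−t)^k − (−1)^k is (−1)^k (t^k − 1).
      signed-power : ∀ k → ((K.- t) ^ k K.- SPK.power (K.- t) K.1# k) K.* SPK.power (K.- t) K.1# k K.≈ SPK.power K.1# (K.- t) k K.- K.1#
      signed-power k = K.trans (SK.solve 2 (λ e p → (e SK.:- p) SK.:* p SK.:= e SK.:* p SK.:- p SK.:* p) ((K.- t) ^ k) (SPK.power (K.- t) K.1# k))
        (K.+-cong (fst k) (K.-‿cong (snd k)))
        where
        fst : ∀ k → (K.- t) ^ k K.* SPK.power (K.- t) K.1# k K.≈ SPK.power K.1# (K.- t) k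
        fst zero    = K.*-identityˡ _
        fst (suc k) = K.trans (SK.solve 3 (λ t e p → (SK.:- t SK.:* e) SK.:* (SK.:- SK.con 1ℤ SK.:* p) SK.:= SK.:- (SK.:- t) SK.:* (e SK.:* p)) t _ _) (K.*-congˡ (fst k))

        snd : ∀ k → SPK.power (K.- t) K.1# k K.* SPK.power (K.- t) K.1# k K.≈ K.1#
        snd zero    = K.*-identityˡ _
        snd (suc k) = K.trans (SK.solve 1 (λ p → (SK.:- SK.con 1ℤ SK.:* p) SK.:* (SK.:- SK.con 1ℤ SK.:* p) SK.:= p SK.:* p) _) (snd k)

      regular-geometric′ : ∀ k → Regular 𝕂 (SPK.geometric (K.- t) K.1# (suc k))
      regular-geometric′ k = regular-factor {R = 𝕂} {b = K.- t K.+ K.1#} (regular-factor {R = 𝕂}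
        (regular-cong (K.sym (K.trans (K.*-congʳ (K.trans (K.*-comm _ _) (geometric-sum 𝕂 {n} (K.- t) K.1# (suc k)))) (signed-power (suc k))))
          (mkRegular λ y eq → cancel (regular-1-power k) y (K.trans
            (SK.solve 2 (λ p y → (SK.con 1ℤ SK.:- p) SK.:* y SK.:= SK.:- ((p SK.:- SK.con 1ℤ) SK.:* y)) _ y)
            (K.trans (K.-‿cong eq) (SK.solve 0 (SK.:- SK.con 0ℤ SK.:= SK.con 0ℤ)))))))

    regular-symmetric : ∀ k → Regular 𝕂 (SPK.geometric! K.1# (K.- t) k)
    regular-symmetric zero    = regular-1
    regular-symmetric (suc k) = regular-* (regular-geometric k) (regular-symmetric k)

    regular-antisymmetric : ∀ k → Regular 𝕂 (SPK.geometric! (K.- t) K.1# k)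
    regular-antisymmetric zero    = regular-1
    regular-antisymmetric (suc k) = regular-* (regular-geometric′ k) (regular-antisymmetric k)

    κ-geometric! : ∀ a b k → κ (SPK.geometric! a b k) Q.≈ SPQ.geometric! (κ a) (κ b) k
    κ-geometric! a b zero    = Q.refl
    κ-geometric! a b (suc k) = Q.trans (κ-* _ _) (Q.*-cong (κ-geometric (suc k)) (κ-geometric! a b k))
      where
      κ-power : ∀ k → κ (SPK.power a b k) Q.≈ SPQ.power (κ a) (κ b) k
      κ-power zero    = Q.refl
      κ-power (suc k) = Q.trans (κ-* _ _) (Q.*-cong (κ-neg b) (κ-power k))

      κ-geometric : ∀ k → κ (SPK.geometric a b k) Q.≈ SPQ.geometric (κ a) (κ b) k
      κ-geometric zero    = κ-0
      κ-geometric (suc k) = Q.trans (κ-+ _ _) (Q.+-cong (Q.trans (κ-* _ _) (Q.*-congˡ (κ-geometric k))) (κ-power k))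

    SPQ-cong : ∀ {a a′ b b′} k → a Q.≈ a′ → b Q.≈ b′ → SPQ.geometric! a b k Q.≈ SPQ.geometric! a′ b′ k
    SPQ-cong zero    eq eq′ = Q.refl
    SPQ-cong {a} {a′} {b} {b′} (suc k) eq eq′ = Q.*-cong (geometric-cong (suc k)) (SPQ-cong k eq eq′)
      where
      power-cong : ∀ k → SPQ.power a b k Q.≈ SPQ.power a′ b′ k
      power-cong zero    = Q.refl
      power-cong (suc k) = Q.*-cong (Q.-‿cong eq′) (power-cong k)

      geometric-cong : ∀ k → SPQ.geometric a b k Q.≈ SPQ.geometric a′ b′ k
      geometric-cong zero    = Q.refl
      geometric-cong (suc k) = Q.+-cong (Q.*-cong eq (geometric-cong k)) (power-cong k)

  open Coefficients

  twist : K[X] → K[X]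
  twist = List.map (λ (a , α) → (a K.* q^ (ℤ.- Vec.last α) , Vec.last α ∷ Vec.init α))

  record Electronic (E : Vec ℤ n → K[X]) : Set (c ⊔ ℓ₁) where
    field
      E0 : E 𝟎 P.≈ P.1#
      E1 : ∀ μ → E (Vec.last μ ℤ.+ 1ℤ ∷ Vec.init μ) P.≈ C (q^ Vec.last μ) P.* x zero P.* twist (E μ)
      E2 : ∀ μ k → (∀ r → 0ℤ ℤ.≤ lookup μ r) → lookup μ (suc k) ℤ.< lookup μ (inject₁ k) →
           ∃[ b ] ∃[ reg ]
             let Q = qt[ μ , inject₁ k , suc k ]
                 ∂ = λ f → Rational.frac (f P.- X.act (adj k) f) (x (inject₁ k) P.- x (suc k)) reg
             in b K.* (K.1# K.- Q) K.≈ (K.1# K.- t) K.* Q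
              × ι (E (adj k • μ)) Q.≈ ∂ (x (inject₁ k) P.* E μ) Q.- ι (C t P.* x (inject₁ k)) Q.* ∂ (E μ) Q.+ ι (C b P.* E μ)
      E3 : ∀ μ → E (Vec.map (ℤ._- 1ℤ) μ) P.≈ X.monomial (Vec.replicate n -1ℤ) P.* E μ

  module ElectronicPolynomials (E : Vec ℤ n → K[X]) (electronic : Electronic E) where
    open Electronic electronic

    module ElectronicRelations where
      open Symmetrizers hiding (s; Δ; N; V; δ; ν)

      spectral : Fin m → Vec ℤ n → K
      spectral k μ = qt[ μ , inject₁ k , suc k ]

      β : Fin m → Vec ℤ n → K
      β k μ = (K.1# K.- t) K.* spectral k μ ÷ K.1# K.- spectral k μ [ regular-1-qt[] μ (inject₁≢suc k) ]

      β-eq : ∀ k μ → β k μ K.* (K.1# K.- spectral k μ) K.≈ (K.1# K.- t) K.* spectral k μ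
      β-eq k μ = ÷-* _ _ (regular-1-qt[] μ (inject₁≢suc k))

      β-unique : ∀ k μ {y} → y K.* (K.1# K.- spectral k μ) K.≈ (K.1# K.- t) K.* spectral k μ → β k μ K.≈ y
      β-unique k μ = ÷-unique (regular-1-qt[] μ (inject₁≢suc k))

      coefficient : Fin m → Vec ℤ n → K[X]
      coefficient k μ = (P.1# P.- C t P.+ C (β k μ)) P.* x (inject₁ k) P.- C (β k μ) P.* x (suc k)

      Relation : Fin m → Vec ℤ n → Set ℓ₁
      Relation k μ = (x (inject₁ k) P.- x (suc k)) P.* E (adj k • μ)
        P.≈ coefficient k μ P.* E μ P.+ (C t P.* x (inject₁ k) P.- x (suc k)) P.* X.act (adj k) (E μ)

      private
        act-x* : ∀ k f → X.act (adj k) (x (inject₁ k) P.* f) P.≈ x (suc k) P.* X.act (adj k) f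
        act-x* k f = P.trans (X.act-mul (adj k) (x (inject₁ k)) f)
          (P.*-congʳ (P.trans (act-variable (adj k) (inject₁ k)) (P.reflexive (≡.cong x (adj-lo k)))))

        relation-nonnegative : ∀ k μ → Nonnegative μ → lookup μ (suc k) ℤ.< lookup μ (inject₁ k) → Relation k μ
        relation-nonnegative k μ nn desc = P.trans cleared (P.trans (P.+-congʳ (P.+-congʳ (P.+-congˡ (P.-‿cong (act-x* k (E μ))))))
          (SP.solve 6 (λ l h e e′ t b → (l SP.:* e SP.:- h SP.:* e′) SP.:- t SP.:* l SP.:* (e SP.:- e′) SP.:+ (l SP.:- h) SP.:* (b SP.:* e)
            SP.:= ((SP.con 1ℤ SP.:- t SP.:+ b) SP.:* l SP.:- b SP.:* h) SP.:* e SP.:+ (t SP.:* l SP.:- h) SP.:* e′) y₁ y₂ (E μ) (X.act (adj k) (E μ)) (C t) (C (β k μ))))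
          where
          y₁ y₂ d F G H : K[X]
          y₁ = x (inject₁ k)
          y₂ = x (suc k)
          d  = y₁ P.- y₂
          F  = y₁ P.* E μ P.- X.act (adj k) (y₁ P.* E μ)
          G  = E μ P.- X.act (adj k) (E μ)
          H  = C (β k μ) P.* E μ

          b : K
          b = proj₁ (E2 μ k nn desc)

          reg : Regular X.ring d
          reg = proj₁ (proj₂ (E2 μ k nn desc))

          E-adj : b K.* (K.1# K.- spectral k μ) K.≈ (K.1# K.- t) K.* spectral k μ
            × ι (E (adj k • μ)) Q.≈ Rational.frac F d reg Q.- ι (C t P.* y₁) Q.* Rational.frac G d reg Q.+ ι (C b P.* E μ)
          E-adj = proj₂ (proj₂ (E2 μ k nn desc))

          r : K⟨X⟩
          r = Rational.frac P.1# d reg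

          cleared : d P.* E (adj k • μ) P.≈ F P.- C t P.* y₁ P.* G P.+ d P.* H
          cleared = FX.ι-injective (begin
            ι (d P.* E (adj k • μ))
              ≈⟨ Rational.ι-* d _ ⟨
            ι d Q.* ι (E (adj k • μ))
              ≈⟨ Q.*-congˡ (Q.trans (proj₂ E-adj) (Q.+-congˡ (Rational.ι-cong (P.*-congʳ (const-cong (K.sym (β-unique k μ (proj₁ E-adj)))))))) ⟩
            ι d Q.* (Rational.frac F d reg Q.- ι (C t P.* y₁) Q.* Rational.frac G d reg Q.+ ι H)
              ≈⟨ Q.*-congˡ (Q.+-congʳ (Q.+-cong (FX.frac-split F reg) (Q.-‿cong (Q.*-congˡ (FX.frac-split G reg))))) ⟩
            ι d Q.* (ι F Q.* r Q.- ι (C t P.* y₁) Q.* (ι G Q.* r) Q.+ ι H)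
              ≈⟨ SQ.solve 6 (λ d f r g h c → d SQ.:* (f SQ.:* r SQ.:- c SQ.:* (g SQ.:* r) SQ.:+ h)
                   SQ.:= (f SQ.:- c SQ.:* g) SQ.:* (d SQ.:* r) SQ.:+ d SQ.:* h) (ι d) (ι F) r (ι G) (ι H) (ι (C t P.* y₁)) ⟩
            (ι F Q.- ι (C t P.* y₁) Q.* ι G) Q.* (ι d Q.* r) Q.+ ι d Q.* ι H
              ≈⟨ Q.+-cong (Q.trans (Q.*-congˡ (FX.recip-inverse reg)) (Q.*-identityʳ _)) (Rational.ι-* d H) ⟩
            ι F Q.- ι (C t P.* y₁) Q.* ι G Q.+ ι (d P.* H)
              ≈⟨ Q.+-congʳ (Q.trans (Q.+-congˡ (Q.-‿cong (Rational.ι-* _ G))) (Q.sym (ι-- F _))) ⟩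
            ι (F P.- C t P.* y₁ P.* G) Q.+ ι (d P.* H)
              ≈⟨ FX.ι-+ _ _ ⟨
            ι (F P.- C t P.* y₁ P.* G P.+ d P.* H) ∎)
            where open Q-Reasoning

        spectral-pred* : ∀ μ i j → qt[ pred* μ , i , j ] ≡ qt[ μ , i , j ]
        spectral-pred* μ i j = ≡.cong₂ (λ a b → q^ a K.* t^ b)
          (≡.trans (≡.cong₂ ℤ._-_ (Vec.lookup-map i _ μ) (Vec.lookup-map j _ μ))
            (solve 2 (λ a b → (a :- con 1ℤ) :- (b :- con 1ℤ) := a :- b) (lookup μ i) (lookup μ j)))
          (≡.cong₂ ℤ._-_ (v-pred i) (v-pred j))
          where
          open ℤSolver
          v-pred : ∀ r → vᶻ (pred* μ) r ≡ vᶻ μ r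
          v-pred = vᶻ-map (ℤ._- 1ℤ) (ℤ.+-monoˡ-≤ -1ℤ) (λ {a} {b} le → ≡.subst₂ ℤ._≤_
            (solve 1 (λ a → (a :- con 1ℤ) :+ con 1ℤ := a) a) (solve 1 (λ a → (a :- con 1ℤ) :+ con 1ℤ := a) b)
            (ℤ.+-monoˡ-≤ 1ℤ le)) μ

        -𝟏 : Vec ℤ n
        -𝟏 = Vec.replicate n -1ℤ

        act-monomial-𝟏 : ∀ w → X.act w (X.monomial -𝟏) ≡ X.monomial -𝟏
        act-monomial-𝟏 w = ≡.cong X.monomial (vec-ext λ i → ≡.trans (lookup-• w -𝟏 i)
          (≡.trans (Vec.lookup-replicate (w ⟨$⟩ˡ i) -1ℤ) (≡.sym (Vec.lookup-replicate i -1ℤ))))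

        adj-pred* : ∀ k (μ : Vec ℤ n) → adj k • pred* μ ≡ pred* (adj k • μ)
        adj-pred* k μ = vec-ext λ i → ≡.trans (lookup-• (adj k) (pred* μ) i) (≡.trans (Vec.lookup-map (adj k ⟨$⟩ˡ i) _ μ)
          (≡.sym (≡.trans (Vec.lookup-map i _ (adj k • μ)) (≡.cong (ℤ._- 1ℤ) (lookup-• (adj k) μ i)))))

      act-E-pred* : ∀ w μ → X.act w (E (pred* μ)) P.≈ X.monomial -𝟏 P.* X.act w (E μ)
      act-E-pred* w μ = P.trans (X.act-cong w (E3 μ)) (P.trans (X.act-mul w (X.monomial -𝟏) (E μ))
        (P.*-congʳ (P.reflexive (act-monomial-𝟏 w))))

      E-pred* : ∀ μ → E (pred* μ) P.≈ X.monomial -𝟏 P.* E μ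
      E-pred* = E3

      β-cong : ∀ k {μ ν} → spectral k μ K.≈ spectral k ν → β k μ K.≈ β k ν
      β-cong k {μ} {ν} eq = β-unique k μ (K.trans (K.*-congˡ (K.+-congˡ (K.-‿cong eq)))
        (K.trans (β-eq k ν) (K.*-congˡ (K.sym eq))))

      relation : ∀ k μ → lookup μ (suc k) ℤ.< lookup μ (inject₁ k) → Relation k μ
      relation k = decrement-induction (λ μ → lookup μ (suc k) ℤ.< lookup μ (inject₁ k) → Relation k μ)
        (relation-nonnegative k) λ μ rel desc → begin
          d P.* E (adj k • pred* μ)
            ≡⟨ ≡.cong (λ ν → d P.* E ν) (adj-pred* k μ) ⟩
          d P.* E (pred* (adj k • μ))
            ≈⟨ P.*-congˡ (E3 (adj k • μ)) ⟩
          d P.* (M P.* E (adj k • μ))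
            ≈⟨ SP.solve 3 (λ d M e → d SP.:* (M SP.:* e) SP.:= M SP.:* (d SP.:* e)) d M (E (adj k • μ)) ⟩
          M P.* (d P.* E (adj k • μ))
            ≈⟨ P.*-congˡ (rel (descent μ desc)) ⟩
          M P.* (coefficient k μ P.* E μ P.+ e P.* X.act (adj k) (E μ))
            ≈⟨ SP.solve 5 (λ M a f e g → M SP.:* (a SP.:* f SP.:+ e SP.:* g) SP.:= a SP.:* (M SP.:* f) SP.:+ e SP.:* (M SP.:* g))
                 M (coefficient k μ) (E μ) e (X.act (adj k) (E μ)) ⟩
          coefficient k μ P.* (M P.* E μ) P.+ e P.* (M P.* X.act (adj k) (E μ))
            ≈⟨ P.+-cong (P.*-cong (same-coefficient μ) (E3 μ)) (P.*-congˡ (act-E-pred* (adj k) μ)) ⟨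
          coefficient k (pred* μ) P.* E (pred* μ) P.+ e P.* X.act (adj k) (E (pred* μ)) ∎
        where
        open P-Reasoning

        d e M : K[X]
        d = x (inject₁ k) P.- x (suc k)
        e = C t P.* x (inject₁ k) P.- x (suc k)
        M = X.monomial -𝟏

        descent : ∀ μ → lookup (pred* μ) (suc k) ℤ.< lookup (pred* μ) (inject₁ k) → lookup μ (suc k) ℤ.< lookup μ (inject₁ k)
        descent μ lt = ℤ.≰⇒> λ le → ℤ.<⇒≱ lt (≡.subst₂ ℤ._≤_ (≡.sym (Vec.lookup-map (inject₁ k) _ μ)) (≡.sym (Vec.lookup-map (suc k) _ μ)) (ℤ.+-monoˡ-≤ -1ℤ le))

        same-coefficient : ∀ μ → coefficient k (pred* μ) P.≈ coefficient k μ
        same-coefficient μ = P.+-cong (P.*-congʳ (P.+-congˡ Cβ)) (P.-‿cong (P.*-congʳ Cβ))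
          where
          Cβ : C (β k (pred* μ)) P.≈ C (β k μ)
          Cβ = const-cong (β-cong k {pred* μ} {μ} (K.reflexive (spectral-pred* μ (inject₁ k) (suc k))))

      E-step : ∀ k μ → lookup μ (suc k) ℤ.< lookup μ (inject₁ k) → ι (E (adj k • μ)) Q.≈ step k (κ (β k μ)) (ι (E μ))
      E-step k μ desc = begin
        ι (E (adj k • μ))
          ≈⟨ Q.trans (Q.sym (Q.*-identityʳ _)) (Q.*-congˡ (Q.sym ([xₗ-xₕ]u k))) ⟩
        ι (E (adj k • μ)) Q.* ((xₗ k Q.- xₕ k) Q.* u k)
          ≈⟨ SQ.solve 3 (λ e d u → e SQ.:* (d SQ.:* u) SQ.:= (d SQ.:* e) SQ.:* u) _ _ _ ⟩
        ((xₗ k Q.- xₕ k) Q.* ι (E (adj k • μ))) Q.* u k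
          ≈⟨ Q.*-congʳ (Q.trans (Q.*-congʳ (Q.sym (ι-- _ _))) (Q.trans (Rational.ι-* _ _) (Rational.ι-cong (relation k μ desc)))) ⟩
        ι (coefficient k μ P.* E μ P.+ (C t P.* x (inject₁ k) P.- x (suc k)) P.* X.act (adj k) (E μ)) Q.* u k
          ≈⟨ Q.*-congʳ (Q.trans (FX.ι-+ _ _) (Q.+-cong
               (Q.trans (Q.sym (Rational.ι-* _ _)) (Q.*-congʳ ι-coefficient))
               (Q.trans (Q.sym (Rational.ι-* _ _)) (Q.*-cong (Q.trans (ι-- _ _) (Q.+-congʳ (Q.sym (Rational.ι-* _ _)))) (Q.sym (act-ι (adj k) (E μ))))))) ⟩
        (((Q.1# Q.- κ t Q.+ κ (β k μ)) Q.* xₗ k Q.- κ (β k μ) Q.* xₕ k) Q.* ι (E μ)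
          Q.+ (κ t Q.* xₗ k Q.- xₕ k) Q.* act (adj k) (ι (E μ))) Q.* u k
          ≈⟨ SQ.solve 5 (λ a f b g u → (a SQ.:* f SQ.:+ b SQ.:* g) SQ.:* u SQ.:= a SQ.:* u SQ.:* f SQ.:+ b SQ.:* u SQ.:* g) _ _ _ _ _ ⟩
        step k (κ (β k μ)) (ι (E μ)) ∎
        where
        open Q-Reasoning

        ι-coefficient : ι (coefficient k μ) Q.≈ (Q.1# Q.- κ t Q.+ κ (β k μ)) Q.* xₗ k Q.- κ (β k μ) Q.* xₕ k
        ι-coefficient = Q.trans (ι-- _ _) (Q.+-cong
          (Q.trans (Q.sym (Rational.ι-* _ _)) (Q.*-congʳ (Q.trans (FX.ι-+ _ _) (Q.+-congʳ (ι-- _ _)))))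
          (Q.-‿cong (Q.sym (Rational.ι-* _ _))))

      coeff-act-adj : ∀ k f ν → coeff (X.act (adj k) f) ν K.≈ coeff f (adj k • ν)
      coeff-act-adj k f ν = K.trans (X.coeff-act (adj k) f ν)
        (K.reflexive (≡.cong (coeff f) (•-cong {w = (adj k) ⁻¹} {adj k} (adj-inverse k) ν)))

      α : Fin m → Vec ℤ n
      α k = 𝐞 (inject₁ k) ⊕ ⊖ 𝐞 (suc k)

      coeff-relation : ∀ k μ → lookup μ (suc k) ℤ.< lookup μ (inject₁ k) → ∀ ν →
        coeff (E (adj k • μ)) ν K.- coeff (E (adj k • μ)) (α k ⊕ ν) K.≈
          ((K.1# K.- t K.+ β k μ) K.* coeff (E μ) ν K.- β k μ K.* coeff (E μ) (α k ⊕ ν))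
          K.+ (t K.* coeff (E μ) (adj k • ν) K.- coeff (E μ) (adj k • (α k ⊕ ν)))
      coeff-relation k μ desc ν = begin
        coeff g ν K.- coeff g (α k ⊕ ν)
          ≈⟨ K.+-cong (low g) (K.-‿cong (high g)) ⟨
        coeff (xₗ′ P.* g) ν′ K.- coeff (xₕ′ P.* g) ν′
          ≈⟨ minus _ _ ⟨
        coeff (xₗ′ P.* g P.- xₕ′ P.* g) ν′
          ≈⟨ X.at (P.trans (SP.solve 3 (λ l h g → l SP.:* g SP.:- h SP.:* g SP.:= (l SP.:- h) SP.:* g) xₗ′ xₕ′ g)
               (P.trans (relation k μ desc) (SP.solve 6 (λ l h e e′ t b →
                 ((SP.con 1ℤ SP.:- t SP.:+ b) SP.:* l SP.:- b SP.:* h) SP.:* e SP.:+ (t SP.:* l SP.:- h) SP.:* e′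
                 SP.:= (l SP.:* e SP.:- t SP.:* (l SP.:* e) SP.:+ b SP.:* (l SP.:* e) SP.:- b SP.:* (h SP.:* e)) SP.:+ (t SP.:* (l SP.:* e′) SP.:- h SP.:* e′)) xₗ′ xₕ′ e e′ (C t) (C b)))) ν′ ⟩
        coeff ((xₗ′ P.* e P.- C t P.* (xₗ′ P.* e) P.+ C b P.* (xₗ′ P.* e) P.- C b P.* (xₕ′ P.* e)) P.+ (C t P.* (xₗ′ P.* e′) P.- xₕ′ P.* e′)) ν′
          ≈⟨ K.trans (coeff-+ _ _ ν′) (K.+-cong
               (K.trans (minus _ _) (K.+-cong (K.trans (coeff-+ _ _ ν′) (K.+-cong (K.trans (minus _ _) (K.+-cong (low e) (K.-‿cong (scaled t (low e))))) (scaled b (low e))))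
                 (K.-‿cong (scaled b (high e)))))
               (K.trans (minus _ _) (K.+-cong (scaled t (K.trans (low e′) (coeff-act-adj k e ν))) (K.-‿cong (K.trans (high e′) (coeff-act-adj k e (α k ⊕ ν))))))) ⟩
        (coeff e ν K.- t K.* coeff e ν K.+ b K.* coeff e ν K.- b K.* coeff e (α k ⊕ ν)) K.+ (t K.* coeff e (adj k • ν) K.- coeff e (adj k • (α k ⊕ ν)))
          ≈⟨ K.+-congʳ (SK.solve 4 (λ t b y z → y SK.:- t SK.:* y SK.:+ b SK.:* y SK.:- b SK.:* z
               SK.:= (SK.con 1ℤ SK.:- t SK.:+ b) SK.:* y SK.:- b SK.:* z) t b (coeff e ν) (coeff e (α k ⊕ ν))) ⟩
        ((K.1# K.- t K.+ b) K.* coeff e ν K.- b K.* coeff e (α k ⊕ ν)) K.+ (t K.* coeff e (adj k • ν) K.- coeff e (adj k • (α k ⊕ ν))) ∎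
        where
        open K-Reasoning

        xₗ′ xₕ′ g e e′ : K[X]
        xₗ′ = x (inject₁ k)
        xₕ′ = x (suc k)
        g   = E (adj k • μ)
        e   = E μ
        e′  = X.act (adj k) e

        b : K
        b = β k μ

        ν′ : Vec ℤ n
        ν′ = 𝐞 (inject₁ k) ⊕ ν

        minus : ∀ f f′ → coeff (f P.- f′) ν′ K.≈ coeff f ν′ K.- coeff f′ ν′
        minus f f′ = K.trans (coeff-+ f (P.- f′) ν′) (K.+-congˡ (coeff-neg f′ ν′))

        low : ∀ f → coeff (xₗ′ P.* f) ν′ K.≈ coeff f ν
        low f = K.trans (coeff-monomial-* (𝐞 (inject₁ k)) f ν′) (K.reflexive (≡.cong (coeff f) (⊕-cancelˡ (𝐞 (inject₁ k)) ν)))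

        high : ∀ f → coeff (xₕ′ P.* f) ν′ K.≈ coeff f (α k ⊕ ν)
        high f = K.trans (coeff-monomial-* (𝐞 (suc k)) f ν′) (K.reflexive (≡.cong (coeff f)
          (≡.trans (≡.sym (⊕-assoc (⊖ 𝐞 (suc k)) (𝐞 (inject₁ k)) ν)) (≡.cong (_⊕ ν) (⊕-comm (⊖ 𝐞 (suc k)) (𝐞 (inject₁ k)))))))

        scaled : ∀ a {f y} → coeff f ν′ K.≈ y → coeff (C a P.* f) ν′ K.≈ a K.* y
        scaled a {f} eq = K.trans (coeff-const-* a f ν′) (K.*-congˡ eq)

      coeff-E0 : ∀ ν → coeff (E 𝟎) ν K.≈ X.δ ν 𝟎
      coeff-E0 ν = K.trans (X.at E0 ν) (K.trans (K.+-identityʳ _) (K.*-identityˡ _))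

      coeff-rotate : ∀ μ ν → coeff (E (rotate μ)) (rotate ν) K.≈ q^ Vec.last μ K.* (q^ (ℤ.- Vec.last ν) K.* coeff (E μ) ν)
      coeff-rotate μ ν = begin
        coeff (E (rotate μ)) (rotate ν)
          ≈⟨ X.at (E1 μ) (rotate ν) ⟩
        coeff (C (q^ Vec.last μ) P.* x zero P.* twist (E μ)) (rotate ν)
          ≈⟨ X.at (P.*-assoc (C (q^ Vec.last μ)) (x zero) (twist (E μ))) (rotate ν) ⟩
        coeff (C (q^ Vec.last μ) P.* (x zero P.* twist (E μ))) (rotate ν)
          ≈⟨ K.trans (coeff-const-* _ (x zero P.* twist (E μ)) (rotate ν)) (K.*-congˡ (coeff-monomial-* (𝐞 zero) (twist (E μ)) (rotate ν))) ⟩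
        q^ Vec.last μ K.* coeff (twist (E μ)) ((⊖ 𝐞 zero) ⊕ rotate ν)
          ≡⟨ ≡.cong (λ γ → q^ Vec.last μ K.* coeff (twist (E μ)) γ) lowered ⟩
        q^ Vec.last μ K.* coeff (twist (E μ)) (Vec.last ν ∷ Vec.init ν)
          ≈⟨ K.*-congˡ (K.trans (twisted (E μ)) (X.⟨⟩-* (E μ) (q^ (ℤ.- Vec.last ν)) (X.δ ν))) ⟩
        q^ Vec.last μ K.* (q^ (ℤ.- Vec.last ν) K.* coeff (E μ) ν) ∎
        where
        open K-Reasoning

        lowered : (⊖ 𝐞 zero) ⊕ rotate ν ≡ Vec.last ν ∷ Vec.init ν
        lowered = ≡.cong₂ _∷_ (solve 1 (λ a → :- con 1ℤ :+ (a :+ con 1ℤ) := a) (Vec.last ν))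
          (vec-ext λ i → ≡.trans (Vec.lookup-zipWith ℤ._+_ i (⊖ tail) (Vec.init ν))
            (≡.trans (≡.cong (ℤ._+ lookup (Vec.init ν) i) (≡.trans (Vec.lookup-map i (λ y → ℤ.- y) tail)
              (≡.cong (λ y → ℤ.- y) (Vec.lookup∘tabulate (λ j → indicator zero (suc j)) i)))) (ℤ.+-identityˡ _)))
          where
          open ℤSolver

          tail : Vec ℤ m
          tail = tabulate λ j → indicator zero (suc j)

        last-init-injective : ∀ {k} (α γ : Vec ℤ (suc k)) → Vec.last α ≡ Vec.last γ → Vec.init α ≡ Vec.init γ → α ≡ γ
        last-init-injective α γ eq eq′ with Vec.initLast α | Vec.initLast γ
        ... | (α′ , a , ≡.refl) | (γ′ , b , ≡.refl) = ≡.cong₂ Vec._∷ʳ_ eq′ eq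

        twisted : ∀ f → coeff (twist f) (Vec.last ν ∷ Vec.init ν) K.≈ X.⟨ f , (λ α → q^ (ℤ.- Vec.last ν) K.* X.δ ν α) ⟩
        twisted []            = K.refl
        twisted ((a , α) ∷ f) = K.+-cong (K.trans (K.*-assoc a _ _) (K.*-congˡ term)) (twisted f)
          where
          term : q^ (ℤ.- Vec.last α) K.* X.δ (Vec.last ν ∷ Vec.init ν) (Vec.last α ∷ Vec.init α) K.≈ q^ (ℤ.- Vec.last ν) K.* X.δ ν α
          term with α ≟ᵉ ν
          ... | yes ≡.refl = K.*-congˡ (δ-refl (Vec.last α ∷ Vec.init α))
          ... | no α≢ν = K.trans (K.*-congˡ (δ-≢ {Vec.last ν ∷ Vec.init ν} {Vec.last α ∷ Vec.init α} λ eq →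
                  α≢ν (last-init-injective α ν (≡.cong Vec.head eq) (≡.cong Vec.tail eq))))
                (K.trans (K.zeroʳ _) (K.sym (K.zeroʳ _)))

      coeff-pred* : ∀ μ ν → coeff (E (pred* μ)) (pred* ν) K.≈ coeff (E μ) ν
      coeff-pred* μ ν = K.trans (X.at (E3 μ) (pred* ν)) (K.trans (coeff-monomial-* -𝟏 (E μ) (pred* ν))
        (K.reflexive (≡.cong (coeff (E μ)) (vec-ext λ i → ≡.trans (Vec.lookup-zipWith ℤ._+_ i (⊖ -𝟏) (pred* ν))
          (≡.trans (≡.cong₂ ℤ._+_ (≡.trans (Vec.lookup-map i _ -𝟏) (≡.cong (λ y → ℤ.- y) (Vec.lookup-replicate i -1ℤ))) (Vec.lookup-map i _ ν))
            (solve 1 (λ a → con 1ℤ :+ (a :- con 1ℤ) := a) (lookup ν i)))))))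
        where open ℤSolver

    module Triangularity where
      open ElectronicRelations

      Triangular : Vec ℤ n → Set ℓ₁
      Triangular μ = coeff (E μ) μ K.≈ K.1#
        × (∀ {r} d ν → r ℕ.≤ n → height r d μ ℤ.< height r d ν → coeff (E μ) ν K.≈ K.0#)

      private
        triangular-0 : Triangular 𝟎
        triangular-0 = K.trans (coeff-E0 𝟎) (δ-refl 𝟎) , λ {r} d ν _ lt → K.trans (coeff-E0 ν)
          (δ-≢ {ν} {𝟎} λ 𝟎≡ν → ℤ.<-irrefl (≡.cong (height r d) 𝟎≡ν) lt)

        triangular-rotate : ∀ μ → Triangular μ → Triangular (rotate μ)
        triangular-rotate μ (lead , vanish) = lead′ , vanish′
          where
          qq⁻¹ : ∀ a → q^ a K.* q^ (ℤ.- a) K.≈ K.1#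
          qq⁻¹ a = K.trans (qt-* a 0ℤ (ℤ.- a) 0ℤ) (K.trans (K.reflexive (≡.cong (λ y → qt y 0ℤ) (ℤ.+-inverseʳ a))) qt-0)

          lead′ : coeff (E (rotate μ)) (rotate μ) K.≈ K.1#
          lead′ = K.trans (coeff-rotate μ μ) (K.trans (K.sym (K.*-assoc _ _ _))
            (K.trans (K.*-cong (qq⁻¹ (Vec.last μ)) lead) (K.*-identityˡ _)))

          zero-from : ∀ {r} d ν → r ℕ.≤ n → height r d μ ℤ.< height r d ν → coeff (E (rotate μ)) (rotate ν) K.≈ K.0#
          zero-from d ν r≤n lt = K.trans (coeff-rotate μ ν)
            (K.trans (K.*-congˡ (K.trans (K.*-congˡ (vanish d ν r≤n lt)) (K.zeroʳ _))) (K.zeroʳ _))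

          vanish-rotated : ∀ {r} d ν → r ℕ.≤ n → height r d (rotate μ) ℤ.< height r d (rotate ν) →
                           coeff (E (rotate μ)) (rotate ν) K.≈ K.0#
          vanish-rotated {zero}  d ν r≤n lt = zero-from {m} (d ℤ.- 1ℤ) ν (ℕ.n≤1+n m)
            (≡.subst₂ ℤ._<_ (height-rotate-zero d μ) (height-rotate-zero d ν) lt)
          vanish-rotated {suc r} d ν (ℕ.s≤s r≤m) lt = zero-from {r} d ν (ℕ.m≤n⇒m≤1+n r≤m)
            (≡.subst₂ ℤ._<_ (height-rotate-suc r d μ r≤m) (height-rotate-suc r d ν r≤m) lt)

          vanish′ : ∀ {r} d ν → r ℕ.≤ n → height r d (rotate μ) ℤ.< height r d ν → coeff (E (rotate μ)) ν K.≈ K.0#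
          vanish′ {r} d ν r≤n lt = ≡.subst (λ ν → coeff (E (rotate μ)) ν K.≈ K.0#) (rotate-unrotate ν)
            (vanish-rotated d (unrotate ν) r≤n (≡.subst (λ ν → height r d (rotate μ) ℤ.< height r d ν) (≡.sym (rotate-unrotate ν)) lt))

        triangular-pred* : ∀ μ → Triangular μ → Triangular (pred* μ)
        triangular-pred* μ (lead , vanish) = K.trans (coeff-pred* μ μ) lead , λ {r} d ν r≤n lt →
          ≡.subst (λ ν → coeff (E (pred* μ)) ν K.≈ K.0#) (pred*-suc* ν) (K.trans (coeff-pred* μ (suc* ν))
            (vanish (1ℤ ℤ.+ d) (suc* ν) r≤n (≡.subst₂ ℤ._<_ (height-pred* r d μ)
              (≡.trans (≡.cong (height r d) (≡.sym (pred*-suc* ν))) (height-pred* r d (suc* ν))) lt)))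

        module _ (k : Fin m) (μ : Vec ℤ n) (desc : lookup μ (suc k) ℤ.< lookup μ (inject₁ k)) (tri : Triangular μ) where
          lead = proj₁ tri
          vanish = proj₂ tri

          iₗ iₕ : Fin n
          iₗ = inject₁ k
          iₕ = suc k

          g : K[X]
          g = E (adj k • μ)

          lookup-α-lo : ∀ ν → lookup (α k ⊕ ν) iₗ ≡ 1ℤ ℤ.+ lookup ν iₗ
          lookup-α-lo ν = ≡.trans (Vec.lookup-zipWith ℤ._+_ iₗ (α k) ν) (≡.cong (ℤ._+ lookup ν iₗ)
            (≡.trans (Vec.lookup-zipWith ℤ._+_ iₗ (𝐞 iₗ) (⊖ 𝐞 iₕ)) (≡.cong₂ ℤ._+_ (lookup-𝐞-≡ iₗ)
              (≡.trans (Vec.lookup-map iₗ _ (𝐞 iₕ)) (≡.cong (λ y → ℤ.- y) (lookup-𝐞-≢ (inject₁≢suc k ∘ ≡.sym)))))))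

          lookup-α-hi : ∀ ν → lookup (α k ⊕ ν) iₕ ≡ -1ℤ ℤ.+ lookup ν iₕ
          lookup-α-hi ν = ≡.trans (Vec.lookup-zipWith ℤ._+_ iₕ (α k) ν) (≡.cong (ℤ._+ lookup ν iₕ)
            (≡.trans (Vec.lookup-zipWith ℤ._+_ iₕ (𝐞 iₗ) (⊖ 𝐞 iₕ)) (≡.cong₂ ℤ._+_ (lookup-𝐞-≢ (inject₁≢suc k))
              (≡.trans (Vec.lookup-map iₕ _ (𝐞 iₕ)) (≡.cong (λ y → ℤ.- y) (lookup-𝐞-≡ iₕ))))))

          lookup-α-off : ∀ ν i → i ≢ iₗ → i ≢ iₕ → lookup (α k ⊕ ν) i ≡ lookup ν i
          lookup-α-off ν i ≢lo ≢hi = ≡.trans (Vec.lookup-zipWith ℤ._+_ i (α k) ν) (≡.trans (≡.cong (ℤ._+ lookup ν i)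
            (≡.trans (Vec.lookup-zipWith ℤ._+_ i (𝐞 iₗ) (⊖ 𝐞 iₕ)) (≡.cong₂ ℤ._+_ (lookup-𝐞-≢ (≢lo ∘ ≡.sym))
              (≡.trans (Vec.lookup-map i _ (𝐞 iₕ)) (≡.cong (λ y → ℤ.- y) (lookup-𝐞-≢ (≢hi ∘ ≡.sym))))))) (ℤ.+-identityˡ _))

          a b : ℕ → ℤ → Vec ℤ n → ℤ
          a r d ν = lookup ν iₗ ℤ.- threshold r d (toℕ iₗ)
          b r d ν = lookup ν iₕ ℤ.- threshold r d (toℕ iₕ)

          a-α : ∀ r d ν → a r d (α k ⊕ ν) ≡ 1ℤ ℤ.+ a r d ν
          a-α r d ν = ≡.trans (≡.cong (ℤ._- threshold r d (toℕ iₗ)) (lookup-α-lo ν)) (ℤ.+-assoc 1ℤ (lookup ν iₗ) _)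

          b-α : ∀ r d ν → b r d ν ≡ 1ℤ ℤ.+ b r d (α k ⊕ ν)
          b-α r d ν = ≡.sym (≡.trans (≡.cong (λ y → 1ℤ ℤ.+ (y ℤ.- threshold r d (toℕ iₕ))) (lookup-α-hi ν))
            (solve 2 (λ y c → con 1ℤ :+ ((:- con 1ℤ :+ y) :- c) := y :- c) (lookup ν iₕ) (threshold r d (toℕ iₕ))))
            where open ℤSolver

          height-ab : ∀ r d ν → height r d ν ≡ (a r d ν ⁺ ℤ.+ b r d ν ⁺) ℤ.+ rest k r d ν
          height-ab r d ν = height-split k r d ν

          rest-α : ∀ r d ν → rest k r d (α k ⊕ ν) ≡ rest k r d ν
          rest-α r d ν = ∑ᶻ-others-cong k {excess r d (α k ⊕ ν)} {excess r d ν} λ i ≢lo ≢hi →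
            ≡.cong (λ y → (y ℤ.- threshold r d (toℕ i)) ⁺) (lookup-α-off ν i ≢lo ≢hi)

          height-α : ∀ r d ν → height r d (α k ⊕ ν) ≡ ((1ℤ ℤ.+ a r d ν) ⁺ ℤ.+ b r d (α k ⊕ ν) ⁺) ℤ.+ rest k r d ν
          height-α r d ν = ≡.trans (height-ab r d (α k ⊕ ν)) (≡.cong₂ (λ y z → (y ⁺ ℤ.+ b r d (α k ⊕ ν) ⁺) ℤ.+ z) (a-α r d ν) (rest-α r d ν))

          height-α′ : ∀ r d ν → height r d ν ≡ (a r d ν ⁺ ℤ.+ (1ℤ ℤ.+ b r d (α k ⊕ ν)) ⁺) ℤ.+ rest k r d ν
          height-α′ r d ν = ≡.trans (height-ab r d ν) (≡.cong (λ y → (a r d ν ⁺ ℤ.+ y ⁺) ℤ.+ rest k r d ν) (b-α r d ν))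

          up : ∀ r d ν → b r d (α k ⊕ ν) ℤ.≤ a r d ν → height r d ν ℤ.≤ height r d (α k ⊕ ν)
          up r d ν le = ≡.subst₂ ℤ._≤_ (≡.sym (height-α′ r d ν)) (≡.sym (height-α r d ν)) (ℤ.+-monoˡ-≤ (rest k r d ν) (⁺-convex le))

          down : ∀ r d ν → a r d ν ℤ.≤ b r d (α k ⊕ ν) → height r d (α k ⊕ ν) ℤ.≤ height r d ν
          down r d ν le = ≡.subst₂ ℤ._≤_
            (≡.trans (≡.cong (ℤ._+ rest k r d ν) (ℤ.+-comm (b r d (α k ⊕ ν) ⁺) _)) (≡.sym (height-α r d ν)))
            (≡.trans (≡.cong (ℤ._+ rest k r d ν) (ℤ.+-comm ((1ℤ ℤ.+ b r d (α k ⊕ ν)) ⁺) _)) (≡.sym (height-α′ r d ν)))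
            (ℤ.+-monoˡ-≤ (rest k r d ν) (⁺-convex le))

          down-strict : ∀ r d ν → 1ℤ ℤ.+ a r d ν ℤ.≤ 0ℤ → 0ℤ ℤ.≤ b r d (α k ⊕ ν) → height r d (α k ⊕ ν) ℤ.< height r d ν
          down-strict r d ν a<0 0≤b = ≡.subst₂ ℤ._<_
            (≡.trans (≡.cong (ℤ._+ rest k r d ν) (ℤ.+-comm (b r d (α k ⊕ ν) ⁺) _)) (≡.sym (height-α r d ν)))
            (≡.trans (≡.cong (ℤ._+ rest k r d ν) (ℤ.+-comm ((1ℤ ℤ.+ b r d (α k ⊕ ν)) ⁺) _)) (≡.sym (height-α′ r d ν)))
            (ℤ.+-monoˡ-< (rest k r d ν) (⁺-convex-strict 0≤b a<0))

          module _ {r : ℕ} {d : ℤ} (r≤n : r ℕ.≤ n) where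
            High : Vec ℤ n → Set
            High ν = height r d (adj k • μ) ℤ.< height r d ν

            E-zero : ∀ ν → High ν → coeff (E μ) ν K.≈ K.0#
            E-zero ν high = vanish d ν r≤n (ℤ.≤-<-trans (height-≤-adj k r d μ desc) high)

            E-zero′ : ∀ ν → High ν → coeff (E μ) (adj k • ν) K.≈ K.0#
            E-zero′ ν high with height-lift k d μ ν desc r≤n high
            ... | r′ , r′≤n , lt = vanish d (adj k • ν) r′≤n lt

            g-shift : ∀ ν → High ν → High (α k ⊕ ν) → coeff g ν K.≈ coeff g (α k ⊕ ν)
            g-shift ν high high′ = RingLemmas.x-y≈0⇒x≈y 𝕂 (K.trans (coeff-relation k μ desc ν) (K.trans
              (K.+-cong (K.+-cong (K.*-congˡ (E-zero ν high)) (K.-‿cong (K.*-congˡ (E-zero (α k ⊕ ν) high′))))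
                        (K.+-cong (K.*-congˡ (E-zero′ ν high)) (K.-‿cong (E-zero′ (α k ⊕ ν) high′))))
              (SK.solve 3 (λ p q r → (p SK.:* SK.con 0ℤ SK.:- q SK.:* SK.con 0ℤ) SK.:+ (r SK.:* SK.con 0ℤ SK.:- SK.con 0ℤ) SK.:= SK.con 0ℤ) _ _ _)))

            g-zero : ∀ ν → High ν → coeff g ν K.≈ K.0#
            g-zero ν high with ℤ.≤-total (b r d ν) (a r d ν)
            ... | inj₁ b≤a = climb iₗ g (α k) α>0 (λ ν → High ν × b r d ν ℤ.≤ a r d ν) next
              (λ ν Z eq → K.trans (g-shift ν (proj₁ Z) (proj₁ (next ν Z))) eq) ν (high , b≤a)
              where
              α>0 : 0ℤ ℤ.< lookup (α k) iₗ
              α>0 = ≡.subst (0ℤ ℤ.<_) (≡.sym (≡.trans (Vec.lookup-zipWith ℤ._+_ iₗ (𝐞 iₗ) (⊖ 𝐞 iₕ)) (≡.cong₂ ℤ._+_ (lookup-𝐞-≡ iₗ)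
                (≡.trans (Vec.lookup-map iₗ _ (𝐞 iₕ)) (≡.cong (λ y → ℤ.- y) (lookup-𝐞-≢ (inject₁≢suc k ∘ ≡.sym))))))) (ℤ.+<+ (ℕ.s≤s ℕ.z≤n))

              next : ∀ ν → High ν × b r d ν ℤ.≤ a r d ν → High (α k ⊕ ν) × b r d (α k ⊕ ν) ℤ.≤ a r d (α k ⊕ ν)
              next ν (high , b≤a) = ℤ.<-≤-trans high (up r d ν b′≤a) ,
                ℤ.≤-trans b′≤a (ℤ.≤-trans (i≤1+i _) (ℤ.≤-reflexive (≡.sym (a-α r d ν))))
                where
                b′≤a : b r d (α k ⊕ ν) ℤ.≤ a r d ν
                b′≤a = ℤ.≤-trans (i≤1+i _) (ℤ.≤-trans (ℤ.≤-reflexive (≡.sym (b-α r d ν))) b≤a)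
            ... | inj₂ a≤b = climb iₕ g (⊖ α k) α>0 (λ ν → High ν × a r d ν ℤ.≤ b r d ν) next
              (λ ν Z eq → K.trans (K.sym (shifted ν Z)) eq) ν (high , a≤b)
              where
              back : ∀ ν → α k ⊕ ((⊖ α k) ⊕ ν) ≡ ν
              back ν = ⊕-cancelˡ′ (α k) ν

              α>0 : 0ℤ ℤ.< lookup (⊖ α k) iₕ
              α>0 = ≡.subst (0ℤ ℤ.<_) (≡.sym (≡.trans (Vec.lookup-map iₕ _ (α k)) (≡.cong (λ y → ℤ.- y)
                (≡.trans (Vec.lookup-zipWith ℤ._+_ iₕ (𝐞 iₗ) (⊖ 𝐞 iₕ)) (≡.cong₂ ℤ._+_ (lookup-𝐞-≢ (inject₁≢suc k))
                  (≡.trans (Vec.lookup-map iₕ _ (𝐞 iₕ)) (≡.cong (λ y → ℤ.- y) (lookup-𝐞-≡ iₕ)))))))) (ℤ.+<+ (ℕ.s≤s ℕ.z≤n))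

              next : ∀ ν → High ν × a r d ν ℤ.≤ b r d ν → High ((⊖ α k) ⊕ ν) × a r d ((⊖ α k) ⊕ ν) ℤ.≤ b r d ((⊖ α k) ⊕ ν)
              next ν (high , a≤b) = ℤ.<-≤-trans (≡.subst High (≡.sym (back ν)) high) (down r d ν′ a′≤b) ,
                ℤ.≤-trans a′≤b (ℤ.≤-trans (i≤1+i _) (ℤ.≤-reflexive (≡.sym (b-α r d ν′))))
                where
                ν′ : Vec ℤ n
                ν′ = (⊖ α k) ⊕ ν

                a′≤b : a r d ν′ ℤ.≤ b r d (α k ⊕ ν′)
                a′≤b = ℤ.≤-trans (i≤1+i _) (ℤ.≤-trans (ℤ.≤-reflexive (≡.sym (a-α r d ν′)))
                  (≡.subst (λ ν → a r d ν ℤ.≤ b r d ν) (≡.sym (back ν)) a≤b))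

              shifted : ∀ ν → High ν × a r d ν ℤ.≤ b r d ν → coeff g ((⊖ α k) ⊕ ν) K.≈ coeff g ν
              shifted ν Z = K.trans (g-shift ((⊖ α k) ⊕ ν) (proj₁ (next ν Z)) (≡.subst High (≡.sym (back ν)) (proj₁ Z)))
                (K.reflexive (≡.cong (coeff g) (back ν)))

          private
            d₀ : ℤ
            d₀ = lookup μ iₕ

            sμ ν : Vec ℤ n
            sμ = adj k • μ
            ν  = (⊖ α k) ⊕ sμ

            α⊕ν : α k ⊕ ν ≡ sμ
            α⊕ν = ⊕-cancelˡ′ (α k) sμ

            top : ℕ
            top = suc (toℕ k)

            top≤n : top ℕ.≤ n
            top≤n = ℕ.m≤n⇒m≤1+n (Fin.toℕ<n k)

            ν-high : height top d₀ sμ ℤ.< height top d₀ ν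
            ν-high = ≡.subst (λ γ → height top d₀ γ ℤ.< height top d₀ ν) α⊕ν (down-strict top d₀ ν
              (≡.subst (ℤ._≤ 0ℤ) (a-α top d₀ ν) (≡.subst (λ γ → a top d₀ γ ℤ.≤ 0ℤ) (≡.sym α⊕ν) a≤0))
              (≡.subst (λ γ → 0ℤ ℤ.≤ b top d₀ γ) (≡.sym α⊕ν) 0≤b))
              where
              a≤0 : a top d₀ sμ ℤ.≤ 0ℤ
              a≤0 = ≡.subst (ℤ._≤ 0ℤ) (≡.sym (≡.cong₂ ℤ._-_ (lookup-adj-lo k μ) (threshold-< {top} d₀ (ℕ.s≤s (ℕ.≤-reflexive (Fin.toℕ-inject₁ k))))))
                (ℤ.i≤j⇒i-j≤0 (i≤1+i d₀))

              0≤b : 0ℤ ℤ.≤ b top d₀ sμ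
              0≤b = ≡.subst (0ℤ ℤ.≤_) (≡.sym (≡.cong₂ ℤ._-_ (lookup-adj-hi k μ) (threshold-≥ {top} d₀ ℕ.≤-refl)))
                (ℤ.i≤j⇒0≤j-i (ℤ.<⇒≤ desc))

          lead-adj : coeff g sμ K.≈ K.1#
          lead-adj = begin
            coeff g sμ
              ≈⟨ SK.solve 2 (λ y z → z SK.:= y SK.:- (y SK.:- z)) (coeff g ν) (coeff g sμ) ⟩
            coeff g ν K.- (coeff g ν K.- coeff g sμ)
              ≡⟨ ≡.cong (λ γ → coeff g ν K.- (coeff g ν K.- coeff g γ)) (≡.sym α⊕ν) ⟩
            coeff g ν K.- (coeff g ν K.- coeff g (α k ⊕ ν))
              ≈⟨ K.+-cong (g-zero {top} {d₀} top≤n ν ν-high) (K.-‿cong (coeff-relation k μ desc ν)) ⟩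
            K.0# K.- (((K.1# K.- t K.+ β k μ) K.* coeff (E μ) ν K.- β k μ K.* coeff (E μ) (α k ⊕ ν))
              K.+ (t K.* coeff (E μ) (adj k • ν) K.- coeff (E μ) (adj k • (α k ⊕ ν))))
              ≈⟨ K.+-congˡ (K.-‿cong (K.+-cong
                   (K.+-cong (K.*-congˡ (E-zero {top} {d₀} top≤n ν ν-high))
                     (K.-‿cong (K.*-congˡ (K.trans (K.reflexive (≡.cong (coeff (E μ)) α⊕ν)) (vanish d₀ sμ top≤n (height-<-adj k μ desc))))))
                   (K.+-cong (K.*-congˡ (E-zero′ {top} {d₀} top≤n ν ν-high))
                     (K.-‿cong (K.trans (K.reflexive (≡.cong (coeff (E μ)) (≡.trans (≡.cong (adj k •_) α⊕ν) (adj•adj• k μ)))) lead))))) ⟩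
            K.0# K.- (((K.1# K.- t K.+ β k μ) K.* K.0# K.- β k μ K.* K.0#) K.+ (t K.* K.0# K.- K.1#))
              ≈⟨ SK.solve 3 (λ p q r → SK.con 0ℤ SK.:- ((p SK.:* SK.con 0ℤ SK.:- q SK.:* SK.con 0ℤ) SK.:+ (r SK.:* SK.con 0ℤ SK.:- SK.con 1ℤ)) SK.:= SK.con 1ℤ) _ _ _ ⟩
            K.1# ∎
            where open K-Reasoning

          triangular-adj : Triangular sμ
          triangular-adj = lead-adj , λ {r} d ν r≤n lt → g-zero {r} {d} r≤n ν lt

      triangular : ∀ μ → Triangular μ
      triangular = decrement-induction Triangular
        (nonnegative-induction Triangular triangular-0
          (λ μ nn pos smaller → ≡.subst Triangular (rotate-unrotate μ)
            (triangular-rotate (unrotate μ) (smaller (unrotate μ) (nonnegative-unrotate μ nn pos) (size-unrotate μ pos))))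
          (λ k μ nn asc smaller → ≡.subst Triangular (adj•adj• k μ)
            (triangular-adj k (adj k • μ)
              (≡.subst₂ ℤ._<_ (≡.sym (lookup-adj-hi k μ)) (≡.sym (lookup-adj-lo k μ)) asc)
              (smaller (adj k • μ) (nonnegative-adj k μ nn) (size-adj k μ) (inject₁ k) (ℕ.≤-reflexive (Fin.toℕ-inject₁ k))
                (≡.subst (0ℤ ℤ.<_) (≡.sym (lookup-adj-lo k μ)) (ℤ.≤-<-trans (nn (inject₁ k)) asc))))))
        triangular-pred*

      -- The increasing rearrangement is maximal in its orbit.
      coeff-increasing : ∀ w anti → (∀ {i j} → i Fin.≤ j → lookup anti i ℤ.≤ lookup anti j) →
                         w • anti ≢ anti → coeff (E (w • anti)) anti K.≈ K.0#
      coeff-increasing w anti inc w•≢ with Fin.any? (λ i → lookup anti i ℤ.<? lookup (w • anti) i)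
      ... | no none = contradiction (vec-ext λ i → ℤ.≤-antisym (le i) (ℤ.≮⇒≥ λ lt →
                ℤ.<-irrefl (∑ᶻ-• w id anti) (∑ᶻ-strict le i lt))) w•≢
        where
        le : ∀ i → lookup (w • anti) i ℤ.≤ lookup anti i
        le i = ℤ.≮⇒≥ λ lt → none (i , lt)
      ... | yes (i , lt) = proj₂ (triangular (w • anti)) {r} d anti (Fin.toℕ<n i) (ℤ.<-≤-trans
          (∑ᶻ-strict {f = excess r d (w • anti)} {λ j → (lookup (w • anti) j ℤ.- d) ⁺} bound i strict)
          (ℤ.≤-reflexive (≡.trans (∑ᶻ-• w (λ y → (y ℤ.- d) ⁺) anti) (∑ᶻ-cong equal))))
        where
        open ℤSolver

        r : ℕ
        r = suc (toℕ i)

        d : ℤ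
        d = lookup anti i

        drop : ∀ y → y ℤ.- d ≡ 1ℤ ℤ.+ (y ℤ.- (1ℤ ℤ.+ d))
        drop y = solve 2 (λ y d → y :- d := con 1ℤ :+ (y :- (con 1ℤ :+ d))) y d

        bound : ∀ j → excess r d (w • anti) j ℤ.≤ (lookup (w • anti) j ℤ.- d) ⁺
        bound j with toℕ j ℕ.<? r
        ... | yes j<r = ≡.subst (λ y → (lookup (w • anti) j ℤ.- y) ⁺ ℤ.≤ (lookup (w • anti) j ℤ.- d) ⁺) (≡.sym (threshold-< {r} d j<r))
          (⁺-mono (ℤ.≤-trans (i≤1+i _) (ℤ.≤-reflexive (≡.sym (drop (lookup (w • anti) j))))))
        ... | no j≮r = ℤ.≤-reflexive (≡.cong (λ y → (lookup (w • anti) j ℤ.- y) ⁺) (threshold-≥ {r} d (ℕ.≮⇒≥ j≮r)))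

        strict : excess r d (w • anti) i ℤ.< (lookup (w • anti) i ℤ.- d) ⁺
        strict = ≡.subst₂ ℤ._<_
          (≡.trans (≡.sym (⁺-nonneg 0≤)) (≡.cong (λ y → (lookup (w • anti) i ℤ.- y) ⁺) (≡.sym (threshold-< {r} d ℕ.≤-refl))))
          (≡.sym (⁺-nonneg (ℤ.i≤j⇒0≤j-i (ℤ.<⇒≤ lt))))
          (≡.subst (lookup (w • anti) i ℤ.- (1ℤ ℤ.+ d) ℤ.<_) (≡.sym (drop (lookup (w • anti) i)))
            (ℤ.suc[i]≤j⇒i<j {lookup (w • anti) i ℤ.- (1ℤ ℤ.+ d)} ℤ.≤-refl))
          where
          0≤ : 0ℤ ℤ.≤ lookup (w • anti) i ℤ.- (1ℤ ℤ.+ d)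
          0≤ = ℤ.i≤j⇒0≤j-i (ℤ.i<j⇒suc[i]≤j lt)

        equal : ∀ j → (lookup anti j ℤ.- d) ⁺ ≡ excess r d anti j
        equal j with toℕ j ℕ.<? r
        ... | no j≮r = ≡.cong (λ y → (lookup anti j ℤ.- y) ⁺) (≡.sym (threshold-≥ {r} d (ℕ.≮⇒≥ j≮r)))
        ... | yes j<r = ≡.trans (⁺-nonpos (ℤ.i≤j⇒i-j≤0 le)) (≡.sym (≡.trans
          (≡.cong (λ y → (lookup anti j ℤ.- y) ⁺) (threshold-< {r} d j<r)) (⁺-nonpos (ℤ.i≤j⇒i-j≤0 (ℤ.≤-trans le (i≤1+i d))))))
          where
          le : lookup anti j ℤ.≤ d
          le = inc (ℕ.s≤s⁻¹ j<r)

    module Symmetry where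
      open ElectronicRelations
      open Symmetrizers using (step)
      open Braids

      β-shift : ∀ j k μ ν → spectral j μ K.≈ t K.* spectral k ν → β j μ K.* (K.1# K.+ β k ν) K.≈ t K.* β k ν
      β-shift j k μ ν Q′≈tQ = regular-cancel
        (regular-* (regular-1-qt[] μ (inject₁≢suc j)) (regular-1-qt[] ν (inject₁≢suc k))) (begin
          b′ K.* (K.1# K.+ b) K.* ((K.1# K.- Q′) K.* (K.1# K.- Q))
            ≈⟨ SK.solve 4 (λ b′ b Q′ Q → b′ SK.:* (SK.con 1ℤ SK.:+ b) SK.:* ((SK.con 1ℤ SK.:- Q′) SK.:* (SK.con 1ℤ SK.:- Q))
                 SK.:= (b′ SK.:* (SK.con 1ℤ SK.:- Q′)) SK.:* ((SK.con 1ℤ SK.:- Q) SK.:+ b SK.:* (SK.con 1ℤ SK.:- Q))) b′ b Q′ Q ⟩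
          (b′ K.* (K.1# K.- Q′)) K.* ((K.1# K.- Q) K.+ b K.* (K.1# K.- Q))
            ≈⟨ K.*-cong (K.trans (β-eq j μ) (K.*-congˡ Q′≈tQ)) (K.+-congˡ (β-eq k ν)) ⟩
          ((K.1# K.- t) K.* (t K.* Q)) K.* ((K.1# K.- Q) K.+ (K.1# K.- t) K.* Q)
            ≈⟨ SK.solve 2 (λ t Q → ((SK.con 1ℤ SK.:- t) SK.:* (t SK.:* Q)) SK.:* ((SK.con 1ℤ SK.:- Q) SK.:+ (SK.con 1ℤ SK.:- t) SK.:* Q)
                 SK.:= t SK.:* ((SK.con 1ℤ SK.:- t) SK.:* Q) SK.:* (SK.con 1ℤ SK.:- t SK.:* Q)) t Q ⟩
          t K.* ((K.1# K.- t) K.* Q) K.* (K.1# K.- t K.* Q)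
            ≈⟨ K.*-cong (K.*-congˡ (β-eq k ν)) (K.+-congˡ (K.-‿cong Q′≈tQ)) ⟨
          t K.* (b K.* (K.1# K.- Q)) K.* (K.1# K.- Q′)
            ≈⟨ SK.solve 4 (λ t b Q′ Q → t SK.:* (b SK.:* (SK.con 1ℤ SK.:- Q)) SK.:* (SK.con 1ℤ SK.:- Q′)
                 SK.:= t SK.:* b SK.:* ((SK.con 1ℤ SK.:- Q′) SK.:* (SK.con 1ℤ SK.:- Q))) t b Q′ Q ⟩
          t K.* b K.* ((K.1# K.- Q′) K.* (K.1# K.- Q)) ∎)
        where
        open K-Reasoning
        b b′ Q Q′ : K
        b  = β k ν
        b′ = β j μ
        Q  = spectral k ν
        Q′ = spectral j μ

      private
        Sym : Fin m → Vec ℤ n → Set ℓ₁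
        Sym k μ = X.act (adj k) (E μ) P.≈ E μ

        Symmetric : Vec ℤ n → Set ℓ₁
        Symmetric μ = ∀ k → lookup μ (inject₁ k) ≡ lookup μ (suc k) → Sym k μ

        coeff-sym : ∀ k μ → (∀ ν → coeff (E μ) (adj k • ν) K.≈ coeff (E μ) ν) → Sym k μ
        coeff-sym k μ eq = X.coeffwise λ ν → K.trans (coeff-act-adj k (E μ) ν) (eq ν)

        sym-coeff : ∀ k μ → Sym k μ → ∀ ν → coeff (E μ) (adj k • ν) K.≈ coeff (E μ) ν
        sym-coeff k μ eq ν = K.trans (K.sym (coeff-act-adj k (E μ) ν)) (X.at eq ν)

        sym⇒▹ : ∀ k μ → Sym k μ → adj k ▹ ι (E μ) Q.≈ ι (E μ)
        sym⇒▹ k μ eq = Q.trans (act-ι (adj k) (E μ)) (Rational.ι-cong eq)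

        ▹⇒sym : ∀ k μ → adj k ▹ ι (E μ) Q.≈ ι (E μ) → Sym k μ
        ▹⇒sym k μ eq = FX.ι-injective (Q.trans (Q.sym (act-ι (adj k) (E μ))) eq)

        symmetric-0 : Symmetric 𝟎
        symmetric-0 k _ = P.trans (X.act-cong (adj k) E0) (P.trans (act-const (adj k) K.1#) (P.sym E0))

        symmetric-pred* : ∀ μ → Symmetric μ → Symmetric (pred* μ)
        symmetric-pred* μ sym k eq = P.trans (act-E-pred* (adj k) μ) (P.trans (P.*-congˡ (sym k eq′)) (P.sym (E-pred* μ)))
          where
          eq′ : lookup μ (inject₁ k) ≡ lookup μ (suc k)
          eq′ = Algebra.Properties.Ring.+-cancelʳ ℤ.+-*-ring -1ℤ _ _
            (≡.trans (≡.sym (Vec.lookup-map (inject₁ k) _ μ)) (≡.trans eq (Vec.lookup-map (suc k) _ μ)))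

      ascent-case : ∀ k₀ μ → Nonnegative μ → lookup μ (inject₁ k₀) ℤ.< lookup μ (suc k₀) →
        (∀ ν → Nonnegative ν → size ν ≡ size μ → ∀ q → toℕ q ℕ.≤ toℕ k₀ → 0ℤ ℤ.< lookup ν q → Symmetric ν) → Symmetric μ
      ascent-case k₀ μ nn asc smaller k eq = ▹⇒sym k μ chain
        where
        μ′ : Vec ℤ n
        μ′ = adj k₀ • μ

        desc : lookup μ′ (suc k₀) ℤ.< lookup μ′ (inject₁ k₀)
        desc = ≡.subst₂ ℤ._<_ (≡.sym (lookup-adj-hi k₀ μ)) (≡.sym (lookup-adj-lo k₀ μ)) asc

        E-μ : ι (E μ) Q.≈ step k₀ (κ (β k₀ μ′)) (ι (E μ′))
        E-μ = Q.trans (Q.reflexive (≡.cong (ι ∘ E) (≡.sym (adj•adj• k₀ μ)))) (E-step k₀ μ′ desc)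

        pos : 0ℤ ℤ.< lookup μ (suc k₀)
        pos = ℤ.≤-<-trans (nn (inject₁ k₀)) asc

        κ-inv : ∀ a w → w ▹ κ a Q.≈ κ a
        κ-inv = κ-invariant

        κ-β-shift : ∀ j k μ ν → spectral j μ K.≈ t K.* spectral k ν → κ (β j μ) Q.* (Q.1# Q.+ κ (β k ν)) Q.≈ κ t Q.* κ (β k ν)
        κ-β-shift j k μ ν Q′ = Q.trans (Q.*-congˡ (Q.sym (κ-+ K.1# (β k ν)))) (Q.trans (Q.sym (κ-* _ _))
          (Q.trans (κ-cong (β-shift j k μ ν Q′)) (κ-* _ _)))

        Goal : Set ℓ₁
        Goal = adj k ▹ step k₀ (κ (β k₀ μ′)) (ι (E μ′)) Q.≈ step k₀ (κ (β k₀ μ′)) (ι (E μ′))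

        disjoint : inject₁ k₀ ≢ inject₁ k → inject₁ k₀ ≢ suc k → suc k₀ ≢ inject₁ k → suc k₀ ≢ suc k → Goal
        disjoint ll lh hl hh = step-disjoint k k₀ (κ-inv (β k₀ μ′)) ll lh hl hh
          (sym⇒▹ k μ′ (smaller μ′ (nonnegative-adj k₀ μ nn) (size-adj k₀ μ) (inject₁ k₀) (ℕ.≤-reflexive (Fin.toℕ-inject₁ k₀))
            (≡.subst (0ℤ ℤ.<_) (≡.sym (lookup-adj-lo k₀ μ)) pos) k
            (≡.trans (lookup-adj-off k₀ μ (ll ∘ ≡.sym) (hl ∘ ≡.sym)) (≡.trans eq (≡.sym (lookup-adj-off k₀ μ (lh ∘ ≡.sym) (hh ∘ ≡.sym)))))))

        -- μ = (c , c , b) at the positions involved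
        below : suc k ≡ inject₁ k₀ → Goal
        below sk≡lk₀ = Q.trans (▹-cong (adj k) E-μ′-step) (Q.trans
          (step-step-symmetric′ k k₀ sk≡lk₀ (κ-inv (β k μ″)) (κ-inv (β k₀ μ′)) (κ-β-shift k k₀ μ″ μ′ spectral-shift)
            (sym⇒▹ k₀ μ″ (smaller μ″ (nonnegative-adj k μ′ (nonnegative-adj k₀ μ nn)) (≡.trans (size-adj k μ′) (size-adj k₀ μ)) (inject₁ k)
              (≡.subst (ℕ._≤ toℕ k₀) (≡.sym (Fin.toℕ-inject₁ k)) (ℕ.≤-trans (ℕ.n≤1+n _) (ℕ.≤-reflexive (≡.trans (≡.cong toℕ sk≡lk₀) (Fin.toℕ-inject₁ k₀)))))
              (≡.subst (0ℤ ℤ.<_) (≡.sym μ″-a) pos) k₀ (≡.trans μ″-b (≡.sym μ″-c)))))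
          (Q.sym E-μ′-step))
          where
          μ″ : Vec ℤ n
          μ″ = adj k • μ′

          lk≢lk₀ : inject₁ k ≢ inject₁ k₀
          lk≢lk₀ e = inject₁≢suc k (≡.trans e (≡.sym sk≡lk₀))

          lk≢sk₀ : inject₁ k ≢ suc k₀
          lk≢sk₀ = Fin.<⇒≢ (ℕ.<-trans (lo<hi k) (≡.subst (Fin._< suc k₀) (≡.sym sk≡lk₀) (lo<hi k₀)))

          sk₀≢sk : suc k₀ ≢ suc k
          sk₀≢sk e = inject₁≢suc k₀ (≡.trans (≡.sym sk≡lk₀) (≡.sym e))

          μ′-a : lookup μ′ (inject₁ k) ≡ lookup μ (inject₁ k₀)
          μ′-a = ≡.trans (lookup-adj-off k₀ μ lk≢lk₀ lk≢sk₀) (≡.trans eq (≡.cong (lookup μ) sk≡lk₀))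

          μ′-b : lookup μ′ (suc k) ≡ lookup μ (suc k₀)
          μ′-b = ≡.trans (≡.cong (lookup μ′) sk≡lk₀) (lookup-adj-lo k₀ μ)

          μ″-a : lookup μ″ (inject₁ k) ≡ lookup μ (suc k₀)
          μ″-a = ≡.trans (lookup-adj-lo k μ′) μ′-b

          μ″-b′ : lookup μ″ (suc k) ≡ lookup μ (inject₁ k₀)
          μ″-b′ = ≡.trans (lookup-adj-hi k μ′) μ′-a

          μ″-b : lookup μ″ (inject₁ k₀) ≡ lookup μ (inject₁ k₀)
          μ″-b = ≡.trans (≡.cong (lookup μ″) (≡.sym sk≡lk₀)) μ″-b′

          μ″-c : lookup μ″ (suc k₀) ≡ lookup μ (inject₁ k₀)
          μ″-c = ≡.trans (lookup-adj-off k μ′ (lk≢sk₀ ∘ ≡.sym) sk₀≢sk) (lookup-adj-hi k₀ μ)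

          desc″ : lookup μ″ (suc k) ℤ.< lookup μ″ (inject₁ k)
          desc″ = ≡.subst₂ ℤ._<_ (≡.sym μ″-b′) (≡.sym μ″-a) asc

          μ′-≡ : adj k • μ″ ≡ μ′
          μ′-≡ = adj•adj• k μ′

          E-μ′-step : step k₀ (κ (β k₀ μ′)) (ι (E μ′)) Q.≈ step k₀ (κ (β k₀ μ′)) (step k (κ (β k μ″)) (ι (E μ″)))
          E-μ′-step = Q.+-cong (Q.*-congˡ E-μ′) (Q.*-congˡ (▹-cong (adj k₀) E-μ′))
            where
            E-μ′ : ι (E μ′) Q.≈ step k (κ (β k μ″)) (ι (E μ″))
            E-μ′ = Q.trans (Q.reflexive (≡.cong (ι ∘ E) (≡.sym μ′-≡))) (E-step k μ″ desc″)

          v′ : ∀ i → vᶻ μ′ (adj k ⟨$⟩ʳ i) ≡ vᶻ μ″ i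
          v′ i = ≡.trans (≡.cong (λ ν → vᶻ ν (adj k ⟨$⟩ʳ i)) (≡.sym μ′-≡)) (vᶻ-adj k μ″ (ℤ.<⇒≢ desc″ ∘ ≡.sym) i)

          spectral-shift : spectral k μ″ K.≈ t K.* spectral k₀ μ′
          spectral-shift = K.trans (K.reflexive (≡.cong₂ (λ a b → q^ a K.* t^ b)
            (≡.trans (≡.cong₂ ℤ._-_ μ″-a μ″-b′) (≡.sym (≡.cong₂ ℤ._-_ (lookup-adj-lo k₀ μ) (lookup-adj-hi k₀ μ))))
            exponent)) (t^-suc (lookup μ′ (inject₁ k₀) ℤ.- lookup μ′ (suc k₀)) (vᶻ μ′ (inject₁ k₀) ℤ.- vᶻ μ′ (suc k₀)))
            where
            open ℤSolver

            lo′ : vᶻ μ′ (inject₁ k₀) ≡ vᶻ μ″ (inject₁ k)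
            lo′ = ≡.trans (≡.cong (vᶻ μ′) (≡.trans (≡.sym sk≡lk₀) (≡.sym (adj-lo k)))) (v′ (inject₁ k))

            hi′ : vᶻ μ′ (suc k₀) ≡ 1ℤ ℤ.+ vᶻ μ″ (suc k)
            hi′ = ≡.trans (≡.cong (vᶻ μ′) (≡.sym (adj-off k (lk≢sk₀ ∘ ≡.sym) sk₀≢sk)))
              (≡.trans (v′ (suc k₀)) (≡.trans (vᶻ-equal k₀ μ″ (≡.trans μ″-b (≡.sym μ″-c)))
                (≡.cong (λ i → 1ℤ ℤ.+ vᶻ μ″ i) (≡.sym sk≡lk₀))))

            exponent : vᶻ μ″ (inject₁ k) ℤ.- vᶻ μ″ (suc k) ≡ 1ℤ ℤ.+ (vᶻ μ′ (inject₁ k₀) ℤ.- vᶻ μ′ (suc k₀))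
            exponent = ≡.sym (≡.trans (≡.cong₂ (λ a b → 1ℤ ℤ.+ (a ℤ.- b)) lo′ hi′)
              (solve 2 (λ a b → con 1ℤ :+ (a :- (con 1ℤ :+ b)) := a :- b) (vᶻ μ″ (inject₁ k)) (vᶻ μ″ (suc k))))

        -- μ = (c , b , b) at the positions involved
        above : suc k₀ ≡ inject₁ k → Goal
        above sk₀≡lk = Q.trans (▹-cong (adj k) E-μ′-step) (Q.trans
          (step-step-symmetric k₀ k sk₀≡lk (κ-inv (β k₀ μ′)) (κ-inv (β k μ″)) (κ-β-shift k k₀ μ″ μ′ spectral-shift)
            (sym⇒▹ k₀ μ″ (smaller μ″ (nonnegative-adj k μ′ (nonnegative-adj k₀ μ nn)) (≡.trans (size-adj k μ′) (size-adj k₀ μ)) (inject₁ k₀)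
              (ℕ.≤-reflexive (Fin.toℕ-inject₁ k₀)) (≡.subst (0ℤ ℤ.<_) (≡.sym μ″-a) pos) k₀ (≡.trans μ″-a (≡.sym μ″-b)))))
          (Q.sym E-μ′-step))
          where
          μ″ : Vec ℤ n
          μ″ = adj k • μ′

          lk₀≢lk : inject₁ k₀ ≢ inject₁ k
          lk₀≢lk e = inject₁≢suc k₀ (≡.trans e (≡.sym sk₀≡lk))

          lk₀≢sk : inject₁ k₀ ≢ suc k
          lk₀≢sk = Fin.<⇒≢ (ℕ.<-trans (lo<hi k₀) (≡.subst (Fin._< suc k) (≡.sym sk₀≡lk) (lo<hi k)))

          sk≢sk₀ : suc k ≢ suc k₀
          sk≢sk₀ e = inject₁≢suc k (≡.trans (≡.sym sk₀≡lk) (≡.sym e))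

          μ′-b : lookup μ′ (inject₁ k) ≡ lookup μ (inject₁ k₀)
          μ′-b = ≡.trans (≡.cong (lookup μ′) (≡.sym sk₀≡lk)) (lookup-adj-hi k₀ μ)

          μ′-c : lookup μ′ (suc k) ≡ lookup μ (suc k₀)
          μ′-c = ≡.trans (lookup-adj-off k₀ μ (lk₀≢sk ∘ ≡.sym) sk≢sk₀) (≡.trans (≡.sym eq) (≡.cong (lookup μ) (≡.sym sk₀≡lk)))

          μ″-a : lookup μ″ (inject₁ k₀) ≡ lookup μ (suc k₀)
          μ″-a = ≡.trans (lookup-adj-off k μ′ lk₀≢lk lk₀≢sk) (lookup-adj-lo k₀ μ)

          μ″-b′ : lookup μ″ (inject₁ k) ≡ lookup μ (suc k₀)
          μ″-b′ = ≡.trans (lookup-adj-lo k μ′) μ′-c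

          μ″-b : lookup μ″ (suc k₀) ≡ lookup μ (suc k₀)
          μ″-b = ≡.trans (≡.cong (lookup μ″) sk₀≡lk) μ″-b′

          μ″-c : lookup μ″ (suc k) ≡ lookup μ (inject₁ k₀)
          μ″-c = ≡.trans (lookup-adj-hi k μ′) μ′-b

          desc″ : lookup μ″ (suc k) ℤ.< lookup μ″ (inject₁ k)
          desc″ = ≡.subst₂ ℤ._<_ (≡.sym μ″-c) (≡.sym μ″-b′) asc

          μ′-≡ : adj k • μ″ ≡ μ′
          μ′-≡ = adj•adj• k μ′

          E-μ′-step : step k₀ (κ (β k₀ μ′)) (ι (E μ′)) Q.≈ step k₀ (κ (β k₀ μ′)) (step k (κ (β k μ″)) (ι (E μ″)))
          E-μ′-step = Q.+-cong (Q.*-congˡ E-μ′) (Q.*-congˡ (▹-cong (adj k₀) E-μ′))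
            where
            E-μ′ : ι (E μ′) Q.≈ step k (κ (β k μ″)) (ι (E μ″))
            E-μ′ = Q.trans (Q.reflexive (≡.cong (ι ∘ E) (≡.sym μ′-≡))) (E-step k μ″ desc″)

          v′ : ∀ i → vᶻ μ′ (adj k ⟨$⟩ʳ i) ≡ vᶻ μ″ i
          v′ i = ≡.trans (≡.cong (λ ν → vᶻ ν (adj k ⟨$⟩ʳ i)) (≡.sym μ′-≡)) (vᶻ-adj k μ″ (ℤ.<⇒≢ desc″ ∘ ≡.sym) i)

          spectral-shift : spectral k μ″ K.≈ t K.* spectral k₀ μ′
          spectral-shift = K.trans (K.reflexive (≡.cong₂ (λ a b → q^ a K.* t^ b)
            (≡.trans (≡.cong₂ ℤ._-_ μ″-b′ μ″-c) (≡.sym (≡.cong₂ ℤ._-_ (lookup-adj-lo k₀ μ) (lookup-adj-hi k₀ μ))))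
            exponent)) (t^-suc (lookup μ′ (inject₁ k₀) ℤ.- lookup μ′ (suc k₀)) (vᶻ μ′ (inject₁ k₀) ℤ.- vᶻ μ′ (suc k₀)))
            where
            open ℤSolver

            lo′ : vᶻ μ′ (inject₁ k₀) ≡ vᶻ μ″ (inject₁ k₀)
            lo′ = ≡.trans (≡.cong (vᶻ μ′) (≡.sym (adj-off k lk₀≢lk lk₀≢sk))) (v′ (inject₁ k₀))

            hi′ : vᶻ μ′ (suc k₀) ≡ vᶻ μ″ (suc k)
            hi′ = ≡.trans (≡.cong (vᶻ μ′) (≡.trans sk₀≡lk (≡.sym (adj-hi k)))) (v′ (suc k))

            mid : vᶻ μ″ (inject₁ k) ≡ 1ℤ ℤ.+ vᶻ μ″ (inject₁ k₀)
            mid = ≡.trans (≡.cong (vᶻ μ″) (≡.sym sk₀≡lk)) (vᶻ-equal k₀ μ″ (≡.trans μ″-a (≡.sym μ″-b)))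

            exponent : vᶻ μ″ (inject₁ k) ℤ.- vᶻ μ″ (suc k) ≡ 1ℤ ℤ.+ (vᶻ μ′ (inject₁ k₀) ℤ.- vᶻ μ′ (suc k₀))
            exponent = ≡.trans (≡.cong (ℤ._- vᶻ μ″ (suc k)) mid) (≡.trans (ℤ.+-assoc 1ℤ (vᶻ μ″ (inject₁ k₀)) (ℤ.- vᶻ μ″ (suc k)))
              (≡.cong₂ (λ a b → 1ℤ ℤ.+ (a ℤ.- b)) (≡.sym lo′) (≡.sym hi′)))

        compare : Tri (toℕ k ℕ.< toℕ k₀) (toℕ k ≡ toℕ k₀) (toℕ k₀ ℕ.< toℕ k) → Goal
        compare (tri≈ _ k≡k₀ _) = contradiction asc (ℤ.<-irrefl
          (≡.subst (λ j → lookup μ (inject₁ j) ≡ lookup μ (suc j)) (Fin.toℕ-injective k≡k₀) eq))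
        compare (tri< k<k₀ _ _) = neighbour (suc k Fin.≟ inject₁ k₀)
          where
          neighbour : Dec (suc k ≡ inject₁ k₀) → Goal
          neighbour (yes sk≡lk₀) = below sk≡lk₀
          neighbour (no  sk≢lk₀) = disjoint
            (λ e → ℕ.<⇒≢ k<k₀ (≡.trans (≡.sym (Fin.toℕ-inject₁ k)) (≡.trans (≡.cong toℕ (≡.sym e)) (Fin.toℕ-inject₁ k₀))))
            (sk≢lk₀ ∘ ≡.sym)
            (λ e → ℕ.<⇒≢ (ℕ.<-trans k<k₀ (ℕ.n<1+n _)) (≡.trans (≡.sym (Fin.toℕ-inject₁ k)) (≡.cong toℕ (≡.sym e))))
            (λ e → ℕ.<⇒≢ k<k₀ (ℕ.suc-injective (≡.cong toℕ (≡.sym e))))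
        compare (tri> _ _ k₀<k) = neighbour (suc k₀ Fin.≟ inject₁ k)
          where
          neighbour : Dec (suc k₀ ≡ inject₁ k) → Goal
          neighbour (yes sk₀≡lk) = above sk₀≡lk
          neighbour (no  sk₀≢lk) = disjoint
            (λ e → ℕ.<⇒≢ k₀<k (≡.trans (≡.sym (Fin.toℕ-inject₁ k₀)) (≡.trans (≡.cong toℕ e) (Fin.toℕ-inject₁ k))))
            (λ e → ℕ.<⇒≢ (ℕ.<-trans k₀<k (ℕ.n<1+n _)) (≡.trans (≡.sym (Fin.toℕ-inject₁ k₀)) (≡.cong toℕ e)))
            sk₀≢lk
            (λ e → ℕ.<⇒≢ k₀<k (ℕ.suc-injective (≡.cong toℕ e)))

        chain : adj k ▹ ι (E μ) Q.≈ ι (E μ)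
        chain = begin
          adj k ▹ ι (E μ)                                      ≈⟨ ▹-cong (adj k) E-μ ⟩
          adj k ▹ step k₀ (κ (β k₀ μ′)) (ι (E μ′))             ≈⟨ compare (ℕ.<-cmp (toℕ k) (toℕ k₀)) ⟩
          step k₀ (κ (β k₀ μ′)) (ι (E μ′))                     ≈⟨ E-μ ⟨
          ι (E μ)                                              ∎
          where open Q-Reasoning

      rotate-case : ∀ μ → Nonnegative μ → 0ℤ ℤ.< lookup μ zero → (∀ ν → Nonnegative ν → size ν ℕ.< size μ → Symmetric ν) → Symmetric μ
      rotate-case μ nn pos smaller k eq = by (rotation k)
        where
        open K-Reasoning

        μ′ μ″ : Vec ℤ n
        μ′ = unrotate μ
        μ″ = unrotate μ′

        nn′ : Nonnegative μ′
        nn′ = nonnegative-unrotate μ nn pos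

        weight : Vec ℤ n → K → ℤ → K
        weight γ y a = q^ Vec.last γ K.* (q^ (ℤ.- a) K.* y)

        by : (∃[ k′ ] Rotation₁ k k′) ⊎ (∃[ k′ ] Rotation₂ k k′) → Sym k μ
        by (inj₁ (k′ , rot)) = ≡.subst (Sym k) (rotate-unrotate μ) (coeff-sym k (rotate μ′) λ ν →
          ≡.subst (λ ν → coeff (E (rotate μ′)) (adj k • ν) K.≈ coeff (E (rotate μ′)) ν) (rotate-unrotate ν) (at-rotate (unrotate ν)))
          where
          open Rotation₁ rot

          at-rotate : ∀ ν → coeff (E (rotate μ′)) (adj k • rotate ν) K.≈ coeff (E (rotate μ′)) (rotate ν)
          at-rotate ν = begin
            coeff (E (rotate μ′)) (adj k • rotate ν)
              ≡⟨ ≡.cong (coeff (E (rotate μ′))) (adj-rotate ν) ⟩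
            coeff (E (rotate μ′)) (rotate (adj k′ • ν))
              ≈⟨ coeff-rotate μ′ (adj k′ • ν) ⟩
            weight μ′ (coeff (E μ′) (adj k′ • ν)) (Vec.last (adj k′ • ν))
              ≈⟨ K.*-congˡ (K.*-cong (K.reflexive (≡.cong (λ a → q^ (ℤ.- a)) (last-fixed ν)))
                   (sym-coeff k′ μ′ (smaller μ′ nn′ (size-unrotate μ pos) k′ (entries μ eq)) ν)) ⟩
            weight μ′ (coeff (E μ′) ν) (Vec.last ν)
              ≈⟨ coeff-rotate μ′ ν ⟨
            coeff (E (rotate μ′)) (rotate ν) ∎
        by (inj₂ (k′ , rot)) = ≡.subst (Sym k) (≡.trans (≡.cong rotate (rotate-unrotate μ′)) (rotate-unrotate μ)) (coeff-sym k (rotate (rotate μ″)) λ ν →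
          ≡.subst (λ ν → coeff (E (rotate (rotate μ″))) (adj k • ν) K.≈ coeff (E (rotate (rotate μ″))) ν)
            (≡.trans (≡.cong rotate (rotate-unrotate (unrotate ν))) (rotate-unrotate ν)) (at-rotate (unrotate (unrotate ν))))
          where
          open Rotation₂ rot

          pos′ : 0ℤ ℤ.< lookup μ′ zero
          pos′ = positive μ eq pos

          coeff-rotate² : ∀ ν → coeff (E (rotate (rotate μ″))) (rotate (rotate ν)) K.≈
            weight (rotate μ″) (weight μ″ (coeff (E μ″) ν) (Vec.last ν)) (Vec.last (rotate ν))
          coeff-rotate² ν = K.trans (coeff-rotate (rotate μ″) (rotate ν)) (K.*-congˡ (K.*-congˡ (coeff-rotate μ″ ν)))

          at-rotate : ∀ ν → coeff (E (rotate (rotate μ″))) (adj k • rotate (rotate ν)) K.≈ coeff (E (rotate (rotate μ″))) (rotate (rotate ν))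
          at-rotate ν = begin
            coeff (E (rotate (rotate μ″))) (adj k • rotate (rotate ν))
              ≡⟨ ≡.cong (coeff (E (rotate (rotate μ″)))) (adj-rotate ν) ⟩
            coeff (E (rotate (rotate μ″))) (rotate (rotate (adj k′ • ν)))
              ≈⟨ coeff-rotate² (adj k′ • ν) ⟩
            weight (rotate μ″) (weight μ″ (coeff (E μ″) (adj k′ • ν)) (Vec.last (adj k′ • ν))) (Vec.last (rotate (adj k′ • ν)))
              ≈⟨ K.*-congˡ (K.*-cong (K.reflexive (≡.cong (λ a → q^ (ℤ.- a)) (last-swap′ ν)))
                   (K.*-congˡ (K.*-cong (K.reflexive (≡.cong (λ a → q^ (ℤ.- a)) (last-swap ν)))
                     (sym-coeff k′ μ″ (smaller μ″ (nonnegative-unrotate μ′ nn′ pos′)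
                       (ℕ.<-trans (size-unrotate μ′ pos′) (size-unrotate μ pos)) k′ (entries μ eq)) ν)))) ⟩
            weight (rotate μ″) (weight μ″ (coeff (E μ″) ν) (Vec.last (rotate ν))) (Vec.last ν)
              ≈⟨ SK.solve 5 (λ p y r z e → p SK.:* (z SK.:* (r SK.:* (y SK.:* e))) SK.:= p SK.:* (y SK.:* (r SK.:* (z SK.:* e))))
                   (q^ Vec.last (rotate μ″)) (q^ (ℤ.- Vec.last (rotate ν))) (q^ Vec.last μ″) (q^ (ℤ.- Vec.last ν)) (coeff (E μ″) ν) ⟩
            weight (rotate μ″) (weight μ″ (coeff (E μ″) ν) (Vec.last ν)) (Vec.last (rotate ν))
              ≈⟨ coeff-rotate² ν ⟨
            coeff (E (rotate (rotate μ″))) (rotate (rotate ν)) ∎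

      symmetric : ∀ μ → Symmetric μ
      symmetric = decrement-induction Symmetric
        (nonnegative-induction Symmetric symmetric-0 rotate-case ascent-case) symmetric-pred*

      E-equal : ∀ k μ → lookup μ (inject₁ k) ≡ lookup μ (suc k) → adj k ▹ ι (E μ) Q.≈ ι (E μ)
      E-equal k μ eq = sym⇒▹ k μ (symmetric μ k eq)

    module Expansion where
      open Symmetrizers using (Δ; N; V; δ; ν; δ-equivariant; ν-equivariant; ▹-recip; Invariant; ▹-∏; symmetrize; antisymmetrize; symmetrize-cong; symmetrize-step;
        antisymmetrize-cong; antisymmetrize-step; symmetrize-0; symmetrize-+; symmetrize-scalar; antisymmetrize-0; antisymmetrize-+; antisymmetrize-scalar; antisymmetrize-signs)

      family : Orbits.Family
      family = record
        { E       = λ μ → ι (E μ)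
        ; β       = λ k μ → κ (ElectronicRelations.β k μ)
        ; β-inv   = λ k μ → κ-invariant (ElectronicRelations.β k μ)
        ; E-step  = ElectronicRelations.E-step
        ; E-equal = Symmetry.E-equal
        }

      β≈B : ∀ k μ → ElectronicRelations.β k μ K.≈ B μ (inject₁ k) (suc k)
      β≈B k μ = ElectronicRelations.β-unique k μ (B-eq μ (inject₁≢suc k))

      orbit-closed : ∀ lam → Orbits.Orbit (orbit lam)
      orbit-closed lam = record
        { unique = orbit-unique lam
        ; closed = λ k μ∈ → case ∈-orbit⁻ lam μ∈ of λ { (w , ≡.refl) → ≡.subst (_∈ orbit lam) (•-· (adj k) w lam) (∈-orbit⁺ lam (adj k · w)) }
        }

      -- the coefficients of P_λ and A_{λ+ρ}, and the ratios of their symmetrizations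
      symC antC symR antR : K → K
      symC b = t K.- b
      antC b = K.- (K.1# K.+ b)
      symR b = K.1# K.+ b
      antR b = b K.- t

      symC-cong : ∀ {a b} → a K.≈ b → symC a K.≈ symC b
      symC-cong eq = K.+-congˡ (K.-‿cong eq)

      antC-cong : ∀ {a b} → a K.≈ b → antC a K.≈ antC b
      antC-cong eq = K.-‿cong (K.+-congˡ eq)

      symR-cong : ∀ {a b} → a K.≈ b → symR a K.≈ symR b
      symR-cong = K.+-congˡ

      antR-cong : ∀ {a b} → a K.≈ b → antR a K.≈ antR b
      antR-cong = K.+-congʳ

      module _ (f : K → K) (f-cong : ∀ {a b} → a K.≈ b → f a K.≈ f b) where
        κ-descent-step : ∀ k μ → Orbits.Descent k μ → κ (descent-product f μ) Q.≈ κ (f (ElectronicRelations.β k μ)) Q.* κ (descent-product f (adj k • μ))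
        κ-descent-step k μ desc = Q.trans (κ-cong (descent-product-step f f-cong k μ desc))
          (Q.trans (κ-* _ _) (Q.*-congʳ (κ-cong (f-cong (K.sym (β≈B k μ))))))

        κ-ascent-step : ∀ k μ → Orbits.Descent k μ → κ (ascent-product f (adj k • μ)) Q.≈ κ (f (ElectronicRelations.β k μ)) Q.* κ (ascent-product f μ)
        κ-ascent-step k μ desc = Q.trans (κ-cong (ascent-product-step f f-cong k μ desc))
          (Q.trans (κ-* _ _) (Q.*-congʳ (κ-cong (f-cong (K.sym (β≈B k μ))))))

        expansion : Vec ℤ n → K[X]
        expansion lam = ∑ X.ring (orbit lam) λ μ → C (descent-product f μ) P.* E μ

        coefficients : Vec ℤ n → K⟨X⟩
        coefficients μ = κ (descent-product f μ)

        combination : Vec ℤ n → K⟨X⟩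
        combination lam = Orbits.combination family (orbit-closed lam) coefficients (λ μ → κ-invariant _)

        ι-expansion : ∀ lam → ι (expansion lam) Q.≈ combination lam
        ι-expansion lam = Q.trans (ι-∑ (orbit lam) _) (∑Q.fold-cong (orbit lam) λ μ → Q.sym (Rational.ι-* _ _))

        ratio : (K → K) → Vec ℤ n → K
        ratio g lam = ∑ 𝕂 (orbit lam) λ μ → descent-product f μ K.* ascent-product g μ

        κ-ratio : ∀ g lam → ∑ Rational.ring (orbit lam) (λ μ → κ (descent-product f μ) Q.* κ (ascent-product g μ)) Q.≈ κ (ratio g lam)
        κ-ratio g lam = Q.trans (∑Q.fold-cong (orbit lam) λ μ → Q.sym (κ-* _ _)) (Q.sym (κ-∑ (orbit lam) _))

      frac-recip : ∀ a {i j} (i≢j : i ≢ j) → Rational.frac a (x i P.- x j) (regular-x-x i≢j) Q.≈ ι a Q.* recip i j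
      frac-recip a {i} {j} i≢j = Q.trans (FX.frac-split a (regular-x-x i≢j)) (Q.*-congˡ (RingLemmas.inverse-unique Rational.ring
        (Q.trans (Q.*-congʳ (Q.sym (ι-- (x i) (x j)))) (FX.recip-inverse (regular-x-x i≢j))) (x-recip i≢j)))

      ι-x-tx : ∀ i j → ι (x i P.- C t P.* x j) Q.≈ ι (x i) Q.- κ t Q.* ι (x j)
      ι-x-tx i j = Q.trans (ι-- _ _) (Q.+-congˡ (Q.-‿cong (Q.sym (Rational.ι-* _ _))))

      symmetrize-1 : symmetrize Q.1# Q.≈ κ (SPK.geometric! K.1# (K.- t) n)
      symmetrize-1 = begin
        ∑ Rational.ring (Sₙ n) (λ w → w ▹ (Δ Q.* Q.1#))
          ≈⟨ ∑Q.fold-cong (Sₙ n) (λ w → Q.trans (act-cong w (Q.*-identityʳ Δ)) (Q.trans (▹-∏ w (pairs n) _)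
               (∏Q.fold-cong (pairs n) λ p → Q.trans (δ-equivariant w (Pair.fst≢snd p)) (Q.*-congʳ
                 (SQ.solve 3 (λ t a b → a SQ.:- t SQ.:* b SQ.:= SQ.con 1ℤ SQ.:* a SQ.:+ SQ.:- t SQ.:* b) (κ t) _ _))))) ⟩
        ∑ Rational.ring (Sₙ n) (λ w → ∏ Rational.ring (pairs n) λ (pair i j _) → SPQ.g Q.1# (Q.- κ t) (λ i → ι (x i)) recip x-recip (w ⟨$⟩ʳ i) (w ⟨$⟩ʳ j))
          ≈⟨ SPQ.symmetrized-product Q.1# (Q.- κ t) (λ i → ι (x i)) recip x-recip ⟩
        SPQ.geometric! Q.1# (Q.- κ t) n
          ≈⟨ SPQ-cong n Q.refl (κ-neg t) ⟨
        SPQ.geometric! Q.1# (κ (K.- t)) n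
          ≈⟨ κ-geometric! K.1# (K.- t) n ⟨
        κ (SPK.geometric! K.1# (K.- t) n) ∎
        where open Q-Reasoning

      antisymmetrize-N : antisymmetrize N Q.≈ κ (SPK.geometric! (K.- t) K.1# n)
      antisymmetrize-N = begin
        ∑ Rational.ring (Sₙ n) (λ w → w ▹ (N Q.* V))
          ≈⟨ ∑Q.fold-cong (Sₙ n) (λ w → Q.trans (act-cong w (Q.sym (∏-* {R = Rational.ring} (pairs n) _ _))) (Q.trans (▹-∏ w (pairs n) _)
               (∏Q.fold-cong (pairs n) λ p → Q.trans (act-Q* w _ _) (Q.*-cong
                 (Q.trans (ν-equivariant w (Pair.fst≢snd p))
                   (SQ.solve 3 (λ t a b → b SQ.:- t SQ.:* a SQ.:= SQ.:- t SQ.:* a SQ.:+ SQ.con 1ℤ SQ.:* b) (κ t) _ _))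
                 (▹-recip w (Pair.fst≢snd p)))))) ⟩
        ∑ Rational.ring (Sₙ n) (λ w → ∏ Rational.ring (pairs n) λ (pair i j _) → SPQ.g (Q.- κ t) Q.1# (λ i → ι (x i)) recip x-recip (w ⟨$⟩ʳ i) (w ⟨$⟩ʳ j))
          ≈⟨ SPQ.symmetrized-product (Q.- κ t) Q.1# (λ i → ι (x i)) recip x-recip ⟩
        SPQ.geometric! (Q.- κ t) Q.1# n
          ≈⟨ SPQ-cong n (κ-neg t) Q.refl ⟨
        SPQ.geometric! (κ (K.- t)) Q.1# n
          ≈⟨ κ-geometric! (K.- t) K.1# n ⟨
        κ (SPK.geometric! (K.- t) K.1# n) ∎
        where open Q-Reasoning

      module _ (lam : Vec ℤ n) (dec : WeaklyDecreasing lam) where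
        S₀ : K⟨X⟩
        S₀ = ∑ Rational.ring (Sₙ n) λ w → act w (ι (E lam) Q.*
               ∏ Rational.ring (pairs n) λ (pair i j i<j) → Rational.frac (x i P.- C t P.* x j) (x i P.- x j) (regular-x-x (Fin.<⇒≢ i<j)))

        NormalizedSymmetrization : K[X] → Set (c ⊔ ℓ₁)
        NormalizedSymmetrization f = ∃[ W ] ∃[ W-regular ] ι f Q.≈ κ (K.1# ÷ W [ W-regular ]) Q.* S₀ × coeff f lam K.≈ K.1#

        private
          open Q-Reasoning

          r : K[X]
          r = expansion symC symC-cong lam

          R S : K⟨X⟩
          R = combination symC symC-cong lam
          S = symmetrize (ι (E lam))

          U D e : K
          U = SPK.geometric! K.1# (K.- t) n
          D = ratio symC symC-cong symR lam
          e = D ÷ U [ regular-symmetric n ]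

          R-invariant : Invariant R
          R-invariant = Orbits.combination-invariant family (orbit-closed lam) _ (λ μ → κ-invariant _) λ k μ desc →
            Q.trans (κ-descent-step symC symC-cong k μ desc) (Q.*-congʳ (κ-- t (ElectronicRelations.β k μ)))

          symmetrize-E : ∀ w → symmetrize (ι (E (w • lam))) Q.≈ κ (ascent-product symR (w • lam)) Q.* S
          symmetrize-E = Orbits.expansion-eigenvalue family symmetrize symmetrize-cong Q.1# (λ k f inv → symmetrize-step k f inv)
            (λ μ → κ (ascent-product symR μ)) lam
            (κ-cong (ascent-product-decreasing symR symR-cong lam dec))
            (λ k μ desc → Q.trans (κ-ascent-step symR symR-cong k μ desc) (Q.*-congʳ (κ-+ K.1# (ElectronicRelations.β k μ))))
            (λ k μ desc → regular-cong (Q.trans (κ-cong (symR-cong (K.sym (β≈B k μ)))) (κ-+ K.1# (ElectronicRelations.β k μ)))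
              (regular-κ (regular-1+B μ (inject₁≢suc k) desc)))

          RU : R Q.* κ U Q.≈ κ D Q.* S
          RU = begin
            R Q.* κ U
              ≈⟨ Q.*-congˡ symmetrize-1 ⟨
            R Q.* symmetrize Q.1#
              ≈⟨ Orbits.symmetrize-invariant R-invariant ⟨
            symmetrize R
              ≈⟨ Orbits.∑-expansion family (orbit-closed lam) (coefficients symC symC-cong) (λ μ → κ-invariant _) symmetrize symmetrize-cong symmetrize-0 symmetrize-+ symmetrize-scalar
                   {λ μ → κ (ascent-product symR μ)} {lam} (λ μ μ∈ → case ∈-orbit⁻ lam μ∈ of λ { (w , ≡.refl) → symmetrize-E w }) ⟩
            ∑ Rational.ring (orbit lam) (λ μ → κ (descent-product symC μ) Q.* κ (ascent-product symR μ)) Q.* S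
              ≈⟨ Q.*-congʳ (κ-ratio symC symC-cong symR lam) ⟩
            κ D Q.* S ∎

          R≈eS : R Q.≈ κ e Q.* S
          R≈eS = FX.regular-cancel (regular-κ (regular-symmetric n)) (begin
            R Q.* κ U            ≈⟨ RU ⟩
            κ D Q.* S            ≈⟨ Q.*-congʳ (κ-cong (÷-* D U (regular-symmetric n))) ⟨
            κ (e K.* U) Q.* S    ≈⟨ Q.*-congʳ (κ-* e U) ⟩
            κ e Q.* κ U Q.* S    ≈⟨ SQ.solve 3 (λ e u s → e SQ.:* u SQ.:* s SQ.:= e SQ.:* s SQ.:* u) (κ e) (κ U) S ⟩
            κ e Q.* S Q.* κ U    ∎)

          r-symmetric : ∀ w → X.act w r P.≈ r
          r-symmetric w = FX.ι-injective (begin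
            ι (X.act w r)  ≈⟨ act-ι w r ⟨
            w ▹ ι r        ≈⟨ act-cong w (ι-expansion symC symC-cong lam) ⟩
            w ▹ R          ≈⟨ R-invariant w ⟩
            R              ≈⟨ ι-expansion symC symC-cong lam ⟨
            ι r            ∎)

          anti : Vec ℤ n
          anti = (w₀ ⁻¹) • lam

          anti-increasing : ∀ {i j} → i Fin.≤ j → lookup anti i ℤ.≤ lookup anti j
          anti-increasing {i} {j} i≤j = ≡.subst₂ ℤ._≤_ (≡.sym (lookup-• (w₀ ⁻¹) lam i)) (≡.sym (lookup-• (w₀ ⁻¹) lam j))
            (dec (ℕ.≮⇒≥ λ lt → ℕ.<⇒≱ (opposite-anti⁻¹ {i = j} {i} lt) i≤j))

          coeff-∑ : ∀ (Ω : List (Vec ℤ n)) f γ → coeff (∑ X.ring Ω f) γ K.≈ ∑ 𝕂 Ω (λ μ → coeff (f μ) γ)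
          coeff-∑ Ω f γ = fold-homo P.+-commutativeMonoid K.+-commutativeMonoid (λ f → coeff f γ) K.refl (λ f g → coeff-+ f g γ) Ω f

          coeff-term-anti : ∀ μ → μ ∈ orbit lam → (d : Dec (anti ≡ μ)) →
            coeff (C (descent-product symC μ) P.* E μ) anti K.≈ ∑K.pick d K.1#
          coeff-term-anti μ μ∈ (yes ≡.refl) = K.trans (coeff-const-* _ (E anti) anti) (K.trans
            (K.*-cong (descent-product-increasing symC symC-cong anti anti-increasing) (proj₁ (Triangularity.triangular anti))) (K.*-identityˡ K.1#))
          coeff-term-anti μ μ∈ (no anti≢μ) = K.trans (coeff-const-* _ (E μ) anti) (K.trans (K.*-congˡ vanish) (K.zeroʳ _))
            where
            vanish : coeff (E μ) anti K.≈ K.0#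
            vanish = case ∈-orbit⁻ lam μ∈ of λ { (w , ≡.refl) → ≡.subst (λ ν → coeff (E ν) anti K.≈ K.0#) (from-anti w)
              (Triangularity.coeff-increasing (w · w₀) anti anti-increasing λ eq → anti≢μ (≡.trans (≡.sym eq) (from-anti w))) }
              where
              from-anti : ∀ w → (w · w₀) • anti ≡ w • lam
              from-anti w = ≡.trans (•-· w w₀ anti) (≡.cong (w •_) (X.•⁻¹• w₀ lam))

          r-normalized : coeff r lam K.≈ K.1#
          r-normalized = K.trans (K.sym (X.at (r-symmetric w₀) lam)) (K.trans (X.coeff-act w₀ r lam) (K.trans (coeff-∑ (orbit lam) _ anti)
            (K.trans (∑K.fold-cong-∈ (orbit lam) λ μ μ∈ → coeff-term-anti μ μ∈ (anti ≟ᵉ μ))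
              (∑K.fold-once (anti ≟ᵉ_) (λ _ → K.1#) K.1# (once-∈ (orbit-unique lam) (∈-orbit⁺ lam (w₀ ⁻¹))) λ _ _ → K.refl))))

          e-regular : Regular 𝕂 e
          e-regular = mkRegular λ y ey≈0 → K.trans (K.sym (K.trans (coeff-const-* y r lam) (K.trans (K.*-congˡ r-normalized) (K.*-identityʳ y))))
            (X.at (FX.ι-injective {C y P.* r} {P.0#} (vanish y ey≈0)) lam)
            where
            vanish : ∀ y → e K.* y K.≈ K.0# → ι (C y P.* r) Q.≈ Q.0#
            vanish y ey≈0 = Q.trans (Q.sym (Rational.ι-* (C y) r)) (Q.trans (Q.*-congˡ (Q.trans (ι-expansion symC symC-cong lam) R≈eS))
              (Q.trans (SQ.solve 3 (λ y e s → y SQ.:* (e SQ.:* s) SQ.:= e SQ.:* y SQ.:* s) (κ y) (κ e) S)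
                (Q.trans (Q.*-congʳ (Q.trans (Q.sym (κ-* e y)) (Q.trans (κ-cong ey≈0) κ-0))) (Q.zeroˡ S))))

          defining-sum : S₀ Q.≈ S
          defining-sum = ∑Q.fold-cong (Sₙ n) λ w → act-cong w (Q.trans (Q.*-comm _ _) (Q.*-congʳ (∏Q.fold-cong (pairs n) λ (pair i j i<j) →
            Q.trans (frac-recip _ (Fin.<⇒≢ i<j)) (Q.*-congʳ (ι-x-tx i j)))))

          r≈eS : ι r Q.≈ κ e Q.* S
          r≈eS = Q.trans (ι-expansion symC symC-cong lam) R≈eS

        normalized⇒expansion : ∀ f → NormalizedSymmetrization f → f P.≈ expansion symC symC-cong lam
        normalized⇒expansion f (W , W-regular , symmetrized , normalized) = FX.ι-injective (begin
          ι f                ≈⟨ f≈aS ⟩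
          κ a Q.* S          ≈⟨ Q.*-congʳ (κ-cong e≈a) ⟨
          κ e Q.* S          ≈⟨ r≈eS ⟨
          ι r                ∎)
          where
          a : K
          a = K.1# ÷ W [ W-regular ]

          f≈aS : ι f Q.≈ κ a Q.* S
          f≈aS = Q.trans symmetrized (Q.*-congˡ defining-sum)

          ef≈ar : C e P.* f P.≈ C a P.* r
          ef≈ar = FX.ι-injective (begin
            ι (C e P.* f)          ≈⟨ Rational.ι-* (C e) f ⟨
            κ e Q.* ι f            ≈⟨ Q.*-congˡ f≈aS ⟩
            κ e Q.* (κ a Q.* S)    ≈⟨ SQ.solve 3 (λ e a s → e SQ.:* (a SQ.:* s) SQ.:= a SQ.:* (e SQ.:* s)) (κ e) (κ a) S ⟩
            κ a Q.* (κ e Q.* S)    ≈⟨ Q.*-congˡ r≈eS ⟨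
            κ a Q.* ι r            ≈⟨ Rational.ι-* (C a) r ⟩
            ι (C a P.* r)          ∎)

          e≈a : e K.≈ a
          e≈a = K.trans (K.sym (K.trans (coeff-const-* e f lam) (K.trans (K.*-congˡ normalized) (K.*-identityʳ e))))
            (K.trans (X.at ef≈ar lam) (K.trans (coeff-const-* a r lam) (K.trans (K.*-congˡ r-normalized) (K.*-identityʳ a))))

        expansion⇒normalized : ∀ f → f P.≈ expansion symC symC-cong lam → NormalizedSymmetrization f
        expansion⇒normalized f f≈r = W , W-regular , symmetrized , K.trans (X.at f≈r lam) r-normalized
          where
          W : K
          W = K.1# ÷ e [ e-regular ]

          eW≈1 : e K.* W K.≈ K.1#
          eW≈1 = K.trans (K.*-comm e W) (÷-* K.1# e e-regular)

          W-regular : Regular 𝕂 W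
          W-regular = invertible⇒regular {R = 𝕂} (÷-* K.1# e e-regular)

          symmetrized : ι f Q.≈ κ (K.1# ÷ W [ W-regular ]) Q.* S₀
          symmetrized = begin
            ι f                              ≈⟨ Rational.ι-cong f≈r ⟩
            ι r                              ≈⟨ r≈eS ⟩
            κ e Q.* S                        ≈⟨ Q.*-cong (κ-cong (÷-unique W-regular eW≈1)) defining-sum ⟨
            κ (K.1# ÷ W [ W-regular ]) Q.* S₀ ∎

    module Antisymmetric where
      open Expansion
      open Symmetrizers using (N; V; ν; antisymmetrize; antisymmetrize-cong; antisymmetrize-step; antisymmetrize-0; antisymmetrize-+; antisymmetrize-scalar; antisymmetrize-signs)

      A : Vec ℤ n → K⟨X⟩
      A μ₀ = (∏ Rational.ring (pairs n) λ (pair i j i<j) → Rational.frac (x j P.- C t P.* x i) (x i P.- x j) (regular-x-x (Fin.<⇒≢ i<j)))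
             Q.* ∑ Rational.ring (Sₙ n) λ w → κ ((K.- K.1#) ^ ℓ w) Q.* act w (ι (E μ₀))

      A-antisymmetrize : ∀ μ₀ → A μ₀ Q.≈ N Q.* antisymmetrize (ι (E μ₀))
      A-antisymmetrize μ₀ = begin
        A μ₀
          ≈⟨ Q.*-cong (Q.trans (∏Q.fold-cong (pairs n) λ (pair i j i<j) → Q.trans (frac-recip _ (Fin.<⇒≢ i<j)) (Q.*-congʳ (ι-x-tx j i)))
                        (∏-* {R = Rational.ring} (pairs n) _ _))
                      (∑Q.fold-cong (Sₙ n) λ w → Q.*-congʳ (κ-sign (ℓ w))) ⟩
        (N Q.* V) Q.* ∑ Rational.ring (Sₙ n) (λ w → (Q.- Q.1#) ^Q ℓ w Q.* w ▹ ι (E μ₀))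
          ≈⟨ Q.*-assoc N V _ ⟩
        N Q.* (V Q.* ∑ Rational.ring (Sₙ n) (λ w → (Q.- Q.1#) ^Q ℓ w Q.* w ▹ ι (E μ₀)))
          ≈⟨ Q.*-congˡ (antisymmetrize-signs _) ⟩
        N Q.* antisymmetrize (ι (E μ₀)) ∎
        where
        open Q-Reasoning
        open Algebra.Properties.Semiring.Exp Q.semiring renaming (_^_ to _^Q_)

        κ-sign : ∀ k → κ ((K.- K.1#) ^ k) Q.≈ (Q.- Q.1#) ^Q k
        κ-sign zero    = Q.refl
        κ-sign (suc k) = Q.trans (κ-* _ _) (Q.*-cong (κ-neg K.1#) (κ-sign k))

      module _ (μ₀ : Vec ℤ n) (strict : ∀ {i j} → i Fin.< j → lookup μ₀ j ℤ.< lookup μ₀ i) where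
        injective : ∀ {i j} → lookup μ₀ i ≡ lookup μ₀ j → i ≡ j
        injective {i} {j} eq with ℕ.<-cmp (toℕ i) (toℕ j)
        ... | tri< i<j _ _ = contradiction (≡.sym eq) (ℤ.<⇒≢ (strict i<j))
        ... | tri≈ _ i≡j _ = Fin.toℕ-injective i≡j
        ... | tri> _ _ j<i = contradiction eq (ℤ.<⇒≢ (strict j<i))

        decreasing : WeaklyDecreasing μ₀
        decreasing {i} {j} i≤j with ℕ.m≤n⇒m<n∨m≡n i≤j
        ... | inj₁ i<j = ℤ.<⇒≤ (strict i<j)
        ... | inj₂ i≡j = ℤ.≤-reflexive (≡.cong (lookup μ₀) (≡.sym (Fin.toℕ-injective i≡j)))

        block-increasing : ∀ z → BlockIncreasing μ₀ z
        block-increasing z eq i<j = contradiction i<j (ℕ.<-irrefl (≡.cong toℕ (injective eq)))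

        once-orbit : ∀ z → Once (λ w → z • μ₀ ≡ (w ⁻¹) • μ₀) (Sₙ n)
        once-orbit z = once-resp
          (λ w w≈ → ≡.sym (•-cong {w = w ⁻¹} {z} (perm-inverse-cong {w = w} {z ⁻¹} w≈) μ₀))
          (λ w eq → perm-inverse-cong {w = w ⁻¹} {z} (blockIncreasing-unique μ₀ {w ⁻¹} {z}
            (λ {i} {j} → block-increasing (w ⁻¹) {i} {j}) (λ {i} {j} → block-increasing z {i} {j}) (≡.sym eq)))
          (once-Sₙ (z ⁻¹))

        once-orbit′ : ∀ z → Once (λ w → w • μ₀ ≡ z • μ₀) (Sₙ n)
        once-orbit′ z = once-resp (λ w w≈ → •-cong {w = w} {z} w≈ μ₀)
          (λ w eq → blockIncreasing-unique μ₀ {w} {z} (λ {i} {j} → block-increasing w {i} {j}) (λ {i} {j} → block-increasing z {i} {j}) eq)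
          (once-Sₙ z)

        private
          y y⁻¹ : Fin n → K
          y i   = qt (lookup μ₀ i) (+ 2 ℤ.* vᶻ μ₀ i)
          y⁻¹ i = qt (ℤ.- lookup μ₀ i) (ℤ.- (+ 2 ℤ.* vᶻ μ₀ i))

          yy⁻¹ : ∀ i → y i K.* y⁻¹ i K.≈ K.1#
          yy⁻¹ i = K.trans (qt-* _ _ _ _) (K.trans (K.reflexive (≡.cong₂ qt (ℤ.+-inverseʳ (lookup μ₀ i)) (ℤ.+-inverseʳ (+ 2 ℤ.* vᶻ μ₀ i)))) qt-0)

          Qy : ∀ i j → qt[ μ₀ , i , j ] K.* y j K.≈ y i
          Qy i j = K.trans (K.*-congʳ (qt-* _ _ _ _)) (K.trans (qt-* _ _ _ _) (K.reflexive (≡.cong₂ qt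
            (ℤSolver.solve 2 (λ a b → ((a ℤSolver.:- b) ℤSolver.:+ ℤSolver.con 0ℤ) ℤSolver.:+ b ℤSolver.:= a) (lookup μ₀ i) (lookup μ₀ j))
            (ℤSolver.solve 2 (λ a b → (ℤSolver.con 0ℤ ℤSolver.:+ ℤSolver.con (+ 2) ℤSolver.:* (a ℤSolver.:- b)) ℤSolver.:+ ℤSolver.con (+ 2) ℤSolver.:* b ℤSolver.:= ℤSolver.con (+ 2) ℤSolver.:* a) (vᶻ μ₀ i) (vᶻ μ₀ j)))))

          y-recip : Fin n → Fin n → K
          y-recip i j = unlessEqual K.0# (i Fin.≟ j) λ i≢j → K.- (y⁻¹ j K.* (K.1# ÷ K.1# K.- qt[ μ₀ , i , j ] [ regular-1-qt[] μ₀ i≢j ]))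

          y-inverse : ∀ {i j} → i ≢ j → (y i K.- y j) K.* y-recip i j K.≈ K.1#
          y-inverse {i} {j} i≢j = unlessEqual-elim (λ r → (y i K.- y j) K.* r K.≈ K.1#) (i Fin.≟ j) _ i≢j λ i≢j →
            let z = K.1# ÷ K.1# K.- Q [ regular-1-qt[] μ₀ i≢j ] in begin
              (y i K.- y j) K.* K.- (y⁻¹ j K.* z)
                ≈⟨ K.*-congʳ (K.+-congʳ (Qy i j)) ⟨
              (Q K.* y j K.- y j) K.* K.- (y⁻¹ j K.* z)
                ≈⟨ SK.solve 4 (λ Q y y⁻¹ z → (Q SK.:* y SK.:- y) SK.:* SK.:- (y⁻¹ SK.:* z) SK.:= (y SK.:* y⁻¹) SK.:* (z SK.:* (SK.con 1ℤ SK.:- Q))) Q (y j) (y⁻¹ j) z ⟩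
              (y j K.* y⁻¹ j) K.* (z K.* (K.1# K.- Q))
                ≈⟨ K.*-cong (yy⁻¹ j) (÷-* K.1# (K.1# K.- Q) (regular-1-qt[] μ₀ i≢j)) ⟩
              K.1# K.* K.1#
                ≈⟨ K.*-identityˡ _ ⟩
              K.1# ∎
            where
            open K-Reasoning
            Q : K
            Q = qt[ μ₀ , i , j ]

          g : Fin n → Fin n → K
          g = SPK.g (K.- t) K.1# y y-recip y-inverse

          cancel-recip : ∀ {i j p z} → i ≢ j → p K.* (y i K.- y j) K.≈ z → p K.≈ z K.* y-recip i j
          cancel-recip {i} {j} {p} {z} i≢j eq = begin
            p                                            ≈⟨ K.*-identityʳ p ⟨
            p K.* K.1#                                   ≈⟨ K.*-congˡ (y-inverse i≢j) ⟨
            p K.* ((y i K.- y j) K.* y-recip i j)        ≈⟨ K.*-assoc _ _ _ ⟨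
            p K.* (y i K.- y j) K.* y-recip i j          ≈⟨ K.*-congʳ eq ⟩
            z K.* y-recip i j                            ∎
            where open K-Reasoning

          antC-g : ∀ {i j} → i ≢ j → antC (B μ₀ i j) K.≈ g i j
          antC-g {i} {j} i≢j = cancel-recip i≢j (begin
            (K.- (K.1# K.+ b)) K.* (y i K.- y j)
              ≈⟨ K.*-congˡ (K.+-congʳ (Qy i j)) ⟨
            (K.- (K.1# K.+ b)) K.* (Q K.* y j K.- y j)
              ≈⟨ SK.solve 3 (λ b Q y → (SK.:- (SK.con 1ℤ SK.:+ b)) SK.:* (Q SK.:* y SK.:- y)
                   SK.:= ((SK.con 1ℤ SK.:- Q) SK.:+ b SK.:* (SK.con 1ℤ SK.:- Q)) SK.:* y) b Q (y j) ⟩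
            ((K.1# K.- Q) K.+ b K.* (K.1# K.- Q)) K.* y j
              ≈⟨ K.*-congʳ (K.+-congˡ (B-eq μ₀ i≢j)) ⟩
            ((K.1# K.- Q) K.+ (K.1# K.- t) K.* Q) K.* y j
              ≈⟨ SK.solve 3 (λ t Q y → ((SK.con 1ℤ SK.:- Q) SK.:+ (SK.con 1ℤ SK.:- t) SK.:* Q) SK.:* y
                   SK.:= (SK.:- t) SK.:* (Q SK.:* y) SK.:+ SK.con 1ℤ SK.:* y) t Q (y j) ⟩
            (K.- t) K.* (Q K.* y j) K.+ K.1# K.* y j
              ≈⟨ K.+-congʳ (K.*-congˡ (Qy i j)) ⟩
            (K.- t) K.* y i K.+ K.1# K.* y j ∎)
            where
            open K-Reasoning
            b Q : K
            b = B μ₀ i j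
            Q = qt[ μ₀ , i , j ]

          antR-g : ∀ {i j} → i ≢ j → antR (B μ₀ j i) K.≈ g i j
          antR-g {i} {j} i≢j = cancel-recip i≢j (begin
            (b K.- t) K.* (y i K.- y j)
              ≈⟨ K.*-congˡ (K.+-congˡ (K.-‿cong (Qy j i))) ⟨
            (b K.- t) K.* (y i K.- Q K.* y i)
              ≈⟨ SK.solve 4 (λ b t Q y → (b SK.:- t) SK.:* (y SK.:- Q SK.:* y)
                   SK.:= (b SK.:* (SK.con 1ℤ SK.:- Q) SK.:- t SK.:* (SK.con 1ℤ SK.:- Q)) SK.:* y) b t Q (y i) ⟩
            (b K.* (K.1# K.- Q) K.- t K.* (K.1# K.- Q)) K.* y i
              ≈⟨ K.*-congʳ (K.+-congʳ (B-eq μ₀ (i≢j ∘ ≡.sym))) ⟩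
            ((K.1# K.- t) K.* Q K.- t K.* (K.1# K.- Q)) K.* y i
              ≈⟨ SK.solve 3 (λ t Q y → ((SK.con 1ℤ SK.:- t) SK.:* Q SK.:- t SK.:* (SK.con 1ℤ SK.:- Q)) SK.:* y
                   SK.:= (SK.:- t) SK.:* y SK.:+ SK.con 1ℤ SK.:* (Q SK.:* y)) t Q (y i) ⟩
            (K.- t) K.* y i K.+ K.1# K.* (Q K.* y i)
              ≈⟨ K.+-congˡ (K.*-congˡ (Qy j i)) ⟩
            (K.- t) K.* y i K.+ K.1# K.* y j ∎)
            where
            open K-Reasoning
            b Q : K
            b = B μ₀ j i
            Q = qt[ μ₀ , j , i ]

          -- Both products together run over all pairs, as in Σ_w w ∏ (x_j − t x_i)/(x_i − x_j).
          products : ∀ w → descent-product antC (w ⁻¹ • μ₀) K.* ascent-product antR (w ⁻¹ • μ₀)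
            K.≈ ∏ 𝕂 (pairs n) (λ (pair i j _) → g (w ⟨$⟩ʳ i) (w ⟨$⟩ʳ j))
          products w = K.trans (K.sym (∏-* {R = 𝕂} (pairs n) _ _)) (∏-cong {R = 𝕂} (pairs n) λ p →
            factor (Pair.fst p) (Pair.snd p) (Pair.fst≢snd p) (ℤ.<-cmp _ _))
            where
            μ : Vec ℤ n
            μ = w ⁻¹ • μ₀

            entries : ∀ i → lookup μ ((w ⁻¹) ⟨$⟩ʳ i) ≡ lookup μ₀ i
            entries = lookup-•ʳ (w ⁻¹) μ₀

            ranks : ∀ i → vᶻ μ ((w ⁻¹) ⟨$⟩ʳ i) ≡ vᶻ μ₀ i
            ranks i = ≡.cong (λ r → + toℕ r) (v-• μ₀ (w ⁻¹) (λ {i} {j} → block-increasing (w ⁻¹) {i} {j}) i)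

            B-w : ∀ i j → i ≢ j → B μ i j K.≈ B μ₀ (w ⟨$⟩ʳ i) (w ⟨$⟩ʳ j)
            B-w i j i≢j = K.trans (K.reflexive (≡.cong₂ (B μ) (≡.sym (Perm.inverseˡ w {i})) (≡.sym (Perm.inverseˡ w {j}))))
              (B-transport {μ₀} {μ} (w ⁻¹) entries ranks {w ⟨$⟩ʳ i} {w ⟨$⟩ʳ j} (i≢j ∘ perm-injective w))

            factor : ∀ i j → i ≢ j → Tri (lookup μ j ℤ.< lookup μ i) (lookup μ j ≡ lookup μ i) (lookup μ i ℤ.< lookup μ j) →
              descent-factor antC μ i j K.* ascent-factor antR μ i j K.≈ g (w ⟨$⟩ʳ i) (w ⟨$⟩ʳ j)
            factor i j i≢j (tri< lt _ ¬gt) = K.trans (K.*-cong (∏K.pick-yes (lookup μ j ℤ.<? lookup μ i) _ lt) (∏K.pick-no (lookup μ i ℤ.<? lookup μ j) _ ¬gt))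
              (K.trans (K.*-identityʳ _) (K.trans (antC-cong (B-w i j i≢j)) (antC-g (i≢j ∘ perm-injective w))))
            factor i j i≢j (tri> ¬lt _ gt) = K.trans (K.*-cong (∏K.pick-no (lookup μ j ℤ.<? lookup μ i) _ ¬lt) (∏K.pick-yes (lookup μ i ℤ.<? lookup μ j) _ gt))
              (K.trans (K.*-identityˡ _) (K.trans (antR-cong (B-w j i (i≢j ∘ ≡.sym))) (antR-g (i≢j ∘ perm-injective w))))
            factor i j i≢j (tri≈ _ eq _) = contradiction (injective
              (≡.trans (≡.sym (lookup-• (w ⁻¹) μ₀ j)) (≡.trans eq (lookup-• (w ⁻¹) μ₀ i)))) (i≢j ∘ ≡.sym ∘ perm-injective w)

          D≈U : ratio antC antC-cong antR μ₀ K.≈ SPK.geometric! (K.- t) K.1# n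
          D≈U = K.trans
            (∑K.fold-bijection (λ μ w → μ ≟ᵉ (w ⁻¹ • μ₀))
              (λ μ μ∈ → case ∈-orbit⁻ μ₀ μ∈ of λ { (z , ≡.refl) → once-orbit z })
              (λ w _ → once-resp (λ _ → ≡.sym) (λ _ → ≡.sym) (once-∈ (orbit-unique μ₀) (∈-orbit⁺ μ₀ (w ⁻¹))))
              (λ { _ w _ ≡.refl → products w }))
            (SPK.symmetrized-product (K.- t) K.1# y y-recip y-inverse)

          R S : K⟨X⟩
          R = combination antC antC-cong μ₀
          S = antisymmetrize (ι (E μ₀))

          U : K
          U = SPK.geometric! (K.- t) K.1# n

          antisymmetrize-E : ∀ w → antisymmetrize (ι (E (w • μ₀))) Q.≈ κ (ascent-product antR (w • μ₀)) Q.* S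
          antisymmetrize-E = Orbits.expansion-eigenvalue family antisymmetrize antisymmetrize-cong (Q.- κ t)
            (λ k {b} f inv → Q.trans (antisymmetrize-step k f inv) (Q.*-congʳ (Q.+-comm b (Q.- κ t))))
            (λ μ → κ (ascent-product antR μ)) μ₀
            (κ-cong (ascent-product-decreasing antR antR-cong μ₀ decreasing))
            (λ k μ desc → Q.trans (κ-ascent-step antR antR-cong k μ desc) (Q.*-congʳ (κ-θ k μ)))
            (λ k μ desc → regular-cong (Q.trans (κ-cong (antR-cong (K.sym (β≈B k μ)))) (κ-θ k μ))
              (regular-κ (regular-B-t μ (inject₁≢suc k) desc)))
            where
            κ-θ : ∀ k μ → κ (antR (ElectronicRelations.β k μ)) Q.≈ Q.- κ t Q.+ κ (ElectronicRelations.β k μ)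
            κ-θ k μ = Q.trans (κ-- (ElectronicRelations.β k μ) t) (Q.+-comm _ _)

          no-equal : ∀ k μ → μ ∈ orbit μ₀ → lookup μ (inject₁ k) ≢ lookup μ (suc k)
          no-equal k μ μ∈ eq = case ∈-orbit⁻ μ₀ μ∈ of λ { (w , ≡.refl) → inject₁≢suc k (perm-injective (w ⁻¹)
            (injective (≡.trans (≡.sym (lookup-• w μ₀ (inject₁ k))) (≡.trans eq (lookup-• w μ₀ (suc k)))))) }

          R-anti : ∃[ h ] (Symmetrizers.Invariant h × R Q.≈ N Q.* h)
          R-anti = Orbits.combination-anti family (orbit-closed μ₀) _ (λ μ → κ-invariant _)
            (λ k μ desc → Q.trans (κ-descent-step antC antC-cong k μ desc)
              (Q.*-congʳ (Q.trans (κ-neg _) (Q.-‿cong (κ-+ K.1# (ElectronicRelations.β k μ))))))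
            no-equal

        antisymmetric-expansion : N Q.* S Q.≈ ι (expansion antC antC-cong μ₀)
        antisymmetric-expansion = Q.trans (FX.regular-cancel (regular-κ (regular-antisymmetric n)) (begin
          N Q.* S Q.* κ U
            ≈⟨ Q.*-congˡ (κ-cong D≈U) ⟨
          N Q.* S Q.* κ (ratio antC antC-cong antR μ₀)
            ≈⟨ SQ.solve 3 (λ a s d → a SQ.:* s SQ.:* d SQ.:= a SQ.:* (d SQ.:* s)) N S _ ⟩
          N Q.* (κ (ratio antC antC-cong antR μ₀) Q.* S)
            ≈⟨ Q.*-congˡ (Q.*-congʳ (κ-ratio antC antC-cong antR μ₀)) ⟨
          N Q.* (∑ Rational.ring (orbit μ₀) (λ μ → κ (descent-product antC μ) Q.* κ (ascent-product antR μ)) Q.* S)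
            ≈⟨ Q.*-congˡ (Orbits.∑-expansion family (orbit-closed μ₀) (coefficients antC antC-cong) (λ μ → κ-invariant _)
                 antisymmetrize antisymmetrize-cong antisymmetrize-0 antisymmetrize-+ antisymmetrize-scalar
                 {λ μ → κ (ascent-product antR μ)} {μ₀} (λ μ μ∈ → case ∈-orbit⁻ μ₀ μ∈ of λ { (w , ≡.refl) → antisymmetrize-E w })) ⟨
          N Q.* antisymmetrize R
            ≈⟨ Orbits.antisymmetrize-invariant (proj₁ (proj₂ R-anti)) (proj₂ (proj₂ R-anti)) ⟩
          R Q.* antisymmetrize N
            ≈⟨ Q.*-congˡ antisymmetrize-N ⟩
          R Q.* κ U ∎)) (Q.sym (ι-expansion antC antC-cong μ₀))
          where open Q-Reasoning

module _ {c ℓ₁ ℓ₂} (𝔽 : HeytingField c ℓ₁ ℓ₂) (m : ℕ) where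
  open Macdonald 𝔽 m

  parameters : Parameters Scalars.ring
  parameters = record
    { qt         = qt
    ; qt-0       = K.refl
    ; qt-*       = qt-*
    ; regular-qt = λ distinct → regular-cong (K.sym (Scalars.ι-- _ _)) (Scalars.regular-ι (F.regular-binomial λ eq →
        [ (λ a≢ → a≢ (≡.cong (λ (γ : Vec ℤ 2) → lookup γ zero) eq)) , (λ b≢ → b≢ (≡.cong (λ (γ : Vec ℤ 2) → lookup γ (suc zero)) eq)) ] distinct))
    ; _÷_[_]     = _÷_[_]
    ; ÷-*        = FractionLemmas.÷-* F.ring
    }

  private
    module Theory = MacdonaldPolynomials Scalars.ring parameters m
    module K-Reasoning = Relation.Binary.Reasoning.Setoid K.setoid
    module SK = IntegerSolver Scalars.ring
    module ∑P = Fold P.+-commutativeMonoid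
  open Theory using (÷-unique)
  open Theory.Coefficients
  open RingLemmas Scalars.ring using (regular-cancel)
  open LaurentLemmas Scalars.ring n using (const-cong)

  module EvaluatedCoefficients (μ : Vec ℤ n) where
    open Evaluation μ hiding (ev; defined-cY; defined-cY⁻¹)

    private
      Value : K⟨Y⟩ → K → Set ℓ₁
      Value r y = y K.* evPoly (Rational.den r) K.≈ evPoly (Rational.num r)

      value-1 : Value Q.1# K.1#
      value-1 = K.*-identityˡ _

      opaque
        unfolding Frac.mul

        num-* : ∀ r r′ → Rational.num (r Q.* r′) ≡ Rational.num r P.* Rational.num r′
        num-* r r′ = ≡.refl

        den-* : ∀ r r′ → Rational.den (r Q.* r′) ≡ Rational.den r P.* Rational.den r′
        den-* r r′ = ≡.refl

      value-* : ∀ {r r′ y y′} → Value r y → Value r′ y′ → Value (r Q.* r′) (y K.* y′)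
      value-* {r} {r′} {y} {y′} eq eq′ = begin
        y K.* y′ K.* evPoly (Rational.den (r Q.* r′))
          ≡⟨ ≡.cong (λ d → y K.* y′ K.* evPoly d) (den-* r r′) ⟩
        y K.* y′ K.* evPoly (Rational.den r P.* Rational.den r′)
          ≈⟨ K.*-congˡ (evPoly-* (Rational.den r) (Rational.den r′)) ⟩
        y K.* y′ K.* (evPoly (Rational.den r) K.* evPoly (Rational.den r′))
          ≈⟨ SK.solve 4 (λ y y′ d d′ → y SK.:* y′ SK.:* (d SK.:* d′) SK.:= (y SK.:* d) SK.:* (y′ SK.:* d′)) y y′ _ _ ⟩
        (y K.* evPoly (Rational.den r)) K.* (y′ K.* evPoly (Rational.den r′))
          ≈⟨ K.*-cong eq eq′ ⟩
        evPoly (Rational.num r) K.* evPoly (Rational.num r′)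
          ≈⟨ evPoly-* (Rational.num r) (Rational.num r′) ⟨
        evPoly (Rational.num r P.* Rational.num r′)
          ≡⟨ ≡.cong evPoly (num-* r r′) ⟨
        evPoly (Rational.num (r Q.* r′)) ∎
        where open K-Reasoning

      value-∏ : ∀ {A : Set} (xs : List A) f y → (∀ i → Value (f i) (y i)) → Value (∏ Rational.ring xs f) (∏ Scalars.ring xs y)
      value-∏ []       f y eq = value-1
      value-∏ (i ∷ xs) f y eq = value-* {f i} (eq i) (value-∏ xs f y eq)

      Y-ratio : ∀ i j → evY^ i 1ℤ K.* evY^ j -1ℤ K.≈ qt[ μ , j , i ]
      Y-ratio i j = begin
        evY^ i 1ℤ K.* evY^ j -1ℤ
          ≈⟨ qt-* _ _ _ _ ⟩
        qt (1ℤ ℤ.* ℤ.- lookup μ i ℤ.+ -1ℤ ℤ.* ℤ.- lookup μ j) (1ℤ ℤ.* (ℤ.- (+ 2 ℤ.* vᶻ μ i) ℤ.+ + m) ℤ.+ -1ℤ ℤ.* (ℤ.- (+ 2 ℤ.* vᶻ μ j) ℤ.+ + m))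
          ≡⟨ ≡.cong₂ qt
               (ℤSolver.solve 2 (λ a b → ℤSolver.con 1ℤ ℤSolver.:* ℤSolver.:- a ℤSolver.:+ ℤSolver.con -1ℤ ℤSolver.:* ℤSolver.:- b ℤSolver.:= (b ℤSolver.:- a) ℤSolver.:+ ℤSolver.con 0ℤ) (lookup μ i) (lookup μ j))
               (ℤSolver.solve 3 (λ a b m → ℤSolver.con 1ℤ ℤSolver.:* (ℤSolver.:- (ℤSolver.con (+ 2) ℤSolver.:* a) ℤSolver.:+ m) ℤSolver.:+ ℤSolver.con -1ℤ ℤSolver.:* (ℤSolver.:- (ℤSolver.con (+ 2) ℤSolver.:* b) ℤSolver.:+ m)
                 ℤSolver.:= ℤSolver.con 0ℤ ℤSolver.:+ ℤSolver.con (+ 2) ℤSolver.:* (b ℤSolver.:- a)) (vᶻ μ i) (vᶻ μ j) (+ m)) ⟩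
        qt ((lookup μ j ℤ.- lookup μ i) ℤ.+ 0ℤ) (0ℤ ℤ.+ + 2 ℤ.* (vᶻ μ j ℤ.- vᶻ μ i))
          ≈⟨ qt-* _ _ _ _ ⟨
        qt[ μ , j , i ] ∎
        where open K-Reasoning

      value-C : ∀ a → evPoly (C a) K.≈ a
      value-C a = K.trans (K.+-identityʳ _) (K.trans (K.*-congˡ evMonomial-𝟎) (K.*-identityʳ a))

      value-ratio : ∀ i j → evPoly (x i P.* x⁻¹ j) K.≈ qt[ μ , j , i ]
      value-ratio i j = K.trans (evPoly-* (x i) (x⁻¹ j)) (K.trans (K.*-cong
        (K.trans (evPoly-monomial (𝐞 i)) (evMonomial-𝐞 i)) (K.trans (evPoly-monomial (⊖ 𝐞 j)) (evMonomial-⊖𝐞 j))) (Y-ratio i j))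

      value-c : ∀ {i j} (i≢j : i ≢ j) {y} → y K.* (K.1# K.- qt[ μ , j , i ]) K.≈ t½^ -1ℤ K.- t½ K.* qt[ μ , j , i ] → Value (c[ i , j ] i≢j) y
      value-c {i} {j} i≢j {y} eq = begin
        y K.* evPoly (P.1# P.- x i P.* x⁻¹ j)
          ≈⟨ K.*-congˡ (K.trans (X.⟨⟩-add P.1# (P.- (x i P.* x⁻¹ j))) (K.+-cong (value-C K.1#) (K.trans (X.⟨⟩-neg (x i P.* x⁻¹ j)) (K.-‿cong (value-ratio i j))))) ⟩
        y K.* (K.1# K.- qt[ μ , j , i ])
          ≈⟨ eq ⟩
        t½^ -1ℤ K.- t½ K.* qt[ μ , j , i ]
          ≈⟨ K.trans (X.⟨⟩-add (C (t½^ -1ℤ)) (P.- (C t½ P.* (x i P.* x⁻¹ j)))) (K.+-cong (value-C _) (K.trans (X.⟨⟩-neg (C t½ P.* (x i P.* x⁻¹ j)))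
               (K.-‿cong (K.trans (evPoly-* (C t½) (x i P.* x⁻¹ j)) (K.*-cong (value-C t½) (value-ratio i j)))))) ⟨
        evPoly (C (t½^ -1ℤ) P.- C t½ P.* (x i P.* x⁻¹ j)) ∎
        where open K-Reasoning

      t½t½⁻¹ : t½ K.* t½^ -1ℤ K.≈ K.1#
      t½t½⁻¹ = qt-* 0ℤ 1ℤ 0ℤ -1ℤ

      inverse-ratio : ∀ i j → qt[ μ , i , j ] K.* qt[ μ , j , i ] K.≈ K.1#
      inverse-ratio i j = K.trans (K.*-cong (qt-* _ _ _ _) (qt-* _ _ _ _)) (K.trans (qt-* _ _ _ _) (K.reflexive (≡.cong₂ qt
        (ℤSolver.solve 2 (λ a b → ((a ℤSolver.:- b) ℤSolver.:+ ℤSolver.con 0ℤ) ℤSolver.:+ ((b ℤSolver.:- a) ℤSolver.:+ ℤSolver.con 0ℤ) ℤSolver.:= ℤSolver.con 0ℤ) (lookup μ i) (lookup μ j))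
        (ℤSolver.solve 2 (λ a b → (ℤSolver.con 0ℤ ℤSolver.:+ ℤSolver.con (+ 2) ℤSolver.:* (a ℤSolver.:- b)) ℤSolver.:+ (ℤSolver.con 0ℤ ℤSolver.:+ ℤSolver.con (+ 2) ℤSolver.:* (b ℤSolver.:- a)) ℤSolver.:= ℤSolver.con 0ℤ) (vᶻ μ i) (vᶻ μ j)))))

      value-symmetric : ∀ {i j} (i≢j : i ≢ j) → Value (c[ i , j ] i≢j) (t½^ -1ℤ K.* (t K.- B μ i j))
      value-symmetric {i} {j} i≢j = value-c i≢j (regular-cancel (invertible⇒regular {R = Scalars.ring} (inverse-ratio i j)) (begin
        h K.* (t K.- b) K.* (K.1# K.- Q′) K.* Q
          ≈⟨ SK.solve 5 (λ h t b Q Q′ → h SK.:* (t SK.:- b) SK.:* (SK.con 1ℤ SK.:- Q′) SK.:* Q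
               SK.:= h SK.:* (t SK.:- b) SK.:* (Q SK.:- Q SK.:* Q′)) h t b Q Q′ ⟩
        h K.* (t K.- b) K.* (Q K.- Q K.* Q′)
          ≈⟨ K.*-congˡ (K.+-congˡ (K.-‿cong (inverse-ratio i j))) ⟩
        h K.* (t K.- b) K.* (Q K.- K.1#)
          ≈⟨ SK.solve 4 (λ h t b Q → h SK.:* (t SK.:- b) SK.:* (Q SK.:- SK.con 1ℤ)
               SK.:= h SK.:* (b SK.:* (SK.con 1ℤ SK.:- Q) SK.:- t SK.:* (SK.con 1ℤ SK.:- Q))) h t b Q ⟩
        h K.* (b K.* (K.1# K.- Q) K.- t K.* (K.1# K.- Q))
          ≈⟨ K.*-congˡ (K.+-congʳ (B-eq μ i≢j)) ⟩
        h K.* ((K.1# K.- t) K.* Q K.- t K.* (K.1# K.- Q))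
          ≈⟨ SK.solve 3 (λ h s Q → h SK.:* ((SK.con 1ℤ SK.:- s SK.:* s) SK.:* Q SK.:- s SK.:* s SK.:* (SK.con 1ℤ SK.:- Q))
               SK.:= h SK.:* Q SK.:- s SK.:* (s SK.:* h)) h t½ Q ⟩
        h K.* Q K.- t½ K.* (t½ K.* h)
          ≈⟨ K.+-congˡ (K.-‿cong (K.*-congˡ (K.trans t½t½⁻¹ (K.sym (inverse-ratio i j))))) ⟩
        h K.* Q K.- t½ K.* (Q K.* Q′)
          ≈⟨ SK.solve 4 (λ h s Q Q′ → h SK.:* Q SK.:- s SK.:* (Q SK.:* Q′) SK.:= (h SK.:- s SK.:* Q′) SK.:* Q) h t½ Q Q′ ⟩
        (h K.- t½ K.* Q′) K.* Q ∎))
        where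
        open K-Reasoning
        h b Q Q′ : K
        h  = t½^ -1ℤ
        b  = B μ i j
        Q  = qt[ μ , i , j ]
        Q′ = qt[ μ , j , i ]

      value-antisymmetric : ∀ {i j} (j≢i : j ≢ i) → Value (c[ j , i ] j≢i) (t½^ -1ℤ K.* (K.1# K.+ B μ i j))
      value-antisymmetric {i} {j} j≢i = value-c j≢i (begin
        h K.* (K.1# K.+ b) K.* (K.1# K.- Q)
          ≈⟨ SK.solve 3 (λ h b Q → h SK.:* (SK.con 1ℤ SK.:+ b) SK.:* (SK.con 1ℤ SK.:- Q)
               SK.:= h SK.:* ((SK.con 1ℤ SK.:- Q) SK.:+ b SK.:* (SK.con 1ℤ SK.:- Q))) h b Q ⟩
        h K.* ((K.1# K.- Q) K.+ b K.* (K.1# K.- Q))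
          ≈⟨ K.*-congˡ (K.+-congˡ (B-eq μ (j≢i ∘ ≡.sym))) ⟩
        h K.* ((K.1# K.- Q) K.+ (K.1# K.- t) K.* Q)
          ≈⟨ SK.solve 3 (λ h s Q → h SK.:* ((SK.con 1ℤ SK.:- Q) SK.:+ (SK.con 1ℤ SK.:- s SK.:* s) SK.:* Q)
               SK.:= h SK.:- s SK.:* h SK.:* s SK.:* Q) h t½ Q ⟩
        h K.- t½ K.* h K.* t½ K.* Q
          ≈⟨ K.+-congˡ (K.-‿cong (K.*-congʳ (K.trans (K.*-congʳ t½t½⁻¹) (K.*-identityˡ _)))) ⟩
        h K.- t½ K.* Q ∎)
        where
        open K-Reasoning
        h b Q : K
        h = t½^ -1ℤ
        b = B μ i j
        Q = qt[ μ , i , j ]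

      power-∏ : ∀ {A : Set} a (xs : List A) (f : A → K) → a ^ length xs K.* ∏ Scalars.ring xs f K.≈ ∏ Scalars.ring xs (λ i → a K.* f i)
      power-∏ a []       f = K.*-identityˡ K.1#
      power-∏ a (i ∷ xs) f = K.trans (SK.solve 4 (λ a p f r → a SK.:* p SK.:* (f SK.:* r) SK.:= a SK.:* f SK.:* (p SK.:* r)) a _ (f i) _)
        (K.*-congˡ (power-∏ a xs f))

      Inv-descents : ∀ w → (∀ {i j} → i Fin.< j → (w ⟨$⟩ʳ j Fin.< w ⟨$⟩ʳ i → lookup μ j ℤ.< lookup μ i) × (lookup μ j ℤ.< lookup μ i → w ⟨$⟩ʳ j Fin.< w ⟨$⟩ʳ i)) →
                     Inv w ≡ descents μ
      Inv-descents w iff = List.filter-≐ _ _ ((λ {p} → proj₁ (iff (Pair.fst<snd p))) , (λ {p} → proj₂ (iff (Pair.fst<snd p)))) (pairs n)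

    module _ (w : Permutation′ n)
      (iff : ∀ {i j} → i Fin.< j → (w ⟨$⟩ʳ j Fin.< w ⟨$⟩ʳ i → lookup μ j ℤ.< lookup μ i) × (lookup μ j ℤ.< lookup μ i → w ⟨$⟩ʳ j Fin.< w ⟨$⟩ʳ i)) where
      evaluated-cY : t½ ^ ℓ w K.* ev μ (cY w) (defined-cY μ w) K.≈ descent-product (λ b → t K.- b) μ
      evaluated-cY = begin
        t½ ^ length (Inv w) K.* ev μ (cY w) (defined-cY μ w)
          ≈⟨ K.*-congˡ (÷-unique (defined-cY μ w) (value-∏ (Inv w) _ (λ p → t½^ -1ℤ K.* (t K.- B μ (Pair.fst p) (Pair.snd p)))
               λ p → value-symmetric (Pair.fst≢snd p))) ⟩
        t½ ^ length (Inv w) K.* ∏ Scalars.ring (Inv w) (λ p → t½^ -1ℤ K.* (t K.- B μ (Pair.fst p) (Pair.snd p)))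
          ≈⟨ power-∏ t½ (Inv w) _ ⟩
        ∏ Scalars.ring (Inv w) (λ p → t½ K.* (t½^ -1ℤ K.* (t K.- B μ (Pair.fst p) (Pair.snd p))))
          ≡⟨ ≡.cong (λ ps → ∏ Scalars.ring ps (λ p → t½ K.* (t½^ -1ℤ K.* (t K.- B μ (Pair.fst p) (Pair.snd p))))) (Inv-descents w iff) ⟩
        ∏ Scalars.ring (descents μ) (λ p → t½ K.* (t½^ -1ℤ K.* (t K.- B μ (Pair.fst p) (Pair.snd p))))
          ≈⟨ descent-product-list (λ b → t K.- b) (λ eq → K.+-congˡ (K.-‿cong eq)) μ _ (λ p →
               K.trans (K.sym (K.*-assoc _ _ _)) (K.trans (K.*-congʳ t½t½⁻¹) (K.*-identityˡ _))) ⟩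
        descent-product (λ b → t K.- b) μ ∎
        where open K-Reasoning

      evaluated-cY⁻¹ : (K.- t½) ^ ℓ w K.* ev μ (cY⁻¹ w) (defined-cY⁻¹ μ w) K.≈ descent-product (λ b → K.- (K.1# K.+ b)) μ
      evaluated-cY⁻¹ = begin
        (K.- t½) ^ length (Inv w) K.* ev μ (cY⁻¹ w) (defined-cY⁻¹ μ w)
          ≈⟨ K.*-congˡ (÷-unique (defined-cY⁻¹ μ w) (value-∏ (Inv w) _ (λ p → t½^ -1ℤ K.* (K.1# K.+ B μ (Pair.fst p) (Pair.snd p)))
               λ p → value-antisymmetric (Pair.fst≢snd p ∘ ≡.sym))) ⟩
        (K.- t½) ^ length (Inv w) K.* ∏ Scalars.ring (Inv w) (λ p → t½^ -1ℤ K.* (K.1# K.+ B μ (Pair.fst p) (Pair.snd p)))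
          ≈⟨ power-∏ (K.- t½) (Inv w) _ ⟩
        ∏ Scalars.ring (Inv w) (λ p → (K.- t½) K.* (t½^ -1ℤ K.* (K.1# K.+ B μ (Pair.fst p) (Pair.snd p))))
          ≡⟨ ≡.cong (λ ps → ∏ Scalars.ring ps (λ p → (K.- t½) K.* (t½^ -1ℤ K.* (K.1# K.+ B μ (Pair.fst p) (Pair.snd p))))) (Inv-descents w iff) ⟩
        ∏ Scalars.ring (descents μ) (λ p → (K.- t½) K.* (t½^ -1ℤ K.* (K.1# K.+ B μ (Pair.fst p) (Pair.snd p))))
          ≈⟨ descent-product-list (λ b → K.- (K.1# K.+ b)) (λ eq → K.-‿cong (K.+-congˡ eq)) μ _ (λ p →
               K.trans (SK.solve 3 (λ s h b → SK.:- s SK.:* (h SK.:* b) SK.:= SK.:- (s SK.:* h SK.:* b)) t½ (t½^ -1ℤ) _)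
                 (K.-‿cong (K.trans (K.*-congʳ t½t½⁻¹) (K.*-identityˡ _)))) ⟩
        descent-product (λ b → K.- (K.1# K.+ b)) μ ∎
        where open K-Reasoning

  module Formulas (E : Vec ℤ n → K[X]) (isE : IsElectronic E) where
    open IsElectronic isE

    electronic : Theory.Electronic E
    electronic = record
      { E0 = E0
      ; E1 = E1
      ; E2 = λ μ k nn desc → _ , regular-x-x (i≢1+i k)
           , FractionLemmas.÷-* F.ring _ _ (regular-1-qt[] μ (i≢1+i k))
           , ≡.subst (Step μ k (regular-x-x (i≢1+i k))) (≡.sym (adj-≡ k)) (E2 μ k nn desc)
      ; E3 = E3
      }
      where
      Step : ∀ μ k → Regular X.ring (x (inject₁ k) P.- x (suc k)) → Permutation′ n → Set ℓ₁
      Step μ k reg w = ι (E (w • μ)) Q.≈ ∂ʷ (x (inject₁ k) P.* E μ) Q.- ι (C t P.* x (inject₁ k)) Q.* ∂ʷ (E μ) Q.+ ι (C b P.* E μ)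
        where
        ∂ʷ : K[X] → K⟨X⟩
        ∂ʷ f = Rational.frac (f P.- X.act w f) (x (inject₁ k) P.- x (suc k)) reg
        b : K
        b = (K.1# K.- t) K.* qt[ μ , inject₁ k , suc k ] ÷ K.1# K.- qt[ μ , inject₁ k , suc k ] [ regular-1-qt[] μ (i≢1+i k) ]

    open Theory.ElectronicPolynomials E electronic
    open Expansion
    open Antisymmetric hiding (A)

    P-orbit-sum A-orbit-sum : Vec ℤ n → K[X]
    P-orbit-sum lam = ∑ X.ring (orbit lam) λ μ →
      C (∏ Scalars.ring (descents μ) λ (pair i j i<j) →
           t K.* ((K.1# K.- q^ (lookup μ i ℤ.- lookup μ j) K.* t^ (vᶻ μ i ℤ.- vᶻ μ j ℤ.- 1ℤ))
                   ÷ K.1# K.- q^ (lookup μ i ℤ.- lookup μ j) K.* t^ (vᶻ μ i ℤ.- vᶻ μ j)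
                   [ regular-1-qt[] μ (Fin.<⇒≢ i<j) ]))
        P.* E μ
    A-orbit-sum μ₀ = ∑ X.ring (orbit μ₀) λ μ →
      C (∏ Scalars.ring (descents μ) λ (pair i j i<j) →
           (K.- K.1#) K.* ((K.1# K.- q^ (lookup μ i ℤ.- lookup μ j) K.* t^ (vᶻ μ i ℤ.- vᶻ μ j ℤ.+ 1ℤ))
                   ÷ K.1# K.- q^ (lookup μ i ℤ.- lookup μ j) K.* t^ (vᶻ μ i ℤ.- vᶻ μ j)
                   [ regular-1-qt[] μ (Fin.<⇒≢ i<j) ]))
        P.* E μ

    P-coset-sum A-group-sum : Vec ℤ n → K[X]
    P-coset-sum lam = ∑ X.ring (W^ lam) λ z →
      C (t½ ^ ℓ (v lam · z ⁻¹) K.* ev (z • lam) (cY (v lam · z ⁻¹)) (defined-cY (z • lam) (v lam · z ⁻¹)))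
        P.* E (z • lam)
    A-group-sum μ₀ = ∑ X.ring (Sₙ n) λ z →
      C ((K.- t½) ^ ℓ (w₀ · z ⁻¹) K.* ev (z • μ₀) (cY⁻¹ (w₀ · z ⁻¹)) (defined-cY⁻¹ (z • μ₀) (w₀ · z ⁻¹)))
        P.* E (z • μ₀)

    P-orbit-sum≈ : ∀ lam → P-orbit-sum lam P.≈ expansion symC symC-cong lam
    P-orbit-sum≈ lam = ∑P.fold-cong (orbit lam) λ μ → P.*-congʳ (const-cong
      (descent-product-list symC symC-cong μ _ λ p → symmetric-coefficient μ (Pair.fst≢snd p) (regular-1-qt[] μ (Pair.fst≢snd p))))

    A-orbit-sum≈ : ∀ μ₀ → A-orbit-sum μ₀ P.≈ expansion antC antC-cong μ₀
    A-orbit-sum≈ μ₀ = ∑P.fold-cong (orbit μ₀) λ μ → P.*-congʳ (const-cong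
      (descent-product-list antC antC-cong μ _ λ p → antisymmetric-coefficient μ (Pair.fst≢snd p) (regular-1-qt[] μ (Pair.fst≢snd p))))

    P-coset-sum≈ : ∀ lam → WeaklyDecreasing lam → P-coset-sum lam P.≈ expansion symC symC-cong lam
    P-coset-sum≈ lam dec = ∑P.fold-bijection (λ z μ → (z • lam) ≟ᵉ μ)
      (λ z _ → once-∈ (orbit-unique lam) (∈-orbit⁺ lam z))
      (λ μ μ∈ → case ∈-orbit⁻ lam μ∈ of λ { (w , ≡.refl) → once-W^ lam dec w })
      λ { z _ z∈ ≡.refl → P.*-congʳ (const-cong (EvaluatedCoefficients.evaluated-cY (z • lam) (v lam · z ⁻¹)
        (inversions-min lam z (minRep⇒blockIncreasing lam dec z (proj₂ (∈.∈-filter⁻ (isMinRep? lam) {xs = Sₙ n} z∈)))))) }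

    A-group-sum≈ : ∀ μ₀ → (∀ {i j} → i Fin.< j → lookup μ₀ j ℤ.< lookup μ₀ i) → A-group-sum μ₀ P.≈ expansion antC antC-cong μ₀
    A-group-sum≈ μ₀ strict = ∑P.fold-bijection (λ z μ → (z • μ₀) ≟ᵉ μ)
      (λ z _ → once-∈ (orbit-unique μ₀) (∈-orbit⁺ μ₀ z))
      (λ μ μ∈ → case ∈-orbit⁻ μ₀ μ∈ of λ { (w , ≡.refl) → once-orbit′ μ₀ strict w })
      λ { z _ _ ≡.refl → P.*-congʳ (const-cong (EvaluatedCoefficients.evaluated-cY⁻¹ (z • μ₀) (w₀ · z ⁻¹) (inversions-w₀ μ₀ strict z))) }

    module _ (lam : Vec ℤ n) (dec : WeaklyDecreasing lam) where
      macdonaldP⇔ : ∀ {g} → g P.≈ expansion symC symC-cong lam → ∀ f → IsMacdonaldP E lam f ⇔ f P.≈ g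
      macdonaldP⇔ g≈ f = mk⇔
        (λ mac → let open IsMacdonaldP mac in
          P.trans (normalized⇒expansion lam dec f (W , W-regular , symmetrized , normalized)) (P.sym g≈))
        (λ f≈g → let (W , W-regular , symmetrized , normalized) = expansion⇒normalized lam dec f (P.trans f≈g g≈) in record
          { W = W ; W-regular = W-regular ; symmetrized = symmetrized ; normalized = normalized })

      A≈ : ∀ {g} → g P.≈ expansion antC antC-cong (lam ⊕ ρ) → A E lam Q.≈ ι g
      A≈ g≈ = Q.trans (A-antisymmetrize (lam ⊕ ρ)) (Q.trans (antisymmetric-expansion (lam ⊕ ρ) (⊕ρ-strict lam dec)) (Rational.ι-cong (P.sym g≈)))

proposition4p7 :
    ∀ {c ℓ₁ ℓ₂} (𝔽 : HeytingField c ℓ₁ ℓ₂) (m : ℕ) → let open Macdonald 𝔽 m in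
    ∀ (E : Vec ℤ n → K[X]) → IsElectronic E →
    ∀ (lam : Vec ℤ n) → WeaklyDecreasing lam →
      (∀ f → IsMacdonaldP E lam f ⇔
        f P.≈ ∑ X.ring (W^ lam) λ z →
          C (t½ ^ ℓ (v lam · z ⁻¹) K.* ev (z • lam) (cY (v lam · z ⁻¹)) (defined-cY (z • lam) (v lam · z ⁻¹)))
            P.* E (z • lam))
    × (A E lam Q.≈ ι (∑ X.ring (Sₙ n) λ z →
        C ((K.- t½) ^ ℓ (w₀ · z ⁻¹)
             K.* ev (z • (lam ⊕ ρ)) (cY⁻¹ (w₀ · z ⁻¹)) (defined-cY⁻¹ (z • (lam ⊕ ρ)) (w₀ · z ⁻¹)))
          P.* E (z • (lam ⊕ ρ))))
    × (∀ f → IsMacdonaldP E lam f ⇔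
        f P.≈ ∑ X.ring (orbit lam) λ μ →
          C (∏ Scalars.ring (descents μ) λ (pair i j i<j) →
               t K.* ((K.1# K.- q^ (lookup μ i ℤ.- lookup μ j) K.* t^ (vᶻ μ i ℤ.- vᶻ μ j ℤ.- 1ℤ))
                       ÷ K.1# K.- q^ (lookup μ i ℤ.- lookup μ j) K.* t^ (vᶻ μ i ℤ.- vᶻ μ j)
                       [ regular-1-qt[] μ (Fin.<⇒≢ i<j) ]))
            P.* E μ)
    × (A E lam Q.≈ ι (∑ X.ring (orbit (lam ⊕ ρ)) λ μ →
        C (∏ Scalars.ring (descents μ) λ (pair i j i<j) →
             (K.- K.1#) K.* ((K.1# K.- q^ (lookup μ i ℤ.- lookup μ j) K.* t^ (vᶻ μ i ℤ.- vᶻ μ j ℤ.+ 1ℤ))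
                       ÷ K.1# K.- q^ (lookup μ i ℤ.- lookup μ j) K.* t^ (vᶻ μ i ℤ.- vᶻ μ j)
                       [ regular-1-qt[] μ (Fin.<⇒≢ i<j) ]))
          P.* E μ))
proposition4p7 𝔽 m E isE lam dec =
    macdonaldP⇔ lam dec (P-coset-sum≈ lam dec)
  , A≈ lam dec (A-group-sum≈ (lam ⊕ ρ) (⊕ρ-strict lam dec))
  , macdonaldP⇔ lam dec (P-orbit-sum≈ lam)
  , A≈ lam dec (A-orbit-sum≈ (lam ⊕ ρ))
  where open Formulas 𝔽 m E isE
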